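{- Let $P$ be a lattice $3$-polytope of width larger than one and of sublattice index three. Then $P$ is unimodularly equivalent either to the tetrahedron $E_{(6,3)}=\conv\{(1,0,0),(-1,-1,0),(1,2,3),(-1,1,-3)\}$ or to $\widetilde F_1(a,b)=\conv\{(0,0,a),(0,0,b),(-1,-1,0),(2,-1,1),(-1,2,-1)\}$ for some integers $a\le 0<b$.
   Context: A lattice $3$-polytope is a polytope in $\mathbb{R}^3$ with vertices in $\mathbb{Z}^3$ and dimension $3$; width is the minimum of $\max f(P)-\min f(P)$ over non-constant affine functionals $f$ with $f(\mathbb{Z}^3)\subseteq\mathbb{Z}$. Sublattice index: index in $\mathbb{Z}^3$ of the affine lattice generated (integer affine combinations) by $P\cap\mathbb{Z}^3$. Unimodular equivalence: affine $f$ with $f(\mathbb{Z}^3)=\mathbb{Z}^3$ mapping one polytope onto the other. -}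

module Defs where

open import Data.Nat using (ℕ)
open import Data.Integer as ℤ using (ℤ; +_; -[1+_])
open import Data.Rational as ℚ using (ℚ; 0ℚ; 1ℚ)
open import Data.Fin using (Fin)
open import Data.Vec using (Vec; _∷_; []; zipWith; map; foldr)
open import Data.List as L using (List; length)
open import Data.List.Relation.Unary.All using (All)
open import Data.Product using (Σ; ∃; _×_; _,_)
open import Relation.Binary.PropositionalEquality using (_≡_; _≢_)
open import Relation.Nullary using (¬_)
open import Function.Bundles using (_⇔_)

Z3 : Set
Z3 = Vec ℤ 3

Q3 : Set
Q3 = Vec ℚ 3

-- 3×3 integer matrices (list of rows)
Mat : Set
Mat = Vec Z3 3

zero3 : Z3
zero3 = + 0 ∷ + 0 ∷ + 0 ∷ []

toQ3 : Z3 → Q3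
toQ3 = map (λ z → z ℚ./ 1)

_+z_ : Z3 → Z3 → Z3
_+z_ = zipWith ℤ._+_

_-z_ : Z3 → Z3 → Z3
_-z_ = zipWith ℤ._-_

_·z_ : ℤ → Z3 → Z3
c ·z v = map (c ℤ.*_) v

dotZ : Z3 → Z3 → ℤ
dotZ u v = foldr _ ℤ._+_ (+ 0) (zipWith ℤ._*_ u v)

_+q_ : Q3 → Q3 → Q3
_+q_ = zipWith ℚ._+_

_·q_ : ℚ → Q3 → Q3
c ·q v = map (c ℚ.*_) v

zeroQ3 : Q3
zeroQ3 = 0ℚ ∷ 0ℚ ∷ 0ℚ ∷ []

dotZQ : Z3 → Q3 → ℚ
dotZQ c x = foldr _ ℚ._+_ 0ℚ (zipWith ℚ._*_ (toQ3 c) x)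

-- A lattice polytope is given as the convex hull of a finite list of
-- integer points V.  A rational point x lies in conv V iff it is a
-- convex combination of the points of V.
sumQ : List ℚ → ℚ
sumQ = L.foldr ℚ._+_ 0ℚ

combQ : List ℚ → List Z3 → Q3
combQ ws vs = L.foldr _+q_ zeroQ3 (L.zipWith (λ w v → w ·q toQ3 v) ws vs)

InConv : List Z3 → Q3 → Set
InConv V x = Σ (List ℚ) λ ws →
  (length ws ≡ length V) × All (λ w → 0ℚ ℚ.≤ w) ws × (sumQ ws ≡ 1ℚ) × (combQ ws V ≡ x)

LatticePt : List Z3 → Z3 → Set
LatticePt V z = InConv V (toQ3 z)

Dim3 : List Z3 → Set
Dim3 V = (c : Z3) → c ≢ zero3 →
  Σ Q3 λ x → Σ Q3 λ y → InConv V x × InConv V y × (dotZQ c x ≢ dotZQ c y)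

-- width of P is larger than one: for every non-constant integral affine
-- functional f (= c·x + const, c ∈ ℤ³ \ {0}), max f(P) - min f(P) > 1,
-- i.e. there are points x, y of P with f(x) - f(y) > 1.
WidthGt1 : List Z3 → Set
WidthGt1 V = (c : Z3) → c ≢ zero3 →
  Σ Q3 λ x → Σ Q3 λ y → InConv V x × InConv V y × (1ℚ ℚ.< dotZQ c x ℚ.- dotZQ c y)

sumZ : List (ℤ × Z3) → ℤ
sumZ = L.foldr (λ { (c , _) s → c ℤ.+ s }) (+ 0)

combZ : List (ℤ × Z3) → Z3
combZ = L.foldr (λ { (c , p) s → (c ·z p) +z s }) zero3

AffLat : List Z3 → Z3 → Set
AffLat V z = Σ (List (ℤ × Z3)) λ cs →
  All (λ { (_ , p) → LatticePt V p }) cs × (sumZ cs ≡ + 1) × (combZ cs ≡ z)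

LinLat : List Z3 → Z3 → Set
LinLat V z = Σ (List (ℤ × Z3)) λ cs →
  All (λ { (_ , p) → LatticePt V p }) cs × (sumZ cs ≡ + 0) × (combZ cs ≡ z)

-- sublattice index n: ℤ³ modulo the lattice has exactly n classes,
-- witnessed by n pairwise inequivalent representatives covering ℤ³.
SublatticeIndex : List Z3 → ℕ → Set
SublatticeIndex V n = Σ (Fin n → Z3) λ r →
  ((i j : Fin n) → LinLat V (r i -z r j) → i ≡ j) ×
  ((z : Z3) → ∃ λ i → LinLat V (z -z r i))

applyZ : Mat → Z3 → Z3 → Z3
applyZ A t x = map (λ row → dotZ row x) A +z t

applyQ : Mat → Z3 → Q3 → Q3
applyQ A t x = map (λ row → dotZQ row x) A +q toQ3 t

-- unimodular equivalence: an affine map f = A·+t with f(ℤ³) = ℤ³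
-- (integral, and surjective onto ℤ³) mapping conv V onto conv W.
UnimodEquiv : List Z3 → List Z3 → Set
UnimodEquiv V W = Σ Mat λ A → Σ Z3 λ t →
  ((y : Z3) → ∃ λ x → applyZ A t x ≡ y) ×
  ((q : Q3) → InConv W q ⇔ (∃ λ p → InConv V p × (applyQ A t p ≡ q)))

pt : ℤ → ℤ → ℤ → Z3
pt a b c = a ∷ b ∷ c ∷ []

E63 : List Z3
E63 = pt (+ 1) (+ 0) (+ 0) L.∷ pt (ℤ.- + 1) (ℤ.- + 1) (+ 0) L.∷
      pt (+ 1) (+ 2) (+ 3) L.∷ pt (ℤ.- + 1) (+ 1) (ℤ.- + 3) L.∷ L.[]

F1 : ℤ → ℤ → List Z3
F1 a b = pt (+ 0) (+ 0) a L.∷ pt (+ 0) (+ 0) b L.∷ pt (ℤ.- + 1) (ℤ.- + 1) (+ 0) L.∷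
         pt (+ 2) (ℤ.- + 1) (+ 1) L.∷ pt (ℤ.- + 1) (+ 2) (ℤ.- + 1) L.∷ L.[]

-- Let A be the set of lattice points of P. A tetrahedron with vertices pᵢ in A has integral barycentric coordinates W with
-- n z = Σ Wᵢ(z) pᵢ, where n is its normalised volume. If it is empty then, by White's theorem, W(z) is modulo n a multiple
-- λ(z) (σ, -σ, 1, -1) for a suitable order of the vertices. Index three yields a character modulo three that is constant on A;
-- hence 3 | n, and a lattice point z with 3 ∤ λ(z) is not in P. For an empty tetrahedron of maximal volume these forbidden
-- points leave only a few possible positions for the points of A next to it. Because the width is larger than one there are
-- points of A beyond its edges, and moving the tetrahedron along an edge towards them shows that n = 3 and that A contains
-- a triangle b, c, e with barycentre o and a further point a with segment oa transversal to it. If all other points of A are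
-- on the line oa, then P is F̃₁; otherwise w = 3b - o - a is in A up to symmetry, and each facet of conv {a, c, e, w} is
-- a facet of P, which is therefore E₍₆,₃₎.

module Submission where

open import Defs
open import Data.Integer as ℤ using (ℤ; +_; -[1+_]; _+_; _*_; _-_; -_; _≤_; _<_; ∣_∣; +≤+; +<+)
open import Data.List as L using (List; length)
open import Data.Product using (Σ; ∃; _×_; _,_; proj₁; proj₂)
open import Data.Sum using (_⊎_; inj₁; inj₂)
open import Data.Empty using (⊥; ⊥-elim)
open import Data.Fin using (Fin; zero; suc)
import Data.Fin.Properties as Finₚ
import Data.Integer.DivMod as ℤ-DM
import Data.Integer.Properties as ℤₚ
open import Data.Integer.Tactic.RingSolver using (solve-∀)
import Data.List.Properties as Listₚ
open import Data.List.Membership.Propositional using (_∈_; find)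
open import Data.List.Relation.Unary.All as All using (All)
import Data.List.Relation.Unary.All.Properties as Allₚ
open import Data.List.Relation.Unary.Any as Any using (Any; here; there)
open import Data.Nat as ℕ using (ℕ; zero; suc; z≤n; s≤s)
import Data.Nat.Divisibility as ℕ-Div
import Data.Nat.GCD as GCD
import Data.Nat.Properties as ℕₚ
open import Data.Rational as ℚ using (ℚ; 0ℚ; 1ℚ)
import Data.Rational.Properties as ℚₚ
open import Data.Rational.Solver using (module +-*-Solver)
import Data.Rational.Unnormalised as ℚᵘ
import Data.Rational.Unnormalised.Properties as ℚᵘₚ
open import Data.Unit using (tt)
open import Data.Vec using (Vec; _∷_; []; lookup)
import Data.Vec.Properties as Vecₚ
open import Function.Base using (_∋_)
open import Function.Bundles using (mk⇔)
open import Relation.Binary.PropositionalEquality using (_≡_; _≢_; refl; sym; trans; cong; cong₂; subst; subst₂)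
open import Relation.Nullary using (¬_; Dec; yes; no; does)
open import Relation.Nullary.Decidable using (_×-dec_; _⊎-dec_; ¬?; True; toWitness)

-- The points of A that width supplies may be far from the tetrahedron T. If |W₁(v)| > n, then the
-- tetrahedron with v in place of p is too large to be empty; its further lattice point is p itself
-- or is nearer to T, measured by the sum of the absolute coordinates. When this descent stops, only
-- a short list of positions is left. Membership in A is tested from one side: z is in A as soon as
-- its coordinates dominate those of a nonnegative combination of known points of A, because the
-- differences are weights at the vertices. Every exclusion exhibits such a z in the wrong class
-- modulo three. Width is applied to (W₁ + W₂)/n, which is integral and equals 1 and 0 on the two
-- edges singled out by White's theorem. The descent can end on the prolongation of the first edge;
-- moving T there keeps n, σ, W₃ and W₄ and brings v closer. A second pair of edges with this role
-- exists only for σ = ±1 modulo n; then the argument is repeated for that pair, and prolonging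
-- edges of both pairs is impossible. No tetrahedron of maximal volume is chosen: a descending
-- induction on n, from a bound on all volumes, shows that every empty tetrahedron of A has volume
-- three.

module LinearArithmetic where

  open import Data.Bool using (Bool; true; false; T; _∧_; not; if_then_else_)
  open import Data.List using ([]; _∷_; map; _++_)
  open import Data.List.Relation.Unary.All using ([]; _∷_)

  infixl 6 _:+_ _:-_
  infixl 7 _:*_
  infix 8 :-_ #_

  -- Reified polynomial expressions and their normal forms

  data Expr : Set where
    con : ℤ → Expr
    var : ℕ → Expr
    _:+_ _:-_ _:*_ : Expr → Expr → Expr
    :-_ : Expr → Expr

  #_ : ℕ → Expr
  # k = con (+ k)

  Env : Set
  Env = List ℤ

  look : Env → ℕ → ℤ
  look []      _       = + 0
  look (x ∷ _) zero    = x
  look (_ ∷ ρ) (suc i) = look ρ i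

  ⟦_⟧ : Expr → Env → ℤ
  ⟦ con c ⟧ ρ  = c
  ⟦ var i ⟧ ρ  = look ρ i
  ⟦ a :+ b ⟧ ρ = ⟦ a ⟧ ρ + ⟦ b ⟧ ρ
  ⟦ a :- b ⟧ ρ = ⟦ a ⟧ ρ - ⟦ b ⟧ ρ
  ⟦ a :* b ⟧ ρ = ⟦ a ⟧ ρ * ⟦ b ⟧ ρ
  ⟦ :- a ⟧ ρ   = - ⟦ a ⟧ ρ

  Mono : Set
  Mono = List ℕ

  Poly : Set
  Poly = List (ℤ × Mono)

  ⟦_⟧m : Mono → Env → ℤ
  ⟦ [] ⟧m ρ    = + 1
  ⟦ i ∷ m ⟧m ρ = look ρ i * ⟦ m ⟧m ρ

  ⟦_⟧p : Poly → Env → ℤ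
  ⟦ [] ⟧p ρ          = + 0
  ⟦ (c , m) ∷ p ⟧p ρ = c * ⟦ m ⟧m ρ + ⟦ p ⟧p ρ

  ins : ℕ → Mono → Mono
  ins i []      = i ∷ []
  ins i (j ∷ m) = if i ℕ.≤ᵇ j then i ∷ j ∷ m else j ∷ ins i m

  mulm : Mono → Mono → Mono
  mulm []      m′       = m′
  mulm (i ∷ m) m′ = ins i (mulm m m′)

  module _ (ρ : Env) where

    private
      swap : ∀ a b c → b * (a * c) ≡ a * (b * c)
      swap = solve-∀

    mulm-sound : ∀ m m′ → ⟦ mulm m m′ ⟧m ρ ≡ ⟦ m ⟧m ρ * ⟦ m′ ⟧m ρ
    mulm-sound []      m′ = sym (ℤₚ.*-identityˡ _)
    mulm-sound (i ∷ m) m′ = trans (ins-sound i (mulm m m′))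
      (trans (cong (look ρ i *_) (mulm-sound m m′)) (sym (ℤₚ.*-assoc (look ρ i) _ _)))
      where
      ins-sound : ∀ i k → ⟦ ins i k ⟧m ρ ≡ look ρ i * ⟦ k ⟧m ρ
      ins-sound i []      = refl
      ins-sound i (j ∷ k) with i ℕ.≤ᵇ j
      ... | true  = refl
      ... | false = trans (cong (look ρ j *_) (ins-sound i k)) (swap (look ρ i) (look ρ j) _)

  _<m_ : Mono → Mono → Bool
  []      <m []       = false
  []      <m (_ ∷ _)  = true
  (_ ∷ _) <m []       = false
  (i ∷ m) <m (j ∷ m′) = if i ℕ.≡ᵇ j then m <m m′ else i ℕ.<ᵇ j

  _≟m_ : (m m′ : Mono) → Dec (m ≡ m′)
  _≟m_ = Listₚ.≡-dec ℕ._≟_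

  -- Zero coefficients are dropped, so that cancellation is visible in the list itself and a
  -- negative constant can be recognised by its shape.
  cons : ℤ → Mono → Poly → Poly
  cons (+ 0) m p = p
  cons c     m p = (c , m) ∷ p

  insert : ℤ → Mono → Poly → Poly
  insert c m [] = cons c m []
  insert c m ((c′ , m′) ∷ q) with m ≟m m′
  ... | yes _ = cons (c + c′) m q
  ... | no  _ = if m <m m′ then (c , m) ∷ (c′ , m′) ∷ q else (c′ , m′) ∷ insert c m q

  addp : Poly → Poly → Poly
  addp []            q = q
  addp ((c , m) ∷ p) q = insert c m (addp p q)

  scalep : ℤ → Mono → Poly → Poly
  scalep c m []             = []
  scalep c m ((c′ , m′) ∷ p) = insert (c * c′) (mulm m m′) (scalep c m p)

  mulp : Poly → Poly → Poly
  mulp []            q = []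
  mulp ((c , m) ∷ p) q = addp (scalep c m q) (mulp p q)

  norm : Expr → Poly
  norm (con c)  = cons c [] []
  norm (var i)  = (+ 1 , i ∷ []) ∷ []
  norm (a :+ b) = addp (norm a) (norm b)
  norm (a :- b) = addp (norm a) (scalep (- + 1) [] (norm b))
  norm (a :* b) = mulp (norm a) (norm b)
  norm (:- a)   = scalep (- + 1) [] (norm a)

  module Sound (ρ : Env) where

    private
      s1 : ∀ a b m q → (a + b) * m + q ≡ a * m + (b * m + q)
      s1 = solve-∀
      s2 : ∀ a p q → a + (p + q) ≡ (a + p) + q
      s2 = solve-∀
      s3 : ∀ b p q → b + (p + q) ≡ p + (b + q)
      s3 = solve-∀
      s4 : ∀ c c′ m m′ r → c * c′ * (m * m′) + c * m * r ≡ c * m * (c′ * m′ + r)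
      s4 = solve-∀
      s5 : ∀ a b q → a * q + b * q ≡ (a + b) * q
      s5 = solve-∀
      s6 : ∀ a b → a + - + 1 * + 1 * b ≡ a - b
      s6 = solve-∀
      s7 : ∀ b → - + 1 * + 1 * b ≡ - b
      s7 = solve-∀
      s8 : ∀ a → + 1 * (a * + 1) + + 0 ≡ a
      s8 = solve-∀
      s9 : ∀ a → a * + 1 + + 0 ≡ a
      s9 = solve-∀

    cons-sound : ∀ c m p → ⟦ cons c m p ⟧p ρ ≡ c * ⟦ m ⟧m ρ + ⟦ p ⟧p ρ
    cons-sound (+ 0)       m p = sym (trans (cong (_+ ⟦ p ⟧p ρ) (ℤₚ.*-zeroˡ (⟦ m ⟧m ρ))) (ℤₚ.+-identityˡ _))
    cons-sound (ℤ.+[1+ n ]) m p = refl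
    cons-sound (-[1+ n ])  m p = refl

    insert-sound : ∀ c m q → ⟦ insert c m q ⟧p ρ ≡ c * ⟦ m ⟧m ρ + ⟦ q ⟧p ρ
    insert-sound c m [] = cons-sound c m []
    insert-sound c m ((c′ , m′) ∷ q) with m ≟m m′
    ... | yes refl = trans (cons-sound (c + c′) m q) (s1 c c′ (⟦ m ⟧m ρ) (⟦ q ⟧p ρ))
    ... | no  _ with m <m m′
    ...   | true  = refl
    ...   | false = trans (cong (λ x → c′ * ⟦ m′ ⟧m ρ + x) (insert-sound c m q))
                      (s3 (c′ * ⟦ m′ ⟧m ρ) (c * ⟦ m ⟧m ρ) (⟦ q ⟧p ρ))

    addp-sound : ∀ p q → ⟦ addp p q ⟧p ρ ≡ ⟦ p ⟧p ρ + ⟦ q ⟧p ρ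
    addp-sound [] q = sym (ℤₚ.+-identityˡ _)
    addp-sound ((c , m) ∷ p) q = trans (insert-sound c m (addp p q))
      (trans (cong (λ x → c * ⟦ m ⟧m ρ + x) (addp-sound p q)) (s2 (c * ⟦ m ⟧m ρ) (⟦ p ⟧p ρ) (⟦ q ⟧p ρ)))

    scalep-sound : ∀ c m p → ⟦ scalep c m p ⟧p ρ ≡ c * ⟦ m ⟧m ρ * ⟦ p ⟧p ρ
    scalep-sound c m [] = sym (ℤₚ.*-zeroʳ (c * ⟦ m ⟧m ρ))
    scalep-sound c m ((c′ , m′) ∷ p) = trans (insert-sound (c * c′) (mulm m m′) (scalep c m p))
      (trans (cong₂ (λ x y → c * c′ * x + y) (mulm-sound ρ m m′) (scalep-sound c m p))
             (s4 c c′ (⟦ m ⟧m ρ) (⟦ m′ ⟧m ρ) (⟦ p ⟧p ρ)))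

    mulp-sound : ∀ p q → ⟦ mulp p q ⟧p ρ ≡ ⟦ p ⟧p ρ * ⟦ q ⟧p ρ
    mulp-sound [] q = sym (ℤₚ.*-zeroˡ (⟦ q ⟧p ρ))
    mulp-sound ((c , m) ∷ p) q = trans (addp-sound (scalep c m q) (mulp p q))
      (trans (cong₂ _+_ (scalep-sound c m q) (mulp-sound p q)) (s5 (c * ⟦ m ⟧m ρ) (⟦ p ⟧p ρ) (⟦ q ⟧p ρ)))

    norm-sound : ∀ e → ⟦ norm e ⟧p ρ ≡ ⟦ e ⟧ ρ
    norm-sound (con c)  = trans (cons-sound c [] []) (s9 c)
    norm-sound (var i)  = s8 (look ρ i)
    norm-sound (a :+ b) = trans (addp-sound (norm a) (norm b)) (cong₂ _+_ (norm-sound a) (norm-sound b))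
    norm-sound (a :- b) = trans (addp-sound (norm a) _)
      (trans (cong₂ _+_ (norm-sound a) (trans (scalep-sound (- + 1) [] (norm b)) (cong (λ x → - + 1 * + 1 * x) (norm-sound b))))
             (s6 (⟦ a ⟧ ρ) (⟦ b ⟧ ρ)))
    norm-sound (a :* b) = trans (mulp-sound (norm a) (norm b)) (cong₂ _*_ (norm-sound a) (norm-sound b))
    norm-sound (:- a)   = trans (scalep-sound (- + 1) [] (norm a))
      (trans (cong (λ x → - + 1 * + 1 * x) (norm-sound a)) (s7 (⟦ a ⟧ ρ)))

  -- Sequents and their refutation by checked linear combinations

  infix 5 _:≤_ _:<_ _:=_
  infixr 4 _⇒_

  data Atom : Set where
    _:≤_ _:<_ _:=_ : Expr → Expr → Atom
    :⊥ : Atom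

  data Seq : Set where
    ⊢_  : Atom → Seq
    _⇒_ : Atom → Seq → Seq

  infix 4 ⊢_

  ⟦_⟧a : Atom → Env → Set
  ⟦ a :≤ b ⟧a ρ = ⟦ a ⟧ ρ ≤ ⟦ b ⟧ ρ
  ⟦ a :< b ⟧a ρ = ⟦ a ⟧ ρ < ⟦ b ⟧ ρ
  ⟦ a := b ⟧a ρ = ⟦ a ⟧ ρ ≡ ⟦ b ⟧ ρ
  ⟦ :⊥ ⟧a ρ     = ⊥

  ⟦_⟧s : Seq → Env → Set
  ⟦ ⊢ a ⟧s ρ   = ⟦ a ⟧a ρ
  ⟦ a ⇒ s ⟧s ρ = ⟦ a ⟧a ρ → ⟦ s ⟧s ρ

  -- A row asserts that its polynomial is zero (true) or non-negative (false).
  Row : Set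
  Row = Bool × Poly

  Holds : Env → Row → Set
  Holds ρ (true  , p) = ⟦ p ⟧p ρ ≡ + 0
  Holds ρ (false , p) = + 0 ≤ ⟦ p ⟧p ρ

  -- Integrality enters only here: `a < b` is sharpened to 1 + a ≤ b. Falsity is the row -1 ≥ 0.
  rowOf : Atom → Row
  rowOf (a :≤ b) = false , norm (b :- a)
  rowOf (a :< b) = false , norm (b :- (# 1 :+ a))
  rowOf (a := b) = true  , norm (b :- a)
  rowOf :⊥       = false , (- + 1 , []) ∷ []

  rowOf-sound : ∀ ρ a → ⟦ a ⟧a ρ → Holds ρ (rowOf a)
  rowOf-sound ρ (a :≤ b) h = subst (+ 0 ≤_) (sym (Sound.norm-sound ρ (b :- a))) (ℤₚ.i≤j⇒0≤j-i h)
  rowOf-sound ρ (a :< b) h = subst (+ 0 ≤_) (sym (Sound.norm-sound ρ (b :- (# 1 :+ a)))) (ℤₚ.i≤j⇒0≤j-i (ℤₚ.i<j⇒suc[i]≤j h))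
  rowOf-sound ρ (a := b) h = trans (Sound.norm-sound ρ (b :- a)) (ℤₚ.i≡j⇒i-j≡0 (sym h))

  isNonNeg : ℤ → Bool
  isNonNeg (+ _)     = true
  isNonNeg (-[1+ _ ]) = false

  combine : List (ℤ × Row) → Poly
  combine []                 = []
  combine ((c , _ , p) ∷ rs) = addp (scalep c [] p) (combine rs)

  valid : List (ℤ × Row) → Bool
  valid []                       = true
  valid ((c , true  , _) ∷ rs)   = valid rs
  valid ((c , false , _) ∷ rs)   = isNonNeg c ∧ valid rs

  negative : Poly → Bool
  negative ((-[1+ _ ] , []) ∷ []) = true
  negative _                      = false

  zipC : List ℤ → List Row → List (ℤ × Row)
  zipC (c ∷ cs) (r ∷ rs) = (c , r) ∷ zipC cs rs
  zipC _        _        = []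

  private
    T-∧ : ∀ {a b} → T (a ∧ b) → T a × T b
    T-∧ {true} {true} _ = tt , tt

  combine-sound : ∀ ρ cs rs → All (Holds ρ) rs → T (valid (zipC cs rs)) → + 0 ≤ ⟦ combine (zipC cs rs) ⟧p ρ
  combine-sound ρ []       rs       hs v = ℤₚ.≤-refl
  combine-sound ρ (c ∷ cs) []       hs v = ℤₚ.≤-refl
  combine-sound ρ (c ∷ cs) ((true , p) ∷ rs) (h ∷ hs) v =
    subst (+ 0 ≤_) (sym (trans (Sound.addp-sound ρ (scalep c [] p) _)
      (trans (cong (_+ _) (trans (Sound.scalep-sound ρ c [] p) (trans (cong (λ x → c * + 1 * x) h) (ℤₚ.*-zeroʳ (c * + 1)))))
             (ℤₚ.+-identityˡ _))))
      (combine-sound ρ cs rs hs v)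
  combine-sound ρ ((+ c) ∷ cs) ((false , p) ∷ rs) (h ∷ hs) v =
    subst (+ 0 ≤_) (sym (trans (Sound.addp-sound ρ (scalep (+ c) [] p) _)
      (cong (_+ _) (trans (Sound.scalep-sound ρ (+ c) [] p) (cong (_* ⟦ p ⟧p ρ) (ℤₚ.*-identityʳ (+ c)))))))
      (ℤₚ.+-mono-≤ (subst (_≤ + c * ⟦ p ⟧p ρ) (ℤₚ.*-zeroʳ (+ c)) (ℤₚ.*-monoˡ-≤-nonNeg (+ c) h))
                   (combine-sound ρ cs rs hs v))

  negative-sound : ∀ ρ p → T (negative p) → + 0 ≤ ⟦ p ⟧p ρ → ⊥
  negative-sound ρ ((-[1+ k ] , []) ∷ []) _ h with subst (+ 0 ≤_) (trans (ℤₚ.+-identityʳ _) (ℤₚ.*-identityʳ -[1+ k ])) h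
  ... | ()

  -- Fourier–Motzkin elimination producing Farkas multipliers; it needs no correctness proof because its output is checked.
  Tracked : Set
  Tracked = Bool × Poly × List ℤ

  coeff : Mono → Poly → ℤ
  coeff m [] = + 0
  coeff m ((c , m′) ∷ p) = if does (m ≟m m′) then c else coeff m p

  addL : List ℤ → List ℤ → List ℤ
  addL []       ys       = ys
  addL (x ∷ xs) []       = x ∷ xs
  addL (x ∷ xs) (y ∷ ys) = (x + y) ∷ addL xs ys

  scaleL : ℤ → List ℤ → List ℤ
  scaleL c = map (c *_)

  lcomb : ℤ → Tracked → ℤ → Tracked → Tracked
  lcomb a (b₁ , p , u) b (b₂ , q , v) =
    (b₁ ∧ b₂) , addp (scalep a [] p) (scalep b [] q) , addL (scaleL a u) (scaleL b v)

  isPos isZero : ℤ → Bool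
  isPos (+ suc _) = true
  isPos _         = false
  isZero (+ 0) = true
  isZero _     = false

  pick : List Tracked → (Tracked → Bool) → List Tracked
  pick [] f = []
  pick (t ∷ ts) f = if f t then t ∷ pick ts f else pick ts f

  firstMono : Poly → List Mono
  firstMono [] = []
  firstMono ((_ , []) ∷ p) = firstMono p
  firstMono ((_ , m@(_ ∷ _)) ∷ p) = m ∷ []

  monos : Poly → List Mono
  monos [] = []
  monos ((_ , []) ∷ p) = monos p
  monos ((_ , m@(_ ∷ _)) ∷ p) = m ∷ monos p

  module _ (m : Mono) where
    co : Tracked → ℤ
    co (_ , p , _) = coeff m p

    -- The row `t` is multiplied by the absolute value of the pivot, so an inequality keeps its
    -- direction; the equation `e` may enter with either sign.
    substEq : Tracked → List Tracked → List Tracked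
    substEq e [] = []
    substEq e (t ∷ ts) = if isZero (co t) then t ∷ substEq e ts
      else (if isPos (co e) then lcomb (co e) t (- co t) e else lcomb (- co e) t (co t) e) ∷ substEq e ts

    cross : List Tracked → List Tracked → List Tracked
    cross [] ns = []
    cross (p ∷ ps) ns = map (λ n → lcomb (- co n) p (co p) n) ns ++ cross ps ns

    cost : List Tracked → ℕ
    cost ts = length (pick ts (λ t → isPos (co t))) ℕ.* length (pick ts (λ t → isPos (- co t)))

    elim : List Tracked → List Tracked
    elim ts = pick ts (λ t → isZero (co t)) ++ cross (pick ts (λ t → isPos (co t))) (pick ts (λ t → isPos (- co t)))

  -- A greedy choice of the monomial whose elimination creates the fewest pairs of rows. Nonlinear
  -- monomials count as independent variables, which is why products are supplied as separate
  -- hypotheses later on.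
  best : List Tracked → List Mono → List (ℕ × Mono)
  best ts [] = []
  best ts (m ∷ ms) with best ts ms
  ... | [] = (cost m ts , m) ∷ []
  ... | (k , m′) ∷ _ = if cost m ts ℕ.≤ᵇ k then (cost m ts , m) ∷ [] else (k , m′) ∷ []

  allMonos : List Tracked → List Mono
  allMonos [] = []
  allMonos ((_ , p , _) ∷ ts) = monos p ++ allMonos ts

  found : List Tracked → List (List ℤ)
  found [] = []
  found ((false , p , u) ∷ ts) = if negative p then u ∷ [] else found ts
  found ((true  , _ , u) ∷ ts) = found ts

  foundEq : List Tracked → List (List ℤ)
  foundEq [] = []
  foundEq ((_ , ((+ suc _) , []) ∷ [] , u) ∷ ts) = scaleL (- + 1) u ∷ []
  foundEq ((_ , (-[1+ _ ] , []) ∷ [] , u) ∷ ts) = u ∷ []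
  foundEq (_ ∷ ts) = foundEq ts

  -- Running out of fuel gives the empty certificate, and the checker rejects it; the bound can make
  -- a search fail but cannot make it unsound.
  fm : ℕ → List Tracked → List ℤ
  fm zero ts = []
  fm (suc k) ts with found ts
  ... | u ∷ _ = u
  ... | [] with best ts (allMonos ts)
  ...   | []          = []
  ...   | (_ , m) ∷ _ = fm k (elim m ts)

  -- Equations are used up before the inequalities, because a pivot equation removes a monomial
  -- without increasing the number of rows.
  gauss : ℕ → List Tracked → List Tracked → List ℤ
  gauss zero    es ts = []
  gauss (suc k) []       ts = fm 40 ts
  gauss (suc k) (e@(_ , p , _) ∷ es) ts with foundEq (e ∷ [])
  ... | u ∷ _ = u
  ... | [] with firstMono p
  ...   | []    = gauss k es ts
  ...   | m ∷ _ = gauss k (substEq m e es) (substEq m e ts)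

  unitL : ℕ → List ℤ
  unitL zero = + 1 ∷ []
  unitL (suc k) = + 0 ∷ unitL k

  track : ℕ → List Row → List Tracked
  track k [] = []
  track k ((b , p) ∷ rs) = (b , p , unitL k) ∷ track (suc k) rs

  certificate : List Row → List ℤ
  certificate rs = gauss 100 (pick (track 0 rs) proj₁) (pick (track 0 rs) (λ t → not (proj₁ t)))

  refuted : List Row → Bool
  refuted rs = let z = zipC (certificate rs) rs in valid z ∧ negative (combine z)

  refuted-sound : ∀ ρ rs → T (refuted rs) → All (Holds ρ) rs → ⊥
  refuted-sound ρ rs t hs with T-∧ {valid (zipC (certificate rs) rs)} t
  ... | v , n = negative-sound ρ _ n (combine-sound ρ (certificate rs) rs hs v)

  goalOK : List Row → Atom → Bool
  goalOK rs (a :≤ b) = refuted (rowOf (b :< a) ∷ rs)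
  goalOK rs (a :< b) = refuted (rowOf (b :≤ a) ∷ rs)
  goalOK rs (a := b) = refuted (rowOf (b :< a) ∷ rs) ∧ refuted (rowOf (a :< b) ∷ rs)
  goalOK rs :⊥       = refuted rs

  goalOK-sound : ∀ ρ rs a → T (goalOK rs a) → All (Holds ρ) rs → ⟦ a ⟧a ρ
  goalOK-sound ρ rs (a :≤ b) t hs = ℤₚ.≮⇒≥ (λ h → refuted-sound ρ _ t (rowOf-sound ρ (b :< a) h ∷ hs))
  goalOK-sound ρ rs (a :< b) t hs = ℤₚ.≰⇒> (λ h → refuted-sound ρ _ t (rowOf-sound ρ (b :≤ a) h ∷ hs))
  goalOK-sound ρ rs (a := b) t hs with T-∧ {refuted (rowOf (b :< a) ∷ rs)} t
  ... | t₁ , t₂ = ℤₚ.≤-antisym (ℤₚ.≮⇒≥ (λ h → refuted-sound ρ _ t₁ (rowOf-sound ρ (b :< a) h ∷ hs)))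
                               (ℤₚ.≮⇒≥ (λ h → refuted-sound ρ _ t₂ (rowOf-sound ρ (a :< b) h ∷ hs)))
  goalOK-sound ρ rs :⊥       t hs = refuted-sound ρ rs t hs

  seqOK : List Row → Seq → Bool
  seqOK rs (⊢ a)   = goalOK rs a
  seqOK rs (a ⇒ s) = seqOK (rowOf a ∷ rs) s

  seqOK-sound : ∀ ρ rs s → T (seqOK rs s) → All (Holds ρ) rs → ⟦ s ⟧s ρ
  seqOK-sound ρ rs (⊢ a)   t hs   = goalOK-sound ρ rs a t hs
  seqOK-sound ρ rs (a ⇒ s) t hs h = seqOK-sound ρ (rowOf a ∷ rs) s t (rowOf-sound ρ a h ∷ hs)

  Nary : ℕ → Set → Set → Set
  Nary zero    A B = B
  Nary (suc k) A B = A → Nary k A B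

  apply : ∀ k → ℕ → Nary k Expr Seq → Seq
  apply zero    i f = f
  apply (suc k) i f = apply k (suc i) (f (var i))

  Claim : ℕ → (List ℤ → List ℤ) → Seq → Set
  Claim zero    acc s = ⟦ s ⟧s (acc [])
  Claim (suc k) acc s = (x : ℤ) → Claim k (λ xs → acc (x ∷ xs)) s

  claim : ∀ k acc s → T (seqOK [] s) → Claim k acc s
  claim zero    acc s t   = seqOK-sound (acc []) [] s t []
  claim (suc k) acc s t x = claim k (λ xs → acc (x ∷ xs)) s t

  -- Polynomial consequences over ℤ whose proof is a linear combination of the hypotheses with constant coefficients.
  abstract
    lin : ∀ k (f : Nary k Expr Seq) → {T (seqOK [] (apply k 0 f))} → Claim k (λ xs → xs) (apply k 0 f)
    lin k f {t} = claim k (λ xs → xs) (apply k 0 f) t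

open LinearArithmetic using (lin; #_; con; _:+_; _:-_; _:*_; :-_; _:=_; _:≤_; _:<_; :⊥; _⇒_; ⊢_; Expr)
open +-*-Solver using (solve) renaming (_:=_ to _⊜_; _:+_ to _⊕_; _:*_ to _⊗_; _:-_ to _⊝_; con to Con)

vec≡ : ∀ {a b c a′ b′ c′ : ℤ} → a ≡ a′ → b ≡ b′ → c ≡ c′ → pt a b c ≡ pt a′ b′ c′
vec≡ refl refl refl = refl

-- Affine functionals and affine combinations

record Aff : Set where
  constructor aff
  field α β γ δ : ℤ

linear : Aff → Z3 → ℤ
linear (aff α β γ δ) (x ∷ y ∷ z ∷ []) = α * x + β * y + γ * z

infixl 21 _⟨_⟩
_⟨_⟩ : Aff → Z3 → ℤ
f ⟨ v ⟩ = linear f v + Aff.δ f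

sumF : (Z3 → ℤ) → List (ℤ × Z3) → ℤ
sumF f L.[]             = + 0
sumF f ((c , p) L.∷ cs) = c * f p + sumF f cs

linear-step : ∀ f c p s → linear f ((c ·z p) +z s) ≡ c * linear f p + linear f s
linear-step (aff α β γ δ) c (x ∷ y ∷ z ∷ []) (u ∷ v ∷ w ∷ []) =
  lin 10 (λ α β γ c x y z u v w → ⊢ α :* (c :* x :+ u) :+ β :* (c :* y :+ v) :+ γ :* (c :* z :+ w)
      := c :* (α :* x :+ β :* y :+ γ :* z) :+ (α :* u :+ β :* v :+ γ :* w)) α β γ c x y z u v w

linear-scale : ∀ f c p → linear f (c ·z p) ≡ c * linear f p
linear-scale (aff α β γ δ) c (x ∷ y ∷ z ∷ []) =
  lin 7 (λ α β γ c x y z → ⊢ α :* (c :* x) :+ β :* (c :* y) :+ γ :* (c :* z) := c :* (α :* x :+ β :* y :+ γ :* z))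
    α β γ c x y z

linear-- : ∀ f x y → linear f (x -z y) ≡ linear f x - linear f y
linear-- (aff α β γ δ) (x ∷ y ∷ z ∷ []) (x′ ∷ y′ ∷ z′ ∷ []) = lin 9 (λ α β γ x y z x′ y′ z′ → ⊢ α :* (x :- x′) :+ β :* (y :- y′) :+ γ :* (z :- z′) := (α :* x :+ β :* y :+ γ :* z) :- (α :* x′ :+ β :* y′ :+ γ :* z′)) α β γ x y z x′ y′ z′

linear-zero : ∀ f → linear f zero3 ≡ + 0
linear-zero (aff α β γ δ) = lin 3 (λ α β γ → ⊢ α :* # 0 :+ β :* # 0 :+ γ :* # 0 := # 0) α β γ

sumF-aff : ∀ f cs → sumF (f ⟨_⟩) cs ≡ linear f (combZ cs) + Aff.δ f * sumZ cs
sumF-aff f L.[] = lin 2 (λ l d → l := # 0 ⇒ ⊢ # 0 := l :+ d :* # 0) (linear f zero3) (Aff.δ f) (linear-zero f)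
sumF-aff f ((c , p) L.∷ cs) =
  lin 7 (λ c l d s m S t → S := m :+ d :* s ⇒ t := c :* l :+ m ⇒ ⊢ c :* (l :+ d) :+ S := t :+ d :* (c :+ s))
    c (linear f p) (Aff.δ f) (sumZ cs) (linear f (combZ cs)) (sumF (f ⟨_⟩) cs) _ (sumF-aff f cs) (linear-step f c p (combZ cs))

aff-comb : ∀ f cs N z → sumZ cs ≡ N → combZ cs ≡ N ·z z → sumF (f ⟨_⟩) cs ≡ N * f ⟨ z ⟩
aff-comb f cs _ z refl e = trans (sumF-aff f cs)
  (trans (cong (λ v → linear f v + Aff.δ f * sumZ cs) e)
    (lin 4 (λ N l d m → m := N :* l ⇒ ⊢ m :+ d :* N := N :* (l :+ d)) N (linear f z) (Aff.δ f) _ (linear-scale f N z)))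
  where N = sumZ cs

·z-one : ∀ z → ((+ 1) ·z z) ≡ z
·z-one (x ∷ y ∷ z ∷ []) = vec≡ (ℤₚ.*-identityˡ x) (ℤₚ.*-identityˡ y) (ℤₚ.*-identityˡ z)

aff-at : ∀ f cs → sumZ cs ≡ + 1 → f ⟨ combZ cs ⟩ ≡ sumF (f ⟨_⟩) cs
aff-at f cs e = sym (trans (aff-comb f cs (+ 1) (combZ cs) e (sym (·z-one _))) (ℤₚ.*-identityˡ _))

-- Volumes and barycentric coordinates

-- The determinant of the edge vectors p - s, q - s and r - s, that is, six times the signed volume.
det4 : Z3 → Z3 → Z3 → Z3 → ℤ
det4 (a ∷ b ∷ c ∷ []) (d ∷ e ∷ f ∷ []) (g ∷ h ∷ i ∷ []) (j ∷ k ∷ l ∷ []) =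
  (a - j) * ((e - k) * (i - l) - (f - l) * (h - k))
  - (b - k) * ((d - j) * (i - l) - (f - l) * (g - j))
  + (c - l) * ((d - j) * (h - k) - (e - k) * (g - j))

vol : Z3 → Z3 → Z3 → Z3 → ℕ
vol p q r s = ∣ det4 p q r s ∣

private
  D′ : Expr → Expr → Expr → Expr → Expr → Expr → Expr → Expr → Expr → Expr → Expr → Expr → Expr
  D′ a b c d e f g h i j k l = (a :- j) :* ((e :- k) :* (i :- l) :- (f :- l) :* (h :- k))
    :- (b :- k) :* ((d :- j) :* (i :- l) :- (f :- l) :* (g :- j))
    :+ (c :- l) :* ((d :- j) :* (h :- k) :- (e :- k) :* (g :- j))

  abs-neg : ∀ {x y} → x ≡ - y → ∣ x ∣ ≡ ∣ y ∣
  abs-neg {x} {y} refl = ℤₚ.∣-i∣≡∣i∣ y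

vol-12 : ∀ p q r s → vol p q r s ≡ vol q p r s
vol-12 (a ∷ b ∷ c ∷ []) (d ∷ e ∷ f ∷ []) (g ∷ h ∷ i ∷ []) (j ∷ k ∷ l ∷ []) = abs-neg
  (lin 12 (λ a b c d e f g h i j k l → ⊢ D′ a b c d e f g h i j k l := :- D′ d e f a b c g h i j k l) a b c d e f g h i j k l)

vol-23 : ∀ p q r s → vol p q r s ≡ vol p r q s
vol-23 (a ∷ b ∷ c ∷ []) (d ∷ e ∷ f ∷ []) (g ∷ h ∷ i ∷ []) (j ∷ k ∷ l ∷ []) = abs-neg
  (lin 12 (λ a b c d e f g h i j k l → ⊢ D′ a b c d e f g h i j k l := :- D′ a b c g h i d e f j k l) a b c d e f g h i j k l)

vol-34 : ∀ p q r s → vol p q r s ≡ vol p q s r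
vol-34 (a ∷ b ∷ c ∷ []) (d ∷ e ∷ f ∷ []) (g ∷ h ∷ i ∷ []) (j ∷ k ∷ l ∷ []) = abs-neg
  (lin 12 (λ a b c d e f g h i j k l → ⊢ D′ a b c d e f g h i j k l := :- D′ a b c d e f j k l g h i) a b c d e f g h i j k l)

vol-deg : ∀ p r s → vol p p r s ≡ 0
vol-deg (a ∷ b ∷ c ∷ []) (g ∷ h ∷ i ∷ []) (j ∷ k ∷ l ∷ []) = cong ∣_∣
  (lin 9 (λ a b c g h i j k l → ⊢ D′ a b c a b c g h i j k l := # 0) a b c g h i j k l)

-- The barycentric coordinates are scaled by the normalised volume, which makes them integral, and
-- their signs are normalised by n > 0. The orientation is thereby forgotten and the four vertices
-- become interchangeable.
record Tet (p q r s : Z3) : Set where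
  field
    n : ℤ
    n>0 : + 0 < n
    n≡vol : n ≡ + vol p q r s
    W₁ W₂ W₃ W₄ : Aff
    sumW : ∀ z → W₁ ⟨ z ⟩ + W₂ ⟨ z ⟩ + W₃ ⟨ z ⟩ + W₄ ⟨ z ⟩ ≡ n
    combW : ∀ z → combZ ((W₁ ⟨ z ⟩ , p) L.∷ (W₂ ⟨ z ⟩ , q) L.∷ (W₃ ⟨ z ⟩ , r) L.∷ (W₄ ⟨ z ⟩ , s) L.∷ L.[]) ≡ n ·z z
    vol₁ : ∀ z → ∣ W₁ ⟨ z ⟩ ∣ ≡ vol z q r s
    vol₂ : ∀ z → ∣ W₂ ⟨ z ⟩ ∣ ≡ vol p z r s
    vol₃ : ∀ z → ∣ W₃ ⟨ z ⟩ ∣ ≡ vol p q z s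
    vol₄ : ∀ z → ∣ W₄ ⟨ z ⟩ ∣ ≡ vol p q r z

-- The signed-determinant description of the coordinates, which fixes the vertex order.
record Raw {p q r s : Z3} (T : Tet p q r s) : Set where
  open Tet T
  field
    ε : ℤ
    ε² : ε * ε ≡ + 1
    n≡ : n ≡ ε * det4 p q r s
    W₂≡ : ∀ z → W₂ ⟨ z ⟩ ≡ ε * det4 p z r s
    W₃≡ : ∀ z → W₃ ⟨ z ⟩ ≡ ε * det4 p q z s

private
  -- Both orientations at once, with ε the sign of the determinant. The vectors `c₁`, `c₂`, `c₃` are
  -- cross products of edge vectors at s, and `W₄` is defined as what the other three coordinates
  -- leave of n.
  mkε : ∀ p q r s ε → ε * ε ≡ + 1 → (∀ x → ∣ ε * x ∣ ≡ ∣ x ∣) → ε * det4 p q r s ≡ + vol p q r s → + 0 < ε * det4 p q r s → Σ (Tet p q r s) Raw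
  mkε p@(a ∷ b ∷ c ∷ []) q@(d ∷ e ∷ f ∷ []) r@(g ∷ h ∷ i ∷ []) s@(j ∷ k ∷ l ∷ []) ε ε² absε eq pos = record
    { n = ε * det4 p q r s ; n>0 = pos ; n≡vol = eq
    ; W₁ = fun c₁x c₁y c₁z ; W₂ = fun c₂x c₂y c₂z ; W₃ = fun c₃x c₃y c₃z
    ; W₄ = aff (- (ε * c₁x + ε * c₂x + ε * c₃x)) (- (ε * c₁y + ε * c₂y + ε * c₃y)) (- (ε * c₁z + ε * c₂z + ε * c₃z))
               (ε * det4 p q r s + (ε * c₁x + ε * c₂x + ε * c₃x) * j + (ε * c₁y + ε * c₂y + ε * c₃y) * k + (ε * c₁z + ε * c₂z + ε * c₃z) * l)
    ; sumW = λ { (x ∷ y ∷ z ∷ []) → lin 17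
        (λ c₁x c₁y c₁z c₂x c₂y c₂z c₃x c₃y c₃z j k l D ε x y z →
          ⊢ (ε :* c₁x :* x :+ ε :* c₁y :* y :+ ε :* c₁z :* z :+ :- (ε :* c₁x :* j :+ ε :* c₁y :* k :+ ε :* c₁z :* l))
          :+ (ε :* c₂x :* x :+ ε :* c₂y :* y :+ ε :* c₂z :* z :+ :- (ε :* c₂x :* j :+ ε :* c₂y :* k :+ ε :* c₂z :* l))
          :+ (ε :* c₃x :* x :+ ε :* c₃y :* y :+ ε :* c₃z :* z :+ :- (ε :* c₃x :* j :+ ε :* c₃y :* k :+ ε :* c₃z :* l))
          :+ (:- (ε :* c₁x :+ ε :* c₂x :+ ε :* c₃x) :* x :+ :- (ε :* c₁y :+ ε :* c₂y :+ ε :* c₃y) :* y :+ :- (ε :* c₁z :+ ε :* c₂z :+ ε :* c₃z) :* z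
             :+ (ε :* D :+ (ε :* c₁x :+ ε :* c₂x :+ ε :* c₃x) :* j :+ (ε :* c₁y :+ ε :* c₂y :+ ε :* c₃y) :* k :+ (ε :* c₁z :+ ε :* c₂z :+ ε :* c₃z) :* l))
          := ε :* D)
        c₁x c₁y c₁z c₂x c₂y c₂z c₃x c₃y c₃z j k l (det4 p q r s) ε x y z }
    ; combW = λ { (x ∷ y ∷ z ∷ []) → vec≡
        (lin 16 (λ ε a b c d e f g h i j k l x y z → ⊢
          W1′ ε d e f g h i j k l x y z :* a :+ (W2′ ε a b c g h i j k l x y z :* d :+ (W3′ ε a b c d e f j k l x y z :* g
            :+ (W4′ ε a b c d e f g h i j k l x y z :* j :+ # 0)))
          := ε :* D′ a b c d e f g h i j k l :* x) ε a b c d e f g h i j k l x y z)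
        (lin 16 (λ ε a b c d e f g h i j k l x y z → ⊢
          W1′ ε d e f g h i j k l x y z :* b :+ (W2′ ε a b c g h i j k l x y z :* e :+ (W3′ ε a b c d e f j k l x y z :* h
            :+ (W4′ ε a b c d e f g h i j k l x y z :* k :+ # 0)))
          := ε :* D′ a b c d e f g h i j k l :* y) ε a b c d e f g h i j k l x y z)
        (lin 16 (λ ε a b c d e f g h i j k l x y z → ⊢
          W1′ ε d e f g h i j k l x y z :* c :+ (W2′ ε a b c g h i j k l x y z :* f :+ (W3′ ε a b c d e f j k l x y z :* i
            :+ (W4′ ε a b c d e f g h i j k l x y z :* l :+ # 0)))
          := ε :* D′ a b c d e f g h i j k l :* z) ε a b c d e f g h i j k l x y z) }
    ; vol₁ = λ { (x ∷ y ∷ z ∷ []) → trans (cong ∣_∣ (lin 13 (λ ε d e f g h i j k l x y z → ⊢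
               W1′ ε d e f g h i j k l x y z := ε :* D′ x y z d e f g h i j k l) ε d e f g h i j k l x y z)) (absε _) }
    ; vol₂ = λ z → trans (cong ∣_∣ (val₂ z)) (absε _)
    ; vol₃ = λ z → trans (cong ∣_∣ (val₃ z)) (absε _)
    ; vol₄ = λ { (x ∷ y ∷ z ∷ []) → trans (cong ∣_∣ (lin 16 (λ ε a b c d e f g h i j k l x y z → ⊢
               W4′ ε a b c d e f g h i j k l x y z := ε :* D′ a b c d e f g h i x y z) ε a b c d e f g h i j k l x y z)) (absε _) }
    } , record { ε = ε ; ε² = ε² ; n≡ = refl ; W₂≡ = val₂ ; W₃≡ = val₃ }
    where
    c₁x = (e - k) * (i - l) - (f - l) * (h - k)
    c₁y = (f - l) * (g - j) - (d - j) * (i - l)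
    c₁z = (d - j) * (h - k) - (e - k) * (g - j)
    c₂x = (h - k) * (c - l) - (i - l) * (b - k)
    c₂y = (i - l) * (a - j) - (g - j) * (c - l)
    c₂z = (g - j) * (b - k) - (h - k) * (a - j)
    c₃x = (b - k) * (f - l) - (c - l) * (e - k)
    c₃y = (c - l) * (d - j) - (a - j) * (f - l)
    c₃z = (a - j) * (e - k) - (b - k) * (d - j)
    fun : ℤ → ℤ → ℤ → Aff
    fun u v w = aff (ε * u) (ε * v) (ε * w) (- (ε * u * j + ε * v * k + ε * w * l))
    fun′ : Expr → Expr → Expr → Expr → Expr → Expr → Expr → Expr → Expr → Expr → Expr
    fun′ ε u v w j k l x y z = ε :* u :* x :+ ε :* v :* y :+ ε :* w :* z :+ :- (ε :* u :* j :+ ε :* v :* k :+ ε :* w :* l)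
    W1′ : Expr → Expr → Expr → Expr → Expr → Expr → Expr → Expr → Expr → Expr → Expr → Expr → Expr → Expr
    W1′ ε d e f g h i j k l x y z = fun′ ε ((e :- k) :* (i :- l) :- (f :- l) :* (h :- k)) ((f :- l) :* (g :- j) :- (d :- j) :* (i :- l))
                                  ((d :- j) :* (h :- k) :- (e :- k) :* (g :- j)) j k l x y z
    W2′ : Expr → Expr → Expr → Expr → Expr → Expr → Expr → Expr → Expr → Expr → Expr → Expr → Expr → Expr
    W2′ ε a b c g h i j k l x y z = fun′ ε ((h :- k) :* (c :- l) :- (i :- l) :* (b :- k)) ((i :- l) :* (a :- j) :- (g :- j) :* (c :- l))
                                  ((g :- j) :* (b :- k) :- (h :- k) :* (a :- j)) j k l x y z
    W3′ : Expr → Expr → Expr → Expr → Expr → Expr → Expr → Expr → Expr → Expr → Expr → Expr → Expr → Expr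
    W3′ ε a b c d e f j k l x y z = fun′ ε ((b :- k) :* (f :- l) :- (c :- l) :* (e :- k)) ((c :- l) :* (d :- j) :- (a :- j) :* (f :- l))
                                  ((a :- j) :* (e :- k) :- (b :- k) :* (d :- j)) j k l x y z
    W4′ : Expr → Expr → Expr → Expr → Expr → Expr → Expr → Expr → Expr → Expr → Expr → Expr → Expr → Expr → Expr → Expr → Expr
    W4′ ε a b c d e f g h i j k l x y z =
      (:- X) :* x :+ (:- Y) :* y :+ (:- Z) :* z :+ (ε :* D′ a b c d e f g h i j k l :+ X :* j :+ Y :* k :+ Z :* l)
      where
      X = ε :* ((e :- k) :* (i :- l) :- (f :- l) :* (h :- k)) :+ ε :* ((h :- k) :* (c :- l) :- (i :- l) :* (b :- k)) :+ ε :* ((b :- k) :* (f :- l) :- (c :- l) :* (e :- k))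
      Y = ε :* ((f :- l) :* (g :- j) :- (d :- j) :* (i :- l)) :+ ε :* ((i :- l) :* (a :- j) :- (g :- j) :* (c :- l)) :+ ε :* ((c :- l) :* (d :- j) :- (a :- j) :* (f :- l))
      Z = ε :* ((d :- j) :* (h :- k) :- (e :- k) :* (g :- j)) :+ ε :* ((g :- j) :* (b :- k) :- (h :- k) :* (a :- j)) :+ ε :* ((a :- j) :* (e :- k) :- (b :- k) :* (d :- j))
    val₂ : ∀ z → fun c₂x c₂y c₂z ⟨ z ⟩ ≡ ε * det4 p z r s
    val₂ (x ∷ y ∷ z ∷ []) = lin 13 (λ ε a b c g h i j k l x y z → ⊢
               W2′ ε a b c g h i j k l x y z := ε :* D′ a b c x y z g h i j k l) ε a b c g h i j k l x y z
    val₃ : ∀ z → fun c₃x c₃y c₃z ⟨ z ⟩ ≡ ε * det4 p q z s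
    val₃ (x ∷ y ∷ z ∷ []) = lin 13 (λ ε a b c d e f j k l x y z → ⊢
               W3′ ε a b c d e f j k l x y z := ε :* D′ a b c d e f x y z j k l) ε a b c d e f j k l x y z

mk : ∀ p q r s → vol p q r s ≢ 0 → Σ (Tet p q r s) Raw
mk p q r s v≢0 with det4 p q r s in eq
... | + zero  = ⊥-elim (v≢0 refl)
... | + suc k = mkε p q r s (+ 1) refl (λ x → cong ∣_∣ (ℤₚ.*-identityˡ x)) (trans (ℤₚ.*-identityˡ _) (trans eq (cong (λ x → + ∣ x ∣) (sym eq))))
                  (subst (+ 0 <_) (sym (trans (ℤₚ.*-identityˡ _) eq)) (ℤ.+<+ (ℕ.s≤s ℕ.z≤n)))
... | -[1+ k ] = mkε p q r s (- + 1) refl (λ x → trans (cong ∣_∣ (ℤₚ.-1*i≡-i x)) (ℤₚ.∣-i∣≡∣i∣ x))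
                  (trans (ℤₚ.-1*i≡-i _) (trans (cong -_ eq) (cong (λ x → + ∣ x ∣) (sym eq))))
                  (subst (+ 0 <_) (sym (trans (ℤₚ.-1*i≡-i _) (cong -_ eq))) (ℤ.+<+ (ℕ.s≤s ℕ.z≤n)))

infix 4 _∣ᶻ_
_∣ᶻ_ : ℤ → ℤ → Set
d ∣ᶻ x = ∃ λ k → x ≡ k * d

cancel< : ∀ {n} a b → + 0 < n → a * n < b * n → a < b
cancel< {n} a b pos = ℤₚ.*-cancelʳ-<-nonNeg {a} {b} n ⦃ ℤ.nonNegative (ℤₚ.<⇒≤ pos) ⦄

cancel≤ : ∀ {n} a b → + 0 < n → a * n ≤ b * n → a ≤ b
cancel≤ {n} a b pos = ℤₚ.*-cancelʳ-≤-pos a b n ⦃ ℤ.positive pos ⦄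

cancel≡ : ∀ {n} a b → + 0 < n → a * n ≡ b * n → a ≡ b
cancel≡ a b pos e = ℤₚ.≤-antisym (cancel≤ a b pos (ℤₚ.≤-reflexive e)) (cancel≤ b a pos (ℤₚ.≤-reflexive (sym e)))

mul≥0 : ∀ {a b} → + 0 ≤ a → + 0 ≤ b → + 0 ≤ a * b
mul≥0 {+ a} {+ b} _ _ = subst (+ 0 ≤_) (ℤₚ.pos-* a b) (+≤+ z≤n)

mul>0 : ∀ {a b} → + 0 < a → + 0 < b → + 0 < a * b
mul>0 {+ suc a} {+ suc b} _ _ = +<+ (s≤s z≤n)
mul>0 {+ zero} (+<+ ()) _
mul>0 {+ suc a} {+ zero} _ (+<+ ())

divide : ∀ n → + 0 < n → ∀ x → ∃ λ q → ∃ λ r → x ≡ r + q * n × + 0 ≤ r × r < n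
divide (+ zero)  (+<+ ()) x
divide (+ suc k) _        x =
  (x ℤ-DM./ℕ suc k) , + (x ℤ-DM.%ℕ suc k) , ℤ-DM.a≡a%ℕn+[a/ℕn]*n x (suc k) , +≤+ z≤n , +<+ (ℤ-DM.n%ℕd<d x (suc k))

small₃ : ∀ t → + 0 ≤ t → t < + 3 → t ≡ + 0 ⊎ t ≡ + 1 ⊎ t ≡ + 2
small₃ (+ 0) _ _ = inj₁ refl
small₃ (+ 1) _ _ = inj₂ (inj₁ refl)
small₃ (+ 2) _ _ = inj₂ (inj₂ refl)
small₃ (+ suc (suc (suc t))) _ (+<+ (s≤s (s≤s (s≤s ()))))

-- Permuting the vertices of a tetrahedron

+z-swap : ∀ (u v w : Z3) → (u +z (v +z w)) ≡ (v +z (u +z w))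
+z-swap (a ∷ b ∷ c ∷ []) (d ∷ e ∷ f ∷ []) (g ∷ h ∷ i ∷ []) = cong₂ _∷_ (s a d g) (cong₂ _∷_ (s b e h) (cong₂ _∷_ (s c f i) refl))
  where
  s : ∀ x y z → x + (y + z) ≡ y + (x + z)
  s = lin 3 λ x y z → ⊢ x :+ (y :+ z) := y :+ (x :+ z)

-- The transposition permutes the fields, so `W₁` of the result is `W₂` of `T` by definition. A
-- statement about one vertex or facet thus serves for all four.
sw12 : ∀ {p q r s} → Tet p q r s → Tet q p r s
sw12 {p} {q} {r} {s} T = record
  { n = n ; n>0 = n>0 ; n≡vol = trans n≡vol (cong +_ (vol-12 p q r s))
  ; W₁ = W₂ ; W₂ = W₁ ; W₃ = W₃ ; W₄ = W₄
  ; sumW = λ z → lin 5 (λ a b c d n → a :+ b :+ c :+ d := n ⇒ ⊢ b :+ a :+ c :+ d := n) (W₁ ⟨ z ⟩) (W₂ ⟨ z ⟩) (W₃ ⟨ z ⟩) (W₄ ⟨ z ⟩) n (sumW z)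
  ; combW = λ z → trans (+z-swap _ _ _) (combW z)
  ; vol₁ = λ z → trans (vol₂ z) (vol-12 p z r s) ; vol₂ = λ z → trans (vol₁ z) (vol-12 z q r s)
  ; vol₃ = λ z → trans (vol₃ z) (vol-12 p q z s) ; vol₄ = λ z → trans (vol₄ z) (vol-12 p q r z) }
  where open Tet T

sw23 : ∀ {p q r s} → Tet p q r s → Tet p r q s
sw23 {p} {q} {r} {s} T = record
  { n = n ; n>0 = n>0 ; n≡vol = trans n≡vol (cong +_ (vol-23 p q r s))
  ; W₁ = W₁ ; W₂ = W₃ ; W₃ = W₂ ; W₄ = W₄
  ; sumW = λ z → lin 5 (λ a b c d n → a :+ b :+ c :+ d := n ⇒ ⊢ a :+ c :+ b :+ d := n) (W₁ ⟨ z ⟩) (W₂ ⟨ z ⟩) (W₃ ⟨ z ⟩) (W₄ ⟨ z ⟩) n (sumW z)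
  ; combW = λ z → trans (cong (λ v → (W₁ ⟨ z ⟩ ·z p) +z v) (+z-swap _ _ _)) (combW z)
  ; vol₁ = λ z → trans (vol₁ z) (vol-23 z q r s) ; vol₂ = λ z → trans (vol₃ z) (vol-23 p q z s)
  ; vol₃ = λ z → trans (vol₂ z) (vol-23 p z r s) ; vol₄ = λ z → trans (vol₄ z) (vol-23 p q r z) }
  where open Tet T

sw34 : ∀ {p q r s} → Tet p q r s → Tet p q s r
sw34 {p} {q} {r} {s} T = record
  { n = n ; n>0 = n>0 ; n≡vol = trans n≡vol (cong +_ (vol-34 p q r s))
  ; W₁ = W₁ ; W₂ = W₂ ; W₃ = W₄ ; W₄ = W₃
  ; sumW = λ z → lin 5 (λ a b c d n → a :+ b :+ c :+ d := n ⇒ ⊢ a :+ b :+ d :+ c := n) (W₁ ⟨ z ⟩) (W₂ ⟨ z ⟩) (W₃ ⟨ z ⟩) (W₄ ⟨ z ⟩) n (sumW z)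
  ; combW = λ z → trans (cong (λ v → (W₁ ⟨ z ⟩ ·z p) +z ((W₂ ⟨ z ⟩ ·z q) +z v)) (+z-swap _ _ _)) (combW z)
  ; vol₁ = λ z → trans (vol₁ z) (vol-34 z q r s) ; vol₂ = λ z → trans (vol₂ z) (vol-34 p z r s)
  ; vol₃ = λ z → trans (vol₄ z) (vol-34 p q r z) ; vol₄ = λ z → trans (vol₃ z) (vol-34 p q z s) }
  where open Tet T

W₁q : ∀ {p q r s} (T : Tet p q r s) → Tet.W₁ T ⟨ q ⟩ ≡ + 0
W₁q {p} {q} {r} {s} T = ℤₚ.∣i∣≡0⇒i≡0 (trans (Tet.vol₁ T q) (vol-deg q r s))

W₁r : ∀ {p q r s} (T : Tet p q r s) → Tet.W₁ T ⟨ r ⟩ ≡ + 0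
W₁r T = W₁q (sw23 T)

W₁s : ∀ {p q r s} (T : Tet p q r s) → Tet.W₁ T ⟨ s ⟩ ≡ + 0
W₁s T = W₁q (sw23 (sw34 T))

W₁p : ∀ {p q r s} (T : Tet p q r s) → Tet.W₁ T ⟨ p ⟩ ≡ Tet.n T
W₁p {p} T = lin 5 (λ a b c d n → a :+ b :+ c :+ d := n ⇒ b := # 0 ⇒ c := # 0 ⇒ d := # 0 ⇒ ⊢ a := n) (W₁ ⟨ p ⟩) (W₂ ⟨ p ⟩) (W₃ ⟨ p ⟩) (W₄ ⟨ p ⟩) n (sumW p)
  (W₁q (sw12 T)) (W₁q (sw12 (sw23 T))) (W₁q (sw12 (sw23 (sw34 T))))
  where open Tet T

bary : ∀ {p q r s} (T : Tet p q r s) (f : Aff) z → let open Tet T in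
  n * f ⟨ z ⟩ ≡ W₁ ⟨ z ⟩ * f ⟨ p ⟩ + W₂ ⟨ z ⟩ * f ⟨ q ⟩ + W₃ ⟨ z ⟩ * f ⟨ r ⟩ + W₄ ⟨ z ⟩ * f ⟨ s ⟩
bary {p} {q} {r} {s} T f z = trans (sym (aff-comb f cs n z
    (trans (assoc (W₁ ⟨ z ⟩) (W₂ ⟨ z ⟩) (W₃ ⟨ z ⟩) (W₄ ⟨ z ⟩)) (sumW z)) (combW z)))
  (assoc (W₁ ⟨ z ⟩ * f ⟨ p ⟩) (W₂ ⟨ z ⟩ * f ⟨ q ⟩) (W₃ ⟨ z ⟩ * f ⟨ r ⟩) (W₄ ⟨ z ⟩ * f ⟨ s ⟩))
  where
  open Tet T
  cs : List (ℤ × Z3)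
  cs = (W₁ ⟨ z ⟩ , p) L.∷ (W₂ ⟨ z ⟩ , q) L.∷ (W₃ ⟨ z ⟩ , r) L.∷ (W₄ ⟨ z ⟩ , s) L.∷ L.[]
  assoc : ∀ a b c d → a + (b + (c + (d + + 0))) ≡ a + b + c + d
  assoc = lin 4 λ a b c d → ⊢ a :+ (b :+ (c :+ (d :+ # 0))) := a :+ b :+ c :+ d

-- The point meant is k z + k₁ p + k₂ q + k₃ r + k₄ s with weights of sum one. All lattice points
-- with prescribed residues modulo n are produced in this way.
record Moved {p q r s : Z3} (T : Tet p q r s) (k k₁ k₂ k₃ k₄ : ℤ) (z : Z3) : Set where
  constructor moved
  open Tet T
  field
    point : Z3
    at₁ : W₁ ⟨ point ⟩ ≡ k * W₁ ⟨ z ⟩ + k₁ * n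
    at₂ : W₂ ⟨ point ⟩ ≡ k * W₂ ⟨ z ⟩ + k₂ * n
    at₃ : W₃ ⟨ point ⟩ ≡ k * W₃ ⟨ z ⟩ + k₃ * n
    at₄ : W₄ ⟨ point ⟩ ≡ k * W₄ ⟨ z ⟩ + k₄ * n

move : ∀ {p q r s} (T : Tet p q r s) k k₁ k₂ k₃ k₄ z → k + k₁ + k₂ + k₃ + k₄ ≡ + 1 → Moved T k k₁ k₂ k₃ k₄ z
move {p} {q} {r} {s} T k k₁ k₂ k₃ k₄ z e = moved (combZ cs) (a1 _ _ _ _ (at W₁) (W₁p T) (W₁q T) (W₁r T) (W₁s T))
    (a2 _ _ _ _ (at W₂) (W₁q T₂) (W₁p T₂) (W₁r T₂) (W₁s T₂))
    (a3 _ _ _ _ (at W₃) (W₁q T₃) (W₁r T₃) (W₁p T₃) (W₁s T₃))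
    (a4 _ _ _ _ (at W₄) (W₁q T₄) (W₁r T₄) (W₁s T₄) (W₁p T₄))
  where
  open Tet T
  T₂ = sw12 T
  T₃ = sw12 (sw23 T)
  T₄ = sw12 (sw23 (sw34 T))
  cs : List (ℤ × Z3)
  cs = (k , z) L.∷ (k₁ , p) L.∷ (k₂ , q) L.∷ (k₃ , r) L.∷ (k₄ , s) L.∷ L.[]
  at : ∀ f → f ⟨ combZ cs ⟩ ≡ k * f ⟨ z ⟩ + (k₁ * f ⟨ p ⟩ + (k₂ * f ⟨ q ⟩ + (k₃ * f ⟨ r ⟩ + (k₄ * f ⟨ s ⟩ + + 0))))
  at f = aff-at f cs (trans (lin 5 (λ k a b c d → ⊢ k :+ (a :+ (b :+ (c :+ (d :+ # 0)))) := k :+ a :+ b :+ c :+ d) k k₁ k₂ k₃ k₄) e)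
  module _ {x y : ℤ} where
    a1 : ∀ a b c d → x ≡ k * y + (k₁ * a + (k₂ * b + (k₃ * c + (k₄ * d + + 0)))) → a ≡ n → b ≡ + 0 → c ≡ + 0 → d ≡ + 0 → x ≡ k * y + k₁ * n
    a1 _ _ _ _ h refl refl refl refl = trans h (lin 6 (λ m a b c d n → ⊢ m :+ (a :* n :+ (b :* # 0 :+ (c :* # 0 :+ (d :* # 0 :+ # 0)))) := m :+ a :* n) (k * y) k₁ k₂ k₃ k₄ n)
    a2 : ∀ a b c d → x ≡ k * y + (k₁ * a + (k₂ * b + (k₃ * c + (k₄ * d + + 0)))) → a ≡ + 0 → b ≡ n → c ≡ + 0 → d ≡ + 0 → x ≡ k * y + k₂ * n
    a2 _ _ _ _ h refl refl refl refl = trans h (lin 6 (λ m a b c d n → ⊢ m :+ (a :* # 0 :+ (b :* n :+ (c :* # 0 :+ (d :* # 0 :+ # 0)))) := m :+ b :* n) (k * y) k₁ k₂ k₃ k₄ n)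
    a3 : ∀ a b c d → x ≡ k * y + (k₁ * a + (k₂ * b + (k₃ * c + (k₄ * d + + 0)))) → a ≡ + 0 → b ≡ + 0 → c ≡ n → d ≡ + 0 → x ≡ k * y + k₃ * n
    a3 _ _ _ _ h refl refl refl refl = trans h (lin 6 (λ m a b c d n → ⊢ m :+ (a :* # 0 :+ (b :* # 0 :+ (c :* n :+ (d :* # 0 :+ # 0)))) := m :+ c :* n) (k * y) k₁ k₂ k₃ k₄ n)
    a4 : ∀ a b c d → x ≡ k * y + (k₁ * a + (k₂ * b + (k₃ * c + (k₄ * d + + 0)))) → a ≡ + 0 → b ≡ + 0 → c ≡ + 0 → d ≡ n → x ≡ k * y + k₄ * n
    a4 _ _ _ _ h refl refl refl refl = trans h (lin 6 (λ m a b c d n → ⊢ m :+ (a :* # 0 :+ (b :* # 0 :+ (c :* # 0 :+ (d :* n :+ # 0)))) := m :+ d :* n) (k * y) k₁ k₂ k₃ k₄ n)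

-- Lattice-point-free tetrahedra

Inside : ∀ {p q r s} → Tet p q r s → Z3 → Set
Inside T z = let open Tet T in + 0 ≤ W₁ ⟨ z ⟩ × + 0 ≤ W₂ ⟨ z ⟩ × + 0 ≤ W₃ ⟨ z ⟩ × + 0 ≤ W₄ ⟨ z ⟩

-- For a point inside, one coordinate equal to n forces the other three to vanish; so these
-- conditions exclude exactly the vertices.
NonVertex : ∀ {p q r s} → Tet p q r s → Z3 → Set
NonVertex T z = let open Tet T in W₁ ⟨ z ⟩ ≢ n × W₂ ⟨ z ⟩ ≢ n × W₃ ⟨ z ⟩ ≢ n × W₄ ⟨ z ⟩ ≢ n

Empty : ∀ {p q r s} → Tet p q r s → Set
Empty T = ∀ z → Inside T z → ¬ NonVertex T z

empty12 : ∀ {p q r s} (T : Tet p q r s) → Empty T → Empty (sw12 T)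
empty12 T e z (a , b , c , d) (a′ , b′ , c′ , d′) = e z (b , a , c , d) (b′ , a′ , c′ , d′)

empty23 : ∀ {p q r s} (T : Tet p q r s) → Empty T → Empty (sw23 T)
empty23 T e z (a , b , c , d) (a′ , b′ , c′ , d′) = e z (a , c , b , d) (a′ , c′ , b′ , d′)

empty34 : ∀ {p q r s} (T : Tet p q r s) → Empty T → Empty (sw34 T)
empty34 T e z (a , b , c , d) (a′ , b′ , c′ , d′) = e z (a , b , d , c) (a′ , b′ , d′ , c′)

-- In an empty tetrahedron every lattice point of a facet plane is an integral combination of the vertices of the facet.
star : ∀ {p q r s} (T : Tet p q r s) → Empty T → ∀ z → let open Tet T in
  n ∣ᶻ W₃ ⟨ z ⟩ → n ∣ᶻ W₁ ⟨ z ⟩ × n ∣ᶻ W₂ ⟨ z ⟩ × n ∣ᶻ W₄ ⟨ z ⟩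
star T e z (m , em) = go (divide n n>0 (W₁ ⟨ z ⟩)) (divide n n>0 (W₂ ⟨ z ⟩)) (divide n n>0 (W₄ ⟨ z ⟩))
  where
  open Tet T
  go : (∃ λ q → ∃ λ r → W₁ ⟨ z ⟩ ≡ r + q * n × + 0 ≤ r × r < n) → (∃ λ q → ∃ λ r → W₂ ⟨ z ⟩ ≡ r + q * n × + 0 ≤ r × r < n) →
       (∃ λ q → ∃ λ r → W₄ ⟨ z ⟩ ≡ r + q * n × + 0 ≤ r × r < n) → n ∣ᶻ W₁ ⟨ z ⟩ × n ∣ᶻ W₂ ⟨ z ⟩ × n ∣ᶻ W₄ ⟨ z ⟩
  go (q₁ , r₁ , e₁ , l₁ , u₁) (q₂ , r₂ , e₂ , l₂ , u₂) (q₄ , r₄ , e₄ , l₄ , u₄) = case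
    (small₃ t (cancel≤ (+ 0) t n>0 (lin 5 (λ t n a b c → a :+ b :+ c := t :* n ⇒ # 0 :≤ a ⇒ # 0 :≤ b ⇒ # 0 :≤ c ⇒ ⊢ # 0 :* n :≤ t :* n) t n r₁ r₂ r₄ sum l₁ l₂ l₄))
              (cancel< t (+ 3) n>0 (lin 5 (λ t n a b c → a :+ b :+ c := t :* n ⇒ a :< n ⇒ b :< n ⇒ c :< n ⇒ ⊢ t :* n :< # 3 :* n) t n r₁ r₂ r₄ sum u₁ u₂ u₄)))
    where
    -- W₃(z) is a multiple of n, so the other three residues add up to a multiple t n, and t < 3.
    t = + 1 - q₁ - q₂ - m - q₄
    sum : r₁ + r₂ + r₄ ≡ t * n
    sum = lin 12 (λ n q₁ q₂ m q₄ r₁ r₂ r₄ a b c d → a :+ b :+ c :+ d := n ⇒ a := r₁ :+ q₁ :* n ⇒ b := r₂ :+ q₂ :* n ⇒ d := r₄ :+ q₄ :* n ⇒ c := m :* n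
          ⇒ ⊢ r₁ :+ r₂ :+ r₄ := (# 1 :- q₁ :- q₂ :- m :- q₄) :* n) n q₁ q₂ m q₄ r₁ r₂ r₄ (W₁ ⟨ z ⟩) (W₂ ⟨ z ⟩) (W₃ ⟨ z ⟩) (W₄ ⟨ z ⟩) (sumW z) e₁ e₂ e₄ em
    case : t ≡ + 0 ⊎ t ≡ + 1 ⊎ t ≡ + 2 → n ∣ᶻ W₁ ⟨ z ⟩ × n ∣ᶻ W₂ ⟨ z ⟩ × n ∣ᶻ W₄ ⟨ z ⟩
    case (inj₁ t0) = (q₁ , zr r₁ (lin 4 (λ a b c n → a :+ b :+ c := # 0 :* n ⇒ # 0 :≤ a ⇒ # 0 :≤ b ⇒ # 0 :≤ c ⇒ ⊢ a := # 0) r₁ r₂ r₄ n s0 l₁ l₂ l₄) e₁)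
                   , (q₂ , zr r₂ (lin 4 (λ a b c n → a :+ b :+ c := # 0 :* n ⇒ # 0 :≤ a ⇒ # 0 :≤ b ⇒ # 0 :≤ c ⇒ ⊢ b := # 0) r₁ r₂ r₄ n s0 l₁ l₂ l₄) e₂)
                   , (q₄ , zr r₄ (lin 4 (λ a b c n → a :+ b :+ c := # 0 :* n ⇒ # 0 :≤ a ⇒ # 0 :≤ b ⇒ # 0 :≤ c ⇒ ⊢ c := # 0) r₁ r₂ r₄ n s0 l₁ l₂ l₄) e₄)
      where
      s0 = trans sum (cong (_* n) t0)
      zr : ∀ {x y} r → r ≡ + 0 → x ≡ r + y → x ≡ y
      zr _ refl h = trans h (ℤₚ.+-identityˡ _)
    -- The residues themselves are the coordinates of a lattice point of the facet, and none of them
    -- is n.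
    case (inj₂ (inj₁ t1)) = ⊥-elim (e point (sub x₁ l₁ , sub x₂ l₂ , sub x₃ ℤₚ.≤-refl , sub x₄ l₄)
        (ne x₁ u₁ , ne x₂ u₂ , ne x₃ n>0 , ne x₄ u₄))
      where
      open Moved (move T (+ 1) (- q₁) (- q₂) (- m) (- q₄) z
        (trans (lin 4 (λ a b c d → ⊢ # 1 :+ (:- a) :+ (:- b) :+ (:- c) :+ (:- d) := # 1 :- a :- b :- c :- d) q₁ q₂ m q₄) t1))
      sub : ∀ {x y} → x ≡ y → + 0 ≤ y → + 0 ≤ x
      sub refl h = h
      ne : ∀ {x y} → x ≡ y → y < n → x ≢ n
      ne refl h refl = ℤₚ.<-irrefl refl h
      red : ∀ {x y} q r → x ≡ + 1 * y + (- q) * n → y ≡ r + q * n → x ≡ r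
      red {x} {y} q r = lin 5 (λ x y q r n → x := # 1 :* y :+ (:- q) :* n ⇒ y := r :+ q :* n ⇒ ⊢ x := r) x y q r n
      x₁ = red q₁ r₁ at₁ e₁
      x₂ = red q₂ r₂ at₂ e₂
      x₃ = red m (+ 0) at₃ (trans em (sym (ℤₚ.+-identityˡ _)))
      x₄ = red q₄ r₄ at₄ e₄
    -- Here the complements n - rᵢ add up to n: a point reflection brings the point back into the
    -- facet.
    case (inj₂ (inj₂ t2)) = ⊥-elim (e point (sub x₁ u₁ , sub x₂ u₂ , ℤₚ.≤-reflexive (sym x₃) , sub x₄ u₄)
        (ne x₁ pos₁ , ne x₂ pos₂ , (λ h → ℤₚ.<-irrefl (trans (sym x₃) h) n>0) , ne x₄ pos₄))
      where
      open Moved (move T (- + 1) (+ 1 + q₁) (+ 1 + q₂) m (+ 1 + q₄) z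
        (lin 4 (λ a b c d → # 1 :- a :- b :- c :- d := # 2 ⇒ ⊢ con (- + 1) :+ (# 1 :+ a) :+ (# 1 :+ b) :+ c :+ (# 1 :+ d) := # 1) q₁ q₂ m q₄ t2))
      s2 = trans sum (cong (_* n) t2)
      sub : ∀ {x y} → x ≡ n - y → y < n → + 0 ≤ x
      sub {x} {y} = lin 3 (λ x y n → x := n :- y ⇒ y :< n ⇒ ⊢ # 0 :≤ x) x y n
      ne : ∀ {x y} → x ≡ n - y → + 0 < y → x ≢ n
      ne {x} {y} = lin 3 (λ x y n → x := n :- y ⇒ # 0 :< y ⇒ x := n ⇒ ⊢ :⊥) x y n
      red : ∀ {x y} q r → x ≡ - + 1 * y + (+ 1 + q) * n → y ≡ r + q * n → x ≡ n - r
      red {x} {y} q r = lin 5 (λ x y q r n → x := con (- + 1) :* y :+ (# 1 :+ q) :* n ⇒ y := r :+ q :* n ⇒ ⊢ x := n :- r) x y q r n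
      x₁ = red q₁ r₁ at₁ e₁
      x₂ = red q₂ r₂ at₂ e₂
      x₃ : W₃ ⟨ point ⟩ ≡ + 0
      x₃ = lin 4 (λ x y m n → x := con (- + 1) :* y :+ m :* n ⇒ y := m :* n ⇒ ⊢ x := # 0) (W₃ ⟨ point ⟩) (W₃ ⟨ z ⟩) m n at₃ em
      x₄ = red q₄ r₄ at₄ e₄
      pos₁ = lin 4 (λ a b c n → a :+ b :+ c := # 2 :* n ⇒ b :< n ⇒ c :< n ⇒ ⊢ # 0 :< a) r₁ r₂ r₄ n s2 u₂ u₄
      pos₂ = lin 4 (λ a b c n → a :+ b :+ c := # 2 :* n ⇒ a :< n ⇒ c :< n ⇒ ⊢ # 0 :< b) r₁ r₂ r₄ n s2 u₁ u₄
      pos₄ = lin 4 (λ a b c n → a :+ b :+ c := # 2 :* n ⇒ a :< n ⇒ b :< n ⇒ ⊢ # 0 :< c) r₁ r₂ r₄ n s2 u₁ u₂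

-- White's theorem on empty tetrahedra, in arithmetic form

ceiling : ∀ b → + 0 < b → ∀ x → ∃ λ p → (p - + 1) * b < x × x ≤ p * b
ceiling b b>0 x with divide b b>0 (x - + 1)
... | q , r , e , r≥0 , r<b = q + + 1
  , lin 4 (λ b x q r → x :- # 1 := r :+ q :* b ⇒ # 0 :≤ r ⇒ ⊢ (q :+ # 1 :- # 1) :* b :< x) b x q r e r≥0
  , lin 4 (λ b x q r → x :- # 1 := r :+ q :* b ⇒ r :< b ⇒ ⊢ x :≤ (q :+ # 1) :* b) b x q r e r<b

-- F is the floor of j x / n, which is never an integer in the range considered.
Floor : ℤ → ℤ → ℤ → Set
Floor n y F = F * n < y × y < (F + + 1) * n

-- The arithmetic trace of emptiness: a, b, c will be residues of negated barycentric coordinates,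
-- and the sum j - 1 of the floors expresses that none of the multiples gives a lattice point
-- inside.
Floors : ℤ → ℤ → ℤ → ℤ → Set
Floors n a b c = ∀ j → + 1 ≤ j → j < n → ∃ λ A → ∃ λ B → ∃ λ C →
  Floor n (j * a) A × Floor n (j * b) B × Floor n (j * c) C × A + B + C ≡ j - + 1

-- The jumps of ⌊jb/n⌋ and ⌊jc/n⌋ together are those of ⌊ja'/n⌋ with a' = n - a < n/2, so the first jump of the
-- c-sequence would fall between two consecutive jumps of the b-sequence, which are too close to each other for that.
module _ (n a b c : ℤ) (sum : a + b + c ≡ n + + 1) (b≤a : b ≤ a) (c≤b : c ≤ b) (2≤c : + 2 ≤ c) (H : Floors n a b c) where

  private
    a′ = n - a

    n≥5 : + 5 ≤ n
    n≥5 = lin 4 (λ n a b c → a :+ b :+ c := n :+ # 1 ⇒ b :≤ a ⇒ c :≤ b ⇒ # 2 :≤ c ⇒ ⊢ # 5 :≤ n) n a b c sum b≤a c≤b 2≤c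
    n>0 : + 0 < n
    n>0 = lin 1 (λ n → # 5 :≤ n ⇒ ⊢ # 0 :< n) n n≥5
    b>0 : + 0 < b
    b>0 = lin 2 (λ b c → c :≤ b ⇒ # 2 :≤ c ⇒ ⊢ # 0 :< b) b c c≤b 2≤c
    c>0 : + 0 < c
    c>0 = lin 1 (λ c → # 2 :≤ c ⇒ ⊢ # 0 :< c) c 2≤c

    below : ∀ {y F} k → Floor n y F → y ≤ k * n → F ≤ k - + 1
    below {y} {F} k (l , u) h = lin 2 (λ F k → F :< k ⇒ ⊢ F :≤ k :- # 1) F k (cancel< F k n>0 (ℤₚ.<-≤-trans l h))

    above : ∀ {y F} k → Floor n y F → k * n ≤ y → k ≤ F
    above {y} {F} k (l , u) h = lin 2 (λ F k → k :< F :+ # 1 ⇒ ⊢ k :≤ F) F k (cancel< k (F + + 1) n>0 (ℤₚ.≤-<-trans h u))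

    scale : ∀ j → + 0 ≤ j → j * c ≤ j * b
    scale j j≥0 = lin 3 (λ j b c → # 0 :≤ j :* (b :- c) ⇒ ⊢ j :* c :≤ j :* b) j b c
      (mul≥0 j≥0 (lin 2 (λ b c → c :≤ b ⇒ ⊢ # 0 :≤ b :- c) b c c≤b))

    -- For j = 2 the floors add up to 1, so the largest of a, b and c exceeds n/2.
    2a′<n : + 2 * a′ < n
    2a′<n with H (+ 2) (lin 0 (⊢ # 1 :≤ # 2)) (lin 1 (λ n → # 5 :≤ n ⇒ ⊢ # 2 :< n) n n≥5)
    ... | A , B , C , fa , fb , fc , e = ℤₚ.≰⇒> λ h → lin 3 (λ A B C → A :≤ # 1 :- # 1 ⇒ B :≤ # 1 :- # 1 ⇒ C :≤ # 1 :- # 1 ⇒ A :+ B :+ C := # 2 :- # 1 ⇒ ⊢ :⊥) A B C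
      (below (+ 1) fa (lin 2 (λ n a → n :≤ # 2 :* (n :- a) ⇒ ⊢ # 2 :* a :≤ # 1 :* n) n a h))
      (below (+ 1) fb (lin 3 (λ n a b → n :≤ # 2 :* (n :- a) ⇒ b :≤ a ⇒ ⊢ # 2 :* b :≤ # 1 :* n) n a b h b≤a))
      (below (+ 1) fc (lin 4 (λ n a b c → n :≤ # 2 :* (n :- a) ⇒ b :≤ a ⇒ c :≤ b ⇒ ⊢ # 2 :* c :≤ # 1 :* n) n a b c h b≤a c≤b)) e

    -- ⌊ja'/n⌋ = ⌊jb/n⌋ + ⌊jc/n⌋
    H′ : ∀ j → + 1 ≤ j → j < n → ∃ λ B → ∃ λ C → Floor n (j * b) B × Floor n (j * c) C × Floor n (j * a′) (B + C)
    H′ j j≥1 j<n with H j j≥1 j<n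
    ... | A , B , C , (al , au) , fb , fc , e = B , C , fb , fc
      , lin 6 (λ n a j A B C → j :* a :< (A :+ # 1) :* n ⇒ A :* n :+ B :* n :+ C :* n := j :* n :- n ⇒ ⊢ (B :+ C) :* n :< j :* (n :- a)) n a j A B C au e′
      , lin 6 (λ n a j A B C → A :* n :< j :* a ⇒ A :* n :+ B :* n :+ C :* n := j :* n :- n ⇒ ⊢ j :* (n :- a) :< (B :+ C :+ # 1) :* n) n a j A B C al e′
      where
      e′ : A * n + B * n + C * n ≡ j * n - n
      e′ = trans (lin 4 (λ n A B C → ⊢ A :* n :+ B :* n :+ C :* n := (A :+ B :+ C) :* n) n A B C)
             (trans (cong (_* n) e) (lin 2 (λ n j → ⊢ (j :- # 1) :* n := j :* n :- n) n j))

    -- Let m = r - 1 - p. Then m b < n, hence m c < n, and `H′` gives m a' < n. With 2a' < n this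
    -- yields (r - p + 1) a' < 2n, although r a' ≥ (k + 2) n and (p - 1) a' < k n.
    jumps : ∀ J p r k → (p - + 1) * b < k * n → k * n ≤ p * b → + 1 ≤ p → p < J → J < r → r ≤ n →
            (r - + 1) * b < (k + + 1) * n → (p - + 1) * a′ < k * n → (k + + 2) * n ≤ r * a′ → ⊥
    jumps J p r k _ kn≤pb 1≤p p<J J<r r≤n r-1 pa ra = fin (H′ m m≥1 m<n)
      where
      m = r - + 1 - p
      mb<n : m * b < n
      mb<n = lin 5 (λ n b p r k → k :* n :≤ p :* b ⇒ (r :- # 1) :* b :< (k :+ # 1) :* n ⇒ ⊢ (r :- # 1 :- p) :* b :< n) n b p r k kn≤pb r-1
      m≥1 : + 1 ≤ m
      m≥1 = lin 3 (λ J p r → p :< J ⇒ J :< r ⇒ ⊢ # 1 :≤ r :- # 1 :- p) J p r p<J J<r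
      m<n : m < n
      m<n = lin 3 (λ n p r → # 1 :≤ p ⇒ r :≤ n ⇒ ⊢ r :- # 1 :- p :< n) n p r 1≤p r≤n
      fin : (∃ λ B → ∃ λ C → Floor n (m * b) B × Floor n (m * c) C × Floor n (m * a′) (B + C)) → ⊥
      fin (B , C , fb , fc , (_ , fa)) = lin 5 (λ n a p r k → (r :- # 1 :- p) :* (n :- a) :< n ⇒ # 2 :* (n :- a) :< n
          ⇒ (p :- # 1) :* (n :- a) :< k :* n ⇒ (k :+ # 2) :* n :≤ r :* (n :- a) ⇒ ⊢ :⊥) n a p r k ma 2a′<n pa ra
        where
        B≤0 : B ≤ + 0
        B≤0 = below (+ 1) fb (lin 2 (λ x n → x :< n ⇒ ⊢ x :≤ # 1 :* n) (m * b) n mb<n)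
        C≤0 : C ≤ + 0
        C≤0 = below (+ 1) fc (lin 3 (λ x y n → x :< n ⇒ y :≤ x ⇒ ⊢ y :≤ # 1 :* n) (m * b) (m * c) n mb<n
                (scale m (lin 1 (λ m → # 1 :≤ m ⇒ ⊢ # 0 :≤ m) m m≥1)))
        ma : m * a′ < n
        ma = ℤₚ.<-≤-trans fa (lin 3 (λ n B C → # 0 :≤ (:- (B :+ C)) :* n ⇒ ⊢ (B :+ C :+ # 1) :* n :≤ n) n B C
               (mul≥0 (lin 2 (λ B C → B :≤ # 0 ⇒ C :≤ # 0 ⇒ ⊢ # 0 :≤ :- (B :+ C)) B C B≤0 C≤0) (ℤₚ.<⇒≤ n>0)))

    -- J is the first index with J c ≥ n. Since 2a' < n, the floor of j a'/n rises by at most one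
    -- from J - 1 to J, and c already accounts for that rise. So the b-sequence does not jump at J:
    -- its neighbouring jumps, to k and to k + 1, are at some p < J and r > J.
    firstJump : ∀ J → (J - + 1) * c < n → n ≤ J * c → ⊥
    firstJump J J-1 Jc = go (H′ (J - + 1) J-1≥1 J-1<n) (H′ J J≥1 J<n)
      where
      2≤J : + 2 ≤ J
      2≤J = ℤₚ.≮⇒≥ λ h → lin 5 (λ J n a b c → n :≤ J :* c ⇒ # 0 :≤ (# 1 :- J) :* c ⇒ a :+ b :+ c := n :+ # 1 ⇒ b :≤ a ⇒ # 2 :≤ b ⇒ ⊢ :⊥) J n a b c Jc
        (mul≥0 (lin 1 (λ J → J :< # 2 ⇒ ⊢ # 0 :≤ # 1 :- J) J h) (ℤₚ.<⇒≤ c>0)) sum b≤a (ℤₚ.≤-trans 2≤c c≤b)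
      J<n : J < n
      J<n = lin 3 (λ J n c → (J :- # 1) :* c :< n ⇒ # 0 :≤ (J :- # 2) :* (c :- # 2) ⇒ # 2 :≤ c ⇒ # 5 :≤ n ⇒ ⊢ J :< n) J n c J-1
        (mul≥0 (lin 1 (λ J → # 2 :≤ J ⇒ ⊢ # 0 :≤ J :- # 2) J 2≤J) (lin 1 (λ c → # 2 :≤ c ⇒ ⊢ # 0 :≤ c :- # 2) c 2≤c)) 2≤c n≥5
      J-1≥1 : + 1 ≤ J - + 1
      J-1≥1 = lin 1 (λ J → # 2 :≤ J ⇒ ⊢ # 1 :≤ J :- # 1) J 2≤J
      J-1<n : J - + 1 < n
      J-1<n = lin 2 (λ J n → J :< n ⇒ ⊢ J :- # 1 :< n) J n J<n
      J≥1 : + 1 ≤ J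
      J≥1 = lin 1 (λ J → # 2 :≤ J ⇒ ⊢ # 1 :≤ J) J 2≤J
      go : (∃ λ B → ∃ λ C → Floor n ((J - + 1) * b) B × Floor n ((J - + 1) * c) C × Floor n ((J - + 1) * a′) (B + C)) →
           (∃ λ B → ∃ λ C → Floor n (J * b) B × Floor n (J * c) C × Floor n (J * a′) (B + C)) → ⊥
      go (B′ , C′ , fb′ , fc′ , fa′) (k , C , fb , fc , fa) = next (ceiling b b>0 (k * n))
        where
        C≥1 : + 1 ≤ C
        C≥1 = above (+ 1) fc (lin 3 (λ J n c → n :≤ J :* c ⇒ ⊢ # 1 :* n :≤ J :* c) J n c Jc)
        C′≤0 : C′ ≤ + 0
        C′≤0 = below (+ 1) fc′ (lin 3 (λ J n c → (J :- # 1) :* c :< n ⇒ ⊢ (J :- # 1) :* c :≤ # 1 :* n) J n c J-1)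
        k≤B′ : k ≤ B′
        k≤B′ = lin 4 (λ k B′ C C′ → k :+ C :< B′ :+ C′ :+ # 2 ⇒ # 1 :≤ C ⇒ C′ :≤ # 0 ⇒ ⊢ k :≤ B′) k B′ C C′
          (cancel< (k + C) (B′ + C′ + + 2) n>0
            (lin 7 (λ n a J k C B′ C′ → (k :+ C) :* n :< J :* (n :- a) ⇒ (J :- # 1) :* (n :- a) :< (B′ :+ C′ :+ # 1) :* n ⇒ # 2 :* (n :- a) :< n ⇒ # 5 :≤ n
               ⇒ ⊢ (k :+ C) :* n :< (B′ :+ C′ :+ # 2) :* n) n a J k C B′ C′ (proj₁ fa) (proj₂ fa′) 2a′<n n≥5)) C≥1 C′≤0
        k≥1 : + 1 ≤ k
        k≥1 = above (+ 1) fb (ℤₚ.≤-trans (lin 3 (λ J n c → n :≤ J :* c ⇒ ⊢ # 1 :* n :≤ J :* c) J n c Jc)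
                               (scale J (lin 1 (λ J → # 2 :≤ J ⇒ ⊢ # 0 :≤ J) J 2≤J)))
        k<b : k < b
        k<b = cancel< k b n>0 (ℤₚ.<-trans (proj₁ fb) (lin 3 (λ J n b → # 0 :< (n :- J) :* b ⇒ ⊢ J :* b :< b :* n) J n b
                (mul>0 (lin 2 (λ J n → J :< n ⇒ ⊢ # 0 :< n :- J) J n J<n) b>0)))
        kn>0 : + 0 < k * n
        kn>0 = mul>0 (lin 1 (λ k → # 1 :≤ k ⇒ ⊢ # 0 :< k) k k≥1) n>0
        next : (∃ λ p → (p - + 1) * b < k * n × k * n ≤ p * b) → ⊥
        next (p , p-1 , kn≤pb) = last (ceiling b b>0 ((k + + 1) * n)) (b ℤₚ.≤? k + + 1)
          where
          p<J : p < J
          p<J = lin 2 (λ p J → p :- # 1 :< J :- # 1 ⇒ ⊢ p :< J) p J (cancel< (p - + 1) (J - + 1) b>0 (ℤₚ.<-trans p-1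
            (ℤₚ.≤-<-trans (lin 3 (λ k B′ n → # 0 :≤ (B′ :- k) :* n ⇒ ⊢ k :* n :≤ B′ :* n) k B′ n
              (mul≥0 (lin 2 (λ k B′ → k :≤ B′ ⇒ ⊢ # 0 :≤ B′ :- k) k B′ k≤B′) (ℤₚ.<⇒≤ n>0))) (proj₁ fb′))))
          p≥1 : + 1 ≤ p
          p≥1 = lin 1 (λ p → # 0 :< p ⇒ ⊢ # 1 :≤ p) p (cancel< (+ 0) p b>0 (lin 3 (λ x p b → # 0 :< x ⇒ x :≤ p :* b ⇒ ⊢ # 0 :* b :< p :* b) (k * n) p b kn>0 kn≤pb))
          pa : (p - + 1) * a′ < k * n
          pa with p ℤₚ.≟ + 1
          ... | yes refl = subst (_< k * n) (sym (ℤₚ.*-zeroˡ a′)) kn>0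
          ... | no p≢1 with H′ (p - + 1) (lin 1 (λ p → # 1 :< p ⇒ ⊢ # 1 :≤ p :- # 1) p (ℤₚ.≤∧≢⇒< p≥1 (λ h → p≢1 (sym h))))
                              (lin 3 (λ p J n → p :< J ⇒ J :< n ⇒ ⊢ p :- # 1 :< n) p J n p<J J<n)
          ...   | B₁ , C₁ , gb , gc , (_ , ga) = ℤₚ.<-≤-trans ga (lin 4 (λ B₁ C₁ k n → # 0 :≤ (k :- # 1 :- B₁ :- C₁) :* n ⇒ ⊢ (B₁ :+ C₁ :+ # 1) :* n :≤ k :* n) B₁ C₁ k n
              (mul≥0 (lin 3 (λ B₁ C₁ k → B₁ :≤ k :- # 1 ⇒ C₁ :≤ # 1 :- # 1 ⇒ ⊢ # 0 :≤ k :- # 1 :- B₁ :- C₁) B₁ C₁ k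
                (below k gb (ℤₚ.<⇒≤ p-1))
                (below (+ 1) gc (lin 4 (λ p J n c → (J :- # 1) :* c :< n ⇒ # 0 :≤ (J :- p) :* c ⇒ ⊢ (p :- # 1) :* c :≤ # 1 :* n) p J n c J-1
                  (mul≥0 (lin 2 (λ p J → p :< J ⇒ ⊢ # 0 :≤ J :- p) p J p<J) (ℤₚ.<⇒≤ c>0)))))
                (ℤₚ.<⇒≤ n>0)))
          last : (∃ λ r → (r - + 1) * b < (k + + 1) * n × (k + + 1) * n ≤ r * b) → Dec (b ≤ k + + 1) → ⊥
          -- The b-sequence does not reach k + 1 before the index n, so n takes the place of r; here
          -- n - a = b + c - 1 ≥ k + 2.
          last _ (yes b≤k+1) = jumps J p n k p-1 kn≤pb p≥1 p<J J<n ℤₚ.≤-refl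
            (lin 3 (λ n b k → # 0 :≤ (k :+ # 1 :- b) :* n ⇒ # 0 :< b ⇒ ⊢ (n :- # 1) :* b :< (k :+ # 1) :* n) n b k
              (mul≥0 (lin 2 (λ b k → b :≤ k :+ # 1 ⇒ ⊢ # 0 :≤ k :+ # 1 :- b) b k b≤k+1) (ℤₚ.<⇒≤ n>0)) b>0)
            pa
            (lin 3 (λ n a k → # 0 :≤ (n :- a :- k :- # 2) :* n ⇒ ⊢ (k :+ # 2) :* n :≤ n :* (n :- a)) n a k
              (mul≥0 (lin 5 (λ n a b c k → a :+ b :+ c := n :+ # 1 ⇒ # 2 :≤ c ⇒ k :< b ⇒ ⊢ # 0 :≤ n :- a :- k :- # 2) n a b c k sum 2≤c k<b) (ℤₚ.<⇒≤ n>0)))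
          last (r , r-1 , kr) (no b≰k+1) = jumps J p r k p-1 kn≤pb p≥1 p<J J<r (ℤₚ.<⇒≤ r<n) r-1 pa ra
            where
            k+1<b = ℤₚ.≰⇒> b≰k+1
            b≤n : b < n
            b≤n = lin 4 (λ n a b c → a :+ b :+ c := n :+ # 1 ⇒ b :≤ a ⇒ # 2 :≤ c ⇒ c :≤ b ⇒ ⊢ b :< n) n a b c sum b≤a 2≤c c≤b
            J<r : J < r
            J<r = cancel< J r b>0 (ℤₚ.<-≤-trans (proj₂ fb) kr)
            r<n : r < n
            r<n = lin 2 (λ r n → r :- # 1 :< n :- # 1 ⇒ ⊢ r :< n) r n (cancel< (r - + 1) (n - + 1) b>0
              (ℤₚ.<-trans r-1 (lin 3 (λ n b k → # 0 :≤ (b :- # 1 :- k :- # 1) :* n ⇒ b :< n ⇒ ⊢ (k :+ # 1) :* n :< (n :- # 1) :* b) n b k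
                (mul≥0 (lin 2 (λ b k → k :+ # 1 :< b ⇒ ⊢ # 0 :≤ b :- # 1 :- k :- # 1) b k k+1<b) (ℤₚ.<⇒≤ n>0)) b≤n)))
            ra : (k + + 2) * n ≤ r * a′
            ra with H′ r (lin 2 (λ J r → # 2 :≤ J ⇒ J :< r ⇒ ⊢ # 1 :≤ r) J r 2≤J J<r) r<n
            ... | B₁ , C₁ , gb , gc , (ga , _) = ℤₚ.≤-trans (lin 4 (λ B₁ C₁ k n → # 0 :≤ (B₁ :+ C₁ :- k :- # 2) :* n ⇒ ⊢ (k :+ # 2) :* n :≤ (B₁ :+ C₁) :* n) B₁ C₁ k n
              (mul≥0 (lin 3 (λ B₁ C₁ k → k :+ # 1 :≤ B₁ ⇒ # 1 :≤ C₁ ⇒ ⊢ # 0 :≤ B₁ :+ C₁ :- k :- # 2) B₁ C₁ k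
                (above (k + + 1) gb kr)
                (above (+ 1) gc (lin 4 (λ r J n c → n :≤ J :* c ⇒ # 0 :≤ (r :- J) :* c ⇒ ⊢ # 1 :* n :≤ r :* c) r J n c Jc
                  (mul≥0 (lin 2 (λ r J → J :< r ⇒ ⊢ # 0 :≤ r :- J) r J J<r) (ℤₚ.<⇒≤ c>0)))))
                (ℤₚ.<⇒≤ n>0))) (ℤₚ.<⇒≤ ga)

  white-sorted : ⊥
  white-sorted with ceiling c c>0 n
  ... | J , J-1 , Jc = firstJump J J-1 Jc

private
  perm12 : ∀ {n a b c} → Floors n a b c → Floors n b a c
  perm12 H j l u with H j l u
  ... | A , B , C , fa , fb , fc , e = B , A , C , fb , fa , fc , trans (cong (_+ C) (ℤₚ.+-comm B A)) e

  perm23 : ∀ {n a b c} → Floors n a b c → Floors n a c b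
  perm23 H j l u with H j l u
  ... | A , B , C , fa , fb , fc , e = A , C , B , fa , fc , fb , trans (lin 3 (λ A B C → ⊢ A :+ C :+ B := A :+ B :+ C) A B C) e

-- Used contrapositively: one of the three residues of an empty tetrahedron is 1. The hypotheses are
-- symmetric, so it suffices to sort a, b and c.
whiteTheorem : ∀ n a b c → a + b + c ≡ n + + 1 → + 2 ≤ a → + 2 ≤ b → + 2 ≤ c → Floors n a b c → ⊥
whiteTheorem n a b c e la lb lc H with ℤₚ.≤-total a b | ℤₚ.≤-total b c | ℤₚ.≤-total a c
... | inj₁ ab | inj₁ bc | _ = white-sorted n c b a (trans (lin 3 (λ a b c → ⊢ c :+ b :+ a := a :+ b :+ c) a b c) e) bc ab la (perm12 (perm23 (perm12 H)))
... | inj₁ ab | inj₂ cb | inj₁ ac = white-sorted n b c a (trans (lin 3 (λ a b c → ⊢ b :+ c :+ a := a :+ b :+ c) a b c) e) cb ac la (perm23 (perm12 H))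
... | inj₁ ab | inj₂ cb | inj₂ ca = white-sorted n b a c (trans (lin 3 (λ a b c → ⊢ b :+ a :+ c := a :+ b :+ c) a b c) e) ab ca lc (perm12 H)
... | inj₂ ba | inj₁ bc | inj₁ ac = white-sorted n c a b (trans (lin 3 (λ a b c → ⊢ c :+ a :+ b := a :+ b :+ c) a b c) e) ac ba lb (perm12 (perm23 H))
... | inj₂ ba | inj₁ bc | inj₂ ca = white-sorted n a c b (trans (lin 3 (λ a b c → ⊢ a :+ c :+ b := a :+ b :+ c) a b c) e) ca bc lb (perm23 H)
... | inj₂ ba | inj₂ cb | _ = white-sorted n a b c e ba cb lc H

bezoutℕ : ∀ m k → ∃ λ d → ∃ λ x → ∃ λ y → (+ d) ∣ᶻ (+ m) × (+ d) ∣ᶻ (+ k) × x * + m + y * + k ≡ + d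
bezoutℕ m k with GCD.Bézout.lemma m k
... | GCD.Bézout.result d g i = d , coeffs i
  where
  ∣→ : ∀ {x} → d ℕ-Div.∣ x → (+ d) ∣ᶻ (+ x)
  ∣→ (ℕ-Div.divides q e) = + q , trans (cong +_ e) (ℤₚ.pos-* q d)
  m∣ = ∣→ (GCD.GCD.gcd∣m g)
  k∣ = ∣→ (GCD.GCD.gcd∣n g)
  coeffs : GCD.Bézout.Identity d m k → ∃ λ x → ∃ λ y → (+ d) ∣ᶻ (+ m) × (+ d) ∣ᶻ (+ k) × x * + m + y * + k ≡ + d
  coeffs (GCD.Bézout.Identity.+- x y e) = + x , - + y , m∣ , k∣ ,
    lin 5 (λ x y m k d → d :+ y :* k := x :* m ⇒ ⊢ x :* m :+ (:- y) :* k := d) (+ x) (+ y) (+ m) (+ k) (+ d)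
      (trans (cong (λ t → + d + t) (sym (ℤₚ.pos-* y k))) (trans (cong +_ e) (ℤₚ.pos-* x m)))
  coeffs (GCD.Bézout.Identity.-+ x y e) = - + x , + y , m∣ , k∣ ,
    lin 5 (λ x y m k d → d :+ x :* m := y :* k ⇒ ⊢ (:- x) :* m :+ y :* k := d) (+ x) (+ y) (+ m) (+ k) (+ d)
      (trans (cong (λ t → + d + t) (sym (ℤₚ.pos-* x m))) (trans (cong +_ e) (ℤₚ.pos-* y k)))

signed : ∀ a → ∃ λ σ → σ * a ≡ + ∣ a ∣ × σ * σ ≡ + 1
signed (+ a)     = + 1 , ℤₚ.*-identityˡ (+ a) , refl
signed (-[1+ a ]) = - + 1 , ℤₚ.-1*i≡-i -[1+ a ] , refl

bezout : ∀ a b → ∃ λ g → ∃ λ x → ∃ λ y → + 0 ≤ g × g ∣ᶻ a × g ∣ᶻ b × x * a + y * b ≡ g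
bezout a b with bezoutℕ ∣ a ∣ ∣ b ∣ | signed a | signed b
... | d , x , y , (q₁ , e₁) , (q₂ , e₂) , e | σ , σe , σ² | τ , τe , τ² =
    + d , x * σ , y * τ , +≤+ z≤n , (σ * q₁ , div a σ q₁ σe σ² e₁) , (τ * q₂ , div b τ q₂ τe τ² e₂)
  , trans (lin 6 (λ x σ a y τ b → ⊢ x :* σ :* a :+ y :* τ :* b := x :* (σ :* a) :+ y :* (τ :* b)) x σ a y τ b)
      (trans (cong₂ (λ u v → x * u + y * v) σe τe) e)
  where
  div : ∀ a σ q → σ * a ≡ + ∣ a ∣ → σ * σ ≡ + 1 → + ∣ a ∣ ≡ q * + d → a ≡ σ * q * + d
  div a σ q e₁ e₂ e₃ = trans (sym (ℤₚ.*-identityˡ a)) (trans (cong (_* a) (sym e₂))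
    (trans (ℤₚ.*-assoc σ σ a) (trans (cong (σ *_) (trans e₁ e₃)) (sym (ℤₚ.*-assoc σ q (+ d))))))

Bezout₃ : ℤ → ℤ → ℤ → Set
Bezout₃ a b c = ∃ λ g → + 0 ≤ g × g ∣ᶻ a × g ∣ᶻ b × g ∣ᶻ c × (∃ λ x → ∃ λ y → ∃ λ z → a * x + b * y + c * z ≡ g)

bezout₃ : ∀ a b c → Bezout₃ a b c
bezout₃ a b c with bezout a b
... | g , x , y , _ , (a′ , ea) , (b′ , eb) , e with bezout g c
...   | h , u , v , h≥0 , (g′ , eg) , (c′ , ec) , e′ = h , h≥0 , (a′ * g′ , tr a′ ea) , (b′ * g′ , tr b′ eb) , (c′ , ec)
  , x * u , y * u , v , trans (lin 7 (λ a b c x y u v → ⊢ a :* (x :* u) :+ b :* (y :* u) :+ c :* v := u :* (x :* a :+ y :* b) :+ v :* c) a b c x y u v)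
      (trans (cong (λ t → u * t + v * c) e) e′)
  where
  tr : ∀ {a} a′ → a ≡ a′ * g → a ≡ a′ * g′ * h
  tr a′ e = trans e (trans (cong (a′ *_) eg) (sym (ℤₚ.*-assoc a′ g′ h)))

-- The facets of an empty tetrahedron are primitive

-- `f` is affine along the ray from (j, k, l), so its value after one step is tied to its value
-- after g steps. This transfers information about a vector to its g-th part.
stretch : ∀ f j k l x y z g {x′ y′ z′} → x′ ≡ x * g → y′ ≡ y * g → z′ ≡ z * g →
  g * f ⟨ pt (j + x) (k + y) (l + z) ⟩ ≡ f ⟨ pt (j + x′) (k + y′) (l + z′) ⟩ + (g - + 1) * f ⟨ pt j k l ⟩
stretch (aff α β γ δ) j k l x y z g refl refl refl =
  lin 11 (λ α β γ δ j k l x y z g → ⊢ g :* (α :* (j :+ x) :+ β :* (k :+ y) :+ γ :* (l :+ z) :+ δ)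
     := α :* (j :+ x :* g) :+ β :* (k :+ y :* g) :+ γ :* (l :+ z :* g) :+ δ :+ (g :- # 1) :* (α :* j :+ β :* k :+ γ :* l :+ δ)) α β γ δ j k l x y z g

module Primitive (a b c d e f h₁ h₂ h₃ j k l : ℤ) where
  p q r s : Z3
  p = pt a b c
  q = pt d e f
  r = pt h₁ h₂ h₃
  s = pt j k l
  cx = (b - k) * (f - l) - (c - l) * (e - k)
  cy = (c - l) * (d - j) - (a - j) * (f - l)
  cz = (a - j) * (e - k) - (b - k) * (d - j)

  DE : Expr → Expr → Expr → Expr → Expr → Expr → Expr → Expr → Expr → Expr → Expr → Expr → Expr
  DE a b c d e f g h i j k l = (a :- j) :* ((e :- k) :* (i :- l) :- (f :- l) :* (h :- k))
    :- (b :- k) :* ((d :- j) :* (i :- l) :- (f :- l) :* (g :- j))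
    :+ (c :- l) :* ((d :- j) :* (h :- k) :- (e :- k) :* (g :- j))
  CX CY CZ : Expr → Expr → Expr → Expr → Expr → Expr → Expr → Expr → Expr → Expr
  CX a b c d e f j k l = (b :- k) :* (f :- l) :- (c :- l) :* (e :- k)
  CY a b c d e f j k l = (c :- l) :* (d :- j) :- (a :- j) :* (f :- l)
  CZ a b c d e f j k l = (a :- j) :* (e :- k) :- (b :- k) :* (d :- j)

  det-dot : ∀ x y z → det4 p q (pt (j + x) (k + y) (l + z)) s ≡ cx * x + cy * y + cz * z
  det-dot x y z = lin 12 (λ a b c d e f j k l x y z → ⊢ DE a b c d e f (j :+ x) (k :+ y) (l :+ z) j k l
    := CX a b c d e f j k l :* x :+ CY a b c d e f j k l :* y :+ CZ a b c d e f j k l :* z) a b c d e f j k l x y z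

  -- (u × v) × e_i, with u = p - s and v = q - s, is orthogonal to u × v, and u × ((u × v) × e_i) = u_i (u × v).
  dx : det4 p (pt (j + + 0) (k + cz) (l + - cy)) r s ≡ (a - j) * det4 p q r s
  dx = lin 12 (λ a b c d e f g h i j k l → ⊢ DE a b c (j :+ # 0) (k :+ CZ a b c d e f j k l) (l :+ :- CY a b c d e f j k l) g h i j k l
    := (a :- j) :* DE a b c d e f g h i j k l) a b c d e f h₁ h₂ h₃ j k l

  dy : det4 p (pt (j + - cz) (k + + 0) (l + cx)) r s ≡ (b - k) * det4 p q r s
  dy = lin 12 (λ a b c d e f g h i j k l → ⊢ DE a b c (j :+ :- CZ a b c d e f j k l) (k :+ # 0) (l :+ CX a b c d e f j k l) g h i j k l
    := (b :- k) :* DE a b c d e f g h i j k l) a b c d e f h₁ h₂ h₃ j k l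

  dz : det4 p (pt (j + cy) (k + - cx) (l + + 0)) r s ≡ (c - l) * det4 p q r s
  dz = lin 12 (λ a b c d e f g h i j k l → ⊢ DE a b c (j :+ CY a b c d e f j k l) (k :+ :- CX a b c d e f j k l) (l :+ # 0) g h i j k l
    := (c :- l) :* DE a b c d e f g h i j k l) a b c d e f h₁ h₂ h₃ j k l

  module _ (T : Tet p q r s) (raw : Raw T) (emp : Empty T) where
    open Tet T
    open Raw raw

    -- The vector (x', y', z') is parallel to the facet opposite r, and W₂ grows by u n along it.
    -- Its g-th part leads from s to a lattice point of the same facet plane, where `star` makes W₂
    -- a multiple of n; hence g divides u.
    coarse : ∀ g → + 0 < g → ∀ x y z {x′ y′ z′} u → x′ ≡ x * g → y′ ≡ y * g → z′ ≡ z * g →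
      cx * x′ + cy * y′ + cz * z′ ≡ + 0 → det4 p (pt (j + x′) (k + y′) (l + z′)) r s ≡ u * det4 p q r s → ∃ λ m → u ≡ m * g
    coarse g g>0 x y z {x′} {y′} {z′} u ex ey ez e₃ e₂ = m , cancel≡ u (m * g) n>0 (sym (trans (lin 3 (λ m g n → ⊢ m :* g :* n := g :* (m :* n)) m g n)
          (trans (cong (g *_) (sym em)) (trans (stretch W₂ j k l x y z g ex ey ez)
            (trans (cong₂ _+_ (trans (W₂≡ z₁) (cong (ε *_) e₂)) (trans (cong ((g - + 1) *_) (W₁s (sw12 T))) (ℤₚ.*-zeroʳ (g - + 1))))
              (trans (lin 3 (λ ε u D → ⊢ ε :* (u :* D) :+ # 0 := u :* (ε :* D)) ε u (det4 p q r s)) (cong (u *_) (sym n≡))))))))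
      where
      z₀ = pt (j + x) (k + y) (l + z)
      z₁ = pt (j + x′) (k + y′) (l + z′)
      w₃ : W₃ ⟨ z₀ ⟩ ≡ + 0
      w₃ = cancel≡ (W₃ ⟨ z₀ ⟩) (+ 0) g>0 (trans (ℤₚ.*-comm (W₃ ⟨ z₀ ⟩) g) (trans (stretch W₃ j k l x y z g ex ey ez)
             (lin 4 (λ A B g ε → A := ε :* # 0 ⇒ B := # 0 ⇒ ⊢ A :+ B := # 0 :* g) (W₃ ⟨ z₁ ⟩) ((g - + 1) * W₃ ⟨ s ⟩) g ε
               (trans (W₃≡ z₁) (cong (ε *_) (trans (det-dot x′ y′ z′) e₃)))
               (trans (cong ((g - + 1) *_) (W₁s (sw12 (sw23 T)))) (ℤₚ.*-zeroʳ (g - + 1))))))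
      st : n ∣ᶻ W₂ ⟨ z₀ ⟩
      st = proj₁ (proj₂ (star T emp z₀ (+ 0 , w₃)))
      m = proj₁ st
      em = proj₂ st

    -- For g > 1 the lattice point s + (p - s)/g would lie in the interior of the edge.
    edge : ∀ g → + 0 < g → ∀ x y z → a - j ≡ x * g → b - k ≡ y * g → c - l ≡ z * g → g ≡ + 1
    edge g g>0 x y z ex ey ez = decide (g ℤₚ.≟ + 1)
      where
      m = pt (j + x) (k + y) (l + z)
      top : ∀ f′ → g * f′ ⟨ m ⟩ ≡ f′ ⟨ p ⟩ + (g - + 1) * f′ ⟨ s ⟩
      top f′ = trans (stretch f′ j k l x y z g {a - j} {b - k} {c - l} ex ey ez) (cong (λ v → f′ ⟨ v ⟩ + (g - + 1) * f′ ⟨ s ⟩)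
        (vec≡ (back j a) (back k b) (back l c)))
        where
        back : ∀ j a → j + (a - j) ≡ a
        back = lin 2 λ j a → ⊢ j :+ (a :- j) := a
      nonneg : ∀ {w v} → g * w ≡ v → + 0 ≤ v → + 0 ≤ w
      nonneg {w} {v} e h = cancel≤ (+ 0) w g>0 (lin 3 (λ g w v → g :* w := v ⇒ # 0 :≤ v ⇒ ⊢ # 0 :* g :≤ w :* g) g w v e h)
      ev : ∀ {A B} f′ → f′ ⟨ p ⟩ ≡ A → f′ ⟨ s ⟩ ≡ B → g * f′ ⟨ m ⟩ ≡ A + (g - + 1) * B
      ev f′ refl refl = top f′
      w₁ : g * W₁ ⟨ m ⟩ ≡ n
      w₁ = trans (ev W₁ (W₁p T) (W₁s T)) (lin 2 (λ n g → ⊢ n :+ (g :- # 1) :* # 0 := n) n g)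
      w₂ : g * W₂ ⟨ m ⟩ ≡ + 0
      w₂ = trans (ev W₂ (W₁q (sw12 T)) (W₁s (sw12 T))) (lin 1 (λ g → ⊢ # 0 :+ (g :- # 1) :* # 0 := # 0) g)
      w₃ : g * W₃ ⟨ m ⟩ ≡ + 0
      w₃ = trans (ev W₃ (W₁q (sw12 (sw23 T))) (W₁s (sw12 (sw23 T)))) (lin 1 (λ g → ⊢ # 0 :+ (g :- # 1) :* # 0 := # 0) g)
      T₄ = sw12 (sw23 (sw34 T))
      w₄ : g * W₄ ⟨ m ⟩ ≡ (g - + 1) * n
      w₄ = trans (ev W₄ (W₁q T₄) (W₁p T₄)) (ℤₚ.+-identityˡ _)
      decide : Dec (g ≡ + 1) → g ≡ + 1
      decide (yes h) = h
      decide (no g≢1) = ⊥-elim (emp m (nonneg w₁ (ℤₚ.<⇒≤ n>0) , nonneg w₂ ℤₚ.≤-refl , nonneg w₃ ℤₚ.≤-refl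
            , nonneg w₄ (mul≥0 (lin 1 (λ g → # 0 :< g ⇒ ⊢ # 0 :≤ g :- # 1) g g>0) (ℤₚ.<⇒≤ n>0)))
          ( (λ h → g≢1 (cancel≡ g (+ 1) n>0 (trans (cong (g *_) (sym h)) (trans w₁ (sym (ℤₚ.*-identityˡ n))))))
          , (λ h → ℤₚ.<-irrefl (trans (sym w₂) (cong (g *_) h)) (mul>0 g>0 n>0))
          , (λ h → ℤₚ.<-irrefl (trans (sym w₃) (cong (g *_) h)) (mul>0 g>0 n>0))
          , (λ h → lin 2 (λ g n → g :* n := (g :- # 1) :* n ⇒ # 0 :< n ⇒ ⊢ :⊥) g n (trans (cong (g *_) (sym h)) w₄) n>0)))

    -- Let g be the greatest common divisor of the components of the normal vector (p - s) × (q -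
    -- s). By `coarse` it divides all components of p - s, so it is 1 by `edge`, and Bézout
    -- coefficients give a point at height one over the facet.
    generator : ∃ λ z → W₃ ⟨ z ⟩ ≡ + 1
    generator = fromBezout (bezout₃ cx cy cz)
      where
      fromBezout : Bezout₃ cx cy cz → ∃ λ z → W₃ ⟨ z ⟩ ≡ + 1
      -- The factor ε in the displacement cancels the sign in W₃ = ε det, as ε² = 1.
      fromBezout (g , g≥0 , (x , ex) , (y , ey) , (z , ez) , (t₁ , t₂ , t₃ , et)) = pt (j + ε * t₁) (k + ε * t₂) (l + ε * t₃)
        , trans (W₃≡ (pt (j + ε * t₁) (k + ε * t₂) (l + ε * t₃))) (trans (cong (ε *_) (det-dot (ε * t₁) (ε * t₂) (ε * t₃)))
          (trans (lin 7 (λ ε x y z t₁ t₂ t₃ → ⊢ ε :* (x :* (ε :* t₁) :+ y :* (ε :* t₂) :+ z :* (ε :* t₃)) := ε :* ε :* (x :* t₁ :+ y :* t₂ :+ z :* t₃)) ε cx cy cz t₁ t₂ t₃)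
            (cong₂ _*_ ε² (trans et g≡1))))
        where
        zero-det : g ≡ + 0 → ⊥
        zero-det refl = ℤₚ.<-irrefl (sym (trans n≡ (trans (cong (ε *_) (trans (cong (λ v → det4 p q v s)
            (vec≡ (back j h₁) (back k h₂) (back l h₃))) (trans (det-dot (h₁ - j) (h₂ - k) (h₃ - l))
            (vanish cx cy cz ex ey ez)))) (ℤₚ.*-zeroʳ ε)))) n>0
          where
          back : ∀ j a → a ≡ j + (a - j)
          back = lin 2 λ j a → ⊢ a := j :+ (a :- j)
          vanish : ∀ A B C → A ≡ x * + 0 → B ≡ y * + 0 → C ≡ z * + 0 → A * (h₁ - j) + B * (h₂ - k) + C * (h₃ - l) ≡ + 0
          vanish _ _ _ refl refl refl = lin 6 (λ x y z a b c → ⊢ x :* # 0 :* a :+ y :* # 0 :* b :+ z :* # 0 :* c := # 0) x y z (h₁ - j) (h₂ - k) (h₃ - l)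
        g>0 : + 0 < g
        g>0 = ℤₚ.≤∧≢⇒< g≥0 (λ h → zero-det (sym h))
        neg : ∀ {A} x → A ≡ x * g → - A ≡ (- x) * g
        neg x refl = lin 2 (λ x g → ⊢ :- (x :* g) := (:- x) :* g) x g
        nul : + 0 ≡ + 0 * g
        nul = sym (ℤₚ.*-zeroˡ g)
        mx = coarse g g>0 (+ 0) z (- y) (a - j) nul ez (neg y ey) (lin 3 (λ x y z → ⊢ x :* # 0 :+ y :* z :+ z :* (:- y) := # 0) cx cy cz) dx
        my = coarse g g>0 (- z) (+ 0) x (b - k) (neg z ez) nul ex (lin 3 (λ x y z → ⊢ x :* (:- z) :+ y :* # 0 :+ z :* x := # 0) cx cy cz) dy
        mz = coarse g g>0 y (- x) (+ 0) (c - l) ey (neg x ex) nul (lin 3 (λ x y z → ⊢ x :* y :+ y :* (:- x) :+ z :* # 0 := # 0) cx cy cz) dz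
        g≡1 : g ≡ + 1
        g≡1 = edge g g>0 (proj₁ mx) (proj₁ my) (proj₁ mz) (proj₂ mx) (proj₂ my) (proj₂ mz)

generator₃ : ∀ {p q r s} (T : Tet p q r s) → Raw T → Empty T → ∃ λ z → Tet.W₃ T ⟨ z ⟩ ≡ + 1
generator₃ {a ∷ b ∷ c ∷ []} {d ∷ e ∷ f ∷ []} {g ∷ h ∷ i ∷ []} {j ∷ k ∷ l ∷ []} = Primitive.generator a b c d e f g h i j k l

-- Abstract hypotheses on the lattice points, and tetrahedra in White's normal form

Bounded : ℕ → Z3 → Set
Bounded M (x ∷ y ∷ z ∷ []) = (∣ x ∣ ℕ.≤ M) × (∣ y ∣ ℕ.≤ M) × (∣ z ∣ ℕ.≤ M)

-- The lattice points of a polytope of width larger than one that all lie in one class of a character modulo three.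
record Config (A : Z3 → Set) : Set where
  field
    conv : ∀ cs N z → All (λ c → + 0 ≤ proj₁ c × A (proj₂ c)) cs → sumZ cs ≡ N → + 0 < N → combZ cs ≡ N ·z z → A z
    M : ℕ
    bound : ∀ z → A z → Bounded M z
    κ : Aff
    κ-A : ∀ p q → A p → A q → + 3 ∣ᶻ (κ ⟨ p ⟩ - κ ⟨ q ⟩)
    κ-nontrivial : ∀ w → ¬ (∀ z → + 3 ∣ᶻ (κ ⟨ z ⟩ - κ ⟨ w ⟩))
    width : ∀ f → (∃ λ z → ∃ λ z′ → f ⟨ z ⟩ ≢ f ⟨ z′ ⟩) → ∃ λ v → A v × (f ⟨ v ⟩ < + 0 ⊎ + 1 < f ⟨ v ⟩)

prime₃ : ∀ x y → + 3 ∣ᶻ x * y → + 3 ∣ᶻ x ⊎ + 3 ∣ᶻ y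
prime₃ x y (k , e) = go (divide (+ 3) (lin 0 (⊢ # 0 :< # 3)) x) (divide (+ 3) (lin 0 (⊢ # 0 :< # 3)) y)
  where
  no₃ : ∀ m c → (+ 3 * m ≡ + c) → c ≡ 1 ⊎ c ≡ 2 ⊎ c ≡ 4 → ⊥
  no₃ m _ h (inj₁ refl) = bad (small₃ m (ℤₚ.≮⇒≥ λ l → lin 1 (λ m → # 3 :* m := # 1 ⇒ m :< # 0 ⇒ ⊢ :⊥) m h l) (lin 1 (λ m → # 3 :* m := # 1 ⇒ ⊢ m :< # 3) m h))
    where
    bad : m ≡ + 0 ⊎ m ≡ + 1 ⊎ m ≡ + 2 → ⊥
    bad (inj₁ refl) = lin 0 (# 0 := # 1 ⇒ ⊢ :⊥) h
    bad (inj₂ (inj₁ refl)) = lin 0 (# 3 := # 1 ⇒ ⊢ :⊥) h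
    bad (inj₂ (inj₂ refl)) = lin 0 (# 6 := # 1 ⇒ ⊢ :⊥) h
  no₃ m _ h (inj₂ (inj₁ refl)) = bad (small₃ m (ℤₚ.≮⇒≥ λ l → lin 1 (λ m → # 3 :* m := # 2 ⇒ m :< # 0 ⇒ ⊢ :⊥) m h l) (lin 1 (λ m → # 3 :* m := # 2 ⇒ ⊢ m :< # 3) m h))
    where
    bad : m ≡ + 0 ⊎ m ≡ + 1 ⊎ m ≡ + 2 → ⊥
    bad (inj₁ refl) = lin 0 (# 0 := # 2 ⇒ ⊢ :⊥) h
    bad (inj₂ (inj₁ refl)) = lin 0 (# 3 := # 2 ⇒ ⊢ :⊥) h
    bad (inj₂ (inj₂ refl)) = lin 0 (# 6 := # 2 ⇒ ⊢ :⊥) h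
  no₃ m _ h (inj₂ (inj₂ refl)) = bad (small₃ m (ℤₚ.≮⇒≥ λ l → lin 1 (λ m → # 3 :* m := # 4 ⇒ m :< # 0 ⇒ ⊢ :⊥) m h l) (lin 1 (λ m → # 3 :* m := # 4 ⇒ ⊢ m :< # 3) m h))
    where
    bad : m ≡ + 0 ⊎ m ≡ + 1 ⊎ m ≡ + 2 → ⊥
    bad (inj₁ refl) = lin 0 (# 0 := # 4 ⇒ ⊢ :⊥) h
    bad (inj₂ (inj₁ refl)) = lin 0 (# 3 := # 4 ⇒ ⊢ :⊥) h
    bad (inj₂ (inj₂ refl)) = lin 0 (# 6 := # 4 ⇒ ⊢ :⊥) h
  go : (∃ λ q → ∃ λ r → x ≡ r + q * + 3 × + 0 ≤ r × r < + 3) → (∃ λ q → ∃ λ r → y ≡ r + q * + 3 × + 0 ≤ r × r < + 3) → + 3 ∣ᶻ x ⊎ + 3 ∣ᶻ y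
  go (q , r , ex , l , u) (q′ , r′ , ey , l′ , u′) = cases (small₃ r l u) (small₃ r′ l′ u′)
    where
    prod : ∀ c → r * r′ ≡ c → + 3 * (k - q * r′ - r * q′ - q * q′ * + 3) ≡ c
    prod c h = trans (lin 5 (λ k q r q′ r′ → k :* # 3 := (r :+ q :* # 3) :* (r′ :+ q′ :* # 3) ⇒ ⊢ # 3 :* (k :- q :* r′ :- r :* q′ :- q :* q′ :* # 3) := r :* r′) k q r q′ r′
      (trans (sym e) (cong₂ _*_ ex ey))) h
    cases : r ≡ + 0 ⊎ r ≡ + 1 ⊎ r ≡ + 2 → r′ ≡ + 0 ⊎ r′ ≡ + 1 ⊎ r′ ≡ + 2 → + 3 ∣ᶻ x ⊎ + 3 ∣ᶻ y
    cases (inj₁ refl) _ = inj₁ (q , trans ex (ℤₚ.+-identityˡ _))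
    cases (inj₂ _) (inj₁ refl) = inj₂ (q′ , trans ey (ℤₚ.+-identityˡ _))
    cases (inj₂ (inj₁ refl)) (inj₂ (inj₁ refl)) = ⊥-elim (no₃ _ 1 (prod (+ 1) refl) (inj₁ refl))
    cases (inj₂ (inj₁ refl)) (inj₂ (inj₂ refl)) = ⊥-elim (no₃ _ 2 (prod (+ 2) refl) (inj₂ (inj₁ refl)))
    cases (inj₂ (inj₂ refl)) (inj₂ (inj₁ refl)) = ⊥-elim (no₃ _ 2 (prod (+ 2) refl) (inj₂ (inj₁ refl)))
    cases (inj₂ (inj₂ refl)) (inj₂ (inj₂ refl)) = ⊥-elim (no₃ _ 4 (prod (+ 4) refl) (inj₂ (inj₂ refl)))

module _ (A : Z3 → Set) where

  -- A tetrahedron in the normal form of White's theorem: modulo n the lattice of barycentric coordinates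
  -- is generated by (σ, -σ, 1, -1), or equivalently by (1, -1, ρ, -ρ).
  record WhiteTet (p q r s : Z3) : Set where
    field
      tet : Tet p q r s
      Ap : A p
      Aq : A q
      Ar : A r
      As : A s
    open Tet tet public
    field
      σ ρ : ℤ
      σ>0 : + 0 < σ
      σ<n : σ < n
      ρ>0 : + 0 < ρ
      ρ<n : ρ < n
      zσ zρ : Z3
      zσ₁ : W₁ ⟨ zσ ⟩ ≡ σ
      zσ₂ : W₂ ⟨ zσ ⟩ ≡ n - σ
      zσ₃ : W₃ ⟨ zσ ⟩ ≡ + 1
      zσ₄ : W₄ ⟨ zσ ⟩ ≡ - + 1
      zρ₁ : W₁ ⟨ zρ ⟩ ≡ + 1
      zρ₂ : W₂ ⟨ zρ ⟩ ≡ - + 1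
      zρ₃ : W₃ ⟨ zρ ⟩ ≡ ρ
      zρ₄ : W₄ ⟨ zρ ⟩ ≡ n - ρ
      cyc : ∀ z → n ∣ᶻ (W₁ ⟨ z ⟩ - σ * W₃ ⟨ z ⟩)
      cyc₁₂ : ∀ z → n ∣ᶻ (W₁ ⟨ z ⟩ + W₂ ⟨ z ⟩)
      3∣n : + 3 ∣ᶻ n
      3∣W₃ : ∀ z → A z → + 3 ∣ᶻ W₃ ⟨ z ⟩

    cyc₃₄ : ∀ z → n ∣ᶻ (W₃ ⟨ z ⟩ + W₄ ⟨ z ⟩)
    cyc₃₄ z with cyc₁₂ z
    ... | k , e = + 1 - k , lin 6 (λ a b c d n k → a :+ b :+ c :+ d := n ⇒ a :+ b := k :* n ⇒ ⊢ c :+ d := (# 1 :- k) :* n)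
                    (W₁ ⟨ z ⟩) (W₂ ⟨ z ⟩) (W₃ ⟨ z ⟩) (W₄ ⟨ z ⟩) n k (sumW z) e

    σρ : n ∣ᶻ (+ 1 - σ * ρ)
    σρ with cyc zρ
    ... | k , e = k , trans (sym (cong₂ (λ x y → x - σ * y) zρ₁ zρ₃)) e

    cycρ : ∀ z → n ∣ᶻ (W₃ ⟨ z ⟩ - ρ * W₁ ⟨ z ⟩)
    cycρ z with cyc z | σρ
    ... | k , e | m , f = W₃ ⟨ z ⟩ * m - ρ * k , go (W₁ ⟨ z ⟩) (W₃ ⟨ z ⟩) e
      where
      go : ∀ a c → a - σ * c ≡ k * n → c - ρ * a ≡ (c * m - ρ * k) * n
      go a c h = trans (lin 4 (λ a c σ ρ → ⊢ c :- ρ :* a := c :* (# 1 :- σ :* ρ) :- ρ :* (a :- σ :* c)) a c σ ρ)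
        (trans (cong₂ (λ x y → c * x - ρ * y) f h) (lin 5 (λ c m n ρ k → ⊢ c :* (m :* n) :- ρ :* (k :* n) := (c :* m :- ρ :* k) :* n) c m n ρ k))

    3∣W₁ : ∀ z → A z → + 3 ∣ᶻ W₁ ⟨ z ⟩
    3∣W₁ z a with cyc z | 3∣W₃ z a | 3∣n
    ... | k , e | m , f | h , g = σ * m + k * h , go (W₁ ⟨ z ⟩) (W₃ ⟨ z ⟩) e f
      where
      go : ∀ a c → a - σ * c ≡ k * n → c ≡ m * + 3 → a ≡ (σ * m + k * h) * + 3
      go a _ e′ refl = trans (lin 3 (λ a σ m → ⊢ a := (a :- σ :* (m :* # 3)) :+ σ :* (m :* # 3)) a σ m)
        (trans (cong (_+ σ * (m * + 3)) (trans e′ (cong (k *_) g))) (lin 4 (λ k h σ m → ⊢ k :* (h :* # 3) :+ σ :* (m :* # 3) := (σ :* m :+ k :* h) :* # 3) k h σ m))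

    3∣+ : ∀ a b → + 3 ∣ᶻ a → n ∣ᶻ (a + b) → + 3 ∣ᶻ b
    3∣+ a b (m , f) (k , e) with 3∣n
    ... | h , g = k * h - m , lin 5 (λ a b k h m → a :+ b := k :* (h :* # 3) ⇒ a := m :* # 3 ⇒ ⊢ b := (k :* h :- m) :* # 3) a b k h m (trans e (cong (k *_) g)) f

    3∣W₂ : ∀ z → A z → + 3 ∣ᶻ W₂ ⟨ z ⟩
    3∣W₂ z a = 3∣+ (W₁ ⟨ z ⟩) (W₂ ⟨ z ⟩) (3∣W₁ z a) (cyc₁₂ z)

    3∣W₄ : ∀ z → A z → + 3 ∣ᶻ W₄ ⟨ z ⟩
    3∣W₄ z a = 3∣+ (W₃ ⟨ z ⟩) (W₄ ⟨ z ⟩) (3∣W₃ z a) (cyc₃₄ z)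

    n≥3 : + 3 ≤ n
    n≥3 with 3∣n
    ... | k , e = subst (+ 3 ≤_) (sym e) (lin 1 (λ k → # 0 :< k ⇒ ⊢ # 3 :≤ k :* # 3) k
            (cancel< (+ 0) k (lin 0 (⊢ # 0 :< # 3)) (subst (+ 0 * + 3 <_) e n>0)))

  private
    comm∣ : ∀ {n} a b → n ∣ᶻ (a + b) → n ∣ᶻ (b + a)
    comm∣ a b (k , e) = k , trans (ℤₚ.+-comm b a) e

  -- Exchanging the ends of one edge turns the generator (σ, -σ, 1, -1) into (-σ, σ, 1, -1), so σ
  -- and its inverse ρ both change sign modulo n.
  wsw12 : ∀ {p q r s} → WhiteTet p q r s → WhiteTet q p r s
  wsw12 T = record
    { tet = sw12 tet ; Ap = Aq ; Aq = Ap ; Ar = Ar ; As = As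
    ; σ = n - σ ; ρ = n - ρ
    ; σ>0 = lin 2 (λ σ n → σ :< n ⇒ ⊢ # 0 :< n :- σ) σ n σ<n ; σ<n = lin 2 (λ σ n → # 0 :< σ ⇒ ⊢ n :- σ :< n) σ n σ>0
    ; ρ>0 = lin 2 (λ σ n → σ :< n ⇒ ⊢ # 0 :< n :- σ) ρ n ρ<n ; ρ<n = lin 2 (λ σ n → # 0 :< σ ⇒ ⊢ n :- σ :< n) ρ n ρ>0
    ; zσ = zσ ; zσ₁ = zσ₂ ; zσ₂ = trans zσ₁ (lin 2 (λ σ n → ⊢ σ := n :- (n :- σ)) σ n) ; zσ₃ = zσ₃ ; zσ₄ = zσ₄
    ; zρ = point
    ; zρ₁ = trans at₂ (trans (cong (λ x → - + 1 * x + + 0 * n) zρ₂) (lin 1 (λ n → ⊢ # 1 :+ # 0 :* n := # 1) n))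
    ; zρ₂ = trans at₁ (trans (cong (λ x → - + 1 * x + + 0 * n) zρ₁) (lin 1 (λ n → ⊢ con (- + 1) :+ # 0 :* n := con (- + 1)) n))
    ; zρ₃ = trans at₃ (trans (cong (λ x → - + 1 * x + + 1 * n) zρ₃) (lin 2 (λ n ρ → ⊢ con (- + 1) :* ρ :+ # 1 :* n := n :- ρ) n ρ))
    ; zρ₄ = trans at₄ (trans (cong (λ x → - + 1 * x + + 1 * n) zρ₄) (lin 2 (λ n ρ → ⊢ con (- + 1) :* (n :- ρ) :+ # 1 :* n := n :- (n :- ρ)) n ρ))
    ; cyc = λ z → c (W₁ ⟨ z ⟩) (W₂ ⟨ z ⟩) (W₃ ⟨ z ⟩) (cyc z) (cyc₁₂ z) ; cyc₁₂ = λ z → comm∣ (W₁ ⟨ z ⟩) (W₂ ⟨ z ⟩) (cyc₁₂ z)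
    ; 3∣n = 3∣n ; 3∣W₃ = 3∣W₃ }
    where
    open WhiteTet T
    open Moved (move tet (- + 1) (+ 0) (+ 0) (+ 1) (+ 1) zρ refl)
    c : ∀ a b c → n ∣ᶻ (a - σ * c) → n ∣ᶻ (a + b) → n ∣ᶻ (b - (n - σ) * c)
    c a b c (k , e) (k′ , e′) = k′ - k - c , lin 7 (λ a b c n σ k k′ → a :- σ :* c := k :* n ⇒ a :+ b := k′ :* n ⇒ ⊢ b :- (n :- σ) :* c := (k′ :- k :- c) :* n) a b c n σ k k′ e e′

  wsw34 : ∀ {p q r s} → WhiteTet p q r s → WhiteTet p q s r
  wsw34 T = record
    { tet = sw34 tet ; Ap = Ap ; Aq = Aq ; Ar = As ; As = Ar
    ; σ = n - σ ; ρ = n - ρ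
    ; σ>0 = lin 2 (λ σ n → σ :< n ⇒ ⊢ # 0 :< n :- σ) σ n σ<n ; σ<n = lin 2 (λ σ n → # 0 :< σ ⇒ ⊢ n :- σ :< n) σ n σ>0
    ; ρ>0 = lin 2 (λ σ n → σ :< n ⇒ ⊢ # 0 :< n :- σ) ρ n ρ<n ; ρ<n = lin 2 (λ σ n → # 0 :< σ ⇒ ⊢ n :- σ :< n) ρ n ρ>0
    ; zρ = zρ ; zρ₁ = zρ₁ ; zρ₂ = zρ₂ ; zρ₃ = zρ₄ ; zρ₄ = trans zρ₃ (lin 2 (λ σ n → ⊢ σ := n :- (n :- σ)) ρ n)
    ; zσ = point
    ; zσ₁ = trans at₁ (trans (cong (λ x → - + 1 * x + + 1 * n) zσ₁) (lin 2 (λ n σ → ⊢ con (- + 1) :* σ :+ # 1 :* n := n :- σ) n σ))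
    ; zσ₂ = trans at₂ (trans (cong (λ x → - + 1 * x + + 1 * n) zσ₂) (lin 2 (λ n σ → ⊢ con (- + 1) :* (n :- σ) :+ # 1 :* n := n :- (n :- σ)) n σ))
    ; zσ₃ = trans at₄ (trans (cong (λ x → - + 1 * x + + 0 * n) zσ₄) (lin 1 (λ n → ⊢ # 1 :+ # 0 :* n := # 1) n))
    ; zσ₄ = trans at₃ (trans (cong (λ x → - + 1 * x + + 0 * n) zσ₃) (lin 1 (λ n → ⊢ con (- + 1) :+ # 0 :* n := con (- + 1)) n))
    ; cyc = λ z → c (W₁ ⟨ z ⟩) (W₃ ⟨ z ⟩) (W₄ ⟨ z ⟩) (cyc z) (cyc₃₄ z) ; cyc₁₂ = cyc₁₂
    ; 3∣n = 3∣n ; 3∣W₃ = 3∣W₄ }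
    where
    open WhiteTet T
    open Moved (move tet (- + 1) (+ 1) (+ 1) (+ 0) (+ 0) zσ refl)
    c : ∀ a c d → n ∣ᶻ (a - σ * c) → n ∣ᶻ (c + d) → n ∣ᶻ (a - (n - σ) * d)
    c a c d (k , e) (k′ , e′) = k + σ * k′ - d , go (c + d) e′
      where
      go : ∀ x → x ≡ k′ * n → a - (n - σ) * d ≡ (k + σ * k′ - d) * n
      go _ refl = trans (lin 5 (λ a c d n σ → ⊢ a :- (n :- σ) :* d := (a :- σ :* c) :+ σ :* (c :+ d) :- d :* n) a c d n σ)
        (trans (cong₂ (λ x y → x + σ * y - d * n) e e′) (lin 5 (λ k k′ n σ d → ⊢ k :* n :+ σ :* (k′ :* n) :- d :* n := (k :+ σ :* k′ :- d) :* n) k k′ n σ d))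

  -- Multiplying the generator by the inverse ρ of σ gives (1, -1, ρ, -ρ); hence the edges pq and rs
  -- have equal rights.
  wflip : ∀ {p q r s} → WhiteTet p q r s → WhiteTet r s p q
  wflip T = record
    { tet = sw23 (sw34 (sw12 (sw23 tet))) ; Ap = Ar ; Aq = As ; Ar = Ap ; As = Aq
    ; σ = ρ ; ρ = σ ; σ>0 = ρ>0 ; σ<n = ρ<n ; ρ>0 = σ>0 ; ρ<n = σ<n
    ; zσ = zρ ; zσ₁ = zρ₃ ; zσ₂ = zρ₄ ; zσ₃ = zρ₁ ; zσ₄ = zρ₂
    ; zρ = zσ ; zρ₁ = zσ₃ ; zρ₂ = zσ₄ ; zρ₃ = zσ₁ ; zρ₄ = zσ₂
    ; cyc = cycρ ; cyc₁₂ = cyc₃₄ ; 3∣n = 3∣n ; 3∣W₃ = 3∣W₁ }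
    where open WhiteTet T

  -- For σ = n - 1 the generator is (-1, 1, 1, -1), which is invariant under exchanging q and r. The
  -- distinguished edges can then be re-paired as pr and qs.
  wsw23 : ∀ {p q r s} (T : WhiteTet p q r s) → WhiteTet.σ T ≡ WhiteTet.n T - + 1 → WhiteTet p r q s
  wsw23 T σ≡ = record
    { tet = sw23 tet ; Ap = Ap ; Aq = Ar ; Ar = Aq ; As = As
    ; σ = σ ; ρ = n - + 1
    ; σ>0 = σ>0 ; σ<n = σ<n
    ; ρ>0 = subst (+ 0 <_) σ≡ σ>0 ; ρ<n = subst (_< n) σ≡ σ<n
    ; zσ = zσ ; zσ₁ = zσ₁ ; zσ₂ = trans zσ₃ one ; zσ₃ = trans zσ₂ (sym one) ; zσ₄ = zσ₄
    ; zρ = point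
    ; zρ₁ = trans at₁ (trans (cong (λ x → - + 1 * x + + 1 * n) (trans zσ₁ σ≡)) (lin 1 (λ n → ⊢ con (- + 1) :* (n :- # 1) :+ # 1 :* n := # 1) n))
    ; zρ₂ = trans at₃ (trans (cong (λ x → - + 1 * x + + 0 * n) zσ₃) (lin 1 (λ n → ⊢ con (- + 1) :+ # 0 :* n := con (- + 1)) n))
    ; zρ₃ = trans at₂ (trans (cong (λ x → - + 1 * x + + 1 * n) (trans zσ₂ (sym one))) (lin 1 (λ n → ⊢ con (- + 1) :+ # 1 :* n := n :- # 1) n))
    ; zρ₄ = trans at₄ (trans (cong (λ x → - + 1 * x + + 0 * n) zσ₄) (lin 1 (λ n → ⊢ # 1 :+ # 0 :* n := n :- (n :- # 1)) n))
    ; cyc = λ z → c (W₁ ⟨ z ⟩) (W₂ ⟨ z ⟩) (cyc₁₂ z)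
    ; cyc₁₂ = λ z → c₁₂ (W₁ ⟨ z ⟩) (W₃ ⟨ z ⟩) (cyc z)
    ; 3∣n = 3∣n ; 3∣W₃ = 3∣W₂ }
    where
    open WhiteTet T
    open Moved (move tet (- + 1) (+ 1) (+ 1) (+ 0) (+ 0) zσ refl)
    one : + 1 ≡ n - σ
    one = lin 2 (λ n σ → σ := n :- # 1 ⇒ ⊢ # 1 := n :- σ) n σ σ≡
    c : ∀ a b → n ∣ᶻ (a + b) → n ∣ᶻ (a - σ * b)
    c a b (k , e) = k - b , trans (cong (λ x → a - x * b) σ≡) (lin 4 (λ a b n k → a :+ b := k :* n ⇒ ⊢ a :- (n :- # 1) :* b := (k :- b) :* n) a b n k e)
    c₁₂ : ∀ a c → n ∣ᶻ (a - σ * c) → n ∣ᶻ (a + c)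
    c₁₂ a c (k , e) = k + c , lin 4 (λ a c n k → a :- (n :- # 1) :* c := k :* n ⇒ ⊢ a :+ c := (k :+ c) :* n) a c n k (trans (cong (λ x → a - x * c) (sym σ≡)) e)

t24 : ∀ {p q r s} → Tet p q r s → Tet p s r q
t24 T = sw34 (sw23 (sw34 T))

t14 : ∀ {p q r s} → Tet p q r s → Tet s q r p
t14 T = sw34 (sw23 (sw12 (sw23 (sw34 T))))

small₄ : ∀ t → + 0 < t → t < + 4 → t ≡ + 1 ⊎ t ≡ + 2 ⊎ t ≡ + 3
small₄ (+ 0) (+<+ ()) _
small₄ (+ 1) _ _ = inj₁ refl
small₄ (+ 2) _ _ = inj₂ (inj₁ refl)
small₄ (+ 3) _ _ = inj₂ (inj₂ refl)
small₄ (+ suc (suc (suc (suc t)))) _ (+<+ (s≤s (s≤s (s≤s (s≤s ())))))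

no-multiple : ∀ n j → + 1 ≤ j → j < n → ¬ (n ∣ᶻ j)
no-multiple n j 1≤j j<n (k , e) = lin 2 (λ k j → # 0 :< k ⇒ k :< # 1 ⇒ ⊢ :⊥) k j
  (cancel< (+ 0) k n>0 (lin 3 (λ n j k → # 1 :≤ j ⇒ j := k :* n ⇒ ⊢ # 0 :* n :< k :* n) n j k 1≤j e))
  (cancel< k (+ 1) n>0 (lin 3 (λ n j k → j :< n ⇒ j := k :* n ⇒ ⊢ k :* n :< # 1 :* n) n j k j<n e))
  where
  n>0 : + 0 < n
  n>0 = lin 2 (λ n j → # 1 :≤ j ⇒ j :< n ⇒ ⊢ # 0 :< n) n j 1≤j j<n

-- In an empty tetrahedron all barycentric coordinates are determined modulo n by the third one.
module Cyclic {p q r s} (T : Tet p q r s) (emp : Empty T) (z₃ : Z3) (z₃≡ : Tet.W₃ T ⟨ z₃ ⟩ ≡ + 1) where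
  open Tet T

  private
    comb : Z3 → List (ℤ × Z3)
    comb z = (+ 1 , z) L.∷ (- (W₃ ⟨ z ⟩) , z₃) L.∷ (W₃ ⟨ z ⟩ , s) L.∷ L.[]

    -- W₃(z) times the vector z₃ - s is subtracted from z, which brings it into the plane W₃ = 0,
    -- where `star` applies.
    rest : Z3 → Z3
    rest z = combZ (comb z)

    rest-at : ∀ f z → f ⟨ rest z ⟩ ≡ f ⟨ z ⟩ - W₃ ⟨ z ⟩ * f ⟨ z₃ ⟩ + W₃ ⟨ z ⟩ * f ⟨ s ⟩
    rest-at f z = trans (aff-at f (comb z) (lin 1 (λ a → ⊢ # 1 :+ (:- a :+ (a :+ # 0)) := # 1) (W₃ ⟨ z ⟩)))
      (lin 4 (λ a b c d → ⊢ # 1 :* a :+ ((:- b) :* c :+ (b :* d :+ # 0)) := a :- b :* c :+ b :* d) (f ⟨ z ⟩) (W₃ ⟨ z ⟩) (f ⟨ z₃ ⟩) (f ⟨ s ⟩))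

    rest₃ : ∀ z → W₃ ⟨ rest z ⟩ ≡ + 0
    rest₃ z = trans (rest-at W₃ z) (trans (cong₂ (λ x y → W₃ ⟨ z ⟩ - W₃ ⟨ z ⟩ * x + W₃ ⟨ z ⟩ * y) z₃≡ (W₁s (sw12 (sw23 T))))
      (lin 1 (λ a → ⊢ a :- a :* # 1 :+ a :* # 0 := # 0) (W₃ ⟨ z ⟩)))

    st : ∀ z → n ∣ᶻ W₁ ⟨ rest z ⟩ × n ∣ᶻ W₂ ⟨ rest z ⟩ × n ∣ᶻ W₄ ⟨ rest z ⟩
    st z = star T emp (rest z) (+ 0 , rest₃ z)

  cyclic₁ : ∀ z → n ∣ᶻ (W₁ ⟨ z ⟩ - W₃ ⟨ z ⟩ * W₁ ⟨ z₃ ⟩)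
  cyclic₁ z = proj₁ (proj₁ (st z)) , trans (lin 2 (λ a b → ⊢ a := a :+ b :* # 0) (W₁ ⟨ z ⟩ - W₃ ⟨ z ⟩ * W₁ ⟨ z₃ ⟩) (W₃ ⟨ z ⟩))
    (trans (cong (λ x → W₁ ⟨ z ⟩ - W₃ ⟨ z ⟩ * W₁ ⟨ z₃ ⟩ + W₃ ⟨ z ⟩ * x) (sym (W₁s T))) (trans (sym (rest-at W₁ z)) (proj₂ (proj₁ (st z)))))

  cyclic₂ : ∀ z → n ∣ᶻ (W₂ ⟨ z ⟩ - W₃ ⟨ z ⟩ * W₂ ⟨ z₃ ⟩)
  cyclic₂ z = proj₁ (proj₁ (proj₂ (st z))) , trans (lin 2 (λ a b → ⊢ a := a :+ b :* # 0) (W₂ ⟨ z ⟩ - W₃ ⟨ z ⟩ * W₂ ⟨ z₃ ⟩) (W₃ ⟨ z ⟩))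
    (trans (cong (λ x → W₂ ⟨ z ⟩ - W₃ ⟨ z ⟩ * W₂ ⟨ z₃ ⟩ + W₃ ⟨ z ⟩ * x) (sym (W₁s (sw12 T)))) (trans (sym (rest-at W₂ z)) (proj₂ (proj₁ (proj₂ (st z))))))

  module _ {A : Z3 → Set} (C : Config A) (Ap : A p) (Aq : A q) (Ar : A r) (As : A s) where
    open Config C

    private
      t = κ ⟨ z₃ ⟩ - κ ⟨ s ⟩

      -- `rest z` is an integral combination of p, q and s, and κ takes the same value modulo three
      -- at these; so κ(z) depends only on W₃(z).
      κ-cyclic : ∀ z → + 3 ∣ᶻ (κ ⟨ z ⟩ - κ ⟨ s ⟩ - W₃ ⟨ z ⟩ * t)
      κ-cyclic z = go (st z) (κ-A p s Ap As) (κ-A q s Aq As)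
        where
        go : n ∣ᶻ W₁ ⟨ rest z ⟩ × n ∣ᶻ W₂ ⟨ rest z ⟩ × n ∣ᶻ W₄ ⟨ rest z ⟩ → + 3 ∣ᶻ (κ ⟨ p ⟩ - κ ⟨ s ⟩) → + 3 ∣ᶻ (κ ⟨ q ⟩ - κ ⟨ s ⟩) → + 3 ∣ᶻ (κ ⟨ z ⟩ - κ ⟨ s ⟩ - W₃ ⟨ z ⟩ * t)
        go ((m₁ , e₁) , (m₂ , e₂) , (m₄ , e₄)) (k₁ , f₁) (k₂ , f₂) = m₁ * k₁ + m₂ * k₂ ,
          trans (trans (lin 4 (λ a b c d → ⊢ a :- d :- b :* (c :- d) := (a :- b :* c :+ b :* d) :- d) (κ ⟨ z ⟩) (W₃ ⟨ z ⟩) (κ ⟨ z₃ ⟩) (κ ⟨ s ⟩)) (cong (_- κ ⟨ s ⟩) (sym (rest-at κ z))))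
            (trans (lin 2 (λ x y → ⊢ x :- y := x :- y) (κ ⟨ rest z ⟩) (κ ⟨ s ⟩)) (trans val
              (trans (cong₂ (λ x y → m₁ * x + m₂ * y) f₁ f₂) (lin 4 (λ m₁ k₁ m₂ k₂ → ⊢ m₁ :* (k₁ :* # 3) :+ m₂ :* (k₂ :* # 3) := (m₁ :* k₁ :+ m₂ :* k₂) :* # 3) m₁ k₁ m₂ k₂))))
          where
          total : m₁ + m₂ + m₄ ≡ + 1
          total = cancel≡ (m₁ + m₂ + m₄) (+ 1) n>0 (lin 8 (λ a b c d n m₁ m₂ m₄ → a :+ b :+ c :+ d := n ⇒ c := # 0 ⇒ a := m₁ :* n ⇒ b := m₂ :* n ⇒ d := m₄ :* n ⇒ ⊢ (m₁ :+ m₂ :+ m₄) :* n := # 1 :* n)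
            (W₁ ⟨ rest z ⟩) (W₂ ⟨ rest z ⟩) (W₃ ⟨ rest z ⟩) (W₄ ⟨ rest z ⟩) n m₁ m₂ m₄ (sumW (rest z)) (rest₃ z) e₁ e₂ e₄)
          κ-rest : n * κ ⟨ rest z ⟩ ≡ m₁ * n * κ ⟨ p ⟩ + m₂ * n * κ ⟨ q ⟩ + + 0 * κ ⟨ r ⟩ + m₄ * n * κ ⟨ s ⟩
          κ-rest = trans (bary T κ (rest z)) (cong₂ _+_ (cong₂ _+_ (cong₂ _+_ (cong (_* κ ⟨ p ⟩) e₁) (cong (_* κ ⟨ q ⟩) e₂)) (cong (_* κ ⟨ r ⟩) (rest₃ z))) (cong (_* κ ⟨ s ⟩) e₄))
          val : κ ⟨ rest z ⟩ - κ ⟨ s ⟩ ≡ m₁ * (κ ⟨ p ⟩ - κ ⟨ s ⟩) + m₂ * (κ ⟨ q ⟩ - κ ⟨ s ⟩)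
          val = cancel≡ (κ ⟨ rest z ⟩ - κ ⟨ s ⟩) (m₁ * (κ ⟨ p ⟩ - κ ⟨ s ⟩) + m₂ * (κ ⟨ q ⟩ - κ ⟨ s ⟩)) n>0
            (arith (κ ⟨ rest z ⟩) (κ ⟨ p ⟩) (κ ⟨ q ⟩) (κ ⟨ r ⟩) (κ ⟨ s ⟩) m₄ κ-rest (lin 3 (λ a b c → a :+ b :+ c := # 1 ⇒ ⊢ c := # 1 :- a :- b) m₁ m₂ m₄ total))
            where
            arith : ∀ x p q r s m₄ → n * x ≡ m₁ * n * p + m₂ * n * q + + 0 * r + m₄ * n * s → m₄ ≡ + 1 - m₁ - m₂ → (x - s) * n ≡ (m₁ * (p - s) + m₂ * (q - s)) * n
            arith x p q r s _ h refl = lin 8 (λ x p q r s m₁ m₂ n → n :* x := m₁ :* n :* p :+ m₂ :* n :* q :+ # 0 :* r :+ (# 1 :- m₁ :- m₂) :* n :* s ⇒ ⊢ (x :- s) :* n := (m₁ :* (p :- s) :+ m₂ :* (q :- s)) :* n) x p q r s m₁ m₂ n h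

    -- κ(z) - κ(s) is congruent to W₃(z) t, and t is not divisible by three, since otherwise κ would
    -- be constant modulo three on all of ℤ³.
    3∣third : ∀ z → A z → + 3 ∣ᶻ W₃ ⟨ z ⟩
    3∣third z a = go (κ-cyclic z) (κ-A z s a As)
      where
      go : + 3 ∣ᶻ (κ ⟨ z ⟩ - κ ⟨ s ⟩ - W₃ ⟨ z ⟩ * t) → + 3 ∣ᶻ (κ ⟨ z ⟩ - κ ⟨ s ⟩) → + 3 ∣ᶻ W₃ ⟨ z ⟩
      go (k , e) (k′ , e′) = pickFirst (prime₃ (W₃ ⟨ z ⟩) t (k′ - k , lin 4 (λ d m k k′ → d :- m := k :* # 3 ⇒ d := k′ :* # 3 ⇒ ⊢ m := (k′ :- k) :* # 3) (κ ⟨ z ⟩ - κ ⟨ s ⟩) (W₃ ⟨ z ⟩ * t) k k′ e e′))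
        where
        pickFirst : + 3 ∣ᶻ W₃ ⟨ z ⟩ ⊎ + 3 ∣ᶻ t → + 3 ∣ᶻ W₃ ⟨ z ⟩
        pickFirst (inj₁ h) = h
        pickFirst (inj₂ (m , h)) = ⊥-elim (κ-nontrivial s (λ z′ → div z′ (κ-cyclic z′)))
          where
          div : ∀ z′ → + 3 ∣ᶻ (κ ⟨ z′ ⟩ - κ ⟨ s ⟩ - W₃ ⟨ z′ ⟩ * t) → + 3 ∣ᶻ (κ ⟨ z′ ⟩ - κ ⟨ s ⟩)
          div z′ (l , g) = l + W₃ ⟨ z′ ⟩ * m , trans (lin 2 (λ d w → ⊢ d := d :- w :+ w) (κ ⟨ z′ ⟩ - κ ⟨ s ⟩) (W₃ ⟨ z′ ⟩ * t))
            (trans (cong₂ _+_ g (cong (W₃ ⟨ z′ ⟩ *_) h)) (lin 3 (λ l w m → ⊢ l :* # 3 :+ w :* (m :* # 3) := (l :+ w :* m) :* # 3) l (W₃ ⟨ z′ ⟩) m))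

    3∣vol : + 3 ∣ᶻ n
    3∣vol = subst (+ 3 ∣ᶻ_) (W₁p (sw12 (sw23 T))) (3∣third r Ar)

    n≥3′ : + 3 ≤ n
    n≥3′ = go 3∣vol
      where
      go : + 3 ∣ᶻ n → + 3 ≤ n
      go (k , e) = subst (+ 3 ≤_) (sym e) (lin 1 (λ k → # 0 :< k ⇒ ⊢ # 3 :≤ k :* # 3) k
            (cancel< (+ 0) k (lin 0 (⊢ # 0 :< # 3)) (subst (+ 0 * + 3 <_) e n>0)))

    -- The case in which the coordinate of z₃ at s is -1 modulo n.
    whiteTet : ∀ q₁ q₂ q₄ a₁ a₂ → W₁ ⟨ z₃ ⟩ ≡ - (a₁ + q₁ * n) → W₂ ⟨ z₃ ⟩ ≡ - (a₂ + q₂ * n) → W₄ ⟨ z₃ ⟩ ≡ - (+ 1 + q₄ * n) →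
      + 0 < a₁ → a₁ < n → a₁ + a₂ ≡ n → WhiteTet A p q r s
    whiteTet q₁ q₂ q₄ a₁ a₂ e₁ e₂ e₄ a₁>0 a₁<n sum = fromBezout (bezout a₂ n)
      where
      Q : q₁ + q₂ + q₄ ≡ - + 2
      Q = cancel≡ (q₁ + q₂ + q₄) (- + 2) n>0 (lin 10 (λ a b c d n q₁ q₂ q₄ a₁ a₂ → a :+ b :+ c :+ d := n ⇒ a := :- (a₁ :+ q₁ :* n) ⇒ b := :- (a₂ :+ q₂ :* n) ⇒ c := # 1 ⇒ d := :- (# 1 :+ q₄ :* n) ⇒ a₁ :+ a₂ := n ⇒ ⊢ (q₁ :+ q₂ :+ q₄) :* n := con (- + 2) :* n)
        (W₁ ⟨ z₃ ⟩) (W₂ ⟨ z₃ ⟩) (W₃ ⟨ z₃ ⟩) (W₄ ⟨ z₃ ⟩) n q₁ q₂ q₄ a₁ a₂ (sumW z₃) e₁ e₂ z₃≡ e₄ sum)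
      mσ = move T (+ 1) (q₁ + + 1) (q₂ + + 1) (+ 0) q₄ z₃ (lin 3 (λ a b c → a :+ b :+ c := con (- + 2) ⇒ ⊢ # 1 :+ (a :+ # 1) :+ (b :+ # 1) :+ # 0 :+ c := # 1) q₁ q₂ q₄ Q)
      open Moved mσ renaming (point to zσ; at₁ to b₁; at₂ to b₂; at₃ to b₃; at₄ to b₄)
      σ₁ : W₁ ⟨ zσ ⟩ ≡ a₂
      σ₁ = lin 6 (λ x w n q a₁ a₂ → x := # 1 :* w :+ (q :+ # 1) :* n ⇒ w := :- (a₁ :+ q :* n) ⇒ a₁ :+ a₂ := n ⇒ ⊢ x := a₂) (W₁ ⟨ zσ ⟩) (W₁ ⟨ z₃ ⟩) n q₁ a₁ a₂ b₁ e₁ sum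
      σ₂ : W₂ ⟨ zσ ⟩ ≡ n - a₂
      σ₂ = lin 5 (λ x w n q a₂ → x := # 1 :* w :+ (q :+ # 1) :* n ⇒ w := :- (a₂ :+ q :* n) ⇒ ⊢ x := n :- a₂) (W₂ ⟨ zσ ⟩) (W₂ ⟨ z₃ ⟩) n q₂ a₂ b₂ e₂
      σ₃ : W₃ ⟨ zσ ⟩ ≡ + 1
      σ₃ = lin 3 (λ x w n → x := # 1 :* w :+ # 0 :* n ⇒ w := # 1 ⇒ ⊢ x := # 1) (W₃ ⟨ zσ ⟩) (W₃ ⟨ z₃ ⟩) n b₃ z₃≡
      σ₄ : W₄ ⟨ zσ ⟩ ≡ - + 1
      σ₄ = lin 4 (λ x w n q → x := # 1 :* w :+ q :* n ⇒ w := :- (# 1 :+ q :* n) ⇒ ⊢ x := con (- + 1)) (W₄ ⟨ zσ ⟩) (W₄ ⟨ z₃ ⟩) n q₄ b₄ e₄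
      σ>0 : + 0 < a₂
      σ>0 = lin 3 (λ a₁ a₂ n → a₁ :< n ⇒ a₁ :+ a₂ := n ⇒ ⊢ # 0 :< a₂) a₁ a₂ n a₁<n sum
      σ<n : a₂ < n
      σ<n = lin 3 (λ a₁ a₂ n → # 0 :< a₁ ⇒ a₁ :+ a₂ := n ⇒ ⊢ a₂ :< n) a₁ a₂ n a₁>0 sum
      cyc : ∀ z → n ∣ᶻ (W₁ ⟨ z ⟩ - a₂ * W₃ ⟨ z ⟩)
      cyc z = go (cyclic₁ z)
        where
        go : n ∣ᶻ (W₁ ⟨ z ⟩ - W₃ ⟨ z ⟩ * W₁ ⟨ z₃ ⟩) → n ∣ᶻ (W₁ ⟨ z ⟩ - a₂ * W₃ ⟨ z ⟩)
        go (k , e) = k - W₃ ⟨ z ⟩ * (q₁ + + 1) , ar (W₁ ⟨ z ⟩) (W₃ ⟨ z ⟩) (W₁ ⟨ z₃ ⟩) a₂ e e₁ (lin 3 (λ a₁ a₂ n → a₁ :+ a₂ := n ⇒ ⊢ a₂ := n :- a₁) a₁ a₂ n sum)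
          where
          ar : ∀ a c d a₂ → a - c * d ≡ k * n → d ≡ - (a₁ + q₁ * n) → a₂ ≡ n - a₁ → a - a₂ * c ≡ (k - c * (q₁ + + 1)) * n
          ar a c _ _ h refl refl = lin 6 (λ a c a₁ q₁ n k → a :- c :* (:- (a₁ :+ q₁ :* n)) := k :* n ⇒ ⊢ a :- (n :- a₁) :* c := (k :- c :* (q₁ :+ # 1)) :* n) a c a₁ q₁ n k h
      cyc₁₂ : ∀ z → n ∣ᶻ (W₁ ⟨ z ⟩ + W₂ ⟨ z ⟩)
      cyc₁₂ z = go (cyclic₁ z) (cyclic₂ z)
        where
        go : n ∣ᶻ (W₁ ⟨ z ⟩ - W₃ ⟨ z ⟩ * W₁ ⟨ z₃ ⟩) → n ∣ᶻ (W₂ ⟨ z ⟩ - W₃ ⟨ z ⟩ * W₂ ⟨ z₃ ⟩) → n ∣ᶻ (W₁ ⟨ z ⟩ + W₂ ⟨ z ⟩)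
        go (k , e) (k′ , e′) = k + k′ - W₃ ⟨ z ⟩ * (+ 1 + q₁ + q₂) , ar (W₁ ⟨ z ⟩) (W₂ ⟨ z ⟩) (W₃ ⟨ z ⟩) (W₁ ⟨ z₃ ⟩) (W₂ ⟨ z₃ ⟩) a₂ e e′ e₁ e₂ (lin 3 (λ a₁ a₂ n → a₁ :+ a₂ := n ⇒ ⊢ a₂ := n :- a₁) a₁ a₂ n sum)
          where
          ar : ∀ a b c d d′ a₂ → a - c * d ≡ k * n → b - c * d′ ≡ k′ * n → d ≡ - (a₁ + q₁ * n) → d′ ≡ - (a₂ + q₂ * n) → a₂ ≡ n - a₁ → a + b ≡ (k + k′ - c * (+ 1 + q₁ + q₂)) * n
          ar a b c _ _ _ h h′ refl refl refl = lin 9 (λ a₁ q₁ q₂ n k k′ a b c → a :- c :* (:- (a₁ :+ q₁ :* n)) := k :* n ⇒ b :- c :* (:- (n :- a₁ :+ q₂ :* n)) := k′ :* n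
            ⇒ ⊢ a :+ b := (k :+ k′ :- c :* (# 1 :+ q₁ :+ q₂)) :* n) a₁ q₁ q₂ n k k′ a b c h h′
      fromBezout : (∃ λ g → ∃ λ x → ∃ λ y → + 0 ≤ g × g ∣ᶻ a₂ × g ∣ᶻ n × x * a₂ + y * n ≡ g) → WhiteTet A p q r s
      fromBezout (g , x , y , g≥0 , (σ′ , eσ) , (n′ , en) , e) = withResidue (divide n n>0 x)
        where
        n′≥0 : + 0 < n′
        n′≥0 = ℤₚ.≰⇒> λ h → lin 3 (λ n n′ g → n := n′ :* g ⇒ # 0 :≤ (:- n′) :* g ⇒ # 0 :< n ⇒ ⊢ :⊥) n n′ g en (mul≥0 (lin 1 (λ a → a :≤ # 0 ⇒ ⊢ # 0 :≤ :- a) n′ h) g≥0) n>0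
        g>0 : + 0 < g
        g>0 = ℤₚ.≤∧≢⇒< g≥0 λ h → ℤₚ.<-irrefl (sym (trans en (trans (cong (n′ *_) (sym h)) (ℤₚ.*-zeroʳ n′)))) n>0
        mult = move T n′ (+ 1 - n′) (+ 0) (+ 0) (+ 0) zσ (lin 1 (λ a → ⊢ a :+ (# 1 :- a) :+ # 0 :+ # 0 :+ # 0 := # 1) n′)
        -- Here n' = n/g, so the first coordinate of n' zσ + (1 - n') p is a multiple of n. By
        -- `star` for the facet opposite p the third coordinate, n', is one too. This leaves g = 1,
        -- so σ is invertible modulo n.
        n∣n′ : n ∣ᶻ n′
        n∣n′ = go (proj₁ (star (sw12 (sw23 (sw12 T))) (empty12 (sw23 (sw12 T)) (empty23 (sw12 T) (empty12 T emp))) (Moved.point mult)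
            (σ′ + + 1 - n′ , trans (Moved.at₁ mult) (trans (cong (λ w → n′ * w + (+ 1 - n′) * n) (trans σ₁ eσ))
              (lin 4 (λ n n′ g σ′ → n := n′ :* g ⇒ n :* σ′ := n′ :* g :* σ′ ⇒ ⊢ n′ :* (σ′ :* g) :+ (# 1 :- n′) :* n := (σ′ :+ # 1 :- n′) :* n) n n′ g σ′ en (cong (_* σ′) en))))))
          where
          go : n ∣ᶻ W₃ ⟨ Moved.point mult ⟩ → n ∣ᶻ n′
          go (k , h) = k , lin 5 (λ x w n n′ k → x := n′ :* w :+ # 0 :* n ⇒ n′ :* w := n′ :* # 1 ⇒ x := k :* n ⇒ ⊢ n′ := k :* n) (W₃ ⟨ Moved.point mult ⟩) (W₃ ⟨ zσ ⟩) n n′ k (Moved.at₃ mult) (cong (n′ *_) σ₃) h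
        g≡1 : g ≡ + 1
        g≡1 = go n∣n′
          where
          go : n ∣ᶻ n′ → g ≡ + 1
          go (k , h) = ℤₚ.≤-antisym (ℤₚ.≮⇒≥ λ g>1 → lin 4 (λ n n′ g k → n := n′ :* g ⇒ # 0 :< (g :- # 1) :* n′ ⇒ n :≤ n′ ⇒ ⊢ :⊥) n n′ g k en
              (mul>0 (lin 1 (λ g → # 1 :< g ⇒ ⊢ # 0 :< g :- # 1) g g>1) n′≥0) n≤n′) (lin 1 (λ g → # 0 :< g ⇒ ⊢ # 1 :≤ g) g g>0)
            where
            k>0 : + 0 < k
            k>0 = cancel< (+ 0) k n>0 (lin 3 (λ n n′ k → # 0 :< n′ ⇒ n′ := k :* n ⇒ ⊢ # 0 :* n :< k :* n) n n′ k n′≥0 h)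
            n≤n′ : n ≤ n′
            n≤n′ = lin 3 (λ n n′ k → # 0 :≤ (k :- # 1) :* n ⇒ n′ := k :* n ⇒ ⊢ n :≤ n′) n n′ k (mul≥0 (lin 1 (λ k → # 0 :< k ⇒ ⊢ # 0 :≤ k :- # 1) k k>0) (ℤₚ.<⇒≤ n>0)) h
        e′ : x * a₂ + y * n ≡ + 1
        e′ = trans e g≡1
        withResidue : (∃ λ u → ∃ λ ρ → x ≡ ρ + u * n × + 0 ≤ ρ × ρ < n) → WhiteTet A p q r s
        withResidue (u , ρ , ex , ρ≥0 , ρ<n) = record
          { tet = T ; Ap = Ap ; Aq = Aq ; Ar = Ar ; As = As ; σ = a₂ ; ρ = ρ ; σ>0 = σ>0 ; σ<n = σ<n
          ; ρ>0 = ℤₚ.≤∧≢⇒< ρ≥0 ρ≢0 ; ρ<n = ρ<n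
          ; zσ = zσ ; zσ₁ = σ₁ ; zσ₂ = σ₂ ; zσ₃ = σ₃ ; zσ₄ = σ₄
          ; zρ = point
          ; zρ₁ = trans at₁ (trans (cong (λ w → x * w + y * n) σ₁) e′)
          ; zρ₂ = trans at₂ (trans (cong (λ w → x * w + (- x - y) * n) σ₂) (lin 4 (λ x y a n → x :* a :+ y :* n := # 1 ⇒ ⊢ x :* (n :- a) :+ (:- x :- y) :* n := con (- + 1)) x y a₂ n e′))
          ; zρ₃ = trans at₃ (trans (cong (λ w → x * w + (- u) * n) σ₃) (lin 4 (λ x u n ρ → x := ρ :+ u :* n ⇒ ⊢ x :* # 1 :+ (:- u) :* n := ρ) x u n ρ ex))
          ; zρ₄ = trans at₄ (trans (cong (λ w → x * w + (+ 1 + u) * n) σ₄) (lin 4 (λ x u n ρ → x := ρ :+ u :* n ⇒ ⊢ x :* con (- + 1) :+ (# 1 :+ u) :* n := n :- ρ) x u n ρ ex))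
          ; cyc = cyc ; cyc₁₂ = cyc₁₂ ; 3∣n = 3∣vol ; 3∣W₃ = 3∣third }
          where
          open Moved (move T x y (- x - y) (- u) (+ 1 + u) zσ (lin 3 (λ x y u → ⊢ x :+ y :+ (:- x :- y) :+ (:- u) :+ (# 1 :+ u) := # 1) x y u))
          ρ≢0 : + 0 ≢ ρ
          ρ≢0 refl = no-multiple n (+ 1) ℤₚ.≤-refl (lin 1 (λ n → # 3 :≤ n ⇒ ⊢ # 1 :< n) n n≥3′)
            (u * a₂ + y , trans (sym e′) (trans (cong (λ w → w * a₂ + y * n) ex) (lin 4 (λ u n a y → ⊢ (# 0 :+ u :* n) :* a :+ y :* n := (u :* a :+ y) :* n) u n a₂ y)))

  -- If n divided j W₁(z₃), then by `star` for the facet opposite p it would divide j W₃(z₃) = j as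
  -- well. The other two facets are treated in the same way.
  unit₁ : ∀ j → + 1 ≤ j → j < n → ¬ (n ∣ᶻ j * W₁ ⟨ z₃ ⟩)
  unit₁ j 1≤j j<n (k , e) = go (proj₁ (star (sw12 (sw23 (sw12 T))) (empty12 (sw23 (sw12 T)) (empty23 (sw12 T) (empty12 T emp))) point
      (k + (+ 1 - j) , trans at₁ (trans (cong (_+ (+ 1 - j) * n) e) (lin 3 (λ k j n → ⊢ k :* n :+ (# 1 :- j) :* n := (k :+ (# 1 :- j)) :* n) k j n)))))
    where
    open Moved (move T j (+ 1 - j) (+ 0) (+ 0) (+ 0) z₃ (lin 1 (λ a → ⊢ a :+ (# 1 :- a) :+ # 0 :+ # 0 :+ # 0 := # 1) j))
    go : n ∣ᶻ W₃ ⟨ point ⟩ → ⊥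
    go (m , h) = no-multiple n j 1≤j j<n (m , trans (lin 2 (λ j n → ⊢ j := j :* # 1 :+ # 0 :* n) j n) (trans (cong (λ w → j * w + + 0 * n) (sym z₃≡)) (trans (sym at₃) h)))

  unit₂ : ∀ j → + 1 ≤ j → j < n → ¬ (n ∣ᶻ j * W₂ ⟨ z₃ ⟩)
  unit₂ j 1≤j j<n (k , e) = go (proj₁ (proj₂ (star (sw23 T) (empty23 T emp) point
      (k , trans at₂ (trans (cong (_+ + 0 * n) e) (lin 2 (λ k n → ⊢ k :* n :+ # 0 :* n := k :* n) k n))))))
    where
    open Moved (move T j (+ 1 - j) (+ 0) (+ 0) (+ 0) z₃ (lin 1 (λ a → ⊢ a :+ (# 1 :- a) :+ # 0 :+ # 0 :+ # 0 := # 1) j))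
    go : n ∣ᶻ W₃ ⟨ point ⟩ → ⊥
    go (m , h) = no-multiple n j 1≤j j<n (m , trans (lin 2 (λ j n → ⊢ j := j :* # 1 :+ # 0 :* n) j n) (trans (cong (λ w → j * w + + 0 * n) (sym z₃≡)) (trans (sym at₃) h)))

  unit₄ : ∀ j → + 1 ≤ j → j < n → ¬ (n ∣ᶻ j * W₄ ⟨ z₃ ⟩)
  unit₄ j 1≤j j<n (k , e) = go (proj₂ (proj₂ (star (sw34 T) (empty34 T emp) point
      (k , trans at₄ (trans (cong (_+ + 0 * n) e) (lin 2 (λ k n → ⊢ k :* n :+ # 0 :* n := k :* n) k n))))))
    where
    open Moved (move T j (+ 1 - j) (+ 0) (+ 0) (+ 0) z₃ (lin 1 (λ a → ⊢ a :+ (# 1 :- a) :+ # 0 :+ # 0 :+ # 0 := # 1) j))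
    go : n ∣ᶻ W₃ ⟨ point ⟩ → ⊥
    go (m , h) = no-multiple n j 1≤j j<n (m , trans (lin 2 (λ j n → ⊢ j := j :* # 1 :+ # 0 :* n) j n) (trans (cong (λ w → j * w + + 0 * n) (sym z₃≡)) (trans (sym at₃) h)))

  module _ (q₁ q₂ q₄ a₁ a₂ a₄ : ℤ) (e₁ : - W₁ ⟨ z₃ ⟩ ≡ a₁ + q₁ * n) (e₂ : - W₂ ⟨ z₃ ⟩ ≡ a₂ + q₂ * n) (e₄ : - W₄ ⟨ z₃ ⟩ ≡ a₄ + q₄ * n) where

    private
      Q = q₁ + q₂ + q₄

      a-sum : a₁ + a₂ + a₄ ≡ + 1 - n - Q * n
      a-sum = lin 11 (λ a b c d n q₁ q₂ q₄ a₁ a₂ a₄ → a :+ b :+ c :+ d := n ⇒ :- a := a₁ :+ q₁ :* n ⇒ :- b := a₂ :+ q₂ :* n ⇒ :- d := a₄ :+ q₄ :* n ⇒ c := # 1 ⇒ ⊢ a₁ :+ a₂ :+ a₄ := # 1 :- n :- (q₁ :+ q₂ :+ q₄) :* n)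
        (W₁ ⟨ z₃ ⟩) (W₂ ⟨ z₃ ⟩) (W₃ ⟨ z₃ ⟩) (W₄ ⟨ z₃ ⟩) n q₁ q₂ q₄ a₁ a₂ a₄ (sumW z₃) e₁ e₂ e₄ z₃≡

    module _ (j : ℤ) (1≤j : + 1 ≤ j) (j<n : j < n) (F₁ F₂ F₄ r₁ r₂ r₄ : ℤ) (f₁ : j * a₁ ≡ r₁ + F₁ * n) (f₂ : j * a₂ ≡ r₂ + F₂ * n) (f₄ : j * a₄ ≡ r₄ + F₄ * n)
      (l₁ : + 0 ≤ r₁) (l₂ : + 0 ≤ r₂) (l₄ : + 0 ≤ r₄) (u₁ : r₁ < n) (u₂ : r₂ < n) (u₄ : r₄ < n) where

      private
        coord : ∀ w a q r F → - w ≡ a + q * n → j * a ≡ r + F * n → j * w ≡ - (r + (F + j * q) * n)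
        coord w a q r F e f = lin 7 (λ w a q r F n j → j :* (:- w) := j :* (a :+ q :* n) ⇒ j :* a := r :+ F :* n ⇒ ⊢ j :* w := :- (r :+ (F :+ j :* q) :* n)) w a q r F n j (cong (j *_) e) f
        g₁ = coord (W₁ ⟨ z₃ ⟩) a₁ q₁ r₁ F₁ e₁ f₁
        g₂ = coord (W₂ ⟨ z₃ ⟩) a₂ q₂ r₂ F₂ e₂ f₂
        g₄ = coord (W₄ ⟨ z₃ ⟩) a₄ q₄ r₄ F₄ e₄ f₄
        multiple : ∀ {w} r G → r ≡ + 0 → j * w ≡ - (r + G * n) → n ∣ᶻ j * w
        multiple r G refl h = - G , trans h (lin 2 (λ G n → ⊢ :- (# 0 :+ G :* n) := (:- G) :* n) G n)

      pos₁ : + 0 < r₁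
      pos₁ = ℤₚ.≤∧≢⇒< l₁ λ h → unit₁ j 1≤j j<n (multiple r₁ (F₁ + j * q₁) (sym h) g₁)
      pos₂ : + 0 < r₂
      pos₂ = ℤₚ.≤∧≢⇒< l₂ λ h → unit₂ j 1≤j j<n (multiple r₂ (F₂ + j * q₂) (sym h) g₂)
      pos₄ : + 0 < r₄
      pos₄ = ℤₚ.≤∧≢⇒< l₄ λ h → unit₄ j 1≤j j<n (multiple r₄ (F₄ + j * q₄) (sym h) g₄)

      private
        t = + 1 - j - j * Q - (F₁ + F₂ + F₄)
        r-sum : r₁ + r₂ + r₄ + (n - j) ≡ t * n
        r-sum = trans (lin 9 (λ r₁ r₂ r₄ F₁ F₂ F₄ n j s → s := r₁ :+ F₁ :* n :+ (r₂ :+ F₂ :* n) :+ (r₄ :+ F₄ :* n) ⇒ ⊢ r₁ :+ r₂ :+ r₄ :+ (n :- j) := s :- (F₁ :+ F₂ :+ F₄) :* n :+ (n :- j))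
              r₁ r₂ r₄ F₁ F₂ F₄ n j (j * (+ 1 - n - Q * n))
              (trans (cong (j *_) (sym a-sum)) (trans (lin 4 (λ j a b c → ⊢ j :* (a :+ b :+ c) := j :* a :+ j :* b :+ j :* c) j a₁ a₂ a₄) (cong₂ _+_ (cong₂ _+_ f₁ f₂) f₄))))
          (lin 4 (λ j n Q F → ⊢ j :* (# 1 :- n :- Q :* n) :- F :* n :+ (n :- j) := (# 1 :- j :- j :* Q :- F) :* n) j n Q (F₁ + F₂ + F₄))
        t>0 : + 0 < t
        t>0 = cancel< (+ 0) t n>0 (lin 6 (λ r₁ r₂ r₄ n j tn → r₁ :+ r₂ :+ r₄ :+ (n :- j) := tn ⇒ # 0 :< r₁ ⇒ # 0 :< r₂ ⇒ # 0 :< r₄ ⇒ j :< n ⇒ ⊢ # 0 :* n :< tn) r₁ r₂ r₄ n j (t * n) r-sum pos₁ pos₂ pos₄ j<n)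
        t<4 : t < + 4
        t<4 = cancel< t (+ 4) n>0 (lin 6 (λ r₁ r₂ r₄ n j tn → r₁ :+ r₂ :+ r₄ :+ (n :- j) := tn ⇒ r₁ :< n ⇒ r₂ :< n ⇒ r₄ :< n ⇒ # 1 :≤ j ⇒ ⊢ tn :< # 4 :* n) r₁ r₂ r₄ n j (t * n) r-sum u₁ u₂ u₄ 1≤j)
        j₃ : j * W₃ ⟨ z₃ ⟩ ≡ j
        j₃ = trans (cong (j *_) z₃≡) (ℤₚ.*-identityʳ j)
        lo : ∀ {x w} r G → x ≡ - j * w + - G * n → j * w ≡ - (r + G * n) → x ≡ r
        lo {x} {w} r G = lin 6 (λ x w r G n j → x := (:- j) :* w :+ (:- G) :* n ⇒ j :* w := :- (r :+ G :* n) ⇒ ⊢ x := r) x w r G n j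
        hi : ∀ {x w} r G → x ≡ j * w + (G + + 1) * n → j * w ≡ - (r + G * n) → x ≡ n - r
        hi {x} {w} r G = lin 6 (λ x w r G n j → x := j :* w :+ (G :+ # 1) :* n ⇒ j :* w := :- (r :+ G :* n) ⇒ ⊢ x := n :- r) x w r G n j
        in′ : ∀ {x r} → x ≡ r → + 0 < r → r < n → + 0 ≤ x × x ≢ n
        in′ refl l u = ℤₚ.<⇒≤ l , λ h → ℤₚ.<-irrefl h u
        comp : ∀ {r} → + 0 < r → r < n → + 0 < n - r × n - r < n
        comp {r} l u = lin 2 (λ r n → r :< n ⇒ ⊢ # 0 :< n :- r) r n u , lin 2 (λ r n → # 0 :< r ⇒ ⊢ n :- r :< n) r n l
        excl : ∀ z {x₁ x₂ x₃ x₄} → W₁ ⟨ z ⟩ ≡ x₁ → W₂ ⟨ z ⟩ ≡ x₂ → W₃ ⟨ z ⟩ ≡ x₃ → W₄ ⟨ z ⟩ ≡ x₄ → + 0 < x₁ × x₁ < n → + 0 < x₂ × x₂ < n → + 0 < x₃ × x₃ < n → + 0 < x₄ × x₄ < n → ⊥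
        excl z h₁ h₂ h₃ h₄ (l₁ , u₁) (l₂ , u₂) (l₃ , u₃) (l₄ , u₄) = emp z
          (proj₁ (in′ h₁ l₁ u₁) , proj₁ (in′ h₂ l₂ u₂) , proj₁ (in′ h₃ l₃ u₃) , proj₁ (in′ h₄ l₄ u₄))
          (proj₂ (in′ h₁ l₁ u₁) , proj₂ (in′ h₂ l₂ u₂) , proj₂ (in′ h₃ l₃ u₃) , proj₂ (in′ h₄ l₄ u₄))
        j>0 : + 0 < j
        j>0 = lin 1 (λ j → # 1 :≤ j ⇒ ⊢ # 0 :< j) j 1≤j
        t≡2 : t ≡ + 1 ⊎ t ≡ + 2 ⊎ t ≡ + 3 → t ≡ + 2
        t≡2 (inj₂ (inj₁ h)) = h
        t≡2 (inj₁ h) = ⊥-elim (excl point (lo r₁ (F₁ + j * q₁) at₁ g₁) (lo r₂ (F₂ + j * q₂) at₂ g₂)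
            (lin 4 (λ x w n j → x := (:- j) :* w :+ # 1 :* n ⇒ j :* w := j ⇒ ⊢ x := n :- j) (W₃ ⟨ point ⟩) (W₃ ⟨ z₃ ⟩) n j at₃ j₃) (lo r₄ (F₄ + j * q₄) at₄ g₄)
            (pos₁ , u₁) (pos₂ , u₂) (comp j>0 j<n) (pos₄ , u₄))
          where
          open Moved (move T (- j) (- (F₁ + j * q₁)) (- (F₂ + j * q₂)) (+ 1) (- (F₄ + j * q₄)) z₃
            (trans (lin 7 (λ j F₁ F₂ F₄ q₁ q₂ q₄ → ⊢ :- j :+ :- (F₁ :+ j :* q₁) :+ :- (F₂ :+ j :* q₂) :+ # 1 :+ :- (F₄ :+ j :* q₄) := # 1 :- j :- j :* (q₁ :+ q₂ :+ q₄) :- (F₁ :+ F₂ :+ F₄)) j F₁ F₂ F₄ q₁ q₂ q₄) h))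
        t≡2 (inj₂ (inj₂ h)) = ⊥-elim (excl point (hi r₁ (F₁ + j * q₁) at₁ g₁) (hi r₂ (F₂ + j * q₂) at₂ g₂)
            (lin 4 (λ x w n j → x := j :* w :+ # 0 :* n ⇒ j :* w := j ⇒ ⊢ x := j) (W₃ ⟨ point ⟩) (W₃ ⟨ z₃ ⟩) n j at₃ j₃) (hi r₄ (F₄ + j * q₄) at₄ g₄)
            (comp pos₁ u₁) (comp pos₂ u₂) (j>0 , j<n) (comp pos₄ u₄))
          where
          open Moved (move T j (F₁ + j * q₁ + + 1) (F₂ + j * q₂ + + 1) (+ 0) (F₄ + j * q₄ + + 1) z₃
            (lin 7 (λ j F₁ F₂ F₄ q₁ q₂ q₄ → # 1 :- j :- j :* (q₁ :+ q₂ :+ q₄) :- (F₁ :+ F₂ :+ F₄) := # 3 ⇒ ⊢ j :+ (F₁ :+ j :* q₁ :+ # 1) :+ (F₂ :+ j :* q₂ :+ # 1) :+ # 0 :+ (F₄ :+ j :* q₄ :+ # 1) := # 1) j F₁ F₂ F₄ q₁ q₂ q₄ h))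

      -- The numbers r₁, r₂, r₄ and n - j lie strictly between 0 and n and add up to t n with 0 < t
      -- < 4. For t = 1 they are the coordinates of a lattice point inside the tetrahedron, and for
      -- t = 3 their complements are; so t = 2.
      residue-sum : r₁ + r₂ + r₄ ≡ n + j
      residue-sum = lin 6 (λ r₁ r₂ r₄ n j tn → r₁ :+ r₂ :+ r₄ :+ (n :- j) := tn ⇒ tn := # 2 :* n ⇒ ⊢ r₁ :+ r₂ :+ r₄ := n :+ j) r₁ r₂ r₄ n j (t * n) r-sum (cong (_* n) (t≡2 (small₄ t t>0 t<4)))

    module _ (n>1 : + 1 < n) (l₁ : + 0 ≤ a₁) (l₂ : + 0 ≤ a₂) (l₄ : + 0 ≤ a₄) (u₁ : a₁ < n) (u₂ : a₂ < n) (u₄ : a₄ < n) where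

      private
        one : ∀ a → + 1 * a ≡ a + + 0 * n
        one a = lin 2 (λ a n → ⊢ # 1 :* a := a :+ # 0 :* n) a n
        le : + 1 ≤ + 1
        le = ℤₚ.≤-refl

      apos₁ : + 0 < a₁
      apos₁ = pos₁ (+ 1) le n>1 (+ 0) (+ 0) (+ 0) a₁ a₂ a₄ (one a₁) (one a₂) (one a₄) l₁ l₂ l₄ u₁ u₂ u₄
      apos₂ : + 0 < a₂
      apos₂ = pos₂ (+ 1) le n>1 (+ 0) (+ 0) (+ 0) a₁ a₂ a₄ (one a₁) (one a₂) (one a₄) l₁ l₂ l₄ u₁ u₂ u₄
      apos₄ : + 0 < a₄
      apos₄ = pos₄ (+ 1) le n>1 (+ 0) (+ 0) (+ 0) a₁ a₂ a₄ (one a₁) (one a₂) (one a₄) l₁ l₂ l₄ u₁ u₂ u₄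

      gen-sum : a₁ + a₂ + a₄ ≡ n + + 1
      gen-sum = residue-sum (+ 1) le n>1 (+ 0) (+ 0) (+ 0) a₁ a₂ a₄ (one a₁) (one a₂) (one a₄) l₁ l₂ l₄ u₁ u₂ u₄

      -- From j (a₁ + a₂ + a₄) = j (n + 1), where the residues take up n + j, the quotients add up
      -- to j - 1.
      floors : Floors n a₁ a₂ a₄
      floors j 1≤j j<n = go (divide n n>0 (j * a₁)) (divide n n>0 (j * a₂)) (divide n n>0 (j * a₄))
        where
        go : (∃ λ q → ∃ λ r → j * a₁ ≡ r + q * n × + 0 ≤ r × r < n) → (∃ λ q → ∃ λ r → j * a₂ ≡ r + q * n × + 0 ≤ r × r < n) → (∃ λ q → ∃ λ r → j * a₄ ≡ r + q * n × + 0 ≤ r × r < n) →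
          ∃ λ A → ∃ λ B → ∃ λ C → Floor n (j * a₁) A × Floor n (j * a₂) B × Floor n (j * a₄) C × A + B + C ≡ j - + 1
        go (F₁ , r₁ , f₁ , m₁ , v₁) (F₂ , r₂ , f₂ , m₂ , v₂) (F₄ , r₄ , f₄ , m₄ , v₄) = F₁ , F₂ , F₄ ,
            fl F₁ f₁ (pos₁ j 1≤j j<n F₁ F₂ F₄ r₁ r₂ r₄ f₁ f₂ f₄ m₁ m₂ m₄ v₁ v₂ v₄) v₁ , fl F₂ f₂ (pos₂ j 1≤j j<n F₁ F₂ F₄ r₁ r₂ r₄ f₁ f₂ f₄ m₁ m₂ m₄ v₁ v₂ v₄) v₂ , fl F₄ f₄ (pos₄ j 1≤j j<n F₁ F₂ F₄ r₁ r₂ r₄ f₁ f₂ f₄ m₁ m₂ m₄ v₁ v₂ v₄) v₄ ,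
            cancel≡ (F₁ + F₂ + F₄) (j - + 1) n>0 (lin 9 (λ F₁ F₂ F₄ r₁ r₂ r₄ n j s → s := r₁ :+ F₁ :* n :+ (r₂ :+ F₂ :* n) :+ (r₄ :+ F₄ :* n) ⇒ r₁ :+ r₂ :+ r₄ := n :+ j ⇒ s := j :* n :+ j :* # 1 ⇒ ⊢ (F₁ :+ F₂ :+ F₄) :* n := (j :- # 1) :* n)
              F₁ F₂ F₄ r₁ r₂ r₄ n j (j * (a₁ + a₂ + a₄)) (trans (lin 4 (λ j a b c → ⊢ j :* (a :+ b :+ c) := j :* a :+ j :* b :+ j :* c) j a₁ a₂ a₄) (cong₂ _+_ (cong₂ _+_ f₁ f₂) f₄))
              (residue-sum j 1≤j j<n F₁ F₂ F₄ r₁ r₂ r₄ f₁ f₂ f₄ m₁ m₂ m₄ v₁ v₂ v₄) (trans (cong (j *_) gen-sum) (lin 2 (λ j n → ⊢ j :* (n :+ # 1) := j :* n :+ j :* # 1) j n)))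
          where
          fl : ∀ {y r} F → y ≡ r + F * n → + 0 < r → r < n → Floor n y F
          fl {y} {r} F e l u = lin 4 (λ y r F n → y := r :+ F :* n ⇒ # 0 :< r ⇒ ⊢ F :* n :< y) y r F n e l , lin 4 (λ y r F n → y := r :+ F :* n ⇒ r :< n ⇒ ⊢ y :< (F :+ # 1) :* n) y r F n e u

-- Empty tetrahedra have White's normal form

module _ {A : Z3 → Set} (C : Config A) where

  record Normalised (n : ℤ) : Set where
    field
      {p′ q′ r′ s′} : Z3
      white-tet : WhiteTet A p′ q′ r′ s′
      same-n : WhiteTet.n white-tet ≡ n

  -- One of a₁, a₂ and a₄ is 1 by White's theorem; the vertex to which it belongs is moved to the
  -- last place.
  normalise : ∀ {p q r s} (T : Tet p q r s) → Raw T → Empty T → A p → A q → A r → A s → Normalised (Tet.n T)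
  normalise {p} {q} {r} {s} T raw emp Ap Aq Ar As = withGenerator (generator₃ T raw emp)
    where
    open Tet T
    withGenerator : (∃ λ z → W₃ ⟨ z ⟩ ≡ + 1) → Normalised n
    withGenerator (z₃ , z₃≡) = withResidues (divide n n>0 (- W₁ ⟨ z₃ ⟩)) (divide n n>0 (- W₂ ⟨ z₃ ⟩)) (divide n n>0 (- W₄ ⟨ z₃ ⟩))
      where
      n>1 : + 1 < n
      n>1 = lin 1 (λ n → # 3 :≤ n ⇒ ⊢ # 1 :< n) n (Cyclic.n≥3′ T emp z₃ z₃≡ C Ap Aq Ar As)
      flipSign : ∀ w {x} → - w ≡ x → w ≡ - x
      flipSign w refl = sym (ℤₚ.neg-involutive w)
      withResidues : (∃ λ q → ∃ λ r → - W₁ ⟨ z₃ ⟩ ≡ r + q * n × + 0 ≤ r × r < n) → (∃ λ q → ∃ λ r → - W₂ ⟨ z₃ ⟩ ≡ r + q * n × + 0 ≤ r × r < n) →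
        (∃ λ q → ∃ λ r → - W₄ ⟨ z₃ ⟩ ≡ r + q * n × + 0 ≤ r × r < n) → Normalised n
      withResidues (q₁ , a₁ , e₁ , l₁ , u₁) (q₂ , a₂ , e₂ , l₂ , u₂) (q₄ , a₄ , e₄ , l₄ , u₄) = choose (a₁ ℤₚ.≟ + 1) (a₂ ℤₚ.≟ + 1) (a₄ ℤₚ.≟ + 1)
        where
        open Cyclic T emp z₃ z₃≡
        b₁ = apos₁ q₁ q₂ q₄ a₁ a₂ a₄ e₁ e₂ e₄ n>1 l₁ l₂ l₄ u₁ u₂ u₄
        b₂ = apos₂ q₁ q₂ q₄ a₁ a₂ a₄ e₁ e₂ e₄ n>1 l₁ l₂ l₄ u₁ u₂ u₄
        b₄ = apos₄ q₁ q₂ q₄ a₁ a₂ a₄ e₁ e₂ e₄ n>1 l₁ l₂ l₄ u₁ u₂ u₄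
        sum = gen-sum q₁ q₂ q₄ a₁ a₂ a₄ e₁ e₂ e₄ n>1 l₁ l₂ l₄ u₁ u₂ u₄
        two : ∀ a → + 0 < a → a ≢ + 1 → + 2 ≤ a
        two a l h = lin 1 (λ a → # 1 :< a ⇒ ⊢ # 2 :≤ a) a (ℤₚ.≤∧≢⇒< (lin 1 (λ a → # 0 :< a ⇒ ⊢ # 1 :≤ a) a l) (λ e → h (sym e)))
        choose : Dec (a₁ ≡ + 1) → Dec (a₂ ≡ + 1) → Dec (a₄ ≡ + 1) → Normalised n
        choose _ _ (yes refl) = record { white-tet = Cyclic.whiteTet T emp z₃ z₃≡ C Ap Aq Ar As q₁ q₂ q₄ a₁ a₂ (flipSign _ e₁) (flipSign _ e₂) (flipSign _ e₄) b₁ u₁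
          (lin 3 (λ a b n → a :+ b :+ # 1 := n :+ # 1 ⇒ ⊢ a :+ b := n) a₁ a₂ n sum) ; same-n = refl }
        choose (yes refl) _ (no _) = record { white-tet = Cyclic.whiteTet (t14 T) (empty34 (sw23 (sw12 (sw23 (sw34 T)))) (empty23 (sw12 (sw23 (sw34 T))) (empty12 (sw23 (sw34 T)) (empty23 (sw34 T) (empty34 T emp))))) z₃ z₃≡ C As Aq Ar Ap q₄ q₂ q₁ a₄ a₂
          (flipSign _ e₄) (flipSign _ e₂) (flipSign _ e₁) b₄ u₄ (lin 3 (λ a b n → # 1 :+ b :+ a := n :+ # 1 ⇒ ⊢ a :+ b := n) a₄ a₂ n sum) ; same-n = refl }
        choose (no _) (yes refl) (no _) = record { white-tet = Cyclic.whiteTet (t24 T) (empty34 (sw23 (sw34 T)) (empty23 (sw34 T) (empty34 T emp))) z₃ z₃≡ C Ap As Ar Aq q₁ q₄ q₂ a₁ a₄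
          (flipSign _ e₁) (flipSign _ e₄) (flipSign _ e₂) b₁ u₁ (lin 3 (λ a b n → a :+ # 1 :+ b := n :+ # 1 ⇒ ⊢ a :+ b := n) a₁ a₄ n sum) ; same-n = refl }
        choose (no h₁) (no h₂) (no h₄) = ⊥-elim (whiteTheorem n a₁ a₂ a₄ sum (two a₁ b₁ h₁) (two a₂ b₂ h₂) (two a₄ b₄ h₄) (floors q₁ q₂ q₄ a₁ a₂ a₄ e₁ e₂ e₄ n>1 l₁ l₂ l₄ u₁ u₂ u₄))

-- Exhaustive search in a box

searchℤ : ∀ {F : Set} {G : ℤ → Set} M → (∀ x → F ⊎ G x) → F ⊎ (∀ x → ∣ x ∣ ℕ.≤ M → G x)
searchℤ zero f with f (+ 0)
... | inj₁ x = inj₁ x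
... | inj₂ g = inj₂ λ { (+ 0) _ → g ; (+ suc _) () ; (-[1+ _ ]) () }
searchℤ {F} {G} (suc M) f with f (+ suc M) | f -[1+ M ] | searchℤ M f
... | inj₁ x | _ | _ = inj₁ x
... | inj₂ _ | inj₁ x | _ = inj₁ x
... | inj₂ _ | inj₂ _ | inj₁ x = inj₁ x
... | inj₂ g₁ | inj₂ g₂ | inj₂ g = inj₂ all
  where
  all : ∀ x → ∣ x ∣ ℕ.≤ suc M → G x
  all (+ k) h with k ℕₚ.≟ suc M
  ... | yes refl = g₁
  ... | no k≢ = g (+ k) (ℕ.s≤s⁻¹ (ℕₚ.≤∧≢⇒< h k≢))
  all (-[1+ k ]) h with k ℕₚ.≟ M
  ... | yes refl = g₂
  ... | no k≢ = g -[1+ k ] (ℕₚ.≤∧≢⇒< (ℕ.s≤s⁻¹ h) k≢)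

search : ∀ {F : Set} {G : Z3 → Set} M → (∀ z → F ⊎ G z) → F ⊎ (∀ z → Bounded M z → G z)
search {F} {G} M f with searchℤ {F} {λ x → ∀ y → ∣ y ∣ ℕ.≤ M → ∀ z → ∣ z ∣ ℕ.≤ M → G (pt x y z)} M
    (λ x → searchℤ M (λ y → searchℤ M (λ z → f (pt x y z))))
... | inj₁ x = inj₁ x
... | inj₂ g = inj₂ λ { (x ∷ y ∷ z ∷ []) (hx , hy , hz) → g x hx y hy z hz }

-- Volumes of tetrahedra in a bounded region

volumeBound : ℕ → ℕ
volumeBound M = K ℕ.* (K ℕ.* K ℕ.+ K ℕ.* K) ℕ.+ K ℕ.* (K ℕ.* K ℕ.+ K ℕ.* K) ℕ.+ K ℕ.* (K ℕ.* K ℕ.+ K ℕ.* K)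
  where K = M ℕ.+ M

private
  -- A record so that the integer can be inferred.
  record Abs≤ (x : ℤ) (X : ℕ) : Set where
    constructor abs≤
    field get : ∣ x ∣ ℕ.≤ X

vol≤ : ∀ M p q r s → Bounded M p → Bounded M q → Bounded M r → Bounded M s → vol p q r s ℕ.≤ volumeBound M
vol≤ M (a ∷ b ∷ c ∷ []) (d ∷ e ∷ f ∷ []) (g ∷ h ∷ i ∷ []) (j ∷ k ∷ l ∷ []) (a′ , b′ , c′) (d′ , e′ , f′) (g′ , h′ , i′) (j′ , k′ , l′) =
  Abs≤.get (plus
    (minus (times (minus (abs≤ {a} a′) (abs≤ {j} j′)) (minus (times (minus (abs≤ {e} e′) (abs≤ {k} k′)) (minus (abs≤ {i} i′) (abs≤ {l} l′))) (times (minus (abs≤ {f} f′) (abs≤ {l} l′)) (minus (abs≤ {h} h′) (abs≤ {k} k′)))))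
           (times (minus (abs≤ {b} b′) (abs≤ {k} k′)) (minus (times (minus (abs≤ {d} d′) (abs≤ {j} j′)) (minus (abs≤ {i} i′) (abs≤ {l} l′))) (times (minus (abs≤ {f} f′) (abs≤ {l} l′)) (minus (abs≤ {g} g′) (abs≤ {j} j′))))))
    (times (minus (abs≤ {c} c′) (abs≤ {l} l′)) (minus (times (minus (abs≤ {d} d′) (abs≤ {j} j′)) (minus (abs≤ {h} h′) (abs≤ {k} k′))) (times (minus (abs≤ {e} e′) (abs≤ {k} k′)) (minus (abs≤ {g} g′) (abs≤ {j} j′))))))
  where
  plus : ∀ {x y X Y} → Abs≤ x X → Abs≤ y Y → Abs≤ (x + y) (X ℕ.+ Y)
  plus {x} {y} (abs≤ hx) (abs≤ hy) = abs≤ (ℕₚ.≤-trans (ℤₚ.∣i+j∣≤∣i∣+∣j∣ x y) (ℕₚ.+-mono-≤ hx hy))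
  minus : ∀ {x y X Y} → Abs≤ x X → Abs≤ y Y → Abs≤ (x - y) (X ℕ.+ Y)
  minus {x} {y} (abs≤ hx) (abs≤ hy) = abs≤ (ℕₚ.≤-trans (ℤₚ.∣i-j∣≤∣i∣+∣j∣ x y) (ℕₚ.+-mono-≤ hx hy))
  times : ∀ {x y X Y} → Abs≤ x X → Abs≤ y Y → Abs≤ (x * y) (X ℕ.* Y)
  times {x} {y} {X} {Y} (abs≤ hx) (abs≤ hy) = abs≤ (subst (ℕ._≤ X ℕ.* Y) (sym (ℤₚ.abs-* x y)) (ℕₚ.*-mono-≤ hx hy))

-- Inside the tetrahedron W₁ + W₂ is 0 or n. If it is 0, then W₁ = 0, so W₃ is a multiple of n and
-- the point is r or s; the other case is symmetric. Emptiness is therefore recovered from the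
-- normal form whenever vertices are replaced.
whiteEmpty : ∀ {A p q r s} (T : WhiteTet A p q r s) → Empty (WhiteTet.tet T)
whiteEmpty T z (g₁ , g₂ , g₃ , g₄) (h₁ , h₂ , h₃ , h₄) = go (cyc₁₂ z)
  where
  open WhiteTet T
  a = W₁ ⟨ z ⟩
  b = W₂ ⟨ z ⟩
  c = W₃ ⟨ z ⟩
  d = W₄ ⟨ z ⟩
  ends : ∀ x y → + 0 ≤ x → + 0 ≤ y → x + y ≡ n → x ≢ n → y ≢ n → n ∣ᶻ x → ⊥
  ends x y l l′ e u v (m , f) = lin 1 (λ m → # 0 :< m ⇒ m :< # 1 ⇒ ⊢ :⊥) m
    (cancel< (+ 0) m n>0 (lin 3 (λ x m n → # 0 :< x ⇒ x := m :* n ⇒ ⊢ # 0 :* n :< m :* n) x m n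
      (ℤₚ.≤∧≢⇒< l λ h → v (trans (sym (ℤₚ.+-identityˡ y)) (trans (cong (_+ y) h) e))) f))
    (cancel< m (+ 1) n>0 (lin 3 (λ x m n → x :< n ⇒ x := m :* n ⇒ ⊢ m :* n :< # 1 :* n) x m n
      (ℤₚ.≤∧≢⇒< (lin 3 (λ x y n → # 0 :≤ y ⇒ x :+ y := n ⇒ ⊢ x :≤ n) x y n l′ e) u) f))
  go : n ∣ᶻ (a + b) → ⊥
  go (k , e) = cases (small₃ k (cancel≤ (+ 0) k n>0 (lin 4 (λ a b k n → # 0 :≤ a ⇒ # 0 :≤ b ⇒ a :+ b := k :* n ⇒ ⊢ # 0 :* n :≤ k :* n) a b k n g₁ g₂ e))
      (lin 1 (λ k → k :≤ # 1 ⇒ ⊢ k :< # 3) k k≤1))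
    where
    k≤1 : k ≤ + 1
    k≤1 = cancel≤ k (+ 1) n>0 (lin 6 (λ a b c d k n → a :+ b :+ c :+ d := n ⇒ # 0 :≤ c ⇒ # 0 :≤ d ⇒ a :+ b := k :* n ⇒ ⊢ k :* n :≤ # 1 :* n) a b c d k n (sumW z) g₃ g₄ e)
    cases : k ≡ + 0 ⊎ k ≡ + 1 ⊎ k ≡ + 2 → ⊥
    cases (inj₁ refl) = ends c d g₃ g₄ (lin 5 (λ a b c d n → a :+ b :+ c :+ d := n ⇒ a :+ b := # 0 :* n ⇒ ⊢ c :+ d := n) a b c d n (sumW z) e) h₃ h₄
      (subst (n ∣ᶻ_) (trans (cong (λ x → c - ρ * x) (lin 3 (λ a b n → # 0 :≤ a ⇒ # 0 :≤ b ⇒ a :+ b := # 0 :* n ⇒ ⊢ a := # 0) a b n g₁ g₂ e)) (lin 2 (λ c ρ → ⊢ c :- ρ :* # 0 := c) c ρ)) (cycρ z))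
    cases (inj₂ (inj₁ refl)) = ends a b g₁ g₂ (trans e (ℤₚ.*-identityˡ n)) h₁ h₂
      (subst (n ∣ᶻ_) (trans (cong (λ x → a - σ * x) (lin 5 (λ a b c d n → a :+ b :+ c :+ d := n ⇒ # 0 :≤ c ⇒ # 0 :≤ d ⇒ a :+ b := # 1 :* n ⇒ ⊢ c := # 0) a b c d n (sumW z) g₃ g₄ e)) (lin 2 (λ c ρ → ⊢ c :- ρ :* # 0 := c) a σ)) (cyc z))
    cases (inj₂ (inj₂ refl)) = lin 0 (# 2 :≤ # 1 ⇒ ⊢ :⊥) k≤1

-- Up to a positive factor, w is a combination of v and the vertices of T with positive weight at v.
record Between {p q r s} (T : Tet p q r s) (v w : Z3) : Set where
  open Tet T
  field
    K τ ρ₁ ρ₂ ρ₃ ρ₄ : ℤ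
    K>0 : + 0 < K
    τ>0 : + 0 < τ
    ρ₁≥0 : + 0 ≤ ρ₁
    ρ₂≥0 : + 0 ≤ ρ₂
    ρ₃≥0 : + 0 ≤ ρ₃
    ρ₄≥0 : + 0 ≤ ρ₄
    eq₁ : K * W₁ ⟨ w ⟩ ≡ τ * W₁ ⟨ v ⟩ + ρ₁
    eq₂ : K * W₂ ⟨ w ⟩ ≡ τ * W₂ ⟨ v ⟩ + ρ₂
    eq₃ : K * W₃ ⟨ w ⟩ ≡ τ * W₃ ⟨ v ⟩ + ρ₃
    eq₄ : K * W₄ ⟨ w ⟩ ≡ τ * W₄ ⟨ v ⟩ + ρ₄

between-refl : ∀ {p q r s} (T : Tet p q r s) v → Between T v v
between-refl T v = record { K = + 1 ; τ = + 1 ; ρ₁ = + 0 ; ρ₂ = + 0 ; ρ₃ = + 0 ; ρ₄ = + 0 ; K>0 = one ; τ>0 = one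
  ; ρ₁≥0 = ℤₚ.≤-refl ; ρ₂≥0 = ℤₚ.≤-refl ; ρ₃≥0 = ℤₚ.≤-refl ; ρ₄≥0 = ℤₚ.≤-refl
  ; eq₁ = sym (ℤₚ.+-identityʳ _) ; eq₂ = sym (ℤₚ.+-identityʳ _) ; eq₃ = sym (ℤₚ.+-identityʳ _) ; eq₄ = sym (ℤₚ.+-identityʳ _) }
  where one = lin 0 (⊢ # 0 :< # 1)

between-trans : ∀ {p q r s} (T : Tet p q r s) {u v w} → Between T u v → Between T v w → Between T u w
between-trans T {u} {v} {w} B B′ = record
  { K = B.K * B′.K ; τ = B.τ * B′.τ ; K>0 = mul>0 B.K>0 B′.K>0 ; τ>0 = mul>0 B.τ>0 B′.τ>0
  ; ρ₁ = B′.τ * B.ρ₁ + B.K * B′.ρ₁ ; ρ₂ = B′.τ * B.ρ₂ + B.K * B′.ρ₂ ; ρ₃ = B′.τ * B.ρ₃ + B.K * B′.ρ₃ ; ρ₄ = B′.τ * B.ρ₄ + B.K * B′.ρ₄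
  ; ρ₁≥0 = pos B.ρ₁≥0 B′.ρ₁≥0 ; ρ₂≥0 = pos B.ρ₂≥0 B′.ρ₂≥0 ; ρ₃≥0 = pos B.ρ₃≥0 B′.ρ₃≥0 ; ρ₄≥0 = pos B.ρ₄≥0 B′.ρ₄≥0
  ; eq₁ = comp (W₁ ⟨ u ⟩) (W₁ ⟨ v ⟩) (W₁ ⟨ w ⟩) B.ρ₁ B′.ρ₁ B.eq₁ B′.eq₁ ; eq₂ = comp (W₂ ⟨ u ⟩) (W₂ ⟨ v ⟩) (W₂ ⟨ w ⟩) B.ρ₂ B′.ρ₂ B.eq₂ B′.eq₂
  ; eq₃ = comp (W₃ ⟨ u ⟩) (W₃ ⟨ v ⟩) (W₃ ⟨ w ⟩) B.ρ₃ B′.ρ₃ B.eq₃ B′.eq₃ ; eq₄ = comp (W₄ ⟨ u ⟩) (W₄ ⟨ v ⟩) (W₄ ⟨ w ⟩) B.ρ₄ B′.ρ₄ B.eq₄ B′.eq₄ }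
  where
  open Tet T
  module B = Between B
  module B′ = Between B′
  pos : ∀ {x y} → + 0 ≤ x → + 0 ≤ y → + 0 ≤ B′.τ * x + B.K * y
  pos hx hy = ℤₚ.+-mono-≤ (mul≥0 (ℤₚ.<⇒≤ B′.τ>0) hx) (mul≥0 (ℤₚ.<⇒≤ B.K>0) hy)
  comp : ∀ x y z r r′ → B.K * y ≡ B.τ * x + r → B′.K * z ≡ B′.τ * y + r′ → B.K * B′.K * z ≡ B.τ * B′.τ * x + (B′.τ * r + B.K * r′)
  comp x y z r r′ e e′ = trans (trans (ℤₚ.*-assoc B.K B′.K z) (cong (B.K *_) e′))
    (trans (lin 5 (λ K τ′ y r′ x → ⊢ K :* (τ′ :* y :+ r′) := τ′ :* (K :* y) :+ K :* r′) B.K B′.τ y r′ x)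
      (trans (cong (λ t → B′.τ * t + B.K * r′) e) (lin 6 (λ K τ τ′ x r r′ → ⊢ τ′ :* (τ :* x :+ r) :+ K :* r′ := τ :* τ′ :* x :+ (τ′ :* r :+ K :* r′)) B.K B.τ B′.τ x r r′)))

-- Distance to a tetrahedron and the descent towards it

size : ∀ {p q r s} → Tet p q r s → Z3 → ℕ
size T z = let open Tet T in ∣ W₁ ⟨ z ⟩ ∣ ℕ.+ ∣ W₂ ⟨ z ⟩ ∣ ℕ.+ ∣ W₃ ⟨ z ⟩ ∣ ℕ.+ ∣ W₄ ⟨ z ⟩ ∣

x≤∣x∣ : ∀ x → x ≤ + ∣ x ∣
x≤∣x∣ (+ _) = ℤₚ.≤-refl
x≤∣x∣ (-[1+ _ ]) = ℤ.-≤+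

-x≤∣x∣ : ∀ x → - x ≤ + ∣ x ∣
-x≤∣x∣ x = subst (λ k → - x ≤ + k) (ℤₚ.∣-i∣≡∣i∣ x) (x≤∣x∣ (- x))

∣x∣≤ : ∀ x {b} → x ≤ b → - x ≤ b → + ∣ x ∣ ≤ b
∣x∣≤ (+ _) h _ = h
∣x∣≤ (-[1+ _ ]) _ h = h

inside? : ∀ {p q r s} (T : Tet p q r s) z → Dec (Inside T z)
inside? T z = (+ 0 ℤₚ.≤? W₁ ⟨ z ⟩) ×-dec (+ 0 ℤₚ.≤? W₂ ⟨ z ⟩) ×-dec (+ 0 ℤₚ.≤? W₃ ⟨ z ⟩) ×-dec (+ 0 ℤₚ.≤? W₄ ⟨ z ⟩)
  where open Tet T

nonVertex? : ∀ {p q r s} (T : Tet p q r s) z → Dec (NonVertex T z)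
nonVertex? T z = ¬? (W₁ ⟨ z ⟩ ℤₚ.≟ n) ×-dec ¬? (W₂ ⟨ z ⟩ ℤₚ.≟ n) ×-dec ¬? (W₃ ⟨ z ⟩ ℤₚ.≟ n) ×-dec ¬? (W₄ ⟨ z ⟩ ℤₚ.≟ n)
  where open Tet T

-- The coordinates add up to n, and a negative one makes the sum of the absolute values larger.
size>n : ∀ {p q r s} (T : Tet p q r s) z → ¬ Inside T z → Tet.n T < + size T z
size>n T z out = by (+ 0 ℤₚ.≤? a) (+ 0 ℤₚ.≤? b) (+ 0 ℤₚ.≤? c) (+ 0 ℤₚ.≤? d)
  where
  open Tet T
  a = W₁ ⟨ z ⟩
  b = W₂ ⟨ z ⟩
  c = W₃ ⟨ z ⟩
  d = W₄ ⟨ z ⟩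
  grow : ∀ {x} → x < + 0 → x < + ∣ x ∣
  grow {x} h = lin 2 (λ x y → x :< # 0 ⇒ :- x :≤ y ⇒ ⊢ x :< y) x (+ ∣ x ∣) h (-x≤∣x∣ x)
  goal : a + b + c + d < + ∣ a ∣ + + ∣ b ∣ + + ∣ c ∣ + + ∣ d ∣ → n < + size T z
  goal h = subst (_< + size T z) (sumW z) h
  by : Dec (+ 0 ≤ a) → Dec (+ 0 ≤ b) → Dec (+ 0 ≤ c) → Dec (+ 0 ≤ d) → n < + size T z
  by (no h) _ _ _ = goal (ℤₚ.+-mono-<-≤ (ℤₚ.+-mono-<-≤ (ℤₚ.+-mono-<-≤ (grow (ℤₚ.≰⇒> h)) (x≤∣x∣ b)) (x≤∣x∣ c)) (x≤∣x∣ d))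
  by _ (no h) _ _ = goal (ℤₚ.+-mono-<-≤ (ℤₚ.+-mono-<-≤ (ℤₚ.+-mono-≤-< (x≤∣x∣ a) (grow (ℤₚ.≰⇒> h))) (x≤∣x∣ c)) (x≤∣x∣ d))
  by _ _ (no h) _ = goal (ℤₚ.+-mono-<-≤ (ℤₚ.+-mono-≤-< (ℤₚ.+-mono-≤ (x≤∣x∣ a) (x≤∣x∣ b)) (grow (ℤₚ.≰⇒> h))) (x≤∣x∣ d))
  by _ _ _ (no h) = goal (ℤₚ.+-mono-≤-< (ℤₚ.+-mono-≤ (ℤₚ.+-mono-≤ (x≤∣x∣ a) (x≤∣x∣ b)) (x≤∣x∣ c)) (grow (ℤₚ.≰⇒> h)))
  by (yes h₁) (yes h₂) (yes h₃) (yes h₄) = ⊥-elim (out (h₁ , h₂ , h₃ , h₄))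

module _ {A : Z3 → Set} (C : Config A) where
  open Config C

  inside-A : ∀ {p q r s} (T : Tet p q r s) → A p → A q → A r → A s → ∀ z → Inside T z → A z
  inside-A {p} {q} {r} {s} T Ap Aq Ar As z (h₁ , h₂ , h₃ , h₄) =
    conv _ n z ((h₁ , Ap) All.∷ (h₂ , Aq) All.∷ (h₃ , Ar) All.∷ (h₄ , As) All.∷ All.[])
      (trans (lin 4 (λ a b c d → ⊢ a :+ (b :+ (c :+ (d :+ # 0))) := a :+ b :+ c :+ d) (W₁ ⟨ z ⟩) (W₂ ⟨ z ⟩) (W₃ ⟨ z ⟩) (W₄ ⟨ z ⟩)) (sumW z)) n>0 (combW z)
    where open Tet T

  -- Lattice points inside belong to A and hence to the box of radius `M`, so a finite search
  -- decides emptiness although A itself is not assumed decidable.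
  emptyOrPoint : ∀ {p q r s} (T : Tet p q r s) → A p → A q → A r → A s → (∃ λ z → A z × Inside T z × NonVertex T z) ⊎ Empty T
  emptyOrPoint T Ap Aq Ar As = finish (search M look-at)
    where
    look-at : ∀ z → (∃ λ z → A z × Inside T z × NonVertex T z) ⊎ (Inside T z → ¬ NonVertex T z)
    look-at z with inside? T z | nonVertex? T z
    ... | yes i | yes v = inj₁ (z , inside-A T Ap Aq Ar As z i , i , v)
    ... | no ¬i | _ = inj₂ λ i _ → ¬i i
    ... | yes _ | no ¬v = inj₂ λ _ v → ¬v v
    finish : (∃ λ z → A z × Inside T z × NonVertex T z) ⊎ (∀ z → Bounded M z → Inside T z → ¬ NonVertex T z) →
             (∃ λ z → A z × Inside T z × NonVertex T z) ⊎ Empty T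
    finish (inj₁ x) = inj₁ x
    finish (inj₂ g) = inj₂ λ z i → g z (bound z (inside-A T Ap Aq Ar As z i)) i

  record EmptyTet : Set where
    field
      {p q r s} : Z3
      tet : Tet p q r s
      raw : Raw tet
      emp : Empty tet
      Ap : A p
      Aq : A q
      Ar : A r
      As : A s

  abs-pos : ∀ {x} k → + 0 < x → x < + suc k → ∣ x ∣ ℕ.≤ k × ∣ x ∣ ≢ 0
  abs-pos {+ suc m} k _ (+<+ (s≤s h)) = h , λ ()
  abs-pos {+ zero} k (+<+ ()) _

  -- Replacing a vertex by a further lattice point of the tetrahedron decreases the volume.
  toEmpty : ∀ k p q r s → A p → A q → A r → A s → vol p q r s ℕ.≤ k → vol p q r s ≢ 0 → EmptyTet
  toEmpty zero p q r s Ap Aq Ar As h v = ⊥-elim (v (ℕₚ.n≤0⇒n≡0 h))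
  toEmpty (suc k) p q r s Ap Aq Ar As h v = step (mk p q r s v)
    where
    step : Σ (Tet p q r s) Raw → EmptyTet
    step (T , raw) = go (emptyOrPoint T Ap Aq Ar As)
      where
      open Tet T
      go : (∃ λ z → A z × Inside T z × NonVertex T z) ⊎ Empty T → EmptyTet
      go (inj₂ e) = record { tet = T ; raw = raw ; emp = e ; Ap = Ap ; Aq = Aq ; Ar = Ar ; As = As }
      go (inj₁ (z , Az , (i₁ , i₂ , i₃ , i₄) , (v₁ , v₂ , v₃ , v₄))) = by (W₁ ⟨ z ⟩ ℤₚ.≟ + 0) (W₂ ⟨ z ⟩ ℤₚ.≟ + 0) (W₃ ⟨ z ⟩ ℤₚ.≟ + 0)
        where
        n≤ : n ≤ + suc k
        n≤ = subst (_≤ + suc k) (sym n≡vol) (+≤+ h)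
        a = W₁ ⟨ z ⟩
        b = W₂ ⟨ z ⟩
        c = W₃ ⟨ z ⟩
        d = W₄ ⟨ z ⟩
        smaller : ∀ x y → + 0 ≤ x → + 0 ≤ y → x + y ≡ n → x ≢ n → x ≢ + 0 → ∣ x ∣ ℕ.≤ k × ∣ x ∣ ≢ 0
        smaller x y hx hy e x≢n x≢0 = abs-pos k (ℤₚ.≤∧≢⇒< hx (λ h → x≢0 (sym h)))
          (ℤₚ.<-≤-trans (ℤₚ.≤∧≢⇒< (lin 3 (λ x y n → # 0 :≤ y ⇒ x :+ y := n ⇒ ⊢ x :≤ n) x y n hy e) x≢n) n≤)
        sum3 : ∀ {x y z} → + 0 ≤ x → + 0 ≤ y → + 0 ≤ z → + 0 ≤ x + y + z
        sum3 hx hy hz = ℤₚ.+-mono-≤ (ℤₚ.+-mono-≤ hx hy) hz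
        by : Dec (a ≡ + 0) → Dec (b ≡ + 0) → Dec (c ≡ + 0) → EmptyTet
        by (no a≢0) _ _ with smaller a (b + c + d) i₁ (sum3 i₂ i₃ i₄) (trans (lin 4 (λ a b c d → ⊢ a :+ (b :+ c :+ d) := a :+ b :+ c :+ d) a b c d) (sumW z)) v₁ a≢0
        ... | l , nz = toEmpty k z q r s Az Aq Ar As (subst (ℕ._≤ k) (vol₁ z) l) (λ e → nz (trans (vol₁ z) e))
        by (yes _) (no b≢0) _ with smaller b (a + c + d) i₂ (sum3 i₁ i₃ i₄) (trans (lin 4 (λ a b c d → ⊢ b :+ (a :+ c :+ d) := a :+ b :+ c :+ d) a b c d) (sumW z)) v₂ b≢0
        ... | l , nz = toEmpty k p z r s Ap Az Ar As (subst (ℕ._≤ k) (vol₂ z) l) (λ e → nz (trans (vol₂ z) e))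
        by (yes _) (yes _) (no c≢0) with smaller c (a + b + d) i₃ (sum3 i₁ i₂ i₄) (trans (lin 4 (λ a b c d → ⊢ c :+ (a :+ b :+ d) := a :+ b :+ c :+ d) a b c d) (sumW z)) v₃ c≢0
        ... | l , nz = toEmpty k p q z s Ap Aq Az As (subst (ℕ._≤ k) (vol₃ z) l) (λ e → nz (trans (vol₃ z) e))
        by (yes a0) (yes b0) (yes c0) = ⊥-elim (v₄ (lin 5 (λ a b c d n → a :+ b :+ c :+ d := n ⇒ a := # 0 ⇒ b := # 0 ⇒ c := # 0 ⇒ ⊢ d := n) a b c d n (sumW z) a0 b0 c0))

  BigFree : ℤ → Set
  BigFree n = (E : EmptyTet) → ¬ (n < Tet.n (EmptyTet.tet E))

  record Smaller {p q r s} (T : Tet p q r s) (v : Z3) : Set where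
    field
      point : Z3
      inA : A point
      outside : ¬ Inside T point
      between : Between T v point
      decreases : size T point ℕ.< size T v

  -- These signs of the coordinates of v mean that p lies in the tetrahedron v, q, r, s and not on
  -- its facet qrs; replacing p by v may then yield no point but p.
  Dominant : ℤ → ℤ → ℤ → ℤ → Set
  Dominant a b c d = + 0 < a × b ≤ + 0 × c ≤ + 0 × d ≤ + 0

  -- The tetrahedron v, q, r, s has volume |W₁(v)| > n and so contains a lattice point z that is not
  -- a vertex. As T is empty, z is not on the facet qrs, and z = p would make v dominant; so z is
  -- outside T. It is nearer, because `size` is convex, equals n at q, r and s, and exceeds n at v.
  reduce : ∀ {p q r s} (T : Tet p q r s) → Empty T → A p → A q → A r → A s → BigFree (Tet.n T) → ∀ v → A v → ¬ Inside T v →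
    let open Tet T in n < + ∣ W₁ ⟨ v ⟩ ∣ → ¬ Dominant (W₁ ⟨ v ⟩) (W₂ ⟨ v ⟩) (W₃ ⟨ v ⟩) (W₄ ⟨ v ⟩) → Smaller T v
  reduce {p} {q} {r} {s} T emp Ap Aq Ar As bf v Av out big ¬dom = step (mk v q r s nz)
    where
    open Tet T
    a = W₁ ⟨ v ⟩
    nz : vol v q r s ≢ 0
    nz e = ℤₚ.<-asym n>0 (subst (λ k → n < + k) (trans (vol₁ v) e) big)
    step : Σ (Tet v q r s) Raw → Smaller T v
    step (T′ , raw) = go (emptyOrPoint T′ Av Aq Ar As)
      where
      module T′ = Tet T′
      n′ = T′.n
      n′≡ : n′ ≡ + ∣ a ∣
      n′≡ = trans T′.n≡vol (cong +_ (sym (vol₁ v)))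
      go : (∃ λ z → A z × Inside T′ z × NonVertex T′ z) ⊎ Empty T′ → Smaller T v
      go (inj₂ e) = ⊥-elim (bf (record { tet = T′ ; raw = raw ; emp = e ; Ap = Av ; Aq = Aq ; Ar = Ar ; As = As }) (subst (n <_) (sym n′≡) big))
      go (inj₁ (z , Az , (i₁ , i₂ , i₃ , i₄) , (v₁ , v₂ , v₃ , v₄))) = record
        { point = z ; inA = Az ; outside = outside
        ; between = record { K = n′ ; τ = x₁ ; ρ₁ = + 0 ; ρ₂ = x₂ * n ; ρ₃ = x₃ * n ; ρ₄ = x₄ * n ; K>0 = T′.n>0 ; τ>0 = x₁>0
            ; ρ₁≥0 = ℤₚ.≤-refl ; ρ₂≥0 = mul≥0 i₂ (ℤₚ.<⇒≤ n>0) ; ρ₃≥0 = mul≥0 i₃ (ℤₚ.<⇒≤ n>0) ; ρ₄≥0 = mul≥0 i₄ (ℤₚ.<⇒≤ n>0)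
            ; eq₁ = eq₁ ; eq₂ = eq₂ ; eq₃ = eq₃ ; eq₄ = eq₄ }
        ; decreases = ℤₚ.drop‿+<+ (cancel< (+ size T z) (+ size T v) T′.n>0 lt) }
        where
        x₁ = T′.W₁ ⟨ z ⟩
        x₂ = T′.W₂ ⟨ z ⟩
        x₃ = T′.W₃ ⟨ z ⟩
        x₄ = T′.W₄ ⟨ z ⟩
        expand : ∀ f {y₂ y₃ y₄} → f ⟨ q ⟩ ≡ y₂ → f ⟨ r ⟩ ≡ y₃ → f ⟨ s ⟩ ≡ y₄ → n′ * f ⟨ z ⟩ ≡ x₁ * f ⟨ v ⟩ + x₂ * y₂ + x₃ * y₃ + x₄ * y₄
        expand f refl refl refl = bary T′ f z
        T₂ = sw12 T
        T₃ = sw12 (sw23 T)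
        T₄ = sw12 (sw23 (sw34 T))
        eq₁ : n′ * W₁ ⟨ z ⟩ ≡ x₁ * W₁ ⟨ v ⟩ + + 0
        eq₁ = trans (expand W₁ (W₁q T) (W₁r T) (W₁s T)) (lin 4 (λ w a b c → ⊢ w :+ a :* # 0 :+ b :* # 0 :+ c :* # 0 := w :+ # 0) (x₁ * W₁ ⟨ v ⟩) x₂ x₃ x₄)
        eq₂ : n′ * W₂ ⟨ z ⟩ ≡ x₁ * W₂ ⟨ v ⟩ + x₂ * n
        eq₂ = trans (expand W₂ (W₁p T₂) (W₁r T₂) (W₁s T₂)) (lin 5 (λ w a b c n → ⊢ w :+ a :* n :+ b :* # 0 :+ c :* # 0 := w :+ a :* n) (x₁ * W₂ ⟨ v ⟩) x₂ x₃ x₄ n)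
        eq₃ : n′ * W₃ ⟨ z ⟩ ≡ x₁ * W₃ ⟨ v ⟩ + x₃ * n
        eq₃ = trans (expand W₃ (W₁r T₃) (W₁p T₃) (W₁s T₃)) (lin 5 (λ w a b c n → ⊢ w :+ a :* # 0 :+ b :* n :+ c :* # 0 := w :+ b :* n) (x₁ * W₃ ⟨ v ⟩) x₂ x₃ x₄ n)
        eq₄ : n′ * W₄ ⟨ z ⟩ ≡ x₁ * W₄ ⟨ v ⟩ + x₄ * n
        eq₄ = trans (expand W₄ (W₁r T₄) (W₁s T₄) (W₁p T₄)) (lin 5 (λ w a b c n → ⊢ w :+ a :* # 0 :+ b :* # 0 :+ c :* n := w :+ c :* n) (x₁ * W₄ ⟨ v ⟩) x₂ x₃ x₄ n)
        nn : ∀ {w y} → n′ * w ≡ y → + 0 ≤ y → + 0 ≤ w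
        nn {w} {y} e h = cancel≤ (+ 0) w T′.n>0 (lin 3 (λ g w y → g :* w := y ⇒ # 0 :≤ y ⇒ ⊢ # 0 :* g :≤ w :* g) n′ w y e h)
        notvertex : ∀ {w y} x → n′ * w ≡ y + x * n → y ≡ + 0 → x ≢ n′ → w ≢ n
        notvertex {w} x e refl h refl = h (cancel≡ x n′ n>0 (sym (trans e (ℤₚ.+-identityˡ _))))
        x₁>0 : + 0 < x₁
        x₁>0 = ℤₚ.≤∧≢⇒< i₁ λ h → emp z
            (nn eq₁ (vanish (W₁ ⟨ v ⟩) (sym h) ℤₚ.≤-refl) , nn eq₂ (vanish (W₂ ⟨ v ⟩) (sym h) (mul≥0 i₂ (ℤₚ.<⇒≤ n>0))) , nn eq₃ (vanish (W₃ ⟨ v ⟩) (sym h) (mul≥0 i₃ (ℤₚ.<⇒≤ n>0))) , nn eq₄ (vanish (W₄ ⟨ v ⟩) (sym h) (mul≥0 i₄ (ℤₚ.<⇒≤ n>0))))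
            ( (λ e → ℤₚ.<-irrefl (sym (trans (sym (cong (n′ *_) e)) (trans eq₁ (trans (ℤₚ.+-identityʳ (x₁ * W₁ ⟨ v ⟩)) (trans (cong (_* W₁ ⟨ v ⟩) (sym h)) (ℤₚ.*-zeroˡ (W₁ ⟨ v ⟩))))))) (mul>0 T′.n>0 n>0))
            , notvertex x₂ eq₂ (zeroed (W₂ ⟨ v ⟩) (sym h)) v₂ , notvertex x₃ eq₃ (zeroed (W₃ ⟨ v ⟩) (sym h)) v₃ , notvertex x₄ eq₄ (zeroed (W₄ ⟨ v ⟩) (sym h)) v₄)
          where
          zeroed : ∀ w → x₁ ≡ + 0 → x₁ * w ≡ + 0
          zeroed w e = trans (cong (_* w) e) (ℤₚ.*-zeroˡ w)
          vanish : ∀ w {y} → x₁ ≡ + 0 → + 0 ≤ y → + 0 ≤ x₁ * w + y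
          vanish w {y} e h = subst (λ t → + 0 ≤ t + y) (sym (zeroed w e)) (subst (+ 0 ≤_) (sym (ℤₚ.+-identityˡ y)) h)
        neg : ∀ {w u x} → n′ * w ≡ x₁ * u + x * n → w ≡ + 0 → + 0 ≤ x → u ≤ + 0
        neg {w} {u} {x} e refl x≥0 = ℤₚ.≮⇒≥ λ u>0 → lin 3 (λ N y z → N :* # 0 := y :+ z ⇒ # 0 :< y ⇒ # 0 :≤ z ⇒ ⊢ :⊥) n′ (x₁ * u) (x * n) e (mul>0 x₁>0 u>0) (mul≥0 x≥0 (ℤₚ.<⇒≤ n>0))
        outside : ¬ Inside T z
        outside (j₁ , j₂ , j₃ , j₄) = emp z (j₁ , j₂ , j₃ , j₄) (first , other j₂ eqz₂ , other j₃ eqz₃ , other j₄ eqz₄)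
          where
          A₁ = W₁ ⟨ z ⟩
          B₁ = W₂ ⟨ z ⟩
          C₁ = W₃ ⟨ z ⟩
          D₁ = W₄ ⟨ z ⟩
          a≢0 : a ≢ + 0
          a≢0 e = ℤₚ.<-asym n>0 (subst (λ t → n < + ∣ t ∣) e big)
          eqz : W₁ ⟨ z ⟩ ≡ + 0 → ⊥
          eqz e = a≢0 (cancel≡ a (+ 0) x₁>0 (trans (ℤₚ.*-comm a x₁) (trans (sym (ℤₚ.+-identityʳ _)) (trans (sym eq₁) (trans (cong (n′ *_) e) (trans (ℤₚ.*-zeroʳ n′) (sym (ℤₚ.*-zeroˡ x₁))))))))
          eqz₂ : B₁ ≡ n → A₁ ≡ + 0
          eqz₂ = lin 5 (λ a b c d n → a :+ b :+ c :+ d := n ⇒ # 0 :≤ a ⇒ # 0 :≤ c ⇒ # 0 :≤ d ⇒ b := n ⇒ ⊢ a := # 0) A₁ B₁ C₁ D₁ n (sumW z) j₁ j₃ j₄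
          eqz₃ : C₁ ≡ n → A₁ ≡ + 0
          eqz₃ = lin 5 (λ a b c d n → a :+ b :+ c :+ d := n ⇒ # 0 :≤ a ⇒ # 0 :≤ b ⇒ # 0 :≤ d ⇒ c := n ⇒ ⊢ a := # 0) A₁ B₁ C₁ D₁ n (sumW z) j₁ j₂ j₄
          eqz₄ : D₁ ≡ n → A₁ ≡ + 0
          eqz₄ = lin 5 (λ a b c d n → a :+ b :+ c :+ d := n ⇒ # 0 :≤ a ⇒ # 0 :≤ b ⇒ # 0 :≤ c ⇒ d := n ⇒ ⊢ a := # 0) A₁ B₁ C₁ D₁ n (sumW z) j₁ j₂ j₃
          other : ∀ {w} → + 0 ≤ w → (w ≡ n → A₁ ≡ + 0) → w ≢ n
          other _ f e = eqz (f e)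
          first : A₁ ≢ n
          first e = ¬dom
            ( cancel< (+ 0) a x₁>0 (lin 4 (λ x a m n → m := x :* a :+ # 0 ⇒ # 0 :< m ⇒ ⊢ # 0 :* x :< a :* x) x₁ a (n′ * n) n (trans (cong (n′ *_) (sym e)) eq₁) (mul>0 T′.n>0 n>0))
            , neg eq₂ (lin 5 (λ a b c d n → a :+ b :+ c :+ d := n ⇒ # 0 :≤ b ⇒ # 0 :≤ c ⇒ # 0 :≤ d ⇒ a := n ⇒ ⊢ b := # 0) A₁ B₁ C₁ D₁ n (sumW z) j₂ j₃ j₄ e) i₂
            , neg eq₃ (lin 5 (λ a b c d n → a :+ b :+ c :+ d := n ⇒ # 0 :≤ b ⇒ # 0 :≤ c ⇒ # 0 :≤ d ⇒ a := n ⇒ ⊢ c := # 0) A₁ B₁ C₁ D₁ n (sumW z) j₂ j₃ j₄ e) i₃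
            , neg eq₄ (lin 5 (λ a b c d n → a :+ b :+ c :+ d := n ⇒ # 0 :≤ b ⇒ # 0 :≤ c ⇒ # 0 :≤ d ⇒ a := n ⇒ ⊢ d := # 0) A₁ B₁ C₁ D₁ n (sumW z) j₂ j₃ j₄ e) i₄)
        lt : + size T z * n′ < + size T v * n′
        lt = lin 15 (λ n N x₁ x₂ x₃ x₄ za zb zc zd va vb vc vd t →
               N :* za :≤ x₁ :* va :+ # 0 ⇒ N :* zb :≤ x₁ :* vb :+ x₂ :* n ⇒ N :* zc :≤ x₁ :* vc :+ x₃ :* n ⇒ N :* zd :≤ x₁ :* vd :+ x₄ :* n ⇒
               # 0 :< (va :+ vb :+ vc :+ vd :- n) :* (N :- x₁) ⇒ x₁ :* n :+ x₂ :* n :+ x₃ :* n :+ x₄ :* n := N :* n ⇒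
               ⊢ (za :+ zb :+ zc :+ zd) :* N :< (va :+ vb :+ vc :+ vd) :* N)
             n n′ x₁ x₂ x₃ x₄ (+ ∣ W₁ ⟨ z ⟩ ∣) (+ ∣ W₂ ⟨ z ⟩ ∣) (+ ∣ W₃ ⟨ z ⟩ ∣) (+ ∣ W₄ ⟨ z ⟩ ∣) (+ ∣ W₁ ⟨ v ⟩ ∣) (+ ∣ W₂ ⟨ v ⟩ ∣) (+ ∣ W₃ ⟨ v ⟩ ∣) (+ ∣ W₄ ⟨ v ⟩ ∣) (+ 0)
             (tri (W₁ ⟨ z ⟩) (W₁ ⟨ v ⟩) ℤₚ.≤-refl eq₁) (tri (W₂ ⟨ z ⟩) (W₂ ⟨ v ⟩) (mul≥0 i₂ (ℤₚ.<⇒≤ n>0)) eq₂) (tri (W₃ ⟨ z ⟩) (W₃ ⟨ v ⟩) (mul≥0 i₃ (ℤₚ.<⇒≤ n>0)) eq₃) (tri (W₄ ⟨ z ⟩) (W₄ ⟨ v ⟩) (mul≥0 i₄ (ℤₚ.<⇒≤ n>0)) eq₄)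
             (mul>0 (lin 2 (λ n t → n :< t ⇒ ⊢ # 0 :< t :- n) n (+ size T v) (size>n T v out)) (lin 2 (λ x N → x :< N ⇒ ⊢ # 0 :< N :- x) x₁ n′ x₁<n′))
             (trans (lin 5 (λ n a b c d → ⊢ a :* n :+ b :* n :+ c :* n :+ d :* n := (a :+ b :+ c :+ d) :* n) n x₁ x₂ x₃ x₄) (cong (_* n) (T′.sumW z)))
          where
          x₁<n′ : x₁ < n′
          x₁<n′ = ℤₚ.≤∧≢⇒< (lin 5 (λ a b c d n → a :+ b :+ c :+ d := n ⇒ # 0 :≤ b ⇒ # 0 :≤ c ⇒ # 0 :≤ d ⇒ ⊢ a :≤ n) x₁ x₂ x₃ x₄ n′ (T′.sumW z) i₂ i₃ i₄) v₁
          tri : ∀ y u {ρ} → + 0 ≤ ρ → n′ * y ≡ x₁ * u + ρ → n′ * + ∣ y ∣ ≤ x₁ * + ∣ u ∣ + ρ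
          tri y u {ρ} ρ≥0 e = subst (_≤ x₁ * + ∣ u ∣ + ρ) scale (∣x∣≤ (n′ * y)
              (lin 4 (λ m p P ρ → m := p :+ ρ ⇒ p :≤ P ⇒ ⊢ m :≤ P :+ ρ) (n′ * y) (x₁ * u) (x₁ * + ∣ u ∣) ρ e (mono (x≤∣x∣ u)))
              (lin 4 (λ m p P ρ → m := p :+ ρ ⇒ :- p :≤ P ⇒ # 0 :≤ ρ ⇒ ⊢ :- m :≤ P :+ ρ) (n′ * y) (x₁ * u) (x₁ * + ∣ u ∣) ρ e (subst (_≤ x₁ * + ∣ u ∣) (sym (ℤₚ.neg-distribʳ-* x₁ u)) (mono (-x≤∣x∣ u))) ρ≥0))
            where
            mono : ∀ {w t} → w ≤ t → x₁ * w ≤ x₁ * t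
            mono = ℤₚ.*-monoˡ-≤-nonNeg x₁ ⦃ ℤ.nonNegative i₁ ⦄
            scale : + ∣ n′ * y ∣ ≡ n′ * + ∣ y ∣
            scale = trans (cong +_ (ℤₚ.abs-* n′ y)) (trans (ℤₚ.pos-* ∣ n′ ∣ ∣ y ∣) (cong (_* + ∣ y ∣) (ℤₚ.0≤i⇒+∣i∣≡i (ℤₚ.<⇒≤ T′.n>0))))

  smaller12 : ∀ {p q r s} (T : Tet p q r s) {v} → Smaller (sw12 T) v → Smaller T v
  smaller12 T {v} S = record
    { point = point ; inA = inA ; outside = λ { (a , b , c , d) → outside (b , a , c , d) }
    ; between = record { K = K ; τ = τ ; ρ₁ = ρ₂ ; ρ₂ = ρ₁ ; ρ₃ = ρ₃ ; ρ₄ = ρ₄ ; K>0 = K>0 ; τ>0 = τ>0 ; ρ₁≥0 = ρ₂≥0 ; ρ₂≥0 = ρ₁≥0 ; ρ₃≥0 = ρ₃≥0 ; ρ₄≥0 = ρ₄≥0 ; eq₁ = eq₂ ; eq₂ = eq₁ ; eq₃ = eq₃ ; eq₄ = eq₄ }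
    ; decreases = subst (λ k → k ℕ.< size T v) (comm point) (subst (λ k → size (sw12 T) point ℕ.< k) (comm v) decreases) }
    where
    open Smaller S
    open Between between
    comm : ∀ z → size (sw12 T) z ≡ size T z
    comm z = cong (λ k → k ℕ.+ ∣ Tet.W₃ T ⟨ z ⟩ ∣ ℕ.+ ∣ Tet.W₄ T ⟨ z ⟩ ∣) (ℕₚ.+-comm ∣ Tet.W₂ T ⟨ z ⟩ ∣ ∣ Tet.W₁ T ⟨ z ⟩ ∣)

  smaller23 : ∀ {p q r s} (T : Tet p q r s) {v} → Smaller (sw23 T) v → Smaller T v
  smaller23 T {v} S = record
    { point = point ; inA = inA ; outside = λ { (a , b , c , d) → outside (a , c , b , d) }
    ; between = record { K = K ; τ = τ ; ρ₁ = ρ₁ ; ρ₂ = ρ₃ ; ρ₃ = ρ₂ ; ρ₄ = ρ₄ ; K>0 = K>0 ; τ>0 = τ>0 ; ρ₁≥0 = ρ₁≥0 ; ρ₂≥0 = ρ₃≥0 ; ρ₃≥0 = ρ₂≥0 ; ρ₄≥0 = ρ₄≥0 ; eq₁ = eq₁ ; eq₂ = eq₃ ; eq₃ = eq₂ ; eq₄ = eq₄ }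
    ; decreases = subst (λ k → k ℕ.< size T v) (comm point) (subst (λ k → size (sw23 T) point ℕ.< k) (comm v) decreases) }
    where
    open Smaller S
    open Between between
    comm : ∀ z → size (sw23 T) z ≡ size T z
    comm z = cong (ℕ._+ ∣ Tet.W₄ T ⟨ z ⟩ ∣) (trans (ℕₚ.+-assoc a c b) (trans (cong (a ℕ.+_) (ℕₚ.+-comm c b)) (sym (ℕₚ.+-assoc a b c))))
      where
      a = ∣ Tet.W₁ T ⟨ z ⟩ ∣
      b = ∣ Tet.W₂ T ⟨ z ⟩ ∣
      c = ∣ Tet.W₃ T ⟨ z ⟩ ∣

  smaller34 : ∀ {p q r s} (T : Tet p q r s) {v} → Smaller (sw34 T) v → Smaller T v
  smaller34 T {v} S = record
    { point = point ; inA = inA ; outside = λ { (a , b , c , d) → outside (a , b , d , c) }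
    ; between = record { K = K ; τ = τ ; ρ₁ = ρ₁ ; ρ₂ = ρ₂ ; ρ₃ = ρ₄ ; ρ₄ = ρ₃ ; K>0 = K>0 ; τ>0 = τ>0 ; ρ₁≥0 = ρ₁≥0 ; ρ₂≥0 = ρ₂≥0 ; ρ₃≥0 = ρ₄≥0 ; ρ₄≥0 = ρ₃≥0 ; eq₁ = eq₁ ; eq₂ = eq₂ ; eq₃ = eq₄ ; eq₄ = eq₃ }
    ; decreases = subst (λ k → k ℕ.< size T v) (comm point) (subst (λ k → size (sw34 T) point ℕ.< k) (comm v) decreases) }
    where
    open Smaller S
    open Between between
    comm : ∀ z → size (sw34 T) z ≡ size T z
    comm z = trans (ℕₚ.+-assoc ab d c) (trans (cong (ab ℕ.+_) (ℕₚ.+-comm d c)) (sym (ℕₚ.+-assoc ab c d)))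
      where
      ab = ∣ Tet.W₁ T ⟨ z ⟩ ∣ ℕ.+ ∣ Tet.W₂ T ⟨ z ⟩ ∣
      c = ∣ Tet.W₃ T ⟨ z ⟩ ∣
      d = ∣ Tet.W₄ T ⟨ z ⟩ ∣

  -- The two situations in which `reduce` does not apply.
  TightAt : ℤ → ℤ → ℤ → ℤ → ℤ → Set
  TightAt n a b c d = (a ≤ n × - n ≤ a) ⊎ Dominant a b c d

  Tight : ∀ {p q r s} → Tet p q r s → Z3 → Set
  Tight T z = let open Tet T in TightAt n (W₁ ⟨ z ⟩) (W₂ ⟨ z ⟩) (W₃ ⟨ z ⟩) (W₄ ⟨ z ⟩) × TightAt n (W₂ ⟨ z ⟩) (W₁ ⟨ z ⟩) (W₃ ⟨ z ⟩) (W₄ ⟨ z ⟩)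
    × TightAt n (W₃ ⟨ z ⟩) (W₁ ⟨ z ⟩) (W₂ ⟨ z ⟩) (W₄ ⟨ z ⟩) × TightAt n (W₄ ⟨ z ⟩) (W₁ ⟨ z ⟩) (W₂ ⟨ z ⟩) (W₃ ⟨ z ⟩)

  record Tightened {p q r s} (T : Tet p q r s) (v : Z3) : Set where
    field
      point : Z3
      inA : A point
      outside : ¬ Inside T point
      between : Between T v point
      tight : Tight T point

  tightOrSmaller : ∀ {p q r s} (T : Tet p q r s) → Empty T → A p → A q → A r → A s → BigFree (Tet.n T) → ∀ v → A v → ¬ Inside T v → let open Tet T in
    TightAt n (W₁ ⟨ v ⟩) (W₂ ⟨ v ⟩) (W₃ ⟨ v ⟩) (W₄ ⟨ v ⟩) ⊎ Smaller T v
  tightOrSmaller T emp Ap Aq Ar As bf v Av out = by (+ ∣ W₁ ⟨ v ⟩ ∣ ℤₚ.≤? n) ((+ 0 ℤₚ.<? W₁ ⟨ v ⟩) ×-dec (W₂ ⟨ v ⟩ ℤₚ.≤? + 0) ×-dec (W₃ ⟨ v ⟩ ℤₚ.≤? + 0) ×-dec (W₄ ⟨ v ⟩ ℤₚ.≤? + 0))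
    where
    open Tet T
    by : Dec (+ ∣ W₁ ⟨ v ⟩ ∣ ≤ n) → Dec (Dominant (W₁ ⟨ v ⟩) (W₂ ⟨ v ⟩) (W₃ ⟨ v ⟩) (W₄ ⟨ v ⟩)) → TightAt n (W₁ ⟨ v ⟩) (W₂ ⟨ v ⟩) (W₃ ⟨ v ⟩) (W₄ ⟨ v ⟩) ⊎ Smaller T v
    by (yes h) _ = inj₁ (inj₁ (ℤₚ.≤-trans (x≤∣x∣ (W₁ ⟨ v ⟩)) h , lin 3 (λ x y n → :- x :≤ y ⇒ y :≤ n ⇒ ⊢ :- n :≤ x) (W₁ ⟨ v ⟩) (+ ∣ W₁ ⟨ v ⟩ ∣) n (-x≤∣x∣ (W₁ ⟨ v ⟩)) h))
    by (no _) (yes d) = inj₁ (inj₂ d)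
    by (no h) (no d) = inj₂ (reduce T emp Ap Aq Ar As bf v Av out (ℤₚ.≰⇒> h) d)

  tighten : ∀ {p q r s} (T : Tet p q r s) → Empty T → A p → A q → A r → A s → BigFree (Tet.n T) → ∀ v → A v → ¬ Inside T v → Tightened T v
  tighten T emp Ap Aq Ar As bf v Av out = loop (suc (size T v)) v ℕₚ.≤-refl Av out
    where
    open Tet T
    loop : ∀ k v → size T v ℕ.< k → A v → ¬ Inside T v → Tightened T v
    loop zero v () Av out
    loop (suc k) v h Av out = by (tightOrSmaller T emp Ap Aq Ar As bf v Av out) (tightOrSmaller (sw12 T) (empty12 T emp) Aq Ap Ar As bf v Av (λ { (a , b , c , d) → out (b , a , c , d) }))
        (tightOrSmaller (sw12 (sw23 T)) (empty12 (sw23 T) (empty23 T emp)) Ar Ap Aq As bf v Av (λ { (a , b , c , d) → out (b , c , a , d) }))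
        (tightOrSmaller (sw12 (sw23 (sw34 T))) (empty12 (sw23 (sw34 T)) (empty23 (sw34 T) (empty34 T emp))) As Ap Aq Ar bf v Av (λ { (a , b , c , d) → out (b , c , d , a) }))
      where
      continue : Smaller T v → Tightened T v
      continue S = record { point = R.point ; inA = R.inA ; outside = R.outside ; between = between-trans T S.between R.between ; tight = R.tight }
        where
        module S = Smaller S
        module R = Tightened (loop k S.point (ℕₚ.<-≤-trans S.decreases (ℕ.s≤s⁻¹ h)) S.inA S.outside)
      by : TightAt n (W₁ ⟨ v ⟩) (W₂ ⟨ v ⟩) (W₃ ⟨ v ⟩) (W₄ ⟨ v ⟩) ⊎ Smaller T v → TightAt n (W₂ ⟨ v ⟩) (W₁ ⟨ v ⟩) (W₃ ⟨ v ⟩) (W₄ ⟨ v ⟩) ⊎ Smaller (sw12 T) v →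
           TightAt n (W₃ ⟨ v ⟩) (W₁ ⟨ v ⟩) (W₂ ⟨ v ⟩) (W₄ ⟨ v ⟩) ⊎ Smaller (sw12 (sw23 T)) v → TightAt n (W₄ ⟨ v ⟩) (W₁ ⟨ v ⟩) (W₂ ⟨ v ⟩) (W₃ ⟨ v ⟩) ⊎ Smaller (sw12 (sw23 (sw34 T))) v → Tightened T v
      by (inj₂ S) _ _ _ = continue S
      by _ (inj₂ S) _ _ = continue (smaller12 T S)
      by _ _ (inj₂ S) _ = continue (smaller23 T (smaller12 (sw23 T) S))
      by _ _ _ (inj₂ S) = continue (smaller34 T (smaller23 (sw34 T) (smaller12 (sw23 (sw34 T)) S)))
      by (inj₁ t₁) (inj₁ t₂) (inj₁ t₃) (inj₁ t₄) = record { point = v ; inA = Av ; outside = out ; between = between-refl T v ; tight = t₁ , t₂ , t₃ , t₄ }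

-- Points adjacent to a tetrahedron in White's normal form

linear-ext : ∀ x y → (∀ f → linear f x ≡ linear f y) → x ≡ y
linear-ext (a ∷ b ∷ c ∷ []) (d ∷ e ∷ f ∷ []) h = vec≡
  (lin 6 (λ a b c d e f → # 1 :* a :+ # 0 :* b :+ # 0 :* c := # 1 :* d :+ # 0 :* e :+ # 0 :* f ⇒ ⊢ a := d) a b c d e f (h (aff (+ 1) (+ 0) (+ 0) (+ 0))))
  (lin 6 (λ a b c d e f → # 0 :* a :+ # 1 :* b :+ # 0 :* c := # 0 :* d :+ # 1 :* e :+ # 0 :* f ⇒ ⊢ b := e) a b c d e f (h (aff (+ 0) (+ 1) (+ 0) (+ 0))))
  (lin 6 (λ a b c d e f → # 0 :* a :+ # 0 :* b :+ # 1 :* c := # 0 :* d :+ # 0 :* e :+ # 1 :* f ⇒ ⊢ c := f) a b c d e f (h (aff (+ 0) (+ 0) (+ 1) (+ 0))))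

3∤1 : ¬ (+ 3 ∣ᶻ + 1)
3∤1 (k , e) = no-multiple (+ 3) (+ 1) (lin 0 (⊢ # 1 :≤ # 1)) (lin 0 (⊢ # 1 :< # 3)) (k , e)

3∤-1 : ¬ (+ 3 ∣ᶻ - + 1)
3∤-1 (k , e) = 3∤1 (- k , lin 1 (λ k → con (- + 1) := k :* # 3 ⇒ ⊢ # 1 := (:- k) :* # 3) k e)

-- Coordinates, in units of n, of the lattice points that can be adjacent to a tetrahedron in White's normal form.
data Out (n σ : ℤ) : ℤ → ℤ → ℤ → ℤ → Set where
  l12 : Out n σ (+ 2) (- + 1) (+ 0) (+ 0)
  l21 : Out n σ (- + 1) (+ 2) (+ 0) (+ 0)
  l34 : Out n σ (+ 0) (+ 0) (+ 2) (- + 1)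
  l43 : Out n σ (+ 0) (+ 0) (- + 1) (+ 2)
  l13 : σ ≡ n - + 1 → Out n σ (+ 2) (+ 0) (- + 1) (+ 0)
  l31 : σ ≡ n - + 1 → Out n σ (- + 1) (+ 0) (+ 2) (+ 0)
  l24 : σ ≡ n - + 1 → Out n σ (+ 0) (+ 2) (+ 0) (- + 1)
  l42 : σ ≡ n - + 1 → Out n σ (+ 0) (- + 1) (+ 0) (+ 2)
  l14 : σ ≡ + 1 → Out n σ (+ 2) (+ 0) (+ 0) (- + 1)
  l41 : σ ≡ + 1 → Out n σ (- + 1) (+ 0) (+ 0) (+ 2)
  l23 : σ ≡ + 1 → Out n σ (+ 0) (+ 2) (- + 1) (+ 0)
  l32 : σ ≡ + 1 → Out n σ (+ 0) (- + 1) (+ 2) (+ 0)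
  f1 : n ≡ + 3 → Out n σ (+ 3) (+ 0) (- + 1) (- + 1)
  f2 : n ≡ + 3 → Out n σ (+ 0) (+ 3) (- + 1) (- + 1)
  f3 : n ≡ + 3 → Out n σ (- + 1) (- + 1) (+ 3) (+ 0)
  f4 : n ≡ + 3 → Out n σ (- + 1) (- + 1) (+ 0) (+ 3)
  g1 : n ≡ + 3 → σ ≡ + 1 → Out n σ (+ 3) (- + 1) (- + 1) (+ 0)
  g2 : n ≡ + 3 → σ ≡ + 1 → Out n σ (- + 1) (+ 3) (+ 0) (- + 1)
  g3 : n ≡ + 3 → σ ≡ + 1 → Out n σ (- + 1) (+ 0) (+ 3) (- + 1)
  g4 : n ≡ + 3 → σ ≡ + 1 → Out n σ (+ 0) (- + 1) (- + 1) (+ 3)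
  h1 : n ≡ + 3 → σ ≡ n - + 1 → Out n σ (+ 3) (- + 1) (+ 0) (- + 1)
  h2 : n ≡ + 3 → σ ≡ n - + 1 → Out n σ (- + 1) (+ 3) (- + 1) (+ 0)
  h3 : n ≡ + 3 → σ ≡ n - + 1 → Out n σ (+ 0) (- + 1) (+ 3) (- + 1)
  h4 : n ≡ + 3 → σ ≡ n - + 1 → Out n σ (- + 1) (+ 0) (- + 1) (+ 3)

module _ {n σ : ℤ} where
  private
    to1 : n - σ ≡ n - + 1 → σ ≡ + 1
    to1 = lin 2 (λ n σ → n :- σ := n :- # 1 ⇒ ⊢ σ := # 1) n σ
    to-1 : n - σ ≡ + 1 → σ ≡ n - + 1
    to-1 = lin 2 (λ n σ → n :- σ := # 1 ⇒ ⊢ σ := n :- # 1) n σ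

  out12 : ∀ {a b c d} → Out n (n - σ) a b c d → Out n σ b a c d
  out12 l12 = l21
  out12 l21 = l12
  out12 l34 = l34
  out12 l43 = l43
  out12 (l13 e) = l23 (to1 e)
  out12 (l31 e) = l32 (to1 e)
  out12 (l24 e) = l14 (to1 e)
  out12 (l42 e) = l41 (to1 e)
  out12 (l14 e) = l24 (to-1 e)
  out12 (l41 e) = l42 (to-1 e)
  out12 (l23 e) = l13 (to-1 e)
  out12 (l32 e) = l31 (to-1 e)
  out12 (f1 e) = f2 e
  out12 (f2 e) = f1 e
  out12 (f3 e) = f3 e
  out12 (f4 e) = f4 e
  out12 (g1 e h) = h2 e (to-1 h)
  out12 (g2 e h) = h1 e (to-1 h)
  out12 (g3 e h) = h3 e (to-1 h)
  out12 (g4 e h) = h4 e (to-1 h)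
  out12 (h1 e h) = g2 e (to1 h)
  out12 (h2 e h) = g1 e (to1 h)
  out12 (h3 e h) = g3 e (to1 h)
  out12 (h4 e h) = g4 e (to1 h)

  out34 : ∀ {a b c d} → Out n (n - σ) a b c d → Out n σ a b d c
  out34 l12 = l12
  out34 l21 = l21
  out34 l34 = l43
  out34 l43 = l34
  out34 (l13 e) = l14 (to1 e)
  out34 (l31 e) = l41 (to1 e)
  out34 (l24 e) = l23 (to1 e)
  out34 (l42 e) = l32 (to1 e)
  out34 (l14 e) = l13 (to-1 e)
  out34 (l41 e) = l31 (to-1 e)
  out34 (l23 e) = l24 (to-1 e)
  out34 (l32 e) = l42 (to-1 e)
  out34 (f1 e) = f1 e
  out34 (f2 e) = f2 e
  out34 (f3 e) = f4 e
  out34 (f4 e) = f3 e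
  out34 (g1 e h) = h1 e (to-1 h)
  out34 (g2 e h) = h2 e (to-1 h)
  out34 (g3 e h) = h4 e (to-1 h)
  out34 (g4 e h) = h3 e (to-1 h)
  out34 (h1 e h) = g1 e (to1 h)
  out34 (h2 e h) = g2 e (to1 h)
  out34 (h3 e h) = g4 e (to1 h)
  out34 (h4 e h) = g3 e (to1 h)

outflip : ∀ {n σ ρ} → (ρ ≡ + 1 → σ ≡ + 1) → (ρ ≡ n - + 1 → σ ≡ n - + 1) → ∀ {a b c d} → Out n ρ a b c d → Out n σ c d a b
outflip u v l12 = l34
outflip u v l21 = l43
outflip u v l34 = l12
outflip u v l43 = l21
outflip u v (l13 e) = l31 (v e)
outflip u v (l31 e) = l13 (v e)
outflip u v (l24 e) = l42 (v e)
outflip u v (l42 e) = l24 (v e)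
outflip u v (l14 e) = l32 (u e)
outflip u v (l41 e) = l23 (u e)
outflip u v (l23 e) = l41 (u e)
outflip u v (l32 e) = l14 (u e)
outflip u v (f1 e) = f3 e
outflip u v (f2 e) = f4 e
outflip u v (f3 e) = f1 e
outflip u v (f4 e) = f2 e
outflip u v (g1 e h) = g3 e (u h)
outflip u v (g2 e h) = g4 e (u h)
outflip u v (g3 e h) = g1 e (u h)
outflip u v (g4 e h) = g2 e (u h)
outflip u v (h1 e h) = h3 e (v h)
outflip u v (h2 e h) = h4 e (v h)
outflip u v (h3 e h) = h1 e (v h)
outflip u v (h4 e h) = h2 e (v h)

record At {p q r s} (T : Tet p q r s) (w : Z3) (a b c d : ℤ) : Set where
  constructor at
  open Tet T
  field
    w₁ : W₁ ⟨ w ⟩ ≡ a * n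
    w₂ : W₂ ⟨ w ⟩ ≡ b * n
    w₃ : W₃ ⟨ w ⟩ ≡ c * n
    w₄ : W₄ ⟨ w ⟩ ≡ d * n

at12 : ∀ {p q r s} {T : Tet p q r s} {w a b c d} → At T w a b c d → At (sw12 T) w b a c d
at12 (at a b c d) = at b a c d

at23 : ∀ {p q r s} {T : Tet p q r s} {w a b c d} → At T w a b c d → At (sw23 T) w a c b d
at23 (at a b c d) = at a c b d

at34 : ∀ {p q r s} {T : Tet p q r s} {w a b c d} → At T w a b c d → At (sw34 T) w a b d c
at34 (at a b c d) = at a b d c

atflip : ∀ {p q r s} {T : Tet p q r s} {w a b c d} → At T w a b c d → At (sw23 (sw34 (sw12 (sw23 T)))) w c d a b
atflip (at a b c d) = at c d a b

module Classify {A : Z3 → Set} (C : Config A) where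
  open Config C

  convBy : ∀ cs N z → All (λ c → + 0 ≤ proj₁ c × A (proj₂ c)) cs → sumZ cs ≡ N → + 0 < N → (∀ f → sumF (f ⟨_⟩) cs ≡ N * f ⟨ z ⟩) → A z
  convBy cs N z all e N>0 h = conv cs N z all e N>0 (linear-ext (combZ cs) (N ·z z) λ f → trans
    (lin 7 (λ S l d s N lz lNz → S := l :+ d :* s ⇒ S := N :* (lz :+ d) ⇒ d :* s := d :* N ⇒ lNz := N :* lz ⇒ ⊢ l := lNz)
      (sumF (f ⟨_⟩) cs) (linear f (combZ cs)) (Aff.δ f) (sumZ cs) N (linear f z) (linear f (N ·z z)) (sumF-aff f cs) (h f) (cong (Aff.δ f *_) e) (linear-scale f N z)) refl)

  -- The nonnegative differences of the coordinates are the weights at p, q, r and s that complete a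
  -- u + b v + c w to a multiple of z.
  dominated : ∀ {p q r s} (T : Tet p q r s) → A p → A q → A r → A s → ∀ {u v w} → A u → A v → A w → ∀ {a b c} K z → + 0 ≤ a → + 0 ≤ b → + 0 ≤ c → + 0 < K → let open Tet T in
    a * W₁ ⟨ u ⟩ + b * W₁ ⟨ v ⟩ + c * W₁ ⟨ w ⟩ ≤ K * W₁ ⟨ z ⟩ → a * W₂ ⟨ u ⟩ + b * W₂ ⟨ v ⟩ + c * W₂ ⟨ w ⟩ ≤ K * W₂ ⟨ z ⟩ →
    a * W₃ ⟨ u ⟩ + b * W₃ ⟨ v ⟩ + c * W₃ ⟨ w ⟩ ≤ K * W₃ ⟨ z ⟩ → a * W₄ ⟨ u ⟩ + b * W₄ ⟨ v ⟩ + c * W₄ ⟨ w ⟩ ≤ K * W₄ ⟨ z ⟩ → A z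
  dominated {p} {q} {r} {s} T Ap Aq Ar As {u} {v} {w} Au Av Aw {a} {b} {c} K z a≥0 b≥0 c≥0 K>0 d₁ d₂ d₃ d₄ =
    convBy cs (n * K) z ((mul≥0 n≥0 a≥0 , Au) All.∷ (mul≥0 n≥0 b≥0 , Av) All.∷ (mul≥0 n≥0 c≥0 , Aw) All.∷ (gap d₁ , Ap) All.∷ (gap d₂ , Aq) All.∷ (gap d₃ , Ar) All.∷ (gap d₄ , As) All.∷ All.[])
      sum (mul>0 n>0 K>0) value
    where
    open Tet T
    n≥0 = ℤₚ.<⇒≤ n>0
    S : Aff → ℤ
    S f = a * f ⟨ u ⟩ + b * f ⟨ v ⟩ + c * f ⟨ w ⟩
    gap : ∀ {x y} → x ≤ y → + 0 ≤ y - x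
    gap = ℤₚ.i≤j⇒0≤j-i
    cs : List (ℤ × Z3)
    cs = (n * a , u) L.∷ (n * b , v) L.∷ (n * c , w) L.∷ (K * W₁ ⟨ z ⟩ - S W₁ , p) L.∷ (K * W₂ ⟨ z ⟩ - S W₂ , q) L.∷ (K * W₃ ⟨ z ⟩ - S W₃ , r) L.∷ (K * W₄ ⟨ z ⟩ - S W₄ , s) L.∷ L.[]
    sum : sumZ cs ≡ n * K
    sum = arith (W₁ ⟨ u ⟩) (W₂ ⟨ u ⟩) (W₃ ⟨ u ⟩) (W₄ ⟨ u ⟩) (W₁ ⟨ v ⟩) (W₂ ⟨ v ⟩) (W₃ ⟨ v ⟩) (W₄ ⟨ v ⟩) (W₁ ⟨ w ⟩) (W₂ ⟨ w ⟩) (W₃ ⟨ w ⟩) (W₄ ⟨ w ⟩) (W₁ ⟨ z ⟩) (W₂ ⟨ z ⟩) (W₃ ⟨ z ⟩) (W₄ ⟨ z ⟩)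
        (cong (a *_) (sumW u)) (cong (b *_) (sumW v)) (cong (c *_) (sumW w)) (cong (K *_) (sumW z))
      where
      arith : ∀ u₁ u₂ u₃ u₄ v₁ v₂ v₃ v₄ w₁ w₂ w₃ w₄ z₁ z₂ z₃ z₄ → a * (u₁ + u₂ + u₃ + u₄) ≡ a * n → b * (v₁ + v₂ + v₃ + v₄) ≡ b * n → c * (w₁ + w₂ + w₃ + w₄) ≡ c * n → K * (z₁ + z₂ + z₃ + z₄) ≡ K * n →
        n * a + (n * b + (n * c + ((K * z₁ - (a * u₁ + b * v₁ + c * w₁)) + ((K * z₂ - (a * u₂ + b * v₂ + c * w₂)) + ((K * z₃ - (a * u₃ + b * v₃ + c * w₃)) + ((K * z₄ - (a * u₄ + b * v₄ + c * w₄)) + + 0)))))) ≡ n * K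
      arith u₁ u₂ u₃ u₄ v₁ v₂ v₃ v₄ w₁ w₂ w₃ w₄ z₁ z₂ z₃ z₄ = lin 21 (λ n K a b c u₁ u₂ u₃ u₄ v₁ v₂ v₃ v₄ w₁ w₂ w₃ w₄ z₁ z₂ z₃ z₄ →
        a :* (u₁ :+ u₂ :+ u₃ :+ u₄) := a :* n ⇒ b :* (v₁ :+ v₂ :+ v₃ :+ v₄) := b :* n ⇒ c :* (w₁ :+ w₂ :+ w₃ :+ w₄) := c :* n ⇒ K :* (z₁ :+ z₂ :+ z₃ :+ z₄) := K :* n ⇒
        ⊢ n :* a :+ (n :* b :+ (n :* c :+ ((K :* z₁ :- (a :* u₁ :+ b :* v₁ :+ c :* w₁)) :+ ((K :* z₂ :- (a :* u₂ :+ b :* v₂ :+ c :* w₂)) :+ ((K :* z₃ :- (a :* u₃ :+ b :* v₃ :+ c :* w₃)) :+ ((K :* z₄ :- (a :* u₄ :+ b :* v₄ :+ c :* w₄)) :+ # 0)))))) := n :* K)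
        n K a b c u₁ u₂ u₃ u₄ v₁ v₂ v₃ v₄ w₁ w₂ w₃ w₄ z₁ z₂ z₃ z₄
    value : ∀ f → sumF (f ⟨_⟩) cs ≡ n * K * f ⟨ z ⟩
    value f = arith (W₁ ⟨ u ⟩) (W₂ ⟨ u ⟩) (W₃ ⟨ u ⟩) (W₄ ⟨ u ⟩) (W₁ ⟨ v ⟩) (W₂ ⟨ v ⟩) (W₃ ⟨ v ⟩) (W₄ ⟨ v ⟩) (W₁ ⟨ w ⟩) (W₂ ⟨ w ⟩) (W₃ ⟨ w ⟩) (W₄ ⟨ w ⟩) (W₁ ⟨ z ⟩) (W₂ ⟨ z ⟩) (W₃ ⟨ z ⟩) (W₄ ⟨ z ⟩)
        (f ⟨ u ⟩) (f ⟨ v ⟩) (f ⟨ w ⟩) (f ⟨ z ⟩) (f ⟨ p ⟩) (f ⟨ q ⟩) (f ⟨ r ⟩) (f ⟨ s ⟩) (cong (a *_) (bary T f u)) (cong (b *_) (bary T f v)) (cong (c *_) (bary T f w)) (cong (K *_) (bary T f z))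
      where
      arith : ∀ u₁ u₂ u₃ u₄ v₁ v₂ v₃ v₄ w₁ w₂ w₃ w₄ z₁ z₂ z₃ z₄ fu fv fw fz p q r s → a * (n * fu) ≡ a * (u₁ * p + u₂ * q + u₃ * r + u₄ * s) → b * (n * fv) ≡ b * (v₁ * p + v₂ * q + v₃ * r + v₄ * s) → c * (n * fw) ≡ c * (w₁ * p + w₂ * q + w₃ * r + w₄ * s) →
        K * (n * fz) ≡ K * (z₁ * p + z₂ * q + z₃ * r + z₄ * s) →
        n * a * fu + (n * b * fv + (n * c * fw + ((K * z₁ - (a * u₁ + b * v₁ + c * w₁)) * p + ((K * z₂ - (a * u₂ + b * v₂ + c * w₂)) * q + ((K * z₃ - (a * u₃ + b * v₃ + c * w₃)) * r + ((K * z₄ - (a * u₄ + b * v₄ + c * w₄)) * s + + 0)))))) ≡ n * K * fz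
      arith u₁ u₂ u₃ u₄ v₁ v₂ v₃ v₄ w₁ w₂ w₃ w₄ z₁ z₂ z₃ z₄ fu fv fw fz p q r s = lin 29 (λ n K a b c u₁ u₂ u₃ u₄ v₁ v₂ v₃ v₄ w₁ w₂ w₃ w₄ z₁ z₂ z₃ z₄ fu fv fw fz p q r s →
        a :* (n :* fu) := a :* (u₁ :* p :+ u₂ :* q :+ u₃ :* r :+ u₄ :* s) ⇒ b :* (n :* fv) := b :* (v₁ :* p :+ v₂ :* q :+ v₃ :* r :+ v₄ :* s) ⇒ c :* (n :* fw) := c :* (w₁ :* p :+ w₂ :* q :+ w₃ :* r :+ w₄ :* s) ⇒
        K :* (n :* fz) := K :* (z₁ :* p :+ z₂ :* q :+ z₃ :* r :+ z₄ :* s) ⇒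
        ⊢ n :* a :* fu :+ (n :* b :* fv :+ (n :* c :* fw :+ ((K :* z₁ :- (a :* u₁ :+ b :* v₁ :+ c :* w₁)) :* p :+ ((K :* z₂ :- (a :* u₂ :+ b :* v₂ :+ c :* w₂)) :* q :+ ((K :* z₃ :- (a :* u₃ :+ b :* v₃ :+ c :* w₃)) :* r :+ ((K :* z₄ :- (a :* u₄ :+ b :* v₄ :+ c :* w₄)) :* s :+ # 0)))))) := n :* K :* fz)
        n K a b c u₁ u₂ u₃ u₄ v₁ v₂ v₃ v₄ w₁ w₂ w₃ w₄ z₁ z₂ z₃ z₄ fu fv fw fz p q r s

  -- The point with coordinates l (σ, n - σ, 1, -1) + n (k₁, k₂, k₃, k₄) is in the wrong class when l is not divisible by three.
  kill : ∀ {p q r s} (T : WhiteTet A p q r s) → ∀ {u v w} → A u → A v → A w → ∀ a b c K l k₁ k₂ k₃ k₄ → + 0 ≤ a → + 0 ≤ b → + 0 ≤ c → + 0 < K →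
    l + k₁ + k₂ + k₃ + k₄ ≡ + 1 → ¬ (+ 3 ∣ᶻ l) → let open WhiteTet T in
    a * W₁ ⟨ u ⟩ + b * W₁ ⟨ v ⟩ + c * W₁ ⟨ w ⟩ ≤ K * (l * σ + k₁ * n) → a * W₂ ⟨ u ⟩ + b * W₂ ⟨ v ⟩ + c * W₂ ⟨ w ⟩ ≤ K * (l * (n - σ) + k₂ * n) →
    a * W₃ ⟨ u ⟩ + b * W₃ ⟨ v ⟩ + c * W₃ ⟨ w ⟩ ≤ K * (l * + 1 + k₃ * n) → a * W₄ ⟨ u ⟩ + b * W₄ ⟨ v ⟩ + c * W₄ ⟨ w ⟩ ≤ K * (l * - + 1 + k₄ * n) → ⊥
  kill T {u} {v} {w} Au Av Aw a b c K l k₁ k₂ k₃ k₄ a≥0 b≥0 c≥0 K>0 e 3∤l d₁ d₂ d₃ d₄ = 3∤l (3∣l (3∣W₃ point inA) 3∣n)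
    where
    open WhiteTet T
    open Moved (move tet l k₁ k₂ k₃ k₄ zσ e)
    value : ∀ {x w w′} k → x ≡ l * w + k * n → w ≡ w′ → x ≡ l * w′ + k * n
    value k refl refl = refl
    F₁ = value k₁ at₁ zσ₁
    F₂ = value k₂ at₂ zσ₂
    F₃ = value k₃ at₃ zσ₃
    F₄ = value k₄ at₄ zσ₄
    inA : A point
    inA = dominated tet Ap Aq Ar As {u} {v} {w} Au Av Aw {a} {b} {c} K point a≥0 b≥0 c≥0 K>0 (to d₁ F₁) (to d₂ F₂) (to d₃ F₃) (to d₄ F₄)
      where
      to : ∀ {x y y′} → x ≤ K * y → y′ ≡ y → x ≤ K * y′
      to h refl = h
    3∣l : + 3 ∣ᶻ W₃ ⟨ point ⟩ → + 3 ∣ᶻ n → + 3 ∣ᶻ l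
    3∣l (m , f) (h , g) = m - k₃ * h , lin 5 (λ x l kn m k → x := l :* # 1 :+ kn ⇒ x := m :* # 3 ⇒ kn := k :* # 3 ⇒ ⊢ l := (m :- k) :* # 3)
      (W₃ ⟨ point ⟩) l (k₃ * n) m (k₃ * h) F₃ f (trans (cong (k₃ *_) g) (sym (ℤₚ.*-assoc k₃ h (+ 3))))

  kill₁ : ∀ {p q r s} (T : WhiteTet A p q r s) → ∀ {w} → A w → ∀ c K l k₁ k₂ k₃ k₄ → + 0 ≤ c → + 0 < K → l + k₁ + k₂ + k₃ + k₄ ≡ + 1 → ¬ (+ 3 ∣ᶻ l) → let open WhiteTet T in
    c * W₁ ⟨ w ⟩ ≤ K * (l * σ + k₁ * n) → c * W₂ ⟨ w ⟩ ≤ K * (l * (n - σ) + k₂ * n) → c * W₃ ⟨ w ⟩ ≤ K * (l * + 1 + k₃ * n) → c * W₄ ⟨ w ⟩ ≤ K * (l * - + 1 + k₄ * n) → ⊥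
  kill₁ T {w} Aw c K l k₁ k₂ k₃ k₄ c≥0 K>0 e 3∤l d₁ d₂ d₃ d₄ = kill T {w} {w} {w} Aw Aw Aw c (+ 0) (+ 0) K l k₁ k₂ k₃ k₄ c≥0 ℤₚ.≤-refl ℤₚ.≤-refl K>0 e 3∤l (pad (W₁ ⟨ w ⟩) d₁) (pad (W₂ ⟨ w ⟩) d₂) (pad (W₃ ⟨ w ⟩) d₃) (pad (W₄ ⟨ w ⟩) d₄)
    where
    open WhiteTet T
    pad : ∀ x {y} → c * x ≤ y → c * x + + 0 * x + + 0 * x ≤ y
    pad x {y} = lin 3 (λ c x y → c :* x :≤ y ⇒ ⊢ c :* x :+ # 0 :* x :+ # 0 :* x :≤ y) c x y

  -- The coordinates on the left are in units of n and those on the right are not: u, v and w have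
  -- the weights a, b and c over K n.
  killAt : ∀ {p q r s} (T : WhiteTet A p q r s) → ∀ {u v w a₁ a₂ a₃ a₄ b₁ b₂ b₃ b₄ c₁ c₂ c₃ c₄} → A u → A v → A w →
    At (WhiteTet.tet T) u a₁ a₂ a₃ a₄ → At (WhiteTet.tet T) v b₁ b₂ b₃ b₄ → At (WhiteTet.tet T) w c₁ c₂ c₃ c₄ →
    ∀ a b c K l k₁ k₂ k₃ k₄ → + 0 ≤ a → + 0 ≤ b → + 0 ≤ c → + 0 < K → l + k₁ + k₂ + k₃ + k₄ ≡ + 1 → ¬ (+ 3 ∣ᶻ l) → let open WhiteTet T in
    a * a₁ + b * b₁ + c * c₁ ≤ K * (l * σ + k₁ * n) → a * a₂ + b * b₂ + c * c₂ ≤ K * (l * (n - σ) + k₂ * n) →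
    a * a₃ + b * b₃ + c * c₃ ≤ K * (l * + 1 + k₃ * n) → a * a₄ + b * b₄ + c * c₄ ≤ K * (l * - + 1 + k₄ * n) → ⊥
  killAt T {u} {v} {w} Au Av Aw (at u₁ u₂ u₃ u₄) (at v₁ v₂ v₃ v₄) (at w₁ w₂ w₃ w₄) a b c K l k₁ k₂ k₃ k₄ a≥0 b≥0 c≥0 K>0 e 3∤l d₁ d₂ d₃ d₄ =
    kill T {u} {v} {w} Au Av Aw a b c (K * n) l k₁ k₂ k₃ k₄ a≥0 b≥0 c≥0 (mul>0 K>0 n>0) e 3∤l
      (scaled u₁ v₁ w₁ d₁) (scaled u₂ v₂ w₂ d₂) (scaled u₃ v₃ w₃ d₃) (scaled u₄ v₄ w₄ d₄)
    where
    open WhiteTet T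
    scaled : ∀ {x y z x′ y′ z′ F} → x ≡ x′ * n → y ≡ y′ * n → z ≡ z′ * n → a * x′ + b * y′ + c * z′ ≤ K * F → a * x + b * y + c * z ≤ K * n * F
    scaled {x′ = x′} {y′} {z′} {F} refl refl refl h = lin 9 (λ a b c x y z K n F → # 0 :≤ (K :* F :- (a :* x :+ b :* y :+ c :* z)) :* n ⇒ ⊢ a :* (x :* n) :+ b :* (y :* n) :+ c :* (z :* n) :≤ K :* n :* F)
      a b c x′ y′ z′ K n F (mul≥0 (ℤₚ.i≤j⇒0≤j-i h) (ℤₚ.<⇒≤ n>0))

  killAt₁ : ∀ {p q r s} (T : WhiteTet A p q r s) → ∀ {w a b c d} → A w → At (WhiteTet.tet T) w a b c d → ∀ m l k₁ k₂ k₃ k₄ → + 0 ≤ m → l + k₁ + k₂ + k₃ + k₄ ≡ + 1 → ¬ (+ 3 ∣ᶻ l) → let open WhiteTet T in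
    m * a ≤ l * σ + k₁ * n → m * b ≤ l * (n - σ) + k₂ * n → m * c ≤ l * + 1 + k₃ * n → m * d ≤ l * - + 1 + k₄ * n → ⊥
  killAt₁ T {w} {a} {b} {c} {d} Aw W m l k₁ k₂ k₃ k₄ m≥0 e 3∤l d₁ d₂ d₃ d₄ = killAt T {w} {w} {w} Aw Aw Aw W W W m (+ 0) (+ 0) (+ 1) l k₁ k₂ k₃ k₄ m≥0 ℤₚ.≤-refl ℤₚ.≤-refl (lin 0 (⊢ # 0 :< # 1)) e 3∤l
      (pad a d₁) (pad b d₂) (pad c d₃) (pad d d₄)
    where
    pad : ∀ x {y} → m * x ≤ y → m * x + + 0 * x + + 0 * x ≤ + 1 * y
    pad x {y} = lin 3 (λ m x y → m :* x :≤ y ⇒ ⊢ m :* x :+ # 0 :* x :+ # 0 :* x :≤ # 1 :* y) m x y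

  -- σ is invertible modulo n, and 3 divides n.
  3∤σ : ∀ {p q r s} (T : WhiteTet A p q r s) → ¬ (+ 3 ∣ᶻ WhiteTet.σ T)
  3∤σ T (m , e) = go σρ 3∣n
    where
    open WhiteTet T
    go : n ∣ᶻ (+ 1 - σ * ρ) → + 3 ∣ᶻ n → ⊥
    go (k , f) (h , g) = 3∤1 (m * ρ + k * h , trans (lin 2 (λ x y → ⊢ # 1 := # 1 :- x :* y :+ x :* y) σ ρ) (trans (cong₂ _+_ (trans f (cong (k *_) g)) (cong (_* ρ) e))
      (lin 4 (λ k h m ρ → ⊢ k :* (h :* # 3) :+ m :* # 3 :* ρ := (m :* ρ :+ k :* h) :* # 3) k h m ρ)))

  private
    1≥0 : + 0 ≤ + 1
    1≥0 = lin 0 (⊢ # 0 :≤ # 1)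
    2≥0 : + 0 ≤ + 2
    2≥0 = lin 0 (⊢ # 0 :≤ # 2)

    module Forbidden {p q r s} (T : WhiteTet A p q r s) {w} (Aw : A w) where
      open WhiteTet T

      -- The forbidden point is p + q - zσ, with coordinates (n - σ, σ, -1, 1); in `lower` it is zσ
      -- itself.
      upper : ∀ {a b c d} → At tet w a b c d → a ≤ n - σ → b ≤ σ → c ≤ - + 1 → d ≤ + 1 → ⊥
      upper {a} {b} {c} {d} W h₁ h₂ h₃ h₄ = killAt₁ T Aw W (+ 1) (- + 1) (+ 1) (+ 1) (+ 0) (+ 0) 1≥0 refl 3∤-1
        (lin 3 (λ a n σ → a :≤ n :- σ ⇒ ⊢ # 1 :* a :≤ con (- + 1) :* σ :+ # 1 :* n) a n σ h₁) (lin 3 (λ b n σ → b :≤ σ ⇒ ⊢ # 1 :* b :≤ con (- + 1) :* (n :- σ) :+ # 1 :* n) b n σ h₂)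
        (lin 2 (λ c n → c :≤ con (- + 1) ⇒ ⊢ # 1 :* c :≤ con (- + 1) :* # 1 :+ # 0 :* n) c n h₃) (lin 2 (λ d n → d :≤ # 1 ⇒ ⊢ # 1 :* d :≤ con (- + 1) :* con (- + 1) :+ # 0 :* n) d n h₄)

      lower : ∀ {a b c d} → At tet w a b c d → a ≤ σ → b ≤ n - σ → c ≤ + 1 → d ≤ - + 1 → ⊥
      lower {a} {b} {c} {d} W h₁ h₂ h₃ h₄ = killAt₁ T Aw W (+ 1) (+ 1) (+ 0) (+ 0) (+ 0) (+ 0) 1≥0 refl 3∤1
        (lin 3 (λ a n σ → a :≤ σ ⇒ ⊢ # 1 :* a :≤ # 1 :* σ :+ # 0 :* n) a n σ h₁) (lin 3 (λ b n σ → b :≤ n :- σ ⇒ ⊢ # 1 :* b :≤ # 1 :* (n :- σ) :+ # 0 :* n) b n σ h₂)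
        (lin 2 (λ c n → c :≤ # 1 ⇒ ⊢ # 1 :* c :≤ # 1 :* # 1 :+ # 0 :* n) c n h₃) (lin 2 (λ d n → d :≤ con (- + 1) ⇒ ⊢ # 1 :* d :≤ # 1 :* con (- + 1) :+ # 0 :* n) d n h₄)

      volume : ∀ {m} → n < + m → m ≡ 6 → n ≡ + 3
      volume h refl = go 3∣n
        where
        go : + 3 ∣ᶻ n → n ≡ + 3
        go (k , e) = trans e (cong (_* + 3) (ℤₚ.≤-antisym (lin 2 (λ k n → n :< # 6 ⇒ n := k :* # 3 ⇒ ⊢ k :≤ # 1) k n h e) (lin 2 (λ k n → # 3 :≤ n ⇒ n := k :* # 3 ⇒ ⊢ # 1 :≤ k) k n n≥3 e)))

      σ₁₂ : n ≡ + 3 → σ ≡ + 1 ⊎ σ ≡ + 2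
      σ₁₂ e = go (small₃ σ (ℤₚ.<⇒≤ σ>0) (subst (σ <_) e σ<n))
        where
        go : σ ≡ + 0 ⊎ σ ≡ + 1 ⊎ σ ≡ + 2 → σ ≡ + 1 ⊎ σ ≡ + 2
        go (inj₁ h) = ⊥-elim (ℤₚ.<-irrefl (sym h) σ>0)
        go (inj₂ h) = h

      -- If neither p + q - zσ nor zσ dominates, then σ and n - σ are less than 4; with σ ≠ 3 and 3
      -- ∣ n this leaves n = 3. There zσ + p - q serves for σ = 1 and 2p - zσ for σ = 2.
      no4 : At tet w (+ 4) (- + 1) (- + 1) (- + 1) → ⊥
      no4 W = go (+ 4 ℤₚ.≤? n - σ) (+ 4 ℤₚ.≤? σ)
        where
        m1 : - + 1 ≤ + 1
        m1 = lin 0 (⊢ con (- + 1) :≤ # 1)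
        go : Dec (+ 4 ≤ n - σ) → Dec (+ 4 ≤ σ) → ⊥
        go (yes h) _ = upper W h (lin 1 (λ σ → # 0 :< σ ⇒ ⊢ con (- + 1) :≤ σ) σ σ>0) ℤₚ.≤-refl m1
        go _ (yes h) = lower W h (lin 2 (λ n σ → σ :< n ⇒ ⊢ con (- + 1) :≤ n :- σ) n σ σ<n) m1 ℤₚ.≤-refl
        go (no h) (no h′) = by3 (σ ℤₚ.≟ + 3)
          where
          by3 : Dec (σ ≡ + 3) → ⊥
          by3 (yes e) = 3∤σ T (+ 1 , e)
          by3 (no σ≢3) = n3 (σ₁₂ (volume (lin 2 (λ n σ → n :- σ :< # 4 ⇒ σ :< # 3 ⇒ ⊢ n :< # 6) n σ (ℤₚ.≰⇒> h) σ<3) refl)) (volume (lin 2 (λ n σ → n :- σ :< # 4 ⇒ σ :< # 3 ⇒ ⊢ n :< # 6) n σ (ℤₚ.≰⇒> h) σ<3) refl)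
            where
            σ<3 : σ < + 3
            σ<3 = ℤₚ.≤∧≢⇒< (lin 1 (λ σ → σ :< # 4 ⇒ ⊢ σ :≤ # 3) σ (ℤₚ.≰⇒> h′)) σ≢3
            n3 : σ ≡ + 1 ⊎ σ ≡ + 2 → n ≡ + 3 → ⊥
            n3 (inj₁ eσ) en = killAt₁ T Aw W (+ 1) (+ 1) (+ 1) (- + 1) (+ 0) (+ 0) 1≥0 refl 3∤1
              (lin 2 (λ n σ → σ := # 1 ⇒ n := # 3 ⇒ ⊢ # 4 :≤ # 1 :* σ :+ # 1 :* n) n σ eσ en) (lin 2 (λ n σ → σ := # 1 ⇒ n := # 3 ⇒ ⊢ con (- + 1) :≤ # 1 :* (n :- σ) :+ con (- + 1) :* n) n σ eσ en)
              (lin 1 (λ n → ⊢ con (- + 1) :≤ # 1 :* # 1 :+ # 0 :* n) n) (lin 1 (λ n → ⊢ con (- + 1) :≤ # 1 :* con (- + 1) :+ # 0 :* n) n)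
            n3 (inj₂ eσ) en = killAt₁ T Aw W (+ 1) (- + 1) (+ 2) (+ 0) (+ 0) (+ 0) 1≥0 refl 3∤-1
              (lin 2 (λ n σ → σ := # 2 ⇒ n := # 3 ⇒ ⊢ # 4 :≤ con (- + 1) :* σ :+ # 2 :* n) n σ eσ en) (lin 2 (λ n σ → σ := # 2 ⇒ n := # 3 ⇒ ⊢ con (- + 1) :≤ con (- + 1) :* (n :- σ) :+ # 0 :* n) n σ eσ en)
              (lin 1 (λ n → ⊢ con (- + 1) :≤ con (- + 1) :* # 1 :+ # 0 :* n) n) (lin 1 (λ n → ⊢ con (- + 1) :≤ con (- + 1) :* con (- + 1) :+ # 0 :* n) n)

      is3011 : At tet w (+ 3) (+ 0) (- + 1) (- + 1) → n ≡ + 3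
      is3011 W = go (+ 3 ℤₚ.≤? n - σ) (+ 3 ℤₚ.≤? σ)
        where
        m1 : - + 1 ≤ + 1
        m1 = lin 0 (⊢ con (- + 1) :≤ # 1)
        go : Dec (+ 3 ≤ n - σ) → Dec (+ 3 ≤ σ) → n ≡ + 3
        go (yes h) _ = ⊥-elim (upper W h (ℤₚ.<⇒≤ σ>0) ℤₚ.≤-refl m1)
        go _ (yes h) = ⊥-elim (lower W h (lin 2 (λ n σ → σ :< n ⇒ ⊢ # 0 :≤ n :- σ) n σ σ<n) m1 ℤₚ.≤-refl)
        go (no h) (no h′) = volume (lin 2 (λ n σ → n :- σ :< # 3 ⇒ σ :< # 3 ⇒ ⊢ n :< # 6) n σ (ℤₚ.≰⇒> h) (ℤₚ.≰⇒> h′)) refl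

      is2010 : At tet w (+ 2) (+ 0) (- + 1) (+ 0) → σ ≡ n - + 1
      is2010 W = go (+ 2 ℤₚ.≤? n - σ)
        where
        go : Dec (+ 2 ≤ n - σ) → σ ≡ n - + 1
        go (yes h) = ⊥-elim (upper W h (ℤₚ.<⇒≤ σ>0) ℤₚ.≤-refl 1≥0)
        go (no h) = lin 2 (λ n σ → n :- σ :< # 2 ⇒ σ :< n ⇒ ⊢ σ := n :- # 1) n σ (ℤₚ.≰⇒> h) σ<n

      -- For n - σ ≤ 2 the forbidden point is 2p - zσ, with coordinates (2n - σ, σ - n, -1, 1). It
      -- excludes n - σ = 1 altogether, and n - σ = 2 unless n = 3.
      is3110 : At tet w (+ 3) (- + 1) (- + 1) (+ 0) → n ≡ + 3 × σ ≡ + 1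
      is3110 W = go (+ 3 ℤₚ.≤? n - σ) (n - σ ℤₚ.≟ + 1) (+ 4 ℤₚ.≤? n)
        where
        go : Dec (+ 3 ≤ n - σ) → Dec (n - σ ≡ + 1) → Dec (+ 4 ≤ n) → n ≡ + 3 × σ ≡ + 1
        go (yes h) _ _ = ⊥-elim (upper W h (lin 1 (λ σ → # 0 :< σ ⇒ ⊢ con (- + 1) :≤ σ) σ σ>0) ℤₚ.≤-refl 1≥0)
        go (no _) (yes h) _ = ⊥-elim (killAt₁ T Aw W (+ 1) (- + 1) (+ 2) (+ 0) (+ 0) (+ 0) 1≥0 refl 3∤-1
              (lin 2 (λ n σ → n :- σ := # 1 ⇒ # 3 :≤ n ⇒ ⊢ # 3 :≤ con (- + 1) :* σ :+ # 2 :* n) n σ h n≥3) (lin 2 (λ n σ → n :- σ := # 1 ⇒ ⊢ con (- + 1) :≤ con (- + 1) :* (n :- σ) :+ # 0 :* n) n σ h)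
              (lin 1 (λ n → ⊢ con (- + 1) :≤ con (- + 1) :* # 1 :+ # 0 :* n) n) (lin 1 (λ n → ⊢ # 0 :≤ con (- + 1) :* con (- + 1) :+ # 0 :* n) n))
        go (no h) (no h′) (yes h″) = ⊥-elim (killAt₁ T Aw W (+ 2) (- + 1) (+ 2) (+ 0) (+ 0) (+ 0) 2≥0 refl 3∤-1
              (lin 2 (λ n σ → n :- σ := # 2 ⇒ # 4 :≤ n ⇒ ⊢ # 6 :≤ con (- + 1) :* σ :+ # 2 :* n) n σ two h″) (lin 2 (λ n σ → n :- σ := # 2 ⇒ ⊢ con (- + 2) :≤ con (- + 1) :* (n :- σ) :+ # 0 :* n) n σ two)
              (lin 1 (λ n → ⊢ con (- + 2) :≤ con (- + 1) :* # 1 :+ # 0 :* n) n) (lin 1 (λ n → ⊢ # 0 :≤ con (- + 1) :* con (- + 1) :+ # 0 :* n) n))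
          where
          two : n - σ ≡ + 2
          two = ℤₚ.≤-antisym (lin 1 (λ x → x :< # 3 ⇒ ⊢ x :≤ # 2) (n - σ) (ℤₚ.≰⇒> h))
            (lin 1 (λ x → # 1 :< x ⇒ ⊢ # 2 :≤ x) (n - σ) (ℤₚ.≤∧≢⇒< (lin 2 (λ n σ → σ :< n ⇒ ⊢ # 1 :≤ n :- σ) n σ σ<n) (λ e → h′ (sym e))))
        go (no h) (no h′) (no h″) = n3 , lin 2 (λ n σ → n :- σ := # 2 ⇒ n := # 3 ⇒ ⊢ σ := # 1) n σ two n3
          where
          n3 : n ≡ + 3
          n3 = volume (lin 1 (λ n → n :< # 4 ⇒ ⊢ n :< # 6) n (ℤₚ.≰⇒> h″)) refl
          two : n - σ ≡ + 2
          two = ℤₚ.≤-antisym (lin 1 (λ x → x :< # 3 ⇒ ⊢ x :≤ # 2) (n - σ) (ℤₚ.≰⇒> h))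
            (lin 1 (λ x → # 1 :< x ⇒ ⊢ # 2 :≤ x) (n - σ) (ℤₚ.≤∧≢⇒< (lin 2 (λ n σ → σ :< n ⇒ ⊢ # 1 :≤ n :- σ) n σ σ<n) (λ e → h′ (sym e))))

  Outcome : ∀ {p q r s} → WhiteTet A p q r s → Z3 → Set
  Outcome T w = let open WhiteTet T in ∃ λ a → ∃ λ b → ∃ λ c → ∃ λ d → Out n σ a b c d × At tet w a b c d

  private
    module Level {p q r s} (T : WhiteTet A p q r s) {w} (Aw : A w) where
      open WhiteTet T
      a = W₁ ⟨ w ⟩
      b = W₂ ⟨ w ⟩
      c = W₃ ⟨ w ⟩
      d = W₄ ⟨ w ⟩

      -- With γ = -c, the contraction of w by 1/γ reaches the level W₃ = -1, which contains the
      -- forbidden points j p + (2 - j) q - zσ. Such a point dominates if j γ lies between m and m +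
      -- γ - x.
      section : ∀ x m j → a - σ * c ≡ m * n → a + b ≡ x * n → c < + 0 → d ≤ - c → m ≤ j * - c → j * - c ≤ m + - c - x → ⊥
      section x m j e e′ c<0 d≤ h₁ h₂ = kill₁ T Aw (+ 1) (- c) (- + 1) j (+ 2 - j) (+ 0) (+ 0) 1≥0 (lin 1 (λ c → c :< # 0 ⇒ ⊢ # 0 :< :- c) c c<0)
        (lin 1 (λ j → ⊢ con (- + 1) :+ j :+ (# 2 :- j) :+ # 0 :+ # 0 := # 1) j) 3∤-1
        (lin 6 (λ a c σ m n j → a :- σ :* c := m :* n ⇒ # 0 :≤ (j :* (:- c) :- m) :* n ⇒ ⊢ # 1 :* a :≤ (:- c) :* (con (- + 1) :* σ :+ j :* n)) a c σ m n j e (mul≥0 (ℤₚ.i≤j⇒0≤j-i h₁) (ℤₚ.<⇒≤ n>0)))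
        (lin 8 (λ a b c σ m n j x → a :- σ :* c := m :* n ⇒ a :+ b := x :* n ⇒ # 0 :≤ (m :+ (:- c) :- x :- j :* (:- c)) :* n ⇒ ⊢ # 1 :* b :≤ (:- c) :* (con (- + 1) :* (n :- σ) :+ (# 2 :- j) :* n)) a b c σ m n j x e e′ (mul≥0 (ℤₚ.i≤j⇒0≤j-i h₂) (ℤₚ.<⇒≤ n>0)))
        (lin 2 (λ c n → ⊢ # 1 :* c :≤ (:- c) :* (con (- + 1) :* # 1 :+ # 0 :* n)) c n)
        (lin 3 (λ c d n → d :≤ :- c ⇒ ⊢ # 1 :* d :≤ (:- c) :* (con (- + 1) :* con (- + 1) :+ # 0 :* n)) c d n d≤)

      -- For x = 1 the interval from m to m + γ - 1 contains a multiple of γ.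
      offLine : a + b ≡ n → c < + 0 → ⊥
      offLine e c<0 = go (cyc w)
        where
        g>0 : + 0 < - c
        g>0 = lin 1 (λ c → c :< # 0 ⇒ ⊢ # 0 :< :- c) c c<0
        go : n ∣ᶻ (a - σ * c) → ⊥
        go (m , f) = go′ (ceiling (- c) g>0 m)
          where
          go′ : (∃ λ j → (j - + 1) * - c < m × m ≤ j * - c) → ⊥
          go′ (j , l , u) = section (+ 1) m j f (trans e (sym (ℤₚ.*-identityˡ n))) c<0
            (lin 5 (λ a b c d n → a :+ b :+ c :+ d := n ⇒ a :+ b := n ⇒ ⊢ d :≤ :- c) a b c d n (sumW w) e) u
            (lin 3 (λ j g m → (j :- # 1) :* g :< m ⇒ ⊢ j :* g :≤ m :+ g :- # 1) j (- c) m l)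

      -- For x = 2 the interval from m to m + γ - 2 misses the multiples of γ only if γ divides m -
      -- 1; `e₀` is the quotient.
      half : a + b ≡ + 2 * n → c < + 0 → d ≤ + 0 → ∃ λ e₀ → a - σ * c - n ≡ e₀ * - c * n
      half e c<0 d≤0 = go (cyc w)
        where
        g>0 : + 0 < - c
        g>0 = lin 1 (λ c → c :< # 0 ⇒ ⊢ # 0 :< :- c) c c<0
        go : n ∣ᶻ (a - σ * c) → ∃ λ e₀ → a - σ * c - n ≡ e₀ * - c * n
        go (m , f) = go′ (ceiling (- c) g>0 m)
          where
          go′ : (∃ λ j → (j - + 1) * - c < m × m ≤ j * - c) → ∃ λ e₀ → a - σ * c - n ≡ e₀ * - c * n
          go′ (j , l , u) = j - + 1 , by (j * - c ℤₚ.≤? m + - c - + 2)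
            where
            by : Dec (j * - c ≤ m + - c - + 2) → a - σ * c - n ≡ (j - + 1) * - c * n
            by (yes h) = ⊥-elim (section (+ 2) m j f e c<0 (lin 2 (λ c d → c :< # 0 ⇒ d :≤ # 0 ⇒ ⊢ d :≤ :- c) c d c<0 d≤0) u h)
            by (no h) = trans (cong (_- n) f) (trans (lin 2 (λ m n → ⊢ m :* n :- n := (m :- # 1) :* n) m n) (cong (_* n)
              (sym (lin 3 (λ j g m → (j :- # 1) :* g :< m ⇒ m :+ g :- # 2 :< j :* g ⇒ ⊢ (j :- # 1) :* g := m :- # 1) j (- c) m l (ℤₚ.≰⇒> h)))))

    -- With c = -γ and d = -γ', where γ + γ' = n, the two halves give γ e = γ' e' = a - n and n | e + e', hence γ' | e; so 3 | σ.
    interior : ∀ {p q r s} (T : WhiteTet A p q r s) {w} → A w → let open WhiteTet T in W₁ ⟨ w ⟩ + W₂ ⟨ w ⟩ ≡ + 2 * n → W₃ ⟨ w ⟩ < + 0 → W₄ ⟨ w ⟩ < + 0 → ⊥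
    interior T {w} Aw e c<0 d<0 = go (Level.half T Aw e c<0 (ℤₚ.<⇒≤ d<0)) (Level.half (wsw34 A T) Aw e d<0 (ℤₚ.<⇒≤ c<0)) (3∣W₄ w Aw) 3∣n
      where
      open WhiteTet T
      a = W₁ ⟨ w ⟩
      b = W₂ ⟨ w ⟩
      c = W₃ ⟨ w ⟩
      d = W₄ ⟨ w ⟩
      go : (∃ λ e₀ → a - σ * c - n ≡ e₀ * - c * n) → (∃ λ e₁ → a - (n - σ) * d - n ≡ e₁ * - d * n) → + 3 ∣ᶻ d → + 3 ∣ᶻ n → ⊥
      go (e₀ , f₀) (e₁ , f₁) (k , g) (h , g′) = 3∤σ T (e₀ * h + k * (e₀ + e₁ - + 1) , trans σ≡ (trans (cong₂ (λ x y → e₀ * x + y * (e₀ + e₁ - + 1)) g′ g)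
          (lin 4 (λ e₀ e₁ h k → ⊢ e₀ :* (h :* # 3) :+ k :* # 3 :* (e₀ :+ e₁ :- # 1) := (e₀ :* h :+ k :* (e₀ :+ e₁ :- # 1)) :* # 3) e₀ e₁ h k)))
        where
        c≡ : c ≡ - n - d
        c≡ = lin 5 (λ a b c d n → a :+ b :+ c :+ d := n ⇒ a :+ b := # 2 :* n ⇒ ⊢ c := :- n :- d) a b c d n (sumW w) e
        σ≡ : σ ≡ e₀ * n + d * (e₀ + e₁ - + 1)
        σ≡ = cancel≡ σ (e₀ * n + d * (e₀ + e₁ - + 1)) n>0 (arith a c d f₀ f₁ c≡)
          where
          arith : ∀ a c d → a - σ * c - n ≡ e₀ * - c * n → a - (n - σ) * d - n ≡ e₁ * - d * n → c ≡ - n - d → σ * n ≡ (e₀ * n + d * (e₀ + e₁ - + 1)) * n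
          arith a _ d p q refl = lin 6 (λ a d n σ e₀ e₁ → a :- σ :* (:- n :- d) :- n := e₀ :* (:- (:- n :- d)) :* n ⇒ a :- (n :- σ) :* d :- n := e₁ :* (:- d) :* n ⇒ ⊢ σ :* n := (e₀ :* n :+ d :* (e₀ :+ e₁ :- # 1)) :* n) a d n σ e₀ e₁ p q

    zeroOrMinus : ∀ {n} x → + 0 < n → - n ≤ x * n → x * n ≤ + 0 → x ≡ + 0 ⊎ x ≡ - + 1
    zeroOrMinus {n} x n>0 l u = go (small₃ (x + + 1) (lin 1 (λ x → con (- + 1) :≤ x ⇒ ⊢ # 0 :≤ x :+ # 1) x (cancel≤ (- + 1) x n>0 (lin 2 (λ n y → :- n :≤ y ⇒ ⊢ con (- + 1) :* n :≤ y) n (x * n) l)))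
        (lin 1 (λ x → x :≤ # 0 ⇒ ⊢ x :+ # 1 :< # 3) x x≤0))
      where
      x≤0 : x ≤ + 0
      x≤0 = cancel≤ x (+ 0) n>0 (subst (x * n ≤_) (sym (ℤₚ.*-zeroˡ n)) u)
      go : x + + 1 ≡ + 0 ⊎ x + + 1 ≡ + 1 ⊎ x + + 1 ≡ + 2 → x ≡ + 0 ⊎ x ≡ - + 1
      go (inj₁ e) = inj₂ (lin 1 (λ x → x :+ # 1 := # 0 ⇒ ⊢ x := con (- + 1)) x e)
      go (inj₂ (inj₁ e)) = inj₁ (lin 1 (λ x → x :+ # 1 := # 1 ⇒ ⊢ x := # 0) x e)
      go (inj₂ (inj₂ e)) = ⊥-elim (lin 1 (λ x → x :+ # 1 := # 2 ⇒ x :≤ # 0 ⇒ ⊢ :⊥) x e x≤0)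

    -- W₁(w) exceeds n, so tightness makes the first coordinate dominant and the others at least -n;
    -- hence x is 2 or 3. The case in which W₃ and W₄ are both negative and x = 2 is excluded by
    -- `interior`; in all others the coordinates are multiples of n.
    peak : ∀ {p q r s} (T : WhiteTet A p q r s) w → A w → let open WhiteTet T in Tight C tet w → ∀ x → W₁ ⟨ w ⟩ + W₂ ⟨ w ⟩ ≡ x * n → + 2 ≤ x → W₂ ⟨ w ⟩ ≤ + 0 → Outcome T w
    peak T w Aw (t₁ , t₂ , t₃ , t₄) x e x≥2 b≤0 = go t₁ t₂ t₃ t₄
      where
      open WhiteTet T
      open Forbidden T Aw
      a = W₁ ⟨ w ⟩
      b = W₂ ⟨ w ⟩
      c = W₃ ⟨ w ⟩
      d = W₄ ⟨ w ⟩
      2n≤ : + 2 * n ≤ x * n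
      2n≤ = lin 2 (λ x n → # 0 :≤ (x :- # 2) :* n ⇒ ⊢ # 2 :* n :≤ x :* n) x n (mul≥0 (ℤₚ.i≤j⇒0≤j-i x≥2) (ℤₚ.<⇒≤ n>0))
      go : TightAt C n a b c d → TightAt C n b a c d → TightAt C n c a b d → TightAt C n d a b c → Outcome T w
      go (inj₁ (h , _)) _ _ _ = ⊥-elim (lin 4 (λ a b xn n → a :+ b := xn ⇒ # 2 :* n :≤ xn ⇒ b :≤ # 0 ⇒ a :≤ n ⇒ # 0 :< n ⇒ ⊢ :⊥) a b (x * n) n e 2n≤ b≤0 h n>0)
      go (inj₂ _) (inj₂ (h , _)) _ _ = ⊥-elim (ℤₚ.<-irrefl refl (ℤₚ.<-≤-trans h b≤0))
      go (inj₂ (_ , _ , c≤0 , _)) (inj₁ _) (inj₂ (h , _)) _ = ⊥-elim (ℤₚ.<-irrefl refl (ℤₚ.<-≤-trans h c≤0))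
      go (inj₂ (_ , _ , _ , d≤0)) (inj₁ _) (inj₁ _) (inj₂ (h , _)) = ⊥-elim (ℤₚ.<-irrefl refl (ℤₚ.<-≤-trans h d≤0))
      go (inj₂ (_ , _ , c≤0 , d≤0)) (inj₁ (_ , b≥)) (inj₁ (_ , c≥)) (inj₁ (_ , d≥)) = byX (x ℤₚ.≟ + 2)
        where
        x≤3 : x ≤ + 3
        x≤3 = cancel≤ x (+ 3) n>0 (lin 6 (λ a b c d n xn → a :+ b :+ c :+ d := n ⇒ a :+ b := xn ⇒ :- n :≤ c ⇒ :- n :≤ d ⇒ ⊢ xn :≤ # 3 :* n) a b c d n (x * n) (sumW w) e c≥ d≥)
        multiples : ∀ y → c ≡ y * n → ∀ x′ → a + b ≡ x′ * n → ∃ λ m → a ≡ (x′ - m) * n × b ≡ m * n × (m ≡ + 0 ⊎ m ≡ - + 1)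
        multiples y ec x′ e′ = done (cyc w)
          where
          done : n ∣ᶻ (a - σ * c) → ∃ λ m → a ≡ (x′ - m) * n × b ≡ m * n × (m ≡ + 0 ⊎ m ≡ - + 1)
          done (k , f) = x′ - k - σ * y , a≡ , b≡ , zeroOrMinus (x′ - k - σ * y) n>0 (subst (- n ≤_) b≡ b≥) (subst (_≤ + 0) b≡ b≤0)
            where
            a≡ : a ≡ (x′ - (x′ - k - σ * y)) * n
            a≡ = lin 7 (λ a σc k n x′ σ y → a :- σc := k :* n ⇒ σc := σ :* (y :* n) ⇒ ⊢ a := (x′ :- (x′ :- k :- σ :* y)) :* n) a (σ * c) k n x′ σ y f (cong (σ *_) ec)
            b≡ : b ≡ (x′ - k - σ * y) * n
            b≡ = lin 6 (λ a b k n x′ t → a :+ b := x′ :* n ⇒ a := (x′ :- t) :* n ⇒ ⊢ b := t :* n) a b k n x′ (x′ - k - σ * y) e′ a≡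
        byX : Dec (x ≡ + 2) → Outcome T w
        byX (no x≢2) = fin (multiples (- + 1) (trans c≡ (sym (ℤₚ.-1*i≡-i n))) (+ 3) e₃)
          where
          x≡3 : x ≡ + 3
          x≡3 = ℤₚ.≤-antisym x≤3 (lin 1 (λ x → # 2 :< x ⇒ ⊢ # 3 :≤ x) x (ℤₚ.≤∧≢⇒< x≥2 (λ h → x≢2 (sym h))))
          e₃ : a + b ≡ + 3 * n
          e₃ = trans e (cong (_* n) x≡3)
          c≡ : c ≡ - n
          c≡ = lin 5 (λ a b c d n → a :+ b :+ c :+ d := n ⇒ a :+ b := # 3 :* n ⇒ :- n :≤ c ⇒ :- n :≤ d ⇒ ⊢ c := :- n) a b c d n (sumW w) e₃ c≥ d≥
          d≡ : d ≡ - n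
          d≡ = lin 5 (λ a b c d n → a :+ b :+ c :+ d := n ⇒ a :+ b := # 3 :* n ⇒ :- n :≤ c ⇒ :- n :≤ d ⇒ ⊢ d := :- n) a b c d n (sumW w) e₃ c≥ d≥
          fin : (∃ λ m → a ≡ (+ 3 - m) * n × b ≡ m * n × (m ≡ + 0 ⊎ m ≡ - + 1)) → Outcome T w
          fin (_ , a≡ , b≡ , inj₁ refl) = _ , _ , _ , _ , f1 (is3011 W) , W
            where W = at a≡ b≡ (trans c≡ (sym (ℤₚ.-1*i≡-i n))) (trans d≡ (sym (ℤₚ.-1*i≡-i n)))
          fin (_ , a≡ , b≡ , inj₂ refl) = ⊥-elim (no4 (at a≡ b≡ (trans c≡ (sym (ℤₚ.-1*i≡-i n))) (trans d≡ (sym (ℤₚ.-1*i≡-i n)))))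
        byX (yes refl) = byZero (c ℤₚ.≟ + 0) (d ℤₚ.≟ + 0)
          where
          byZero : Dec (c ≡ + 0) → Dec (d ≡ + 0) → Outcome T w
          byZero (yes c0) _ = fin (multiples (+ 0) (trans c0 (sym (ℤₚ.*-zeroˡ n))) (+ 2) e)
            where
            c≡ : c ≡ + 0 * n
            c≡ = trans c0 (sym (ℤₚ.*-zeroˡ n))
            d≡ : d ≡ - + 1 * n
            d≡ = lin 5 (λ a b c d n → a :+ b :+ c :+ d := n ⇒ a :+ b := # 2 :* n ⇒ c := # 0 ⇒ ⊢ d := con (- + 1) :* n) a b c d n (sumW w) e c0
            fin : (∃ λ m → a ≡ (+ 2 - m) * n × b ≡ m * n × (m ≡ + 0 ⊎ m ≡ - + 1)) → Outcome T w
            fin (_ , a≡ , b≡ , inj₁ refl) = _ , _ , _ , _ , out34 (l13 (Forbidden.is2010 (wsw34 A T) Aw (at34 W))) , W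
              where W = at a≡ b≡ c≡ d≡
            fin (_ , a≡ , b≡ , inj₂ refl) = _ , _ , _ , _ , out34 (g1 (proj₁ r) (proj₂ r)) , W
              where
              W = at a≡ b≡ c≡ d≡
              r = Forbidden.is3110 (wsw34 A T) Aw (at34 W)
          byZero (no _) (yes d0) = fin (multiples (- + 1) c≡ (+ 2) e)
            where
            d≡ : d ≡ + 0 * n
            d≡ = trans d0 (sym (ℤₚ.*-zeroˡ n))
            c≡ : c ≡ - + 1 * n
            c≡ = lin 5 (λ a b c d n → a :+ b :+ c :+ d := n ⇒ a :+ b := # 2 :* n ⇒ d := # 0 ⇒ ⊢ c := con (- + 1) :* n) a b c d n (sumW w) e d0
            fin : (∃ λ m → a ≡ (+ 2 - m) * n × b ≡ m * n × (m ≡ + 0 ⊎ m ≡ - + 1)) → Outcome T w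
            fin (_ , a≡ , b≡ , inj₁ refl) = _ , _ , _ , _ , l13 (is2010 W) , W
              where W = at a≡ b≡ c≡ d≡
            fin (_ , a≡ , b≡ , inj₂ refl) = _ , _ , _ , _ , g1 (proj₁ (is3110 W)) (proj₂ (is3110 W)) , W
              where W = at a≡ b≡ c≡ d≡
          byZero (no c≢0) (no d≢0) = ⊥-elim (interior T Aw e (ℤₚ.≤∧≢⇒< c≤0 c≢0) (ℤₚ.≤∧≢⇒< d≤0 d≢0))

    -- With two positive coordinates none is dominant, so both are n. Tightness leaves (1, 1, 0, -1)
    -- and (1, 1, -1, 0), and these are dominated by zσ and by p + q - zσ.
    parallelogram : ∀ {p q r s} (T : WhiteTet A p q r s) w → A w → let open WhiteTet T in Tight C tet w → ∀ x → W₁ ⟨ w ⟩ + W₂ ⟨ w ⟩ ≡ x * n → + 2 ≤ x → + 0 < W₁ ⟨ w ⟩ → + 0 < W₂ ⟨ w ⟩ → ⊥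
    parallelogram T w Aw (t₁ , t₂ , t₃ , t₄) x e x≥2 a>0 b>0 = go t₁ t₂ t₃ t₄
      where
      open WhiteTet T
      open Forbidden T Aw
      a = W₁ ⟨ w ⟩
      b = W₂ ⟨ w ⟩
      c = W₃ ⟨ w ⟩
      d = W₄ ⟨ w ⟩
      2n≤ : + 2 * n ≤ x * n
      2n≤ = lin 2 (λ x n → # 0 :≤ (x :- # 2) :* n ⇒ ⊢ # 2 :* n :≤ x :* n) x n (mul≥0 (ℤₚ.i≤j⇒0≤j-i x≥2) (ℤₚ.<⇒≤ n>0))
      clash : ∀ {y} → + 0 < y → y ≤ + 0 → ⊥
      clash h h′ = ℤₚ.<-irrefl refl (ℤₚ.<-≤-trans h h′)
      go : TightAt C n a b c d → TightAt C n b a c d → TightAt C n c a b d → TightAt C n d a b c → ⊥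
      go (inj₂ (_ , h , _)) _ _ _ = clash b>0 h
      go _ (inj₂ (_ , h , _)) _ _ = clash a>0 h
      go _ _ (inj₂ (_ , h , _)) _ = clash a>0 h
      go _ _ _ (inj₂ (_ , h , _)) = clash a>0 h
      go (inj₁ (a≤ , _)) (inj₁ (b≤ , _)) (inj₁ (_ , c≥)) (inj₁ (_ , d≥)) = fin (cycρ w)
        where
        a≡ : a ≡ + 1 * n
        a≡ = lin 4 (λ a b n xn → a :+ b := xn ⇒ # 2 :* n :≤ xn ⇒ a :≤ n ⇒ b :≤ n ⇒ ⊢ a := # 1 :* n) a b n (x * n) e 2n≤ a≤ b≤
        b≡ : b ≡ + 1 * n
        b≡ = lin 4 (λ a b n xn → a :+ b := xn ⇒ # 2 :* n :≤ xn ⇒ a :≤ n ⇒ b :≤ n ⇒ ⊢ b := # 1 :* n) a b n (x * n) e 2n≤ a≤ b≤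
        fin : n ∣ᶻ (c - ρ * a) → ⊥
        fin (k , f) = by (zeroOrMinus (k + ρ) n>0 (subst (- n ≤_) c≡ c≥) (subst (_≤ + 0) c≡ c≤0))
          where
          c≡ : c ≡ (k + ρ) * n
          c≡ = lin 5 (λ c k n ρ ρa → c :- ρa := k :* n ⇒ ρa := ρ :* (# 1 :* n) ⇒ ⊢ c := (k :+ ρ) :* n) c k n ρ (ρ * a) f (cong (ρ *_) a≡)
          c≤0 : c ≤ + 0
          c≤0 = lin 5 (λ a b c d n → a :+ b :+ c :+ d := n ⇒ a := # 1 :* n ⇒ b := # 1 :* n ⇒ :- n :≤ d ⇒ ⊢ c :≤ # 0) a b c d n (sumW w) a≡ b≡ d≥
          d≡ : d ≡ (- + 1 - (k + ρ)) * n
          d≡ = lin 6 (λ a b c d n y → a :+ b :+ c :+ d := n ⇒ a := # 1 :* n ⇒ b := # 1 :* n ⇒ c := y :* n ⇒ ⊢ d := (con (- + 1) :- y) :* n) a b c d n (k + ρ) (sumW w) a≡ b≡ c≡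
          σ≥1 : + 1 ≤ σ
          σ≥1 = lin 1 (λ σ → # 0 :< σ ⇒ ⊢ # 1 :≤ σ) σ σ>0
          σ≤ : + 1 ≤ n - σ
          σ≤ = lin 2 (λ σ n → σ :< n ⇒ ⊢ # 1 :≤ n :- σ) σ n σ<n
          by : k + ρ ≡ + 0 ⊎ k + ρ ≡ - + 1 → ⊥
          by (inj₁ h) = lower (at a≡ b≡ (trans c≡ (cong (_* n) h)) (trans d≡ (cong (λ y → (- + 1 - y) * n) h))) σ≥1 σ≤ 1≥0 ℤₚ.≤-refl
          by (inj₂ h) = upper (at a≡ b≡ (trans c≡ (cong (_* n) h)) (trans d≡ (cong (λ y → (- + 1 - y) * n) h))) σ≤ σ≥1 ℤₚ.≤-refl 1≥0

    -- `offLine`, applied also with r and s exchanged, confines w to the line pq, where tightness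
    -- permits only the two neighbours of the edge.
    line : ∀ {p q r s} (T : WhiteTet A p q r s) w → A w → let open WhiteTet T in ¬ Inside tet w → Tight C tet w → W₁ ⟨ w ⟩ + W₂ ⟨ w ⟩ ≡ n → Outcome T w
    line T w Aw out (t₁ , t₂ , t₃ , t₄) e = byC (c ℤₚ.≟ + 0) (c ℤₚ.<? + 0)
      where
      open WhiteTet T
      a = W₁ ⟨ w ⟩
      b = W₂ ⟨ w ⟩
      c = W₃ ⟨ w ⟩
      d = W₄ ⟨ w ⟩
      byC : Dec (c ≡ + 0) → Dec (c < + 0) → Outcome T w
      byC (no c≢0) (yes c<0) = ⊥-elim (Level.offLine T Aw e c<0)
      byC (no c≢0) (no c≮0) = ⊥-elim (Level.offLine (wsw34 A T) Aw e (lin 5 (λ a b c d n → a :+ b :+ c :+ d := n ⇒ a :+ b := n ⇒ # 0 :< c ⇒ ⊢ d :< # 0) a b c d n (sumW w) e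
        (ℤₚ.≤∧≢⇒< (ℤₚ.≮⇒≥ c≮0) (λ h → c≢0 (sym h)))))
      byC (yes c0) _ = byK (cyc w)
        where
        d0 : d ≡ + 0
        d0 = lin 5 (λ a b c d n → a :+ b :+ c :+ d := n ⇒ a :+ b := n ⇒ c := # 0 ⇒ ⊢ d := # 0) a b c d n (sumW w) e c0
        c≡ : c ≡ + 0 * n
        c≡ = trans c0 (sym (ℤₚ.*-zeroˡ n))
        d≡ : d ≡ + 0 * n
        d≡ = trans d0 (sym (ℤₚ.*-zeroˡ n))
        byK : n ∣ᶻ (a - σ * c) → Outcome T w
        byK (k , f) = split (+ 0 ℤₚ.≤? k) (k ℤₚ.≤? + 1) t₁ t₂
          where
          a≡ : a ≡ k * n
          a≡ = lin 4 (λ a σc k n → a :- σc := k :* n ⇒ σc := # 0 ⇒ ⊢ a := k :* n) a (σ * c) k n f (trans (cong (σ *_) c0) (ℤₚ.*-zeroʳ σ))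
          b≡ : b ≡ (+ 1 - k) * n
          b≡ = lin 4 (λ a b k n → a :+ b := n ⇒ a := k :* n ⇒ ⊢ b := (# 1 :- k) :* n) a b k n e a≡
          split : Dec (+ 0 ≤ k) → Dec (k ≤ + 1) → TightAt C n a b c d → TightAt C n b a c d → Outcome T w
          split (yes l) (yes u) _ _ = ⊥-elim (out (subst (+ 0 ≤_) (sym a≡) (mul≥0 l (ℤₚ.<⇒≤ n>0)) , subst (+ 0 ≤_) (sym b≡) (mul≥0 (ℤₚ.i≤j⇒0≤j-i u) (ℤₚ.<⇒≤ n>0)) , ℤₚ.≤-reflexive (sym c0) , ℤₚ.≤-reflexive (sym d0)))
          split (no l) _ (inj₂ (h , _)) _ = ⊥-elim (l (ℤₚ.<⇒≤ (cancel< (+ 0) k n>0 (subst₂′ (ℤₚ.*-zeroˡ n) a≡ h))))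
            where
            subst₂′ : ∀ {x y} → + 0 * n ≡ x → a ≡ y → x < a → + 0 * n < y
            subst₂′ refl refl h = h
          split (no l) _ (inj₁ (_ , h)) _ = _ , _ , _ , _ , l21 , at (trans a≡ (cong (_* n) k≡)) (trans b≡ (cong (λ y → (+ 1 - y) * n) k≡)) c≡ d≡
            where
            k≡ : k ≡ - + 1
            k≡ = ℤₚ.≤-antisym (lin 1 (λ k → k :< # 0 ⇒ ⊢ k :≤ con (- + 1)) k (ℤₚ.≰⇒> l)) (cancel≤ (- + 1) k n>0 (lin 3 (λ a n kn → :- n :≤ a ⇒ a := kn ⇒ ⊢ con (- + 1) :* n :≤ kn) a n (k * n) h a≡))
          split (yes _) (no u) _ (inj₂ (h , _)) = ⊥-elim (u (ℤₚ.<⇒≤ (lin 1 (λ k → # 0 :< # 1 :- k ⇒ ⊢ k :< # 1) k (cancel< (+ 0) (+ 1 - k) n>0 (subst₂′ (ℤₚ.*-zeroˡ n) b≡ h)))))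
            where
            subst₂′ : ∀ {x y} → + 0 * n ≡ x → b ≡ y → x < b → + 0 * n < y
            subst₂′ refl refl h = h
          split (yes _) (no u) _ (inj₁ (_ , h)) = _ , _ , _ , _ , l12 , at (trans a≡ (cong (_* n) k≡)) (trans b≡ (cong (λ y → (+ 1 - y) * n) k≡)) c≡ d≡
            where
            k≡ : k ≡ + 2
            k≡ = ℤₚ.≤-antisym (lin 1 (λ k → con (- + 1) :≤ # 1 :- k ⇒ ⊢ k :≤ # 2) k (cancel≤ (- + 1) (+ 1 - k) n>0 (lin 3 (λ b n kn → :- n :≤ b ⇒ b := kn ⇒ ⊢ con (- + 1) :* n :≤ kn) b n ((+ 1 - k) * n) h b≡)))
                   (lin 1 (λ k → # 1 :< k ⇒ ⊢ # 2 :≤ k) k (ℤₚ.≰⇒> u))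

    tight12 : ∀ {p q r s} (T : Tet p q r s) w → Tight C T w → Tight C (sw12 T) w
    tight12 T w (t₁ , t₂ , t₃ , t₄) = t₂ , t₁ , sw t₃ , sw t₄
      where
      sw : ∀ {n a b c d} → TightAt C n a b c d → TightAt C n a c b d
      sw (inj₁ h) = inj₁ h
      sw (inj₂ (h₁ , h₂ , h₃ , h₄)) = inj₂ (h₁ , h₃ , h₂ , h₄)

    tightflip : ∀ {p q r s} (T : Tet p q r s) w → Tight C T w → Tight C (sw23 (sw34 (sw12 (sw23 T)))) w
    tightflip T w (t₁ , t₂ , t₃ , t₄) = sw t₃ , sw t₄ , sw′ t₁ , sw′ t₂
      where
      sw : ∀ {n a b c d} → TightAt C n a b c d → TightAt C n a d b c
      sw (inj₁ h) = inj₁ h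
      sw (inj₂ (h₁ , h₂ , h₃ , h₄)) = inj₂ (h₁ , h₄ , h₂ , h₃)
      sw′ : ∀ {n a b c d} → TightAt C n a b c d → TightAt C n a c d b
      sw′ (inj₁ h) = inj₁ h
      sw′ (inj₂ (h₁ , h₂ , h₃ , h₄)) = inj₂ (h₁ , h₃ , h₄ , h₂)

    classify⁺ : ∀ {p q r s} (T : WhiteTet A p q r s) w → A w → let open WhiteTet T in ¬ Inside tet w → Tight C tet w → ∀ x → W₁ ⟨ w ⟩ + W₂ ⟨ w ⟩ ≡ x * n → + 1 ≤ x → Outcome T w
    classify⁺ T w Aw out t x e x≥1 = byX (x ℤₚ.≟ + 1) (W₁ ⟨ w ⟩ ℤₚ.≤? + 0) (W₂ ⟨ w ⟩ ℤₚ.≤? + 0)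
      where
      open WhiteTet T
      x≥2 : x ≢ + 1 → + 2 ≤ x
      x≥2 h = lin 1 (λ x → # 1 :< x ⇒ ⊢ # 2 :≤ x) x (ℤₚ.≤∧≢⇒< x≥1 (λ h′ → h (sym h′)))
      byX : Dec (x ≡ + 1) → Dec (W₁ ⟨ w ⟩ ≤ + 0) → Dec (W₂ ⟨ w ⟩ ≤ + 0) → Outcome T w
      byX (yes refl) _ _ = line T w Aw out t (trans e (ℤₚ.*-identityˡ n))
      byX (no h) _ (yes b≤0) = peak T w Aw t x e (x≥2 h) b≤0
      byX (no h) (yes a≤0) (no _) = back (peak (wsw12 A T) w Aw (tight12 tet w t) x (trans (ℤₚ.+-comm (W₂ ⟨ w ⟩) (W₁ ⟨ w ⟩)) e) (x≥2 h) a≤0)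
        where
        back : Outcome (wsw12 A T) w → Outcome T w
        back (a , b , c , d , o , at w₁ w₂ w₃ w₄) = b , a , c , d , out12 o , at w₂ w₁ w₃ w₄
      byX (no h) (no a>0) (no b>0) = ⊥-elim (parallelogram T w Aw t x e (x≥2 h) (ℤₚ.≰⇒> a>0) (ℤₚ.≰⇒> b>0))

  σ-from-ρ : ∀ {p q r s} (T : WhiteTet A p q r s) → let open WhiteTet T in (ρ ≡ + 1 → σ ≡ + 1) × (ρ ≡ n - + 1 → σ ≡ n - + 1)
  σ-from-ρ T = one , minus
    where
    open WhiteTet T
    one : ρ ≡ + 1 → σ ≡ + 1
    one e = go σρ
      where
      go : n ∣ᶻ (+ 1 - σ * ρ) → σ ≡ + 1
      go (k , f) = ℤₚ.≤-antisym (ℤₚ.≮⇒≥ λ h → no-multiple n (σ - + 1) (lin 1 (λ σ → # 1 :< σ ⇒ ⊢ # 1 :≤ σ :- # 1) σ h) (lin 2 (λ σ n → σ :< n ⇒ ⊢ σ :- # 1 :< n) σ n σ<n) (- k , val)) (lin 1 (λ σ → # 0 :< σ ⇒ ⊢ # 1 :≤ σ) σ σ>0)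
        where
        val : σ - + 1 ≡ - k * n
        val = lin 4 (λ σ m k n → # 1 :- m := k :* n ⇒ m := σ :* # 1 ⇒ ⊢ σ :- # 1 := (:- k) :* n) σ (σ * ρ) k n f (cong (σ *_) e)
    minus : ρ ≡ n - + 1 → σ ≡ n - + 1
    minus e = go σρ
      where
      go : n ∣ᶻ (+ 1 - σ * ρ) → σ ≡ n - + 1
      go (k , f) = ℤₚ.≤-antisym (lin 2 (λ σ n → σ :< n ⇒ ⊢ σ :≤ n :- # 1) σ n σ<n) (ℤₚ.≮⇒≥ λ h → no-multiple n (σ + + 1) (lin 1 (λ σ → # 0 :< σ ⇒ ⊢ # 1 :≤ σ :+ # 1) σ σ>0) (lin 2 (λ σ n → σ :< n :- # 1 ⇒ ⊢ σ :+ # 1 :< n) σ n h) (k + σ , val))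
        where
        val : σ + + 1 ≡ (k + σ) * n
        val = lin 4 (λ σ m k n → # 1 :- m := k :* n ⇒ m := σ :* (n :- # 1) ⇒ ⊢ σ :+ # 1 := (k :+ σ) :* n) σ (σ * ρ) k n f (cong (σ *_) e)

  -- W₁ + W₂ and W₃ + W₄ are multiples of n with sum n, so one of them is at least n; `wflip` makes
  -- it the first.
  classify : ∀ {p q r s} (T : WhiteTet A p q r s) w → A w → ¬ Inside (WhiteTet.tet T) w → Tight C (WhiteTet.tet T) w → Outcome T w
  classify T w Aw out t = go (cyc₁₂ w)
    where
    open WhiteTet T
    go : n ∣ᶻ (W₁ ⟨ w ⟩ + W₂ ⟨ w ⟩) → Outcome T w
    go (x , e) = byX (+ 1 ℤₚ.≤? x)
      where
      byX : Dec (+ 1 ≤ x) → Outcome T w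
      byX (yes h) = classify⁺ T w Aw out t x e h
      byX (no h) = back (classify⁺ (wflip A T) w Aw (λ { (a , b , c , d) → out (c , d , a , b) }) (tightflip tet w t) (+ 1 - x)
          (lin 6 (λ a b c d n x → a :+ b :+ c :+ d := n ⇒ a :+ b := x :* n ⇒ ⊢ c :+ d := (# 1 :- x) :* n) (W₁ ⟨ w ⟩) (W₂ ⟨ w ⟩) (W₃ ⟨ w ⟩) (W₄ ⟨ w ⟩) n x (sumW w) e)
          (lin 1 (λ x → x :< # 1 ⇒ ⊢ # 1 :≤ # 1 :- x) x (ℤₚ.≰⇒> h)))
        where
        back : Outcome (wflip A T) w → Outcome T w
        back (a , b , c , d , o , at w₁ w₂ w₃ w₄) = c , d , a , b , outflip (proj₁ (σ-from-ρ T)) (proj₂ (σ-from-ρ T)) o , at w₃ w₄ w₁ w₂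

  record Adjacent {p q r s} (T : WhiteTet A p q r s) (v : Z3) : Set where
    field
      point : Z3
      inA : A point
      between : Between (WhiteTet.tet T) v point
      {a b c d} : ℤ
      out : Out (WhiteTet.n T) (WhiteTet.σ T) a b c d
      coords : At (WhiteTet.tet T) point a b c d

  adjacent : ∀ {p q r s} (T : WhiteTet A p q r s) → BigFree C (WhiteTet.n T) → ∀ v → A v → ¬ Inside (WhiteTet.tet T) v → Adjacent T v
  adjacent T bf v Av out = make (classify T point inA outside tight)
    where
    open WhiteTet T
    open Tightened (tighten C tet (whiteEmpty T) Ap Aq Ar As bf v Av out)
    make : Outcome T point → Adjacent T v
    make (a , b , c , d , o , W) = record { point = point ; inA = inA ; between = between ; out = o ; coords = W }

-- Replacing a vertex without changing the volume

record Replaced {p q r s : Z3} (T : Tet p q r s) (u : Z3) (ε b c d : ℤ) : Set where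
  open Tet T using (n; W₁; W₂; W₃; W₄)
  field
    tet : Tet u q r s
    n≡ : Tet.n tet ≡ n
    new₁ : ∀ z → Tet.W₁ tet ⟨ z ⟩ ≡ ε * W₁ ⟨ z ⟩
    new₂ : ∀ z → Tet.W₂ tet ⟨ z ⟩ ≡ W₂ ⟨ z ⟩ - ε * b * W₁ ⟨ z ⟩
    new₃ : ∀ z → Tet.W₃ tet ⟨ z ⟩ ≡ W₃ ⟨ z ⟩ - ε * c * W₁ ⟨ z ⟩
    new₄ : ∀ z → Tet.W₄ tet ⟨ z ⟩ ≡ W₄ ⟨ z ⟩ - ε * d * W₁ ⟨ z ⟩

-- The new volume is |W₁(u)| = n because ε = ±1. Evaluating the old coordinates by the new ones and
-- solving, again possible because ε is a unit, gives the formulas.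
replaceFirst : ∀ {p q r s} (T : Tet p q r s) u {ε b c d} → At T u ε b c d → ε ≡ + 1 ⊎ ε ≡ - + 1 → Replaced T u ε b c d
replaceFirst {p} {q} {r} {s} T u {ε} {b} {c} {d} (at u₁ u₂ u₃ u₄) ε± = record { tet = T′ ; n≡ = n′≡ ; new₁ = new₁ ; new₂ = new₂ ; new₃ = new₃ ; new₄ = new₄ }
  where
  open Tet T
  unsign : ∀ {ε} → ε ≡ + 1 ⊎ ε ≡ - + 1 → ∣ ε * n ∣ ≡ ∣ n ∣
  unsign (inj₁ refl) = cong ∣_∣ (ℤₚ.*-identityˡ n)
  unsign (inj₂ refl) = trans (cong ∣_∣ (ℤₚ.-1*i≡-i n)) (ℤₚ.∣-i∣≡∣i∣ n)
  ε² : ∀ {ε} → ε ≡ + 1 ⊎ ε ≡ - + 1 → ε * ε ≡ + 1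
  ε² (inj₁ refl) = refl
  ε² (inj₂ refl) = refl
  vol≡ : + vol u q r s ≡ n
  vol≡ = trans (cong +_ (trans (sym (vol₁ u)) (trans (cong ∣_∣ u₁) (unsign ε±)))) (ℤₚ.0≤i⇒+∣i∣≡i (ℤₚ.<⇒≤ n>0))
  T′ = proj₁ (mk u q r s (λ e → ℤₚ.<-irrefl (trans (cong +_ (sym e)) vol≡) n>0))
  module T′ = Tet T′
  n′≡ : T′.n ≡ n
  n′≡ = trans T′.n≡vol vol≡
  T₂ = sw12 T
  T₃ = sw12 (sw23 T)
  T₄ = sw12 (sw23 (sw34 T))
  expand : ∀ f z {y₁ y₂ y₃ y₄} → f ⟨ u ⟩ ≡ y₁ → f ⟨ q ⟩ ≡ y₂ → f ⟨ r ⟩ ≡ y₃ → f ⟨ s ⟩ ≡ y₄ → n * f ⟨ z ⟩ ≡ T′.W₁ ⟨ z ⟩ * y₁ + T′.W₂ ⟨ z ⟩ * y₂ + T′.W₃ ⟨ z ⟩ * y₃ + T′.W₄ ⟨ z ⟩ * y₄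
  expand f z refl refl refl refl = trans (cong (_* f ⟨ z ⟩) (sym n′≡)) (bary T′ f z)
  x₁ : ∀ z → W₁ ⟨ z ⟩ ≡ ε * T′.W₁ ⟨ z ⟩
  x₁ z = cancel≡ (W₁ ⟨ z ⟩) (ε * T′.W₁ ⟨ z ⟩) n>0 (lin 7 (λ n w x₁ x₂ x₃ x₄ ε → n :* w := x₁ :* (ε :* n) :+ x₂ :* # 0 :+ x₃ :* # 0 :+ x₄ :* # 0 ⇒ ⊢ w :* n := ε :* x₁ :* n)
    n (W₁ ⟨ z ⟩) (T′.W₁ ⟨ z ⟩) (T′.W₂ ⟨ z ⟩) (T′.W₃ ⟨ z ⟩) (T′.W₄ ⟨ z ⟩) ε (expand W₁ z u₁ (W₁q T) (W₁r T) (W₁s T)))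
  new₁ : ∀ z → T′.W₁ ⟨ z ⟩ ≡ ε * W₁ ⟨ z ⟩
  new₁ z = sym (trans (cong (ε *_) (x₁ z)) (trans (sym (ℤₚ.*-assoc ε ε (T′.W₁ ⟨ z ⟩))) (trans (cong (_* T′.W₁ ⟨ z ⟩) (ε² ε±)) (ℤₚ.*-identityˡ _))))
  module _ (z : Z3) where
    back : ∀ b w x → w ≡ b * T′.W₁ ⟨ z ⟩ + x → x ≡ w - ε * b * W₁ ⟨ z ⟩
    back b w x h = lin 5 (λ w x t y b → w := b :* t :+ x ⇒ y := b :* t ⇒ ⊢ x := w :- y) w x (T′.W₁ ⟨ z ⟩) (ε * b * W₁ ⟨ z ⟩) b h
      (trans (lin 3 (λ ε b w → ⊢ ε :* b :* w := b :* (ε :* w)) ε b (W₁ ⟨ z ⟩)) (cong (b *_) (sym (new₁ z))))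
    new₂ : T′.W₂ ⟨ z ⟩ ≡ W₂ ⟨ z ⟩ - ε * b * W₁ ⟨ z ⟩
    new₂ = back b (W₂ ⟨ z ⟩) (T′.W₂ ⟨ z ⟩) (cancel≡ (W₂ ⟨ z ⟩) (b * T′.W₁ ⟨ z ⟩ + T′.W₂ ⟨ z ⟩) n>0 (lin 7 (λ n w x₁ x₂ x₃ x₄ b → n :* w := x₁ :* (b :* n) :+ x₂ :* n :+ x₃ :* # 0 :+ x₄ :* # 0 ⇒ ⊢ w :* n := (b :* x₁ :+ x₂) :* n)
      n (W₂ ⟨ z ⟩) (T′.W₁ ⟨ z ⟩) (T′.W₂ ⟨ z ⟩) (T′.W₃ ⟨ z ⟩) (T′.W₄ ⟨ z ⟩) b (expand W₂ z u₂ (W₁p T₂) (W₁r T₂) (W₁s T₂))))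
    new₃ : T′.W₃ ⟨ z ⟩ ≡ W₃ ⟨ z ⟩ - ε * c * W₁ ⟨ z ⟩
    new₃ = back c (W₃ ⟨ z ⟩) (T′.W₃ ⟨ z ⟩) (cancel≡ (W₃ ⟨ z ⟩) (c * T′.W₁ ⟨ z ⟩ + T′.W₃ ⟨ z ⟩) n>0 (lin 7 (λ n w x₁ x₂ x₃ x₄ b → n :* w := x₁ :* (b :* n) :+ x₂ :* # 0 :+ x₃ :* n :+ x₄ :* # 0 ⇒ ⊢ w :* n := (b :* x₁ :+ x₃) :* n)
      n (W₃ ⟨ z ⟩) (T′.W₁ ⟨ z ⟩) (T′.W₂ ⟨ z ⟩) (T′.W₃ ⟨ z ⟩) (T′.W₄ ⟨ z ⟩) c (expand W₃ z u₃ (W₁r T₃) (W₁p T₃) (W₁s T₃))))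
    new₄ : T′.W₄ ⟨ z ⟩ ≡ W₄ ⟨ z ⟩ - ε * d * W₁ ⟨ z ⟩
    new₄ = back d (W₄ ⟨ z ⟩) (T′.W₄ ⟨ z ⟩) (cancel≡ (W₄ ⟨ z ⟩) (d * T′.W₁ ⟨ z ⟩ + T′.W₄ ⟨ z ⟩) n>0 (lin 7 (λ n w x₁ x₂ x₃ x₄ b → n :* w := x₁ :* (b :* n) :+ x₂ :* # 0 :+ x₃ :* # 0 :+ x₄ :* n ⇒ ⊢ w :* n := (b :* x₁ :+ x₄) :* n)
      n (W₄ ⟨ z ⟩) (T′.W₁ ⟨ z ⟩) (T′.W₂ ⟨ z ⟩) (T′.W₃ ⟨ z ⟩) (T′.W₄ ⟨ z ⟩) d (expand W₄ z u₄ (W₁r T₄) (W₁s T₄) (W₁p T₄))))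

-- Moving a tetrahedron along the line of an edge

module Loop {A : Z3 → Set} (C : Config A) where
  open Config C
  open Classify C

  -- Lattice points on the lines through the edges pq and rs, next to the edge.
  data OnLine : ℤ → ℤ → ℤ → ℤ → Set where
    l12′ : OnLine (+ 2) (- + 1) (+ 0) (+ 0)
    l21′ : OnLine (- + 1) (+ 2) (+ 0) (+ 0)
    l34′ : OnLine (+ 0) (+ 0) (+ 2) (- + 1)
    l43′ : OnLine (+ 0) (+ 0) (- + 1) (+ 2)

  Third : ∀ {p q r s} → WhiteTet A p q r s → Set
  Third T = ∃ λ u → A u × ∃ λ a → ∃ λ b → ∃ λ c → ∃ λ d → OnLine a b c d × At (WhiteTet.tet T) u a b c d

  -- T′ arises from T by moving the edge pq along its line.
  record Shifted {p q r s} (T : WhiteTet A p q r s) : Set where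
    field
      {p′ q′} : Z3
      white : WhiteTet A p′ q′ r s
      n≡ : WhiteTet.n white ≡ WhiteTet.n T
      σ≡ : WhiteTet.σ white ≡ WhiteTet.σ T
      W₃≡ : ∀ z → WhiteTet.W₃ white ⟨ z ⟩ ≡ WhiteTet.W₃ T ⟨ z ⟩
      W₄≡ : ∀ z → WhiteTet.W₄ white ⟨ z ⟩ ≡ WhiteTet.W₄ T ⟨ z ⟩
      third : Third white
      thirdOn12 : ∃ λ u → A u × (At (WhiteTet.tet white) u (+ 2) (- + 1) (+ 0) (+ 0) ⊎ At (WhiteTet.tet white) u (- + 1) (+ 2) (+ 0) (+ 0))

  record Shift {p q r s} (T : WhiteTet A p q r s) (u : Z3) : Set where
    open WhiteTet T using (n; σ; W₁; W₂; W₃; W₄)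
    field
      white : WhiteTet A u p r s
      n≡ : WhiteTet.n white ≡ n
      σ≡ : WhiteTet.σ white ≡ σ
      W₁≡ : ∀ z → WhiteTet.W₁ white ⟨ z ⟩ ≡ - W₂ ⟨ z ⟩
      W₂≡ : ∀ z → WhiteTet.W₂ white ⟨ z ⟩ ≡ W₁ ⟨ z ⟩ + + 2 * W₂ ⟨ z ⟩
      W₃≡ : ∀ z → WhiteTet.W₃ white ⟨ z ⟩ ≡ W₃ ⟨ z ⟩
      W₄≡ : ∀ z → WhiteTet.W₄ white ⟨ z ⟩ ≡ W₄ ⟨ z ⟩

  -- Since u = 2p - q, the edge pq is translated along its line by p - q. W₃ and W₄ are unaffected,
  -- and σ and ρ stay the same.
  shift : ∀ {p q r s} (T : WhiteTet A p q r s) u → A u → At (WhiteTet.tet T) u (+ 2) (- + 1) (+ 0) (+ 0) → Shift T u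
  shift {p} {q} {r} {s} T u Au (at u₁ u₂ u₃ u₄) = record
    { white = record
      { tet = tet′ ; Ap = Au ; Aq = Ap ; Ar = Ar ; As = As ; σ = σ ; ρ = ρ ; σ>0 = σ>0 ; ρ>0 = ρ>0
      ; σ<n = subst (σ <_) (sym n≡) σ<n ; ρ<n = subst (ρ <_) (sym n≡) ρ<n
      ; zσ = point
      ; zσ₁ = trans at₁ (cmp (+ 1) (trans (W₁≡ zσ) (cong -_ zσ₂)) (lin 2 (λ n σ → ⊢ # 1 :* (:- (n :- σ)) :+ # 1 :* n := σ) n σ))
      ; zσ₂ = trans at₂ (trans (cmp (- + 1) (trans (W₂≡ zσ) (cong₂ (λ x y → x + + 2 * y) zσ₁ zσ₂)) (lin 2 (λ n σ → ⊢ # 1 :* (σ :+ # 2 :* (n :- σ)) :+ con (- + 1) :* n := n :- σ) n σ)) (cong (_- σ) (sym n≡)))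
      ; zσ₃ = trans at₃ (cmp (+ 0) (trans (W₃≡ zσ) zσ₃) (lin 1 (λ n → ⊢ # 1 :* # 1 :+ # 0 :* n := # 1) n))
      ; zσ₄ = trans at₄ (cmp (+ 0) (trans (W₄≡ zσ) zσ₄) (lin 1 (λ n → ⊢ # 1 :* con (- + 1) :+ # 0 :* n := con (- + 1)) n))
      ; zρ = zρ ; zρ₁ = trans (W₁≡ zρ) (cong -_ zρ₂) ; zρ₂ = trans (W₂≡ zρ) (cong₂ (λ x y → x + + 2 * y) zρ₁ zρ₂)
      ; zρ₃ = trans (W₃≡ zρ) zρ₃ ; zρ₄ = trans (W₄≡ zρ) (trans zρ₄ (cong (_- ρ) (sym n≡)))
      ; cyc = λ z → dv (cyc′ z (cyc z) (cyc₁₂ z)) (cong₂ (λ x y → x - σ * y) (W₁≡ z) (W₃≡ z))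
      ; cyc₁₂ = λ z → dv (cyc₁₂ z) (trans (cong₂ _+_ (W₁≡ z) (W₂≡ z)) (lin 2 (λ a b → ⊢ (:- b) :+ (a :+ # 2 :* b) := a :+ b) (W₁ ⟨ z ⟩) (W₂ ⟨ z ⟩)))
      ; 3∣n = subst (+ 3 ∣ᶻ_) (sym n≡) 3∣n ; 3∣W₃ = λ z a → subst (+ 3 ∣ᶻ_) (sym (W₃≡ z)) (3∣W₃ z a) }
    ; n≡ = n≡ ; σ≡ = refl ; W₁≡ = W₁≡ ; W₂≡ = W₂≡ ; W₃≡ = W₃≡ ; W₄≡ = W₄≡ }
    where
    open WhiteTet T
    R = replaceFirst (sw12 tet) u {ε = - + 1} {b = + 2} {c = + 0} {d = + 0} (at u₂ u₁ u₃ u₄) (inj₂ refl)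
    open Replaced R renaming (tet to tet′)
    module T′ = Tet tet′
    W₁≡ : ∀ z → T′.W₁ ⟨ z ⟩ ≡ - W₂ ⟨ z ⟩
    W₁≡ z = trans (new₁ z) (ℤₚ.-1*i≡-i _)
    W₂≡ : ∀ z → T′.W₂ ⟨ z ⟩ ≡ W₁ ⟨ z ⟩ + + 2 * W₂ ⟨ z ⟩
    W₂≡ z = trans (new₂ z) (lin 2 (λ a b → ⊢ a :- con (- + 2) :* b := a :+ # 2 :* b) (W₁ ⟨ z ⟩) (W₂ ⟨ z ⟩))
    W₃≡ : ∀ z → T′.W₃ ⟨ z ⟩ ≡ W₃ ⟨ z ⟩
    W₃≡ z = trans (new₃ z) (lin 2 (λ a b → ⊢ a :- # 0 :* b := a) (W₃ ⟨ z ⟩) (W₂ ⟨ z ⟩))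
    W₄≡ : ∀ z → T′.W₄ ⟨ z ⟩ ≡ W₄ ⟨ z ⟩
    W₄≡ z = trans (new₄ z) (lin 2 (λ a b → ⊢ a :- # 0 :* b := a) (W₄ ⟨ z ⟩) (W₂ ⟨ z ⟩))
    open Moved (move tet′ (+ 1) (+ 1) (- + 1) (+ 0) (+ 0) zσ refl)
    cmp : ∀ {x y v} k → x ≡ y → + 1 * y + k * n ≡ v → + 1 * x + k * T′.n ≡ v
    cmp {x} k refl e = trans (cong (λ m → + 1 * x + k * m) n≡) e
    dv : ∀ {x y} → n ∣ᶻ x → y ≡ x → T′.n ∣ᶻ y
    dv (k , e) refl = k , trans e (cong (k *_) (sym n≡))
    cyc′ : ∀ z → n ∣ᶻ (W₁ ⟨ z ⟩ - σ * W₃ ⟨ z ⟩) → n ∣ᶻ (W₁ ⟨ z ⟩ + W₂ ⟨ z ⟩) → n ∣ᶻ (- W₂ ⟨ z ⟩ - σ * W₃ ⟨ z ⟩)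
    cyc′ z (k , e) (k′ , e′) = k - k′ , lin 6 (λ a b m k k′ n → a :- m := k :* n ⇒ a :+ b := k′ :* n ⇒ ⊢ :- b :- m := (k :- k′) :* n) (W₁ ⟨ z ⟩) (W₂ ⟨ z ⟩) (σ * W₃ ⟨ z ⟩) k k′ n e e′

  OffLine : ∀ {p q r s} → WhiteTet A p q r s → Z3 → Set
  OffLine T v = let open WhiteTet T in ¬ Inside tet v × ¬ (W₃ ⟨ v ⟩ ≡ + 0 × W₄ ⟨ v ⟩ ≡ + 0)

  -- By `whiteEmpty` a lattice point inside the new tetrahedron is one of its vertices; u and p are
  -- on the line, while r and s belong to the old tetrahedron.
  shift-offLine : ∀ {p q r s} (T : WhiteTet A p q r s) u (S : Shift T u) v → OffLine T v → OffLine (Shift.white S) v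
  shift-offLine T u S v (out , off) = out′ , (λ { (e₃ , e₄) → off (trans (sym (W₃≡ v)) e₃ , trans (sym (W₄≡ v)) e₄) })
    where
    open Shift S
    open WhiteTet T using (W₁; W₂; W₃; W₄)
    module T′ = WhiteTet white
    out′ : ¬ Inside T′.tet v
    out′ (g₁ , g₂ , g₃ , g₄) = whiteEmpty white v (g₁ , g₂ , g₃ , g₄)
        ( (λ e → off (trans (sym (W₃≡ v)) (lin 5 (λ a b c d n → a :+ b :+ c :+ d := n ⇒ # 0 :≤ b ⇒ # 0 :≤ c ⇒ # 0 :≤ d ⇒ a := n ⇒ ⊢ c := # 0) a b c d T′.n (T′.sumW v) g₂ g₃ g₄ e)
                      , trans (sym (W₄≡ v)) (lin 5 (λ a b c d n → a :+ b :+ c :+ d := n ⇒ # 0 :≤ b ⇒ # 0 :≤ c ⇒ # 0 :≤ d ⇒ a := n ⇒ ⊢ d := # 0) a b c d T′.n (T′.sumW v) g₂ g₃ g₄ e)))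
        , (λ e → off (trans (sym (W₃≡ v)) (lin 5 (λ a b c d n → a :+ b :+ c :+ d := n ⇒ # 0 :≤ a ⇒ # 0 :≤ c ⇒ # 0 :≤ d ⇒ b := n ⇒ ⊢ c := # 0) a b c d T′.n (T′.sumW v) g₁ g₃ g₄ e)
                      , trans (sym (W₄≡ v)) (lin 5 (λ a b c d n → a :+ b :+ c :+ d := n ⇒ # 0 :≤ a ⇒ # 0 :≤ c ⇒ # 0 :≤ d ⇒ b := n ⇒ ⊢ d := # 0) a b c d T′.n (T′.sumW v) g₁ g₃ g₄ e)))
        , (λ e → inside (lin 5 (λ a b c d n → a :+ b :+ c :+ d := n ⇒ # 0 :≤ a ⇒ # 0 :≤ b ⇒ # 0 :≤ d ⇒ c := n ⇒ ⊢ a := # 0) a b c d T′.n (T′.sumW v) g₁ g₂ g₄ e)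
                         (lin 5 (λ a b c d n → a :+ b :+ c :+ d := n ⇒ # 0 :≤ a ⇒ # 0 :≤ b ⇒ # 0 :≤ d ⇒ c := n ⇒ ⊢ b := # 0) a b c d T′.n (T′.sumW v) g₁ g₂ g₄ e))
        , (λ e → inside (lin 5 (λ a b c d n → a :+ b :+ c :+ d := n ⇒ # 0 :≤ a ⇒ # 0 :≤ b ⇒ # 0 :≤ c ⇒ d := n ⇒ ⊢ a := # 0) a b c d T′.n (T′.sumW v) g₁ g₂ g₃ e)
                         (lin 5 (λ a b c d n → a :+ b :+ c :+ d := n ⇒ # 0 :≤ a ⇒ # 0 :≤ b ⇒ # 0 :≤ c ⇒ d := n ⇒ ⊢ b := # 0) a b c d T′.n (T′.sumW v) g₁ g₂ g₃ e)))
      where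
      a = T′.W₁ ⟨ v ⟩
      b = T′.W₂ ⟨ v ⟩
      c = T′.W₃ ⟨ v ⟩
      d = T′.W₄ ⟨ v ⟩
      inside : a ≡ + 0 → b ≡ + 0 → ⊥
      inside a0 b0 = out (ℤₚ.≤-reflexive (lin 4 (λ a b x y → a := # 0 ⇒ b := # 0 ⇒ a := :- y ⇒ b := x :+ # 2 :* y ⇒ ⊢ # 0 := x) a b (W₁ ⟨ v ⟩) (W₂ ⟨ v ⟩) a0 b0 (W₁≡ v) (W₂≡ v))
        , ℤₚ.≤-reflexive (lin 2 (λ a y → a := # 0 ⇒ a := :- y ⇒ ⊢ # 0 := y) a (W₂ ⟨ v ⟩) a0 (W₁≡ v)) , subst (+ 0 ≤_) (W₃≡ v) g₃ , subst (+ 0 ≤_) (W₄≡ v) g₄)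

  -- As u is between T and v, the coordinates (a, b, c, d) of v satisfy b < 0 and c, d ≤ 0. The move
  -- replaces a and b by -b and a + 2b, and |a + 2b| < a.
  shift-size : ∀ {p q r s} (T : WhiteTet A p q r s) u (S : Shift T u) v → At (WhiteTet.tet T) u (+ 2) (- + 1) (+ 0) (+ 0) → Between (WhiteTet.tet T) v u →
    size (WhiteTet.tet (Shift.white S)) v ℕ.< size (WhiteTet.tet T) v
  shift-size T u S v (at u₁ u₂ u₃ u₄) B = ℤₚ.drop‿+<+ (lin 13 (λ a b c d n x₁ x₂ x₃ x₄ A₁ B₁ C₁ D₁ →
        x₁ :≤ :- b ⇒ x₂ :< A₁ ⇒ x₃ :≤ :- c ⇒ x₄ :≤ :- d ⇒ a :≤ A₁ ⇒ :- b :≤ B₁ ⇒ :- c :≤ C₁ ⇒ :- d :≤ D₁ ⇒ ⊢ x₁ :+ x₂ :+ x₃ :+ x₄ :< A₁ :+ B₁ :+ C₁ :+ D₁)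
      a b c d n (+ ∣ T′.W₁ ⟨ v ⟩ ∣) (+ ∣ T′.W₂ ⟨ v ⟩ ∣) (+ ∣ T′.W₃ ⟨ v ⟩ ∣) (+ ∣ T′.W₄ ⟨ v ⟩ ∣) (+ ∣ a ∣) (+ ∣ b ∣) (+ ∣ c ∣) (+ ∣ d ∣)
      (∣x∣≤ (T′.W₁ ⟨ v ⟩) (ℤₚ.≤-reflexive (W₁≡ v)) (lin 2 (λ x b → x := :- b ⇒ b :< # 0 ⇒ ⊢ :- x :≤ :- b) (T′.W₁ ⟨ v ⟩) b (W₁≡ v) b<0))
      (ℤₚ.≤-<-trans (∣x∣≤ (T′.W₂ ⟨ v ⟩) {a - + 1}
          (lin 3 (λ x a b → x := a :+ # 2 :* b ⇒ b :< # 0 ⇒ ⊢ x :≤ a :- # 1) (T′.W₂ ⟨ v ⟩) a b (W₂≡ v) b<0)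
          (lin 6 (λ x a b c d n → x := a :+ # 2 :* b ⇒ a :+ b :+ c :+ d := n ⇒ c :≤ # 0 ⇒ d :≤ # 0 ⇒ # 0 :< n ⇒ ⊢ :- x :≤ a :- # 1) (T′.W₂ ⟨ v ⟩) a b c d n (W₂≡ v) (sumW v) c≤0 d≤0 n>0))
        (lin 2 (λ a y → a :≤ y ⇒ ⊢ a :- # 1 :< y) a (+ ∣ a ∣) (x≤∣x∣ a)))
      (∣x∣≤ (T′.W₃ ⟨ v ⟩) (lin 2 (λ x c → x := c ⇒ c :≤ # 0 ⇒ ⊢ x :≤ :- c) (T′.W₃ ⟨ v ⟩) c (W₃≡ v) c≤0) (lin 2 (λ x c → x := c ⇒ ⊢ :- x :≤ :- c) (T′.W₃ ⟨ v ⟩) c (W₃≡ v)))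
      (∣x∣≤ (T′.W₄ ⟨ v ⟩) (lin 2 (λ x c → x := c ⇒ c :≤ # 0 ⇒ ⊢ x :≤ :- c) (T′.W₄ ⟨ v ⟩) d (W₄≡ v) d≤0) (lin 2 (λ x c → x := c ⇒ ⊢ :- x :≤ :- c) (T′.W₄ ⟨ v ⟩) d (W₄≡ v)))
      (x≤∣x∣ a) (-x≤∣x∣ b) (-x≤∣x∣ c) (-x≤∣x∣ d))
    where
    open WhiteTet T
    open Shift S
    open Between B
    module T′ = WhiteTet white
    a = W₁ ⟨ v ⟩
    b = W₂ ⟨ v ⟩
    c = W₃ ⟨ v ⟩
    d = W₄ ⟨ v ⟩
    b<0 : b < + 0
    b<0 = cancel< b (+ 0) τ>0 (lin 5 (λ τ b ρ K n → :- K :* n := τ :* b :+ ρ ⇒ # 0 :≤ ρ ⇒ # 0 :< K :* n ⇒ ⊢ b :* τ :< # 0 :* τ) τ b ρ₂ K n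
      (trans (lin 2 (λ K n → ⊢ :- K :* n := K :* (con (- + 1) :* n)) K n) (trans (cong (K *_) (sym u₂)) eq₂)) ρ₂≥0 (mul>0 K>0 n>0))
    npos : ∀ {x y ρ} → K * x ≡ τ * y + ρ → x ≡ + 0 * n → + 0 ≤ ρ → y ≤ + 0
    npos {x} {y} {ρ} e refl h = cancel≤ y (+ 0) τ>0 (lin 5 (λ K n τ y ρ → K :* (# 0 :* n) := τ :* y :+ ρ ⇒ # 0 :≤ ρ ⇒ ⊢ y :* τ :≤ # 0 :* τ) K n τ y ρ e h)
    c≤0 = npos eq₃ u₃ ρ₃≥0
    d≤0 = npos eq₄ u₄ ρ₄≥0

  record Step {p q r s} (T : WhiteTet A p q r s) (v : Z3) : Set where
    field
      shifted : Shifted T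
    open Shifted shifted
    field
      off : OffLine white v
      smaller : size (WhiteTet.tet white) v ℕ.< size (WhiteTet.tet T) v

  -- The abandoned vertex q is next to the new edge, so that after a move the line contains three
  -- points of A.
  step12 : ∀ {p q r s} (T : WhiteTet A p q r s) u v → A u → At (WhiteTet.tet T) u (+ 2) (- + 1) (+ 0) (+ 0) → Between (WhiteTet.tet T) v u → OffLine T v → Step T v
  step12 {p} {q} T u v Au U B off = record
    { shifted = record { white = white ; n≡ = n≡ ; σ≡ = σ≡ ; W₃≡ = W₃≡ ; W₄≡ = W₄≡ ; third = q , Aq , _ , _ , _ , _ , l21′ , old ; thirdOn12 = q , Aq , inj₂ old }
    ; off = shift-offLine T u S v off ; smaller = shift-size T u S v U B }
    where
    open WhiteTet T
    S = shift T u Au U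
    open Shift S
    T₂ = sw12 tet
    T₃ = sw12 (sw23 tet)
    T₄ = sw12 (sw23 (sw34 tet))
    old : At (WhiteTet.tet white) q (- + 1) (+ 2) (+ 0) (+ 0)
    old = at (trans (W₁≡ q) (trans (cong -_ (trans (W₁p T₂) (sym n≡))) (sym (ℤₚ.-1*i≡-i (WhiteTet.n white)))))
             (trans (W₂≡ q) (trans (cong₂ (λ x y → x + + 2 * y) (W₁q tet) (trans (W₁p T₂) (sym n≡))) (ℤₚ.+-identityˡ _)))
             (trans (W₃≡ q) (trans (W₁r T₃) (sym (ℤₚ.*-zeroˡ (WhiteTet.n white)))))
             (trans (W₄≡ q) (trans (W₁r T₄) (sym (ℤₚ.*-zeroˡ (WhiteTet.n white)))))

  private
    size12 : ∀ {p q r s} (T : Tet p q r s) z → size (sw12 T) z ≡ size T z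
    size12 T z = cong (λ k → k ℕ.+ ∣ Tet.W₃ T ⟨ z ⟩ ∣ ℕ.+ ∣ Tet.W₄ T ⟨ z ⟩ ∣) (ℕₚ.+-comm ∣ Tet.W₂ T ⟨ z ⟩ ∣ ∣ Tet.W₁ T ⟨ z ⟩ ∣)

    line12 : ∀ {a b c d} → OnLine a b c d → OnLine b a c d
    line12 l12′ = l21′
    line12 l21′ = l12′
    line12 l34′ = l34′
    line12 l43′ = l43′

    unstep12 : ∀ {p q r s} (T : WhiteTet A p q r s) v → Step (wsw12 A T) v → Step T v
    unstep12 T v St = record
      { shifted = record { white = wsw12 A white ; n≡ = n≡
          ; σ≡ = lin 4 (λ n n′ σ σ′ → n′ := n ⇒ σ′ := n :- σ ⇒ ⊢ n′ :- σ′ := σ) (WhiteTet.n T) (WhiteTet.n white) (WhiteTet.σ T) (WhiteTet.σ white) n≡ σ≡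
          ; W₃≡ = W₃≡ ; W₄≡ = W₄≡
          ; third = flipThird third ; thirdOn12 = flipOn thirdOn12 }
      ; off = (λ { (a , b , c , d) → proj₁ off (b , a , c , d) }) , proj₂ off
      ; smaller = subst (λ k → k ℕ.< size (WhiteTet.tet T) v) (sym (size12 (WhiteTet.tet white) v)) (subst (λ k → size (WhiteTet.tet white) v ℕ.< k) (size12 (WhiteTet.tet T) v) smaller) }
      where
      open Step St
      open Shifted shifted
      flipThird : Third white → Third (wsw12 A white)
      flipThird (u , Au , a , b , c , d , o , W) = u , Au , b , a , c , d , line12 o , at12 W
      flipOn : (∃ λ u → A u × (At (WhiteTet.tet white) u (+ 2) (- + 1) (+ 0) (+ 0) ⊎ At (WhiteTet.tet white) u (- + 1) (+ 2) (+ 0) (+ 0))) →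
        ∃ λ u → A u × (At (sw12 (WhiteTet.tet white)) u (+ 2) (- + 1) (+ 0) (+ 0) ⊎ At (sw12 (WhiteTet.tet white)) u (- + 1) (+ 2) (+ 0) (+ 0))
      flipOn (u , Au , inj₁ W) = u , Au , inj₂ (at12 W)
      flipOn (u , Au , inj₂ W) = u , Au , inj₁ (at12 W)

    between12 : ∀ {p q r s} {T : Tet p q r s} {v w} → Between T v w → Between (sw12 T) v w
    between12 B = record { K = K ; τ = τ ; ρ₁ = ρ₂ ; ρ₂ = ρ₁ ; ρ₃ = ρ₃ ; ρ₄ = ρ₄ ; K>0 = K>0 ; τ>0 = τ>0 ; ρ₁≥0 = ρ₂≥0 ; ρ₂≥0 = ρ₁≥0 ; ρ₃≥0 = ρ₃≥0 ; ρ₄≥0 = ρ₄≥0 ; eq₁ = eq₂ ; eq₂ = eq₁ ; eq₃ = eq₃ ; eq₄ = eq₄ }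
      where open Between B

  step21 : ∀ {p q r s} (T : WhiteTet A p q r s) u v → A u → At (WhiteTet.tet T) u (- + 1) (+ 2) (+ 0) (+ 0) → Between (WhiteTet.tet T) v u → OffLine T v → Step T v
  step21 T u v Au U B (out , off) = unstep12 T v (step12 (wsw12 A T) u v Au (at12 U) (between12 B) ((λ { (a , b , c , d) → out (b , a , c , d) }) , off))

  -- Everything that can be adjacent, except for points on the line pq.
  data Out′ (n σ : ℤ) : ℤ → ℤ → ℤ → ℤ → Set where
    onRS : ∀ {a b c d} → OnLine a b c d → a ≡ + 0 → b ≡ + 0 → Out′ n σ a b c d
    other : ∀ {a b c d} → Out n σ a b c d → ¬ (OnLine a b c d) → Out′ n σ a b c d

  record Final {p q r s} (T : WhiteTet A p q r s) (v : Z3) : Set where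
    field
      point : Z3
      inA : A point
      between : Between (WhiteTet.tet T) v point
      {a b c d} : ℤ
      out : Out′ (WhiteTet.n T) (WhiteTet.σ T) a b c d
      coords : At (WhiteTet.tet T) point a b c d

  bigFree-≡ : ∀ {n m} → n ≡ m → BigFree C m → BigFree C n
  bigFree-≡ refl bf = bf

  private
    compose : ∀ {p q r s} (T : WhiteTet A p q r s) (S : Shifted T) → Shifted (Shifted.white S) → Shifted T
    compose T S S′ = record { white = S′.white ; n≡ = trans S′.n≡ S.n≡ ; σ≡ = trans S′.σ≡ S.σ≡ ; W₃≡ = λ z → trans (S′.W₃≡ z) (S.W₃≡ z) ; W₄≡ = λ z → trans (S′.W₄≡ z) (S.W₄≡ z) ; third = S′.third ; thirdOn12 = S′.thirdOn12 }
      where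
      module S = Shifted S
      module S′ = Shifted S′

    run : ∀ k {p q r s} (T : WhiteTet A p q r s) → BigFree C (WhiteTet.n T) → ∀ v → A v → OffLine T v → size (WhiteTet.tet T) v ℕ.< k →
      Final T v ⊎ Σ (Shifted T) λ S → Final (Shifted.white S) v
    run zero T bf v Av off ()
    run (suc k) T bf v Av off lt = go (adjacent T bf v Av (proj₁ off))
      where
      continue : Step T v → Final T v ⊎ Σ (Shifted T) λ S → Final (Shifted.white S) v
      continue St = join (run k S.white (bigFree-≡ S.n≡ bf) v Av (Step.off St) (ℕₚ.<-≤-trans (Step.smaller St) (ℕ.s≤s⁻¹ lt)))
        where
        module S = Shifted (Step.shifted St)
        join : Final S.white v ⊎ (Σ (Shifted S.white) λ S′ → Final (Shifted.white S′) v) → Final T v ⊎ Σ (Shifted T) λ S → Final (Shifted.white S) v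
        join (inj₁ F) = inj₂ (Step.shifted St , F)
        join (inj₂ (S′ , F)) = inj₂ (compose T (Step.shifted St) S′ , F)
      go : Adjacent T v → Final T v ⊎ Σ (Shifted T) λ S → Final (Shifted.white S) v
      go adj = by (Adjacent.out adj) (Adjacent.coords adj)
        where
        open Adjacent adj using (point; inA; between)
        fin : ∀ {a b c d} → Out′ (WhiteTet.n T) (WhiteTet.σ T) a b c d → At (WhiteTet.tet T) point a b c d → Final T v ⊎ Σ (Shifted T) λ S → Final (Shifted.white S) v
        fin o W = inj₁ (record { point = point ; inA = inA ; between = between ; out = o ; coords = W })
        by : ∀ {a b c d} → Out (WhiteTet.n T) (WhiteTet.σ T) a b c d → At (WhiteTet.tet T) point a b c d → Final T v ⊎ Σ (Shifted T) λ S → Final (Shifted.white S) v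
        by l12 W = continue (step12 T point v inA W between off)
        by l21 W = continue (step21 T point v inA W between off)
        by l34 W = fin (onRS l34′ refl refl) W
        by l43 W = fin (onRS l43′ refl refl) W
        by o@(l13 _) W = fin (other o λ ()) W
        by o@(l31 _) W = fin (other o λ ()) W
        by o@(l24 _) W = fin (other o λ ()) W
        by o@(l42 _) W = fin (other o λ ()) W
        by o@(l14 _) W = fin (other o λ ()) W
        by o@(l41 _) W = fin (other o λ ()) W
        by o@(l23 _) W = fin (other o λ ()) W
        by o@(l32 _) W = fin (other o λ ()) W
        by o@(f1 _) W = fin (other o λ ()) W
        by o@(f2 _) W = fin (other o λ ()) W
        by o@(f3 _) W = fin (other o λ ()) W
        by o@(f4 _) W = fin (other o λ ()) W
        by o@(g1 _ _) W = fin (other o λ ()) W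
        by o@(g2 _ _) W = fin (other o λ ()) W
        by o@(g3 _ _) W = fin (other o λ ()) W
        by o@(g4 _ _) W = fin (other o λ ()) W
        by o@(h1 _ _) W = fin (other o λ ()) W
        by o@(h2 _ _) W = fin (other o λ ()) W
        by o@(h3 _ _) W = fin (other o λ ()) W
        by o@(h4 _ _) W = fin (other o λ ()) W

  -- The edge pq is moved as long as the point adjacent in the direction of v lies on its line.
  -- Whether a move took place is recorded, because a move leaves a third point of A on the line.
  loop : ∀ {p q r s} (T : WhiteTet A p q r s) → BigFree C (WhiteTet.n T) → ∀ v → A v → OffLine T v → Final T v ⊎ Σ (Shifted T) λ S → Final (Shifted.white S) v
  loop T bf v Av off = run (suc (size (WhiteTet.tet T) v)) T bf v Av off ℕₚ.≤-refl

  -- The neighbours of the edges pr and qs, which for σ = n - 1 play the same role as pq and rs.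
  data Cross : ℤ → ℤ → ℤ → ℤ → Set where
    l13′ : Cross (+ 2) (+ 0) (- + 1) (+ 0)
    l31′ : Cross (- + 1) (+ 0) (+ 2) (+ 0)
    l24′ : Cross (+ 0) (+ 2) (+ 0) (- + 1)
    l42′ : Cross (+ 0) (- + 1) (+ 0) (+ 2)

  module _ {p q r s} (T : WhiteTet A p q r s) (σ≡ : WhiteTet.σ T ≡ WhiteTet.n T - + 1) where
    open WhiteTet T
    private
      -- The sum of the two points, divided by K n, is compared with the forbidden point l zσ + k₁ p
      -- + k₂ q + k₃ r + k₄ s. The cases of `clash` supply K, l and the kᵢ; every estimate follows
      -- from σ = n - 1 and n ≥ 3.
      k : ∀ {u v a₁ a₂ a₃ a₄ b₁ b₂ b₃ b₄} → A u × At tet u a₁ a₂ a₃ a₄ → A v × At tet v b₁ b₂ b₃ b₄ → ∀ K l k₁ k₂ k₃ k₄ → + 0 < K → l + k₁ + k₂ + k₃ + k₄ ≡ + 1 → ¬ (+ 3 ∣ᶻ l) →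
        a₁ + b₁ ≤ K * (l * σ + k₁ * n) → a₂ + b₂ ≤ K * (l * (n - σ) + k₂ * n) → a₃ + b₃ ≤ K * (l * + 1 + k₃ * n) → a₄ + b₄ ≤ K * (l * - + 1 + k₄ * n) → ⊥
      k {u} {v} {a₁} {a₂} {a₃} {a₄} {b₁} {b₂} {b₃} {b₄} (Au , U) (Av , V) K l k₁ k₂ k₃ k₄ K>0 e 3∤l d₁ d₂ d₃ d₄ =
        killAt T {u} {v} {v} Au Av Av U V V (+ 1) (+ 1) (+ 0) K l k₁ k₂ k₃ k₄ one one ℤₚ.≤-refl K>0 e 3∤l (pad a₁ b₁ d₁) (pad a₂ b₂ d₂) (pad a₃ b₃ d₃) (pad a₄ b₄ d₄)
        where
        one : + 0 ≤ + 1
        one = lin 0 (⊢ # 0 :≤ # 1)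
        pad : ∀ a b {y} → a + b ≤ y → + 1 * a + + 1 * b + + 0 * b ≤ y
        pad a b {y} = lin 3 (λ a b y → a :+ b :≤ y ⇒ ⊢ # 1 :* a :+ # 1 :* b :+ # 0 :* b :≤ y) a b y

    -- The edges of the four-cycle pqsr cannot be prolonged in both directions.
    clash : ∀ {u v a₁ a₂ a₃ a₄ b₁ b₂ b₃ b₄} → OnLine a₁ a₂ a₃ a₄ → Cross b₁ b₂ b₃ b₄ → A u × At tet u a₁ a₂ a₃ a₄ → A v × At tet v b₁ b₂ b₃ b₄ → ⊥
    clash l12′ l13′ U V = k U V (+ 1) (- + 1) (+ 2) (+ 0) (+ 0) (+ 0) (lin 0 (⊢ # 0 :< # 1)) refl 3∤-1
      (lin 2 (λ n σ → σ := n :- # 1 ⇒ # 3 :≤ n ⇒ ⊢ # 4 :≤ # 1 :* (con (- + 1) :* σ :+ # 2 :* n)) n σ σ≡ n≥3)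
      (lin 2 (λ n σ → σ := n :- # 1 ⇒ # 3 :≤ n ⇒ ⊢ con (- + 1) :≤ # 1 :* (con (- + 1) :* (n :- σ) :+ # 0 :* n)) n σ σ≡ n≥3)
      (lin 2 (λ n σ → σ := n :- # 1 ⇒ # 3 :≤ n ⇒ ⊢ con (- + 1) :≤ # 1 :* (con (- + 1) :* # 1 :+ # 0 :* n)) n σ σ≡ n≥3)
      (lin 2 (λ n σ → σ := n :- # 1 ⇒ # 3 :≤ n ⇒ ⊢ # 0 :≤ # 1 :* (con (- + 1) :* con (- + 1) :+ # 0 :* n)) n σ σ≡ n≥3)
    clash l12′ l31′ U V = k U V (+ 1) (- + 1) (+ 1) (+ 0) (+ 1) (+ 0) (lin 0 (⊢ # 0 :< # 1)) refl 3∤-1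
      (lin 2 (λ n σ → σ := n :- # 1 ⇒ # 3 :≤ n ⇒ ⊢ # 1 :≤ # 1 :* (con (- + 1) :* σ :+ # 1 :* n)) n σ σ≡ n≥3)
      (lin 2 (λ n σ → σ := n :- # 1 ⇒ # 3 :≤ n ⇒ ⊢ con (- + 1) :≤ # 1 :* (con (- + 1) :* (n :- σ) :+ # 0 :* n)) n σ σ≡ n≥3)
      (lin 2 (λ n σ → σ := n :- # 1 ⇒ # 3 :≤ n ⇒ ⊢ # 2 :≤ # 1 :* (con (- + 1) :* # 1 :+ # 1 :* n)) n σ σ≡ n≥3)
      (lin 2 (λ n σ → σ := n :- # 1 ⇒ # 3 :≤ n ⇒ ⊢ # 0 :≤ # 1 :* (con (- + 1) :* con (- + 1) :+ # 0 :* n)) n σ σ≡ n≥3)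
    clash l12′ l24′ U V = k U V (+ 1) (+ 1) (+ 0) (+ 0) (+ 0) (+ 0) (lin 0 (⊢ # 0 :< # 1)) refl 3∤1
      (lin 2 (λ n σ → σ := n :- # 1 ⇒ # 3 :≤ n ⇒ ⊢ # 2 :≤ # 1 :* (# 1 :* σ :+ # 0 :* n)) n σ σ≡ n≥3)
      (lin 2 (λ n σ → σ := n :- # 1 ⇒ # 3 :≤ n ⇒ ⊢ # 1 :≤ # 1 :* (# 1 :* (n :- σ) :+ # 0 :* n)) n σ σ≡ n≥3)
      (lin 2 (λ n σ → σ := n :- # 1 ⇒ # 3 :≤ n ⇒ ⊢ # 0 :≤ # 1 :* (# 1 :* # 1 :+ # 0 :* n)) n σ σ≡ n≥3)
      (lin 2 (λ n σ → σ := n :- # 1 ⇒ # 3 :≤ n ⇒ ⊢ con (- + 1) :≤ # 1 :* (# 1 :* con (- + 1) :+ # 0 :* n)) n σ σ≡ n≥3)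
    clash l12′ l42′ U V = k U V (+ 2) (- + 1) (+ 1) (+ 0) (+ 1) (+ 0) (lin 0 (⊢ # 0 :< # 2)) refl 3∤-1
      (lin 2 (λ n σ → σ := n :- # 1 ⇒ # 3 :≤ n ⇒ ⊢ # 2 :≤ # 2 :* (con (- + 1) :* σ :+ # 1 :* n)) n σ σ≡ n≥3)
      (lin 2 (λ n σ → σ := n :- # 1 ⇒ # 3 :≤ n ⇒ ⊢ con (- + 2) :≤ # 2 :* (con (- + 1) :* (n :- σ) :+ # 0 :* n)) n σ σ≡ n≥3)
      (lin 2 (λ n σ → σ := n :- # 1 ⇒ # 3 :≤ n ⇒ ⊢ # 0 :≤ # 2 :* (con (- + 1) :* # 1 :+ # 1 :* n)) n σ σ≡ n≥3)
      (lin 2 (λ n σ → σ := n :- # 1 ⇒ # 3 :≤ n ⇒ ⊢ # 2 :≤ # 2 :* (con (- + 1) :* con (- + 1) :+ # 0 :* n)) n σ σ≡ n≥3)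
    clash l21′ l13′ U V = k U V (+ 1) (- + 1) (+ 1) (+ 1) (+ 0) (+ 0) (lin 0 (⊢ # 0 :< # 1)) refl 3∤-1
      (lin 2 (λ n σ → σ := n :- # 1 ⇒ # 3 :≤ n ⇒ ⊢ # 1 :≤ # 1 :* (con (- + 1) :* σ :+ # 1 :* n)) n σ σ≡ n≥3)
      (lin 2 (λ n σ → σ := n :- # 1 ⇒ # 3 :≤ n ⇒ ⊢ # 2 :≤ # 1 :* (con (- + 1) :* (n :- σ) :+ # 1 :* n)) n σ σ≡ n≥3)
      (lin 2 (λ n σ → σ := n :- # 1 ⇒ # 3 :≤ n ⇒ ⊢ con (- + 1) :≤ # 1 :* (con (- + 1) :* # 1 :+ # 0 :* n)) n σ σ≡ n≥3)
      (lin 2 (λ n σ → σ := n :- # 1 ⇒ # 3 :≤ n ⇒ ⊢ # 0 :≤ # 1 :* (con (- + 1) :* con (- + 1) :+ # 0 :* n)) n σ σ≡ n≥3)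
    clash l21′ l31′ U V = k U V (+ 2) (+ 1) (- + 1) (+ 0) (+ 0) (+ 1) (lin 0 (⊢ # 0 :< # 2)) refl 3∤1
      (lin 2 (λ n σ → σ := n :- # 1 ⇒ # 3 :≤ n ⇒ ⊢ con (- + 2) :≤ # 2 :* (# 1 :* σ :+ con (- + 1) :* n)) n σ σ≡ n≥3)
      (lin 2 (λ n σ → σ := n :- # 1 ⇒ # 3 :≤ n ⇒ ⊢ # 2 :≤ # 2 :* (# 1 :* (n :- σ) :+ # 0 :* n)) n σ σ≡ n≥3)
      (lin 2 (λ n σ → σ := n :- # 1 ⇒ # 3 :≤ n ⇒ ⊢ # 2 :≤ # 2 :* (# 1 :* # 1 :+ # 0 :* n)) n σ σ≡ n≥3)
      (lin 2 (λ n σ → σ := n :- # 1 ⇒ # 3 :≤ n ⇒ ⊢ # 0 :≤ # 2 :* (# 1 :* con (- + 1) :+ # 1 :* n)) n σ σ≡ n≥3)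
    clash l21′ l24′ U V = k U V (+ 1) (+ 1) (- + 1) (+ 1) (+ 0) (+ 0) (lin 0 (⊢ # 0 :< # 1)) refl 3∤1
      (lin 2 (λ n σ → σ := n :- # 1 ⇒ # 3 :≤ n ⇒ ⊢ con (- + 1) :≤ # 1 :* (# 1 :* σ :+ con (- + 1) :* n)) n σ σ≡ n≥3)
      (lin 2 (λ n σ → σ := n :- # 1 ⇒ # 3 :≤ n ⇒ ⊢ # 4 :≤ # 1 :* (# 1 :* (n :- σ) :+ # 1 :* n)) n σ σ≡ n≥3)
      (lin 2 (λ n σ → σ := n :- # 1 ⇒ # 3 :≤ n ⇒ ⊢ # 0 :≤ # 1 :* (# 1 :* # 1 :+ # 0 :* n)) n σ σ≡ n≥3)
      (lin 2 (λ n σ → σ := n :- # 1 ⇒ # 3 :≤ n ⇒ ⊢ con (- + 1) :≤ # 1 :* (# 1 :* con (- + 1) :+ # 0 :* n)) n σ σ≡ n≥3)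
    clash l21′ l42′ U V = k U V (+ 1) (+ 1) (- + 1) (+ 0) (+ 0) (+ 1) (lin 0 (⊢ # 0 :< # 1)) refl 3∤1
      (lin 2 (λ n σ → σ := n :- # 1 ⇒ # 3 :≤ n ⇒ ⊢ con (- + 1) :≤ # 1 :* (# 1 :* σ :+ con (- + 1) :* n)) n σ σ≡ n≥3)
      (lin 2 (λ n σ → σ := n :- # 1 ⇒ # 3 :≤ n ⇒ ⊢ # 1 :≤ # 1 :* (# 1 :* (n :- σ) :+ # 0 :* n)) n σ σ≡ n≥3)
      (lin 2 (λ n σ → σ := n :- # 1 ⇒ # 3 :≤ n ⇒ ⊢ # 0 :≤ # 1 :* (# 1 :* # 1 :+ # 0 :* n)) n σ σ≡ n≥3)
      (lin 2 (λ n σ → σ := n :- # 1 ⇒ # 3 :≤ n ⇒ ⊢ # 2 :≤ # 1 :* (# 1 :* con (- + 1) :+ # 1 :* n)) n σ σ≡ n≥3)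
    clash l34′ l13′ U V = k U V (+ 1) (+ 1) (+ 0) (+ 0) (+ 0) (+ 0) (lin 0 (⊢ # 0 :< # 1)) refl 3∤1
      (lin 2 (λ n σ → σ := n :- # 1 ⇒ # 3 :≤ n ⇒ ⊢ # 2 :≤ # 1 :* (# 1 :* σ :+ # 0 :* n)) n σ σ≡ n≥3)
      (lin 2 (λ n σ → σ := n :- # 1 ⇒ # 3 :≤ n ⇒ ⊢ # 0 :≤ # 1 :* (# 1 :* (n :- σ) :+ # 0 :* n)) n σ σ≡ n≥3)
      (lin 2 (λ n σ → σ := n :- # 1 ⇒ # 3 :≤ n ⇒ ⊢ # 1 :≤ # 1 :* (# 1 :* # 1 :+ # 0 :* n)) n σ σ≡ n≥3)
      (lin 2 (λ n σ → σ := n :- # 1 ⇒ # 3 :≤ n ⇒ ⊢ con (- + 1) :≤ # 1 :* (# 1 :* con (- + 1) :+ # 0 :* n)) n σ σ≡ n≥3)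
    clash l34′ l31′ U V = k U V (+ 1) (+ 1) (- + 1) (+ 0) (+ 1) (+ 0) (lin 0 (⊢ # 0 :< # 1)) refl 3∤1
      (lin 2 (λ n σ → σ := n :- # 1 ⇒ # 3 :≤ n ⇒ ⊢ con (- + 1) :≤ # 1 :* (# 1 :* σ :+ con (- + 1) :* n)) n σ σ≡ n≥3)
      (lin 2 (λ n σ → σ := n :- # 1 ⇒ # 3 :≤ n ⇒ ⊢ # 0 :≤ # 1 :* (# 1 :* (n :- σ) :+ # 0 :* n)) n σ σ≡ n≥3)
      (lin 2 (λ n σ → σ := n :- # 1 ⇒ # 3 :≤ n ⇒ ⊢ # 4 :≤ # 1 :* (# 1 :* # 1 :+ # 1 :* n)) n σ σ≡ n≥3)
      (lin 2 (λ n σ → σ := n :- # 1 ⇒ # 3 :≤ n ⇒ ⊢ con (- + 1) :≤ # 1 :* (# 1 :* con (- + 1) :+ # 0 :* n)) n σ σ≡ n≥3)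
    clash l34′ l24′ U V = k U V (+ 2) (+ 1) (+ 0) (+ 0) (+ 0) (+ 0) (lin 0 (⊢ # 0 :< # 2)) refl 3∤1
      (lin 2 (λ n σ → σ := n :- # 1 ⇒ # 3 :≤ n ⇒ ⊢ # 0 :≤ # 2 :* (# 1 :* σ :+ # 0 :* n)) n σ σ≡ n≥3)
      (lin 2 (λ n σ → σ := n :- # 1 ⇒ # 3 :≤ n ⇒ ⊢ # 2 :≤ # 2 :* (# 1 :* (n :- σ) :+ # 0 :* n)) n σ σ≡ n≥3)
      (lin 2 (λ n σ → σ := n :- # 1 ⇒ # 3 :≤ n ⇒ ⊢ # 2 :≤ # 2 :* (# 1 :* # 1 :+ # 0 :* n)) n σ σ≡ n≥3)
      (lin 2 (λ n σ → σ := n :- # 1 ⇒ # 3 :≤ n ⇒ ⊢ con (- + 2) :≤ # 2 :* (# 1 :* con (- + 1) :+ # 0 :* n)) n σ σ≡ n≥3)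
    clash l34′ l42′ U V = k U V (+ 1) (- + 1) (+ 1) (+ 0) (+ 1) (+ 0) (lin 0 (⊢ # 0 :< # 1)) refl 3∤-1
      (lin 2 (λ n σ → σ := n :- # 1 ⇒ # 3 :≤ n ⇒ ⊢ # 0 :≤ # 1 :* (con (- + 1) :* σ :+ # 1 :* n)) n σ σ≡ n≥3)
      (lin 2 (λ n σ → σ := n :- # 1 ⇒ # 3 :≤ n ⇒ ⊢ con (- + 1) :≤ # 1 :* (con (- + 1) :* (n :- σ) :+ # 0 :* n)) n σ σ≡ n≥3)
      (lin 2 (λ n σ → σ := n :- # 1 ⇒ # 3 :≤ n ⇒ ⊢ # 2 :≤ # 1 :* (con (- + 1) :* # 1 :+ # 1 :* n)) n σ σ≡ n≥3)
      (lin 2 (λ n σ → σ := n :- # 1 ⇒ # 3 :≤ n ⇒ ⊢ # 1 :≤ # 1 :* (con (- + 1) :* con (- + 1) :+ # 0 :* n)) n σ σ≡ n≥3)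
    clash l43′ l13′ U V = k U V (+ 2) (- + 1) (+ 1) (+ 1) (+ 0) (+ 0) (lin 0 (⊢ # 0 :< # 2)) refl 3∤-1
      (lin 2 (λ n σ → σ := n :- # 1 ⇒ # 3 :≤ n ⇒ ⊢ # 2 :≤ # 2 :* (con (- + 1) :* σ :+ # 1 :* n)) n σ σ≡ n≥3)
      (lin 2 (λ n σ → σ := n :- # 1 ⇒ # 3 :≤ n ⇒ ⊢ # 0 :≤ # 2 :* (con (- + 1) :* (n :- σ) :+ # 1 :* n)) n σ σ≡ n≥3)
      (lin 2 (λ n σ → σ := n :- # 1 ⇒ # 3 :≤ n ⇒ ⊢ con (- + 2) :≤ # 2 :* (con (- + 1) :* # 1 :+ # 0 :* n)) n σ σ≡ n≥3)
      (lin 2 (λ n σ → σ := n :- # 1 ⇒ # 3 :≤ n ⇒ ⊢ # 2 :≤ # 2 :* (con (- + 1) :* con (- + 1) :+ # 0 :* n)) n σ σ≡ n≥3)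
    clash l43′ l31′ U V = k U V (+ 1) (+ 1) (- + 1) (+ 0) (+ 0) (+ 1) (lin 0 (⊢ # 0 :< # 1)) refl 3∤1
      (lin 2 (λ n σ → σ := n :- # 1 ⇒ # 3 :≤ n ⇒ ⊢ con (- + 1) :≤ # 1 :* (# 1 :* σ :+ con (- + 1) :* n)) n σ σ≡ n≥3)
      (lin 2 (λ n σ → σ := n :- # 1 ⇒ # 3 :≤ n ⇒ ⊢ # 0 :≤ # 1 :* (# 1 :* (n :- σ) :+ # 0 :* n)) n σ σ≡ n≥3)
      (lin 2 (λ n σ → σ := n :- # 1 ⇒ # 3 :≤ n ⇒ ⊢ # 1 :≤ # 1 :* (# 1 :* # 1 :+ # 0 :* n)) n σ σ≡ n≥3)
      (lin 2 (λ n σ → σ := n :- # 1 ⇒ # 3 :≤ n ⇒ ⊢ # 2 :≤ # 1 :* (# 1 :* con (- + 1) :+ # 1 :* n)) n σ σ≡ n≥3)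
    clash l43′ l24′ U V = k U V (+ 1) (- + 1) (+ 1) (+ 1) (+ 0) (+ 0) (lin 0 (⊢ # 0 :< # 1)) refl 3∤-1
      (lin 2 (λ n σ → σ := n :- # 1 ⇒ # 3 :≤ n ⇒ ⊢ # 0 :≤ # 1 :* (con (- + 1) :* σ :+ # 1 :* n)) n σ σ≡ n≥3)
      (lin 2 (λ n σ → σ := n :- # 1 ⇒ # 3 :≤ n ⇒ ⊢ # 2 :≤ # 1 :* (con (- + 1) :* (n :- σ) :+ # 1 :* n)) n σ σ≡ n≥3)
      (lin 2 (λ n σ → σ := n :- # 1 ⇒ # 3 :≤ n ⇒ ⊢ con (- + 1) :≤ # 1 :* (con (- + 1) :* # 1 :+ # 0 :* n)) n σ σ≡ n≥3)
      (lin 2 (λ n σ → σ := n :- # 1 ⇒ # 3 :≤ n ⇒ ⊢ # 1 :≤ # 1 :* (con (- + 1) :* con (- + 1) :+ # 0 :* n)) n σ σ≡ n≥3)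
    clash l43′ l42′ U V = k U V (+ 1) (- + 1) (+ 1) (+ 0) (+ 0) (+ 1) (lin 0 (⊢ # 0 :< # 1)) refl 3∤-1
      (lin 2 (λ n σ → σ := n :- # 1 ⇒ # 3 :≤ n ⇒ ⊢ # 0 :≤ # 1 :* (con (- + 1) :* σ :+ # 1 :* n)) n σ σ≡ n≥3)
      (lin 2 (λ n σ → σ := n :- # 1 ⇒ # 3 :≤ n ⇒ ⊢ con (- + 1) :≤ # 1 :* (con (- + 1) :* (n :- σ) :+ # 0 :* n)) n σ σ≡ n≥3)
      (lin 2 (λ n σ → σ := n :- # 1 ⇒ # 3 :≤ n ⇒ ⊢ con (- + 1) :≤ # 1 :* (con (- + 1) :* # 1 :+ # 0 :* n)) n σ σ≡ n≥3)
      (lin 2 (λ n σ → σ := n :- # 1 ⇒ # 3 :≤ n ⇒ ⊢ # 4 :≤ # 1 :* (con (- + 1) :* con (- + 1) :+ # 1 :* n)) n σ σ≡ n≥3)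

-- Width across two opposite edges, and the reduction to volume three

divAff : ∀ f n → (∀ z → n ∣ᶻ f ⟨ z ⟩) → ∃ λ g → ∀ z → f ⟨ z ⟩ ≡ g ⟨ z ⟩ * n
divAff (aff α β γ δ) n h = go (h (pt (+ 0) (+ 0) (+ 0))) (h (pt (+ 1) (+ 0) (+ 0))) (h (pt (+ 0) (+ 1) (+ 0))) (h (pt (+ 0) (+ 0) (+ 1)))
  where
  f = aff α β γ δ
  go : n ∣ᶻ f ⟨ pt (+ 0) (+ 0) (+ 0) ⟩ → n ∣ᶻ f ⟨ pt (+ 1) (+ 0) (+ 0) ⟩ → n ∣ᶻ f ⟨ pt (+ 0) (+ 1) (+ 0) ⟩ → n ∣ᶻ f ⟨ pt (+ 0) (+ 0) (+ 1) ⟩ → ∃ λ g → ∀ z → f ⟨ z ⟩ ≡ g ⟨ z ⟩ * n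
  go (d , e₀) (a , e₁) (b , e₂) (c , e₃) = aff (a - d) (b - d) (c - d) d , λ { (x ∷ y ∷ z ∷ []) → arith x y z α β γ δ α≡ β≡ γ≡ δ≡ }
    where
    δ≡ : δ ≡ d * n
    δ≡ = lin 6 (λ α β γ δ d n → α :* # 0 :+ β :* # 0 :+ γ :* # 0 :+ δ := d :* n ⇒ ⊢ δ := d :* n) α β γ δ d n e₀
    α≡ : α ≡ (a - d) * n
    α≡ = lin 7 (λ α β γ δ a d n → α :* # 1 :+ β :* # 0 :+ γ :* # 0 :+ δ := a :* n ⇒ δ := d :* n ⇒ ⊢ α := (a :- d) :* n) α β γ δ a d n e₁ δ≡
    β≡ : β ≡ (b - d) * n
    β≡ = lin 7 (λ α β γ δ a d n → α :* # 0 :+ β :* # 1 :+ γ :* # 0 :+ δ := a :* n ⇒ δ := d :* n ⇒ ⊢ β := (a :- d) :* n) α β γ δ b d n e₂ δ≡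
    γ≡ : γ ≡ (c - d) * n
    γ≡ = lin 7 (λ α β γ δ a d n → α :* # 0 :+ β :* # 0 :+ γ :* # 1 :+ δ := a :* n ⇒ δ := d :* n ⇒ ⊢ γ := (a :- d) :* n) α β γ δ c d n e₃ δ≡
    arith : ∀ x y z α β γ δ → α ≡ (a - d) * n → β ≡ (b - d) * n → γ ≡ (c - d) * n → δ ≡ d * n → α * x + β * y + γ * z + δ ≡ ((a - d) * x + (b - d) * y + (c - d) * z + d) * n
    arith x y z _ _ _ _ refl refl refl refl = lin 8 (λ x y z a b c d n → ⊢ (a :- d) :* n :* x :+ (b :- d) :* n :* y :+ (c :- d) :* n :* z :+ d :* n := ((a :- d) :* x :+ (b :- d) :* y :+ (c :- d) :* z :+ d) :* n) x y z a b c d n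

addAff : Aff → Aff → Aff
addAff (aff a b c d) (aff a′ b′ c′ d′) = aff (a + a′) (b + b′) (c + c′) (d + d′)

addAff-at : ∀ f g z → addAff f g ⟨ z ⟩ ≡ f ⟨ z ⟩ + g ⟨ z ⟩
addAff-at (aff a b c d) (aff a′ b′ c′ d′) (x ∷ y ∷ z ∷ []) = lin 11 (λ a b c d a′ b′ c′ d′ x y z → ⊢ (a :+ a′) :* x :+ (b :+ b′) :* y :+ (c :+ c′) :* z :+ (d :+ d′) := (a :* x :+ b :* y :+ c :* z :+ d) :+ (a′ :* x :+ b′ :* y :+ c′ :* z :+ d′)) a b c d a′ b′ c′ d′ x y z

module Process {A : Z3 → Set} (C : Config A) where
  open Config C
  open Classify C
  open Loop C

  -- A point beyond the edge pq as seen from the edge rs.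
  Target : ∀ {p q r s} → WhiteTet A p q r s → Set
  Target T = let open WhiteTet T in ∃ λ v → A v × ∃ λ x → W₁ ⟨ v ⟩ + W₂ ⟨ v ⟩ ≡ x * n × + 2 ≤ x

  -- (W₁ + W₂)/n is an integral functional with the value 1 at p and 0 at r. Width gives a point
  -- where it is at least 2 or negative; a negative value means W₃ + W₄ ≥ 2n.
  target : ∀ {p q r s} (T : WhiteTet A p q r s) → Target T ⊎ Target (wflip A T)
  target {p} {q} {r} {s} T = fromDiv (divAff (addAff W₁ W₂) n (λ z → subst (n ∣ᶻ_) (sym (addAff-at W₁ W₂ z)) (cyc₁₂ z)))
    where
    open WhiteTet T
    fromDiv : (∃ λ g → ∀ z → addAff W₁ W₂ ⟨ z ⟩ ≡ g ⟨ z ⟩ * n) → Target T ⊎ Target (wflip A T)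
    fromDiv (g , e) = fromWidth (width g (p , r , λ h → lin 3 (λ n gp gr → gp :* n := n ⇒ gr :* n := # 0 ⇒ gp :* n := gr :* n ⇒ # 0 :< n ⇒ ⊢ :⊥) n (g ⟨ p ⟩) (g ⟨ r ⟩)
        (trans (sym (val p)) (trans (cong₂ _+_ (W₁p tet) (W₁q (sw12 tet))) (ℤₚ.+-identityʳ n))) (trans (sym (val r)) (cong₂ _+_ (W₁r tet) (W₁r (sw12 tet)))) (cong (_* n) h) n>0))
      where
      val : ∀ z → W₁ ⟨ z ⟩ + W₂ ⟨ z ⟩ ≡ g ⟨ z ⟩ * n
      val z = trans (sym (addAff-at W₁ W₂ z)) (e z)
      fromWidth : (∃ λ v → A v × (g ⟨ v ⟩ < + 0 ⊎ + 1 < g ⟨ v ⟩)) → Target T ⊎ Target (wflip A T)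
      fromWidth (v , Av , inj₂ h) = inj₁ (v , Av , g ⟨ v ⟩ , val v , lin 1 (λ x → # 1 :< x ⇒ ⊢ # 2 :≤ x) (g ⟨ v ⟩) h)
      fromWidth (v , Av , inj₁ h) = inj₂ (v , Av , + 1 - g ⟨ v ⟩ , lin 6 (λ a b c d n x → a :+ b :+ c :+ d := n ⇒ a :+ b := x :* n ⇒ ⊢ c :+ d := (# 1 :- x) :* n) (W₁ ⟨ v ⟩) (W₂ ⟨ v ⟩) (W₃ ⟨ v ⟩) (W₄ ⟨ v ⟩) n (g ⟨ v ⟩) (sumW v) (val v)
        , lin 1 (λ x → x :< # 0 ⇒ ⊢ # 2 :≤ # 1 :- x) (g ⟨ v ⟩) h)

  module _ {p q r s} (T : WhiteTet A p q r s) (v : Z3) {x : ℤ} (e : WhiteTet.W₁ T ⟨ v ⟩ + WhiteTet.W₂ T ⟨ v ⟩ ≡ x * WhiteTet.n T) (x≥2 : + 2 ≤ x) where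
    open WhiteTet T
    private
      2n≤ : + 2 * n ≤ x * n
      2n≤ = lin 2 (λ x n → # 0 :≤ (x :- # 2) :* n ⇒ ⊢ # 2 :* n :≤ x :* n) x n (mul≥0 (ℤₚ.i≤j⇒0≤j-i x≥2) (ℤₚ.<⇒≤ n>0))

    beyond-off : OffLine T v
    beyond-off = (λ { (_ , _ , c , d) → lin 6 (λ a b c d n xn → a :+ b :+ c :+ d := n ⇒ a :+ b := xn ⇒ # 2 :* n :≤ xn ⇒ # 0 :≤ c ⇒ # 0 :≤ d ⇒ # 0 :< n ⇒ ⊢ :⊥) (W₁ ⟨ v ⟩) (W₂ ⟨ v ⟩) (W₃ ⟨ v ⟩) (W₄ ⟨ v ⟩) n (x * n) (sumW v) e 2n≤ c d n>0 })
               , (λ { (c , d) → lin 6 (λ a b c d n xn → a :+ b :+ c :+ d := n ⇒ a :+ b := xn ⇒ # 2 :* n :≤ xn ⇒ c := # 0 ⇒ d := # 0 ⇒ # 0 :< n ⇒ ⊢ :⊥) (W₁ ⟨ v ⟩) (W₂ ⟨ v ⟩) (W₃ ⟨ v ⟩) (W₄ ⟨ v ⟩) n (x * n) (sumW v) e 2n≤ c d n>0 })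

    -- W₁ + W₂ is positive at v. A point between v and the tetrahedron adds only nonnegative terms
    -- to this, so W₁ and W₂ cannot both vanish there.
    beyond-RS : ∀ w {a b c d} → Between tet v w → At tet w a b c d → a ≡ + 0 → b ≡ + 0 → ⊥
    beyond-RS w B (at w₁ w₂ _ _) refl refl = lin 8 (λ K τ a b n ρ₁ ρ₂ xn → K :* (# 0 :* n) := τ :* a :+ ρ₁ ⇒ K :* (# 0 :* n) := τ :* b :+ ρ₂ ⇒ # 0 :≤ ρ₁ ⇒ # 0 :≤ ρ₂ ⇒ # 0 :< τ :* (a :+ b) ⇒ ⊢ :⊥)
        K τ (W₁ ⟨ v ⟩) (W₂ ⟨ v ⟩) n ρ₁ ρ₂ (x * n) (trans (cong (K *_) (sym w₁)) eq₁) (trans (cong (K *_) (sym w₂)) eq₂) ρ₁≥0 ρ₂≥0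
        (mul>0 τ>0 (lin 4 (λ a b n xn → a :+ b := xn ⇒ # 2 :* n :≤ xn ⇒ # 0 :< n ⇒ ⊢ # 0 :< a :+ b) (W₁ ⟨ v ⟩) (W₂ ⟨ v ⟩) n (x * n) e 2n≤ n>0))
      where open Between B

  level-shift : ∀ {p q r s} (T : WhiteTet A p q r s) (S : Shifted T) v {x} → WhiteTet.W₁ T ⟨ v ⟩ + WhiteTet.W₂ T ⟨ v ⟩ ≡ x * WhiteTet.n T →
    WhiteTet.W₁ (Shifted.white S) ⟨ v ⟩ + WhiteTet.W₂ (Shifted.white S) ⟨ v ⟩ ≡ x * WhiteTet.n (Shifted.white S)
  level-shift T S v {x} e = trans (lin 10 (λ a b c d n a′ b′ c′ d′ n′ → a :+ b :+ c :+ d := n ⇒ a′ :+ b′ :+ c′ :+ d′ := n′ ⇒ n′ := n ⇒ c′ := c ⇒ d′ := d ⇒ ⊢ a′ :+ b′ := a :+ b)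
      (W₁ ⟨ v ⟩) (W₂ ⟨ v ⟩) (W₃ ⟨ v ⟩) (W₄ ⟨ v ⟩) n (S.W₁ ⟨ v ⟩) (S.W₂ ⟨ v ⟩) (S.W₃ ⟨ v ⟩) (S.W₄ ⟨ v ⟩) S.n (sumW v) (S.sumW v) n≡ (W₃≡ v) (W₄≡ v)) (trans e (cong (x *_) (sym n≡)))
    where
    open WhiteTet T
    open Shifted S using (white; n≡; W₃≡; W₄≡)
    module S = WhiteTet white

  -- Three lattice points with barycentre o, and a lattice segment oa.
  record Spike : Set where
    field
      {o a b c} : Z3
      white : WhiteTet A o a b c
      n≡3 : WhiteTet.n white ≡ + 3
      σ≡ : WhiteTet.σ white ≡ WhiteTet.n white - + 1
      e : Z3
      Ae : A e
      e-at : At (WhiteTet.tet white) e (+ 3) (+ 0) (- + 1) (- + 1)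

  private
    σ₁₂ : ∀ {p q r s} (T : WhiteTet A p q r s) → let open WhiteTet T in n ≡ + 3 → n - σ ≡ n - + 1 ⊎ σ ≡ n - + 1
    σ₁₂ T h = go (small₃ σ (ℤₚ.<⇒≤ σ>0) (subst (σ <_) h σ<n))
      where
      open WhiteTet T
      go : σ ≡ + 0 ⊎ σ ≡ + 1 ⊎ σ ≡ + 2 → n - σ ≡ n - + 1 ⊎ σ ≡ n - + 1
      go (inj₁ e) = ⊥-elim (ℤₚ.<-irrefl (sym e) σ>0)
      go (inj₂ (inj₁ e)) = inj₁ (cong (λ x → n - x) e)
      go (inj₂ (inj₂ e)) = inj₂ (trans e (cong (_- + 1) (sym h)))

    spike₁ : ∀ {p q r s} (T : WhiteTet A p q r s) w → A w → WhiteTet.n T ≡ + 3 → At (WhiteTet.tet T) w (+ 3) (+ 0) (- + 1) (- + 1) → Spike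
    spike₁ T w Aw n≡3 W = go (σ₁₂ T n≡3)
      where
      go : WhiteTet.n T - WhiteTet.σ T ≡ WhiteTet.n T - + 1 ⊎ WhiteTet.σ T ≡ WhiteTet.n T - + 1 → Spike
      go (inj₂ e) = record { white = T ; n≡3 = n≡3 ; σ≡ = e ; e = w ; Ae = Aw ; e-at = W }
      go (inj₁ e) = record { white = wsw34 A T ; n≡3 = n≡3 ; σ≡ = e ; e = w ; Ae = Aw ; e-at = at34 W }

    2≢1 : ∀ {p q r s} (T : WhiteTet A p q r s) → let open WhiteTet T in σ ≡ n - + 1 → σ ≡ + 1 → ⊥
    2≢1 T e e′ = lin 2 (λ n σ → σ := n :- # 1 ⇒ σ := # 1 ⇒ # 3 :≤ n ⇒ ⊢ :⊥) n σ e e′ n≥3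
      where open WhiteTet T

  data Found (n : ℤ) : Set where
    found : n ≡ + 3 → Spike → Found n

  private
    -- For n = 3 and σ = 2 the exchange of q and r takes the positions h to positions f. The
    -- positions g become h when r and s are exchanged.
    h-spike : ∀ {p q r s} (T : WhiteTet A p q r s) → WhiteTet.σ T ≡ WhiteTet.n T - + 1 → WhiteTet.n T ≡ + 3 → ∀ {w} → A w → let W = At (WhiteTet.tet T) w in
      W (+ 3) (- + 1) (+ 0) (- + 1) ⊎ W (- + 1) (+ 3) (- + 1) (+ 0) ⊎ W (+ 0) (- + 1) (+ 3) (- + 1) ⊎ W (- + 1) (+ 0) (- + 1) (+ 3) → Spike
    h-spike T σ≡ n≡3 Aw (inj₁ W) = spike₁ (wsw23 A T σ≡) _ Aw n≡3 (at23 W)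
    h-spike T σ≡ n≡3 Aw (inj₂ (inj₁ W)) = spike₁ (wflip A (wsw23 A T σ≡)) _ Aw n≡3 (atflip (at23 W))
    h-spike T σ≡ n≡3 Aw (inj₂ (inj₂ (inj₁ W))) = spike₁ (wsw12 A (wsw23 A T σ≡)) _ Aw n≡3 (at12 (at23 W))
    h-spike T σ≡ n≡3 Aw (inj₂ (inj₂ (inj₂ W))) = spike₁ (wsw12 A (wflip A (wsw23 A T σ≡))) _ Aw n≡3 (at12 (atflip (at23 W)))

    data Sorted {p q r s} (T : WhiteTet A p q r s) (w : Z3) : Set where
      spike : Found (WhiteTet.n T) → Sorted T w
      cross : ∀ {a b c d} → WhiteTet.σ T ≡ WhiteTet.n T - + 1 → Cross a b c d → At (WhiteTet.tet T) w a b c d → Sorted T w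
      cross′ : ∀ {a b c d} → WhiteTet.σ T ≡ + 1 → Cross a b c d → At (sw34 (WhiteTet.tet T)) w a b c d → Sorted T w

    sort : ∀ {p q r s} (T : WhiteTet A p q r s) {w a b c d} → A w → Out (WhiteTet.n T) (WhiteTet.σ T) a b c d → ¬ OnLine a b c d → At (WhiteTet.tet T) w a b c d → Sorted T w
    sort T Aw l12 ¬l W = ⊥-elim (¬l l12′)
    sort T Aw l21 ¬l W = ⊥-elim (¬l l21′)
    sort T Aw l34 ¬l W = ⊥-elim (¬l l34′)
    sort T Aw l43 ¬l W = ⊥-elim (¬l l43′)
    sort T Aw (l13 e) ¬l W = cross e l13′ W
    sort T Aw (l31 e) ¬l W = cross e l31′ W
    sort T Aw (l24 e) ¬l W = cross e l24′ W
    sort T Aw (l42 e) ¬l W = cross e l42′ W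
    sort T Aw (l14 e) ¬l W = cross′ e l13′ (at34 W)
    sort T Aw (l41 e) ¬l W = cross′ e l31′ (at34 W)
    sort T Aw (l23 e) ¬l W = cross′ e l24′ (at34 W)
    sort T Aw (l32 e) ¬l W = cross′ e l42′ (at34 W)
    sort T Aw (f1 e) ¬l W = spike (found e (spike₁ T _ Aw e W))
    sort T Aw (f2 e) ¬l W = spike (found e (spike₁ (wsw12 A T) _ Aw e (at12 W)))
    sort T Aw (f3 e) ¬l W = spike (found e (spike₁ (wflip A T) _ Aw e (atflip W)))
    sort T Aw (f4 e) ¬l W = spike (found e (spike₁ (wsw12 A (wflip A T)) _ Aw e (at12 (atflip W))))
    sort T Aw (g1 e h) ¬l W = spike (found e (h-spike (wsw34 A T) (cong (λ x → WhiteTet.n T - x) h) e Aw (inj₁ (at34 W))))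
    sort T Aw (g2 e h) ¬l W = spike (found e (h-spike (wsw34 A T) (cong (λ x → WhiteTet.n T - x) h) e Aw (inj₂ (inj₁ (at34 W)))))
    sort T Aw (g3 e h) ¬l W = spike (found e (h-spike (wsw34 A T) (cong (λ x → WhiteTet.n T - x) h) e Aw (inj₂ (inj₂ (inj₂ (at34 W))))))
    sort T Aw (g4 e h) ¬l W = spike (found e (h-spike (wsw34 A T) (cong (λ x → WhiteTet.n T - x) h) e Aw (inj₂ (inj₂ (inj₁ (at34 W))))))
    sort T Aw (h1 e h) ¬l W = spike (found e (h-spike T h e Aw (inj₁ W)))
    sort T Aw (h2 e h) ¬l W = spike (found e (h-spike T h e Aw (inj₂ (inj₁ W))))
    sort T Aw (h3 e h) ¬l W = spike (found e (h-spike T h e Aw (inj₂ (inj₂ (inj₁ W)))))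
    sort T Aw (h4 e h) ¬l W = spike (found e (h-spike T h e Aw (inj₂ (inj₂ (inj₂ W)))))

    found-≡ : ∀ {m n} → m ≡ n → Found m → Found n
    found-≡ refl F = F

    turn : ∀ {p q r s} (T : WhiteTet A p q r s) (σ≡ : WhiteTet.σ T ≡ WhiteTet.n T - + 1) {w a b c d} → A w → Cross a b c d → At (WhiteTet.tet T) w a b c d → Third (wsw23 A T σ≡)
    turn T σ≡ Aw l13′ W = _ , Aw , _ , _ , _ , _ , l12′ , at23 W
    turn T σ≡ Aw l31′ W = _ , Aw , _ , _ , _ , _ , l21′ , at23 W
    turn T σ≡ Aw l24′ W = _ , Aw , _ , _ , _ , _ , l34′ , at23 W
    turn T σ≡ Aw l42′ W = _ , Aw , _ , _ , _ , _ , l43′ , at23 W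

    -- Second stage: one of the lines pq, rs already contains a further point and the polytope is not confined to the levels of pq and rs.
    second⁺ : ∀ {p q r s} (T : WhiteTet A p q r s) → WhiteTet.σ T ≡ WhiteTet.n T - + 1 → BigFree C (WhiteTet.n T) → Third T → Target T → Found (WhiteTet.n T)
    second⁺ T σ≡ bf third (v , Av , x , e , x≥2) = go (loop T bf v Av (beyond-off T v e x≥2))
      where
      finish : ∀ {p q r s} (T′ : WhiteTet A p q r s) → WhiteTet.σ T′ ≡ WhiteTet.n T′ - + 1 → Third T′ → WhiteTet.W₁ T′ ⟨ v ⟩ + WhiteTet.W₂ T′ ⟨ v ⟩ ≡ x * WhiteTet.n T′ → Final T′ v → Found (WhiteTet.n T′)
      finish T′ σ≡′ (u , Au , _ , _ , _ , _ , o , U) e′ F = by (Final.out F) (Final.coords F)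
        where
        open Final F using (point; inA; between)
        by : ∀ {a b c d} → Out′ (WhiteTet.n T′) (WhiteTet.σ T′) a b c d → At (WhiteTet.tet T′) point a b c d → Found (WhiteTet.n T′)
        by (onRS _ a0 b0) W = ⊥-elim (beyond-RS T′ v e′ x≥2 point between W a0 b0)
        by (other o′ ¬l) W = done (sort T′ inA o′ ¬l W)
          where
          done : Sorted T′ point → Found (WhiteTet.n T′)
          done (spike F) = F
          done (cross _ c W) = ⊥-elim (clash T′ σ≡′ o c (Au , U) (inA , W))
          done (cross′ h _ _) = ⊥-elim (2≢1 T′ σ≡′ h)
      go : Final T v ⊎ (Σ (Shifted T) λ S → Final (Shifted.white S) v) → Found (WhiteTet.n T)
      go (inj₁ F) = finish T σ≡ third e F
      go (inj₂ (S , F)) = found-≡ n≡ (finish white (trans σ≡′ (trans σ≡ (cong (_- + 1) (sym n≡)))) third′ (level-shift T S v {x} e) F)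
        where
        open Shifted S renaming (σ≡ to σ≡′; third to third′)

    second : ∀ {p q r s} (T : WhiteTet A p q r s) → WhiteTet.σ T ≡ WhiteTet.n T - + 1 → WhiteTet.ρ T ≡ WhiteTet.n T - + 1 → BigFree C (WhiteTet.n T) → Third T → Found (WhiteTet.n T)
    second T σ≡ ρ≡ bf third = go (target T)
      where
      flipThird : Third T → Third (wflip A T)
      flipThird (u , Au , _ , _ , _ , _ , l12′ , W) = u , Au , _ , _ , _ , _ , l34′ , atflip W
      flipThird (u , Au , _ , _ , _ , _ , l21′ , W) = u , Au , _ , _ , _ , _ , l43′ , atflip W
      flipThird (u , Au , _ , _ , _ , _ , l34′ , W) = u , Au , _ , _ , _ , _ , l12′ , atflip W
      flipThird (u , Au , _ , _ , _ , _ , l43′ , W) = u , Au , _ , _ , _ , _ , l21′ , atflip W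
      go : Target T ⊎ Target (wflip A T) → Found (WhiteTet.n T)
      go (inj₁ t) = second⁺ T σ≡ bf third t
      go (inj₂ t) = second⁺ (wflip A T) ρ≡ bf (flipThird third) t

    -- Unless a spike is found, the adjacent point prolongs an edge outside the distinguished pair,
    -- and σ = ±1 modulo n. After re-pairing it lies on a distinguished line; in the second stage a
    -- further point of this kind is impossible by `clash`.
    first⁺ : ∀ {p q r s} (T : WhiteTet A p q r s) → BigFree C (WhiteTet.n T) → Target T → Found (WhiteTet.n T)
    first⁺ T bf (v , Av , x , e , x≥2) = go (loop T bf v Av (beyond-off T v e x≥2))
      where
      finish : ∀ {p q r s} (T′ : WhiteTet A p q r s) → BigFree C (WhiteTet.n T′) → WhiteTet.W₁ T′ ⟨ v ⟩ + WhiteTet.W₂ T′ ⟨ v ⟩ ≡ x * WhiteTet.n T′ → Final T′ v → Found (WhiteTet.n T′)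
      finish T′ bf e′ F = by (Final.out F) (Final.coords F)
        where
        open Final F using (point; inA; between)
        by : ∀ {a b c d} → Out′ (WhiteTet.n T′) (WhiteTet.σ T′) a b c d → At (WhiteTet.tet T′) point a b c d → Found (WhiteTet.n T′)
        by (onRS _ a0 b0) W = ⊥-elim (beyond-RS T′ v e′ x≥2 point between W a0 b0)
        by (other o′ ¬l) W = done (sort T′ inA o′ ¬l W)
          where
          done : Sorted T′ point → Found (WhiteTet.n T′)
          done (spike F) = F
          done (cross h c W) = second (wsw23 A T′ h) h refl bf (turn T′ h inA c W)
          done (cross′ h c W) = second (wsw23 A (wsw34 A T′) h′) h′ refl bf (turn (wsw34 A T′) h′ inA c W)
            where
            h′ : WhiteTet.n T′ - WhiteTet.σ T′ ≡ WhiteTet.n T′ - + 1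
            h′ = cong (λ y → WhiteTet.n T′ - y) h
      go : Final T v ⊎ (Σ (Shifted T) λ S → Final (Shifted.white S) v) → Found (WhiteTet.n T)
      go (inj₁ F) = finish T bf e F
      go (inj₂ (S , F)) = found-≡ (Shifted.n≡ S) (finish (Shifted.white S) (bigFree-≡ (Shifted.n≡ S) bf) (level-shift T S v {x} e) F)

  process : ∀ {p q r s} (T : WhiteTet A p q r s) → BigFree C (WhiteTet.n T) → Found (WhiteTet.n T)
  process T bf = go (target T)
    where
    go : Target T ⊎ Target (wflip A T) → Found (WhiteTet.n T)
    go (inj₁ t) = first⁺ T bf t
    go (inj₂ t) = first⁺ (wflip A T) bf t

  private
    fromEmpty : ∀ (E : EmptyTet C) → BigFree C (Tet.n (EmptyTet.tet E)) → Found (Tet.n (EmptyTet.tet E))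
    fromEmpty E bf = found-≡ same-n (process white-tet (bigFree-≡ same-n bf))
      where
      open EmptyTet E
      open Normalised (normalise C tet raw emp Ap Aq Ar As)

    volume≤ : ∀ (E : EmptyTet C) → Tet.n (EmptyTet.tet E) ≤ + volumeBound M
    volume≤ E = subst (_≤ + volumeBound M) (sym (Tet.n≡vol tet)) (+≤+ (vol≤ M p q r s (bound p Ap) (bound q Aq) (bound r Ar) (bound s As)))
      where open EmptyTet E

    -- Induction on the distance of the volume from the bound. A larger empty tetrahedron would have
    -- volume three by the induction hypothesis, but the volume of `E` is at least three already; so
    -- `E` is maximal and `process` applies.
    allThree : ∀ k (E : EmptyTet C) → + volumeBound M ≤ Tet.n (EmptyTet.tet E) + + k → Found (Tet.n (EmptyTet.tet E))
    allThree zero E h = fromEmpty E λ E′ lt → lin 3 (λ B n n′ → B :≤ n :+ # 0 ⇒ n :< n′ ⇒ n′ :≤ B ⇒ ⊢ :⊥) (+ volumeBound M) (Tet.n (EmptyTet.tet E)) (Tet.n (EmptyTet.tet E′)) h lt (volume≤ E′)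
    allThree (suc k) E h = fromEmpty E λ E′ lt → absurd E′ lt (allThree k E′ (lin 4 (λ B n n′ k → B :≤ n :+ (# 1 :+ k) ⇒ n :< n′ ⇒ ⊢ B :≤ n′ :+ k) (+ volumeBound M) (Tet.n (EmptyTet.tet E)) (Tet.n (EmptyTet.tet E′)) (+ k) h lt))
      where
      n≥3 : + 3 ≤ Tet.n (EmptyTet.tet E)
      n≥3 = subst (+ 3 ≤_) same-n (WhiteTet.n≥3 white-tet)
        where
        open EmptyTet E
        open Normalised (normalise C tet raw emp Ap Aq Ar As)
      absurd : ∀ E′ → Tet.n (EmptyTet.tet E) < Tet.n (EmptyTet.tet E′) → Found (Tet.n (EmptyTet.tet E′)) → ⊥
      absurd E′ lt (found e _) = ℤₚ.<-irrefl refl (ℤₚ.≤-<-trans n≥3 (subst (Tet.n (EmptyTet.tet E) <_) e lt))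

  findSpike : ∀ (E : EmptyTet C) → Found (Tet.n (EmptyTet.tet E))
  findSpike E = allThree (volumeBound M) E (lin 2 (λ B n → # 0 :< n ⇒ ⊢ B :≤ n :+ B) (+ volumeBound M) (Tet.n (EmptyTet.tet E)) (Tet.n>0 (EmptyTet.tet E)))

  bigFree₃ : BigFree C (+ 3)
  bigFree₃ E lt = go (findSpike E)
    where
    go : Found (Tet.n (EmptyTet.tet E)) → ⊥
    go (found e _) = ℤₚ.<-irrefl (sym e) lt

-- Tetrahedra of volume three: spikes and the exceptional configuration

unique : ∀ {p q r s} (T : Tet p q r s) {z z′} → let open Tet T in W₁ ⟨ z ⟩ ≡ W₁ ⟨ z′ ⟩ → W₂ ⟨ z ⟩ ≡ W₂ ⟨ z′ ⟩ → W₃ ⟨ z ⟩ ≡ W₃ ⟨ z′ ⟩ → W₄ ⟨ z ⟩ ≡ W₄ ⟨ z′ ⟩ → z ≡ z′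
unique {p} {q} {r} {s} T {z} {z′} e₁ e₂ e₃ e₄ = linear-ext z z′ λ f → lin 3 (λ a b d → a :+ d := b :+ d ⇒ ⊢ a := b) (linear f z) (linear f z′) (Aff.δ f) (same f)
  where
  open Tet T
  same : ∀ f → f ⟨ z ⟩ ≡ f ⟨ z′ ⟩
  same f = cancel≡ (f ⟨ z ⟩) (f ⟨ z′ ⟩) n>0 (trans (ℤₚ.*-comm (f ⟨ z ⟩) n) (trans (bary T f z) (trans
    (cong₂ _+_ (cong₂ _+_ (cong₂ _+_ (cong (_* f ⟨ p ⟩) e₁) (cong (_* f ⟨ q ⟩) e₂)) (cong (_* f ⟨ r ⟩) e₃)) (cong (_* f ⟨ s ⟩) e₄))
    (trans (sym (bary T f z′)) (ℤₚ.*-comm n (f ⟨ z′ ⟩))))))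

_≟Z_ : (x y : Z3) → Dec (x ≡ y)
_≟Z_ = Vecₚ.≡-dec ℤₚ._≟_

module Three {A : Z3 → Set} (C : Config A) where
  open Config C
  open Classify C
  open Loop C
  open Process C

  module _ {p q r s} (T : WhiteTet A p q r s) (n≡3 : WhiteTet.n T ≡ + 3) (σ≡ : WhiteTet.σ T ≡ WhiteTet.n T - + 1) where
    open WhiteTet T

    -- With n = 3 and σ = 2 all coordinates are numerals, so the hypotheses of `killAt` are decided
    -- by evaluation.
    kill₃ : ∀ {u v w a₁ a₂ a₃ a₄ b₁ b₂ b₃ b₄ c₁ c₂ c₃ c₄} → A u × At tet u a₁ a₂ a₃ a₄ → A v × At tet v b₁ b₂ b₃ b₄ → A w × At tet w c₁ c₂ c₃ c₄ →
      ∀ a b c K l k₁ k₂ k₃ k₄ → l ≡ + 1 ⊎ l ≡ - + 1 →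
      {True ((+ 0 ℤₚ.≤? a) ×-dec (+ 0 ℤₚ.≤? b) ×-dec (+ 0 ℤₚ.≤? c) ×-dec (+ 0 ℤₚ.<? K) ×-dec (l + k₁ + k₂ + k₃ + k₄ ℤₚ.≟ + 1) ×-dec
        (a * a₁ + b * b₁ + c * c₁ ℤₚ.≤? K * (l * + 2 + k₁ * + 3)) ×-dec (a * a₂ + b * b₂ + c * c₂ ℤₚ.≤? K * (l * + 1 + k₂ * + 3)) ×-dec
        (a * a₃ + b * b₃ + c * c₃ ℤₚ.≤? K * (l * + 1 + k₃ * + 3)) ×-dec (a * a₄ + b * b₄ + c * c₄ ℤₚ.≤? K * (l * - + 1 + k₄ * + 3)))} → ⊥
    kill₃ {u} {v} {w} (Au , U) (Av , V) (Aw , W) a b c K l k₁ k₂ k₃ k₄ l± {t} = go (toWitness t)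
      where
      σ2 : + 2 ≡ σ
      σ2 = lin 2 (λ n σ → n := # 3 ⇒ σ := n :- # 1 ⇒ ⊢ # 2 := σ) n σ n≡3 σ≡
      n-σ : + 1 ≡ n - σ
      n-σ = lin 2 (λ n σ → σ := n :- # 1 ⇒ ⊢ # 1 := n :- σ) n σ σ≡
      3∤l : l ≡ + 1 ⊎ l ≡ - + 1 → ¬ (+ 3 ∣ᶻ l)
      3∤l (inj₁ refl) = 3∤1
      3∤l (inj₂ refl) = 3∤-1
      go : _ → ⊥
      go (ha , hb , hc , hK , e , d₁ , d₂ , d₃ , d₄) = killAt T {u} {v} {w} Au Av Aw U V W a b c K l k₁ k₂ k₃ k₄ ha hb hc hK e (3∤l l±)
        (to d₁ (cong₂ (λ x y → l * x + k₁ * y) σ2 (sym n≡3))) (to d₂ (cong₂ (λ x y → l * x + k₂ * y) n-σ (sym n≡3)))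
        (to d₃ (cong (λ y → l * + 1 + k₃ * y) (sym n≡3))) (to d₄ (cong (λ y → l * - + 1 + k₄ * y) (sym n≡3)))
        where
        to : ∀ {x y y′} → x ≤ K * y → y ≡ y′ → x ≤ K * y′
        to h refl = h

    stays : ∀ {x y τ ρ K m} → + 0 < K → + 0 < τ → + 0 ≤ ρ → K * y ≡ τ * x + ρ → y ≡ m * n → + 0 ≤ x → + 0 ≤ m
    stays {x} {y} {τ} {ρ} {K} {m} K>0 τ>0 ρ≥0 e refl x≥0 = cancel≤ (+ 0) m (mul>0 K>0 n>0) (lin 4 (λ K n m s → K :* (m :* n) := s ⇒ # 0 :≤ s ⇒ ⊢ # 0 :* (K :* n) :≤ m :* (K :* n)) K n m (τ * x + ρ) e (ℤₚ.+-mono-≤ (mul≥0 (ℤₚ.<⇒≤ τ>0) x≥0) ρ≥0))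

    no-l14 : σ ≡ + 1 → ⊥
    no-l14 e = lin 2 (λ n σ → n := # 3 ⇒ σ := n :- # 1 ⇒ σ := # 1 ⇒ ⊢ :⊥) n σ n≡3 σ≡ e

    private
      neg : + 0 ≤ - + 1 → ⊥
      neg ()

    data Side (w : Z3) : Set where
      l31 : At tet w (- + 1) (+ 0) (+ 2) (+ 0) → Side w
      l42 : At tet w (+ 0) (- + 1) (+ 0) (+ 2) → Side w
      f3 : At tet w (- + 1) (- + 1) (+ 3) (+ 0) → Side w
      f4 : At tet w (- + 1) (- + 1) (+ 0) (+ 3) → Side w

    -- W₃ and W₄ stay nonnegative on the way from v to the adjacent point, which leaves four
    -- positions.
    side : ∀ {v} → + 0 ≤ W₃ ⟨ v ⟩ → + 0 ≤ W₄ ⟨ v ⟩ → (F : Final T v) → Side (Final.point F)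
    side {v} h₃ h₄ F = by (Final.out F) (Final.coords F)
      where
      open Final F using (point; inA; between)
      open Between between
      ok : ∀ {a b c d} → At tet point a b c d → + 0 ≤ c × + 0 ≤ d
      ok (at _ _ w₃ w₄) = stays {W₃ ⟨ v ⟩} {W₃ ⟨ point ⟩} K>0 τ>0 ρ₃≥0 eq₃ w₃ h₃ , stays {W₄ ⟨ v ⟩} {W₄ ⟨ point ⟩} K>0 τ>0 ρ₄≥0 eq₄ w₄ h₄
      by : ∀ {a b c d} → Out′ n σ a b c d → At tet point a b c d → Side point
      by (onRS l12′ () _) W
      by (onRS l21′ () _) W
      by (onRS l34′ _ _) W = ⊥-elim (neg (proj₂ (ok W)))
      by (onRS l43′ _ _) W = ⊥-elim (neg (proj₁ (ok W)))
      by (other l12 h) W = ⊥-elim (h l12′)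
      by (other l21 h) W = ⊥-elim (h l21′)
      by (other l34 h) W = ⊥-elim (h l34′)
      by (other l43 h) W = ⊥-elim (h l43′)
      by (other (l13 _) _) W = ⊥-elim (neg (proj₁ (ok W)))
      by (other (l31 _) _) W = l31 W
      by (other (l24 _) _) W = ⊥-elim (neg (proj₂ (ok W)))
      by (other (l42 _) _) W = l42 W
      by (other (l14 e) _) W = ⊥-elim (no-l14 e)
      by (other (l41 e) _) W = ⊥-elim (no-l14 e)
      by (other (l23 e) _) W = ⊥-elim (no-l14 e)
      by (other (l32 e) _) W = ⊥-elim (no-l14 e)
      by (other (f1 _) _) W = ⊥-elim (neg (proj₁ (ok W)))
      by (other (f2 _) _) W = ⊥-elim (neg (proj₁ (ok W)))
      by (other (f3 _) _) W = f3 W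
      by (other (f4 _) _) W = f4 W
      by (other (g1 _ e) _) W = ⊥-elim (no-l14 e)
      by (other (g2 _ e) _) W = ⊥-elim (no-l14 e)
      by (other (g3 _ e) _) W = ⊥-elim (no-l14 e)
      by (other (g4 _ e) _) W = ⊥-elim (no-l14 e)
      by (other (h1 _ _) _) W = ⊥-elim (neg (proj₂ (ok W)))
      by (other (h2 _ _) _) W = ⊥-elim (neg (proj₁ (ok W)))
      by (other (h3 _ _) _) W = ⊥-elim (neg (proj₂ (ok W)))
      by (other (h4 _ _) _) W = ⊥-elim (neg (proj₁ (ok W)))

    -- A third point on the line pq and a point in a side position together generate a forbidden
    -- point. The numerals are the weights of the points, then K, l and the multiples of the
    -- vertices.
    long-spike : ∀ {u w} → A u → At tet u (+ 2) (- + 1) (+ 0) (+ 0) ⊎ At tet u (- + 1) (+ 2) (+ 0) (+ 0) → A w → Side w → ⊥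
    long-spike Au (inj₁ U) Aw (l31 W) = kill₃ (Aw , W) (Au , U) (Au , U) (+ 3) (+ 3) (+ 0) (+ 3) (- + 1) (+ 1) (+ 0) (+ 1) (+ 0) (inj₂ refl)
    long-spike Au (inj₁ U) Aw (l42 W) = kill₃ (Aw , W) (Au , U) (Au , U) (+ 3) (+ 3) (+ 0) (+ 3) (+ 1) (+ 0) (- + 1) (+ 0) (+ 1) (inj₁ refl)
    long-spike Au (inj₁ U) Aw (f3 W) = kill₃ (Aw , W) (Au , U) (Au , U) (+ 3) (+ 3) (+ 0) (+ 5) (- + 1) (+ 1) (+ 0) (+ 1) (+ 0) (inj₂ refl)
    long-spike Au (inj₁ U) Aw (f4 W) = kill₃ (Aw , W) (Au , U) (Au , U) (+ 3) (+ 6) (+ 0) (+ 9) (- + 1) (+ 1) (+ 0) (+ 1) (+ 0) (inj₂ refl)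
    long-spike Au (inj₂ U) Aw (l31 W) = kill₃ (Aw , W) (Au , U) (Au , U) (+ 3) (+ 3) (+ 0) (+ 3) (- + 1) (+ 0) (+ 1) (+ 1) (+ 0) (inj₂ refl)
    long-spike Au (inj₂ U) Aw (l42 W) = kill₃ (Aw , W) (Au , U) (Au , U) (+ 3) (+ 3) (+ 0) (+ 3) (+ 1) (- + 1) (+ 0) (+ 0) (+ 1) (inj₁ refl)
    long-spike Au (inj₂ U) Aw (f3 W) = kill₃ (Aw , W) (Au , U) (Au , U) (+ 3) (+ 6) (+ 0) (+ 9) (+ 1) (- + 1) (+ 0) (+ 0) (+ 1) (inj₁ refl)
    long-spike Au (inj₂ U) Aw (f4 W) = kill₃ (Aw , W) (Au , U) (Au , U) (+ 3) (+ 3) (+ 0) (+ 5) (+ 1) (- + 1) (+ 0) (+ 0) (+ 1) (inj₁ refl)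

    -- Shows that the facet qrs of T is on the boundary of P, given the points b = 3p - r - s and w
    -- = 8p - q - 3r - 3s. A point v behind it would have an adjacent point with first coordinate at
    -- most 0, and every such position produces a forbidden point together with b and w.
    facet : ∀ {b w} → A b → At tet b (+ 3) (+ 0) (- + 1) (- + 1) → A w → At tet w (+ 8) (- + 1) (- + 3) (- + 3) → ∀ v → A v → + 0 ≤ W₁ ⟨ v ⟩
    facet Ab B Aw W v Av = ℤₚ.≮⇒≥ λ h → go h (adjacent T (bigFree-≡ n≡3 bigFree₃) v Av (λ { (g , _) → ℤₚ.<-irrefl refl (ℤₚ.<-≤-trans h g) }))
      where
      k : ∀ {x a₁ a₂ a₃ a₄} → A x → At tet x a₁ a₂ a₃ a₄ → ∀ a b c K l k₁ k₂ k₃ k₄ → l ≡ + 1 ⊎ l ≡ - + 1 →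
        {True ((+ 0 ℤₚ.≤? a) ×-dec (+ 0 ℤₚ.≤? b) ×-dec (+ 0 ℤₚ.≤? c) ×-dec (+ 0 ℤₚ.<? K) ×-dec (l + k₁ + k₂ + k₃ + k₄ ℤₚ.≟ + 1) ×-dec
          (a * a₁ + b * + 3 + c * + 8 ℤₚ.≤? K * (l * + 2 + k₁ * + 3)) ×-dec (a * a₂ + b * + 0 + c * - + 1 ℤₚ.≤? K * (l * + 1 + k₂ * + 3)) ×-dec
          (a * a₃ + b * - + 1 + c * - + 3 ℤₚ.≤? K * (l * + 1 + k₃ * + 3)) ×-dec (a * a₄ + b * - + 1 + c * - + 3 ℤₚ.≤? K * (l * - + 1 + k₄ * + 3)))} → ⊥
      k Ax X a b c K l k₁ k₂ k₃ k₄ l± {t} = kill₃ (Ax , X) (Ab , B) (Aw , W) a b c K l k₁ k₂ k₃ k₄ l± {t}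
      go : W₁ ⟨ v ⟩ < + 0 → Adjacent T v → ⊥
      go h adj = by out coords (first coords)
        where
        open Adjacent adj
        open Between between
        -- K times the last three coordinates of `point` add up to at least τ (n - W₁(v)) > 0, so
        -- its first coordinate is less than n.
        first : ∀ {a b c d} → At tet point a b c d → a < + 1
        first {a} (at w₁ _ _ _) = cancel< a (+ 1) (mul>0 K>0 n>0) (lin 16 (λ K n a τ v₁ v₂ v₃ v₄ p₁ p₂ p₃ p₄ r₁ r₂ r₃ r₄ →
            K :* p₁ := τ :* v₁ :+ r₁ ⇒ K :* p₂ := τ :* v₂ :+ r₂ ⇒ K :* p₃ := τ :* v₃ :+ r₃ ⇒ K :* p₄ := τ :* v₄ :+ r₄ ⇒ K :* (p₁ :+ p₂ :+ p₃ :+ p₄) := K :* n ⇒ τ :* (v₁ :+ v₂ :+ v₃ :+ v₄) := τ :* n ⇒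
            # 0 :< τ :* (:- v₁) ⇒ # 0 :≤ r₂ ⇒ # 0 :≤ r₃ ⇒ # 0 :≤ r₄ ⇒ # 0 :< τ :* n ⇒ K :* p₁ := K :* (a :* n) ⇒ ⊢ a :* (K :* n) :< # 1 :* (K :* n))
          K n a τ (W₁ ⟨ v ⟩) (W₂ ⟨ v ⟩) (W₃ ⟨ v ⟩) (W₄ ⟨ v ⟩) (W₁ ⟨ point ⟩) (W₂ ⟨ point ⟩) (W₃ ⟨ point ⟩) (W₄ ⟨ point ⟩) ρ₁ ρ₂ ρ₃ ρ₄
          eq₁ eq₂ eq₃ eq₄ (cong (K *_) (sumW point)) (cong (τ *_) (sumW v)) (mul>0 τ>0 (lin 1 (λ x → x :< # 0 ⇒ ⊢ # 0 :< :- x) (W₁ ⟨ v ⟩) h)) ρ₂≥0 ρ₃≥0 ρ₄≥0 (mul>0 τ>0 n>0) (cong (K *_) w₁))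
        by : ∀ {a b c d} → Out n σ a b c d → At tet point a b c d → a < + 1 → ⊥
        by l12 X (+<+ (s≤s ()))
        by (l13 _) X (+<+ (s≤s ()))
        by (l14 e) X _ = no-l14 e
        by (l41 e) X _ = no-l14 e
        by (l23 e) X _ = no-l14 e
        by (l32 e) X _ = no-l14 e
        by (f1 _) X (+<+ (s≤s ()))
        by (g1 _ e) X _ = no-l14 e
        by (g2 _ e) X _ = no-l14 e
        by (g3 _ e) X _ = no-l14 e
        by (g4 _ e) X _ = no-l14 e
        by (h1 _ _) X (+<+ (s≤s ()))
        by l21 X _ = k inA X (+ 3) (+ 3) (+ 3) (+ 6) (+ 1) (+ 1) (+ 0) (- + 1) (+ 0) (inj₁ refl)
        by l34 X _ = k inA X (+ 3) (+ 3) (+ 0) (+ 5) (+ 1) (+ 0) (+ 0) (+ 0) (+ 0) (inj₁ refl)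
        by l43 X _ = k inA X (+ 3) (+ 6) (+ 3) (+ 9) (+ 1) (+ 1) (+ 0) (- + 1) (+ 0) (inj₁ refl)
        by (l31 _) X _ = k inA X (+ 3) (+ 0) (+ 3) (+ 3) (- + 1) (+ 3) (+ 0) (+ 0) (- + 1) (inj₂ refl)
        by (l24 _) X _ = k inA X (+ 3) (+ 0) (+ 3) (+ 3) (+ 1) (+ 2) (+ 0) (- + 1) (- + 1) (inj₁ refl)
        by (l42 _) X _ = k inA X (+ 3) (+ 0) (+ 3) (+ 3) (+ 1) (+ 2) (- + 1) (- + 1) (+ 0) (inj₁ refl)
        by (f2 _) X _ = k inA X (+ 3) (+ 0) (+ 3) (+ 6) (- + 1) (+ 2) (+ 1) (+ 0) (- + 1) (inj₂ refl)
        by (f3 _) X _ = k inA X (+ 3) (+ 6) (+ 3) (+ 6) (- + 1) (+ 3) (+ 0) (+ 0) (- + 1) (inj₂ refl)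
        by (f4 _) X _ = k inA X (+ 3) (+ 0) (+ 3) (+ 6) (- + 1) (+ 2) (+ 0) (+ 0) (+ 0) (inj₂ refl)
        by (h2 _ _) X _ = k inA X (+ 3) (+ 0) (+ 3) (+ 3) (- + 1) (+ 3) (+ 1) (- + 1) (- + 1) (inj₂ refl)
        by (h4 _ _) X _ = k inA X (+ 3) (+ 0) (+ 3) (+ 3) (- + 1) (+ 3) (+ 0) (- + 1) (+ 0) (inj₂ refl)
        by (h3 _ _) X _ = k inA X (+ 3) (+ 0) (+ 3) (+ 3) (+ 1) (+ 2) (- + 1) (+ 0) (- + 1) (inj₁ refl)

  -- For volume three the normal form follows from two congruences and one lattice point with
  -- coordinates (-1, 1, 1, -1) modulo 3; σ = 2 is its own inverse.
  whiteTet₃ : ∀ {p q r s} (T : Tet p q r s) → let open Tet T in n ≡ + 3 → A p → A q → A r → A s → ∀ z m₁ m₂ m₃ m₄ →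
    W₁ ⟨ z ⟩ ≡ m₁ * + 3 - + 1 → W₂ ⟨ z ⟩ ≡ m₂ * + 3 + + 1 → W₃ ⟨ z ⟩ ≡ m₃ * + 3 + + 1 → W₄ ⟨ z ⟩ ≡ m₄ * + 3 - + 1 →
    (∀ z → + 3 ∣ᶻ (W₁ ⟨ z ⟩ + W₃ ⟨ z ⟩)) → (∀ z → + 3 ∣ᶻ (W₁ ⟨ z ⟩ + W₂ ⟨ z ⟩)) → (∀ z → A z → + 3 ∣ᶻ W₃ ⟨ z ⟩) → WhiteTet A p q r s
  whiteTet₃ T n≡3 Ap Aq Ar As z m₁ m₂ m₃ m₄ e₁ e₂ e₃ e₄ c₁₃ c₁₂ h₃ = record
    { tet = T ; Ap = Ap ; Aq = Aq ; Ar = Ar ; As = As ; σ = + 2 ; ρ = + 2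
    ; σ>0 = lin 0 (⊢ # 0 :< # 2) ; ρ>0 = lin 0 (⊢ # 0 :< # 2) ; σ<n = lt ; ρ<n = lt
    ; zσ = M.point ; zσ₁ = z₁ ; zσ₂ = z₂ ; zσ₃ = z₃ ; zσ₄ = z₄
    ; zρ = M′.point
    ; zρ₁ = lin 3 (λ x w n → x := con (- + 1) :* w :+ # 1 :* n ⇒ w := # 2 ⇒ n := # 3 ⇒ ⊢ x := # 1) (W₁ ⟨ M′.point ⟩) (W₁ ⟨ M.point ⟩) n M′.at₁ z₁ n≡3
    ; zρ₂ = lin 3 (λ x w n → x := con (- + 1) :* w :+ # 0 :* n ⇒ w := n :- # 2 ⇒ n := # 3 ⇒ ⊢ x := con (- + 1)) (W₂ ⟨ M′.point ⟩) (W₂ ⟨ M.point ⟩) n M′.at₂ z₂ n≡3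
    ; zρ₃ = lin 3 (λ x w n → x := con (- + 1) :* w :+ # 1 :* n ⇒ w := # 1 ⇒ n := # 3 ⇒ ⊢ x := # 2) (W₃ ⟨ M′.point ⟩) (W₃ ⟨ M.point ⟩) n M′.at₃ z₃ n≡3
    ; zρ₄ = lin 3 (λ x w n → x := con (- + 1) :* w :+ # 0 :* n ⇒ w := con (- + 1) ⇒ n := # 3 ⇒ ⊢ x := n :- # 2) (W₄ ⟨ M′.point ⟩) (W₄ ⟨ M.point ⟩) n M′.at₄ z₄ n≡3
    ; cyc = λ z → subst (_∣ᶻ (W₁ ⟨ z ⟩ - + 2 * W₃ ⟨ z ⟩)) (sym n≡3) (cyc z (c₁₃ z)) ; cyc₁₂ = λ z → subst (_∣ᶻ (W₁ ⟨ z ⟩ + W₂ ⟨ z ⟩)) (sym n≡3) (c₁₂ z)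
    ; 3∣n = + 1 , trans n≡3 refl ; 3∣W₃ = h₃ }
    where
    open Tet T
    lt : + 2 < n
    lt = subst (+ 2 <_) (sym n≡3) (lin 0 (⊢ # 2 :< # 3))
    sum : m₁ + m₂ + m₃ + m₄ ≡ + 1
    sum = lin 9 (λ a b c d n m₁ m₂ m₃ m₄ → a :+ b :+ c :+ d := n ⇒ n := # 3 ⇒ a := m₁ :* # 3 :- # 1 ⇒ b := m₂ :* # 3 :+ # 1 ⇒ c := m₃ :* # 3 :+ # 1 ⇒ d := m₄ :* # 3 :- # 1 ⇒ ⊢ m₁ :+ m₂ :+ m₃ :+ m₄ := # 1)
      (W₁ ⟨ z ⟩) (W₂ ⟨ z ⟩) (W₃ ⟨ z ⟩) (W₄ ⟨ z ⟩) n m₁ m₂ m₃ m₄ (sumW z) n≡3 e₁ e₂ e₃ e₄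
    module M = Moved (move T (+ 1) (+ 1 - m₁) (- m₂) (- m₃) (- m₄) z (lin 4 (λ a b c d → a :+ b :+ c :+ d := # 1 ⇒ ⊢ # 1 :+ (# 1 :- a) :+ (:- b) :+ (:- c) :+ (:- d) := # 1) m₁ m₂ m₃ m₄ sum))
    reduce3 : ∀ {x y} k v m → x ≡ + 1 * y + (k - m) * n → y ≡ m * + 3 + v → x ≡ v + k * + 3
    reduce3 {x} {y} k v m h h′ = trans h (trans (cong (λ t → + 1 * y + (k - m) * t) n≡3) (lin 4 (λ y k v m → y := m :* # 3 :+ v ⇒ ⊢ # 1 :* y :+ (k :- m) :* # 3 := v :+ k :* # 3) y k v m h′))
    neg-m : ∀ {x y} m → x ≡ + 1 * y + (- m) * n → x ≡ + 1 * y + (+ 0 - m) * n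
    neg-m {x} {y} m h = trans h (cong (λ t → + 1 * y + t * n) (sym (ℤₚ.+-identityˡ (- m))))
    z₁ : W₁ ⟨ M.point ⟩ ≡ + 2
    z₁ = reduce3 {W₁ ⟨ M.point ⟩} {W₁ ⟨ z ⟩} (+ 1) (- + 1) m₁ M.at₁ e₁
    z₂ : W₂ ⟨ M.point ⟩ ≡ n - + 2
    z₂ = trans (reduce3 {W₂ ⟨ M.point ⟩} {W₂ ⟨ z ⟩} (+ 0) (+ 1) m₂ (neg-m {W₂ ⟨ M.point ⟩} {W₂ ⟨ z ⟩} m₂ M.at₂) e₂) (cong (_- + 2) (sym n≡3))
    z₃ : W₃ ⟨ M.point ⟩ ≡ + 1
    z₃ = reduce3 {W₃ ⟨ M.point ⟩} {W₃ ⟨ z ⟩} (+ 0) (+ 1) m₃ (neg-m {W₃ ⟨ M.point ⟩} {W₃ ⟨ z ⟩} m₃ M.at₃) e₃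
    z₄ : W₄ ⟨ M.point ⟩ ≡ - + 1
    z₄ = reduce3 {W₄ ⟨ M.point ⟩} {W₄ ⟨ z ⟩} (+ 0) (- + 1) m₄ (neg-m {W₄ ⟨ M.point ⟩} {W₄ ⟨ z ⟩} m₄ M.at₄) e₄
    module M′ = Moved (move T (- + 1) (+ 1) (+ 0) (+ 1) (+ 0) M.point refl)
    cyc : ∀ z → + 3 ∣ᶻ (W₁ ⟨ z ⟩ + W₃ ⟨ z ⟩) → + 3 ∣ᶻ (W₁ ⟨ z ⟩ - + 2 * W₃ ⟨ z ⟩)
    cyc z (k , e) = k - W₃ ⟨ z ⟩ , lin 3 (λ a c k → a :+ c := k :* # 3 ⇒ ⊢ a :- # 2 :* c := (k :- c) :* # 3) (W₁ ⟨ z ⟩) (W₃ ⟨ z ⟩) k e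

  module Residues {p q r s} (T : WhiteTet A p q r s) (n≡3 : WhiteTet.n T ≡ + 3) (σ≡ : WhiteTet.σ T ≡ WhiteTet.n T - + 1) where
    open WhiteTet T

    σ2 : σ ≡ + 2
    σ2 = lin 2 (λ n σ → n := # 3 ⇒ σ := n :- # 1 ⇒ ⊢ σ := # 2) n σ n≡3 σ≡
    c₁₂ : ∀ z → + 3 ∣ᶻ (W₁ ⟨ z ⟩ + W₂ ⟨ z ⟩)
    c₁₂ z = subst (_∣ᶻ (W₁ ⟨ z ⟩ + W₂ ⟨ z ⟩)) n≡3 (cyc₁₂ z)
    c₃₄ : ∀ z → + 3 ∣ᶻ (W₃ ⟨ z ⟩ + W₄ ⟨ z ⟩)
    c₃₄ z = subst (_∣ᶻ (W₃ ⟨ z ⟩ + W₄ ⟨ z ⟩)) n≡3 (cyc₃₄ z)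
    c₁₃ : ∀ z → + 3 ∣ᶻ (W₁ ⟨ z ⟩ + W₃ ⟨ z ⟩)
    c₁₃ z = go (subst (_∣ᶻ (W₁ ⟨ z ⟩ - σ * W₃ ⟨ z ⟩)) n≡3 (cyc z))
      where
      go : + 3 ∣ᶻ (W₁ ⟨ z ⟩ - σ * W₃ ⟨ z ⟩) → + 3 ∣ᶻ (W₁ ⟨ z ⟩ + W₃ ⟨ z ⟩)
      go (k , e) = k + W₃ ⟨ z ⟩ , lin 3 (λ a c k → a :- # 2 :* c := k :* # 3 ⇒ ⊢ a :+ c := (k :+ c) :* # 3) (W₁ ⟨ z ⟩) (W₃ ⟨ z ⟩) k (trans (cong (λ x → W₁ ⟨ z ⟩ - x * W₃ ⟨ z ⟩) (sym σ2)) e)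
    g₁ : W₁ ⟨ zσ ⟩ ≡ + 2
    g₁ = trans zσ₁ σ2
    g₂ : W₂ ⟨ zσ ⟩ ≡ + 1
    g₂ = trans zσ₂ (lin 2 (λ n σ → σ := n :- # 1 ⇒ ⊢ n :- σ := # 1) n σ σ≡)

  -- o is the barycentre of b, c and e, so these can be permuted cyclically: in the tetrahedron o,
  -- a, c, e the point b has the position that e had.
  record Rotated (S : Spike) : Set where
    open Spike S
    open WhiteTet white
    field
      white′ : WhiteTet A o a c e
      n≡3′ : WhiteTet.n white′ ≡ + 3
      σ≡′ : WhiteTet.σ white′ ≡ WhiteTet.n white′ - + 1
      new₁ : ∀ z → WhiteTet.W₁ white′ ⟨ z ⟩ ≡ W₁ ⟨ z ⟩ + + 3 * W₃ ⟨ z ⟩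
      new₂ : ∀ z → WhiteTet.W₂ white′ ⟨ z ⟩ ≡ W₂ ⟨ z ⟩
      new₃ : ∀ z → WhiteTet.W₃ white′ ⟨ z ⟩ ≡ W₄ ⟨ z ⟩ - W₃ ⟨ z ⟩
      new₄ : ∀ z → WhiteTet.W₄ white′ ⟨ z ⟩ ≡ - W₃ ⟨ z ⟩
      b-at : At (WhiteTet.tet white′) b (+ 3) (+ 0) (- + 1) (- + 1)
    spike′ : Spike
    spike′ = record { white = white′ ; n≡3 = n≡3′ ; σ≡ = σ≡′ ; e = b ; Ae = Ar ; e-at = b-at }

  rotate : (S : Spike) → Rotated S
  rotate S = record { white′ = white′ ; n≡3′ = n≡3′ ; σ≡′ = cong (_- + 1) (sym n≡3′) ; new₁ = w₁ ; new₂ = w₂ ; new₃ = w₃ ; new₄ = w₄ ; b-at = b-at }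
    where
    open Spike S
    open WhiteTet white
    open Residues white n≡3 σ≡
    flip-at : At tet e (+ 3) (+ 0) (- + 1) (- + 1) → At (sw12 (sw23 tet)) e (- + 1) (+ 3) (+ 0) (- + 1)
    flip-at (at a b c d) = at c a b d
    R = replaceFirst (sw12 (sw23 tet)) e {ε = - + 1} {b = + 3} {c = + 0} {d = - + 1} (flip-at e-at) (inj₂ refl)
    T′ : Tet o a c e
    T′ = sw34 (sw23 (sw12 (Replaced.tet R)))
    module T′ = Tet T′
    w₁ : ∀ z → T′.W₁ ⟨ z ⟩ ≡ W₁ ⟨ z ⟩ + + 3 * W₃ ⟨ z ⟩
    w₁ z = trans (Replaced.new₂ R z) (lin 2 (λ a b → ⊢ a :- con (- + 3) :* b := a :+ # 3 :* b) (W₁ ⟨ z ⟩) (W₃ ⟨ z ⟩))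
    w₂ : ∀ z → T′.W₂ ⟨ z ⟩ ≡ W₂ ⟨ z ⟩
    w₂ z = trans (Replaced.new₃ R z) (lin 2 (λ a b → ⊢ a :- # 0 :* b := a) (W₂ ⟨ z ⟩) (W₃ ⟨ z ⟩))
    w₃ : ∀ z → T′.W₃ ⟨ z ⟩ ≡ W₄ ⟨ z ⟩ - W₃ ⟨ z ⟩
    w₃ z = trans (Replaced.new₄ R z) (lin 2 (λ a b → ⊢ a :- # 1 :* b := a :- b) (W₄ ⟨ z ⟩) (W₃ ⟨ z ⟩))
    w₄ : ∀ z → T′.W₄ ⟨ z ⟩ ≡ - W₃ ⟨ z ⟩
    w₄ z = trans (Replaced.new₁ R z) (ℤₚ.-1*i≡-i (W₃ ⟨ z ⟩))
    n≡3′ : T′.n ≡ + 3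
    n≡3′ = trans (Replaced.n≡ R) n≡3
    c₁₃′ : ∀ z → + 3 ∣ᶻ (T′.W₁ ⟨ z ⟩ + T′.W₃ ⟨ z ⟩)
    c₁₃′ z = go (c₁₃ z) (c₃₄ z)
      where
      go : + 3 ∣ᶻ (W₁ ⟨ z ⟩ + W₃ ⟨ z ⟩) → + 3 ∣ᶻ (W₃ ⟨ z ⟩ + W₄ ⟨ z ⟩) → + 3 ∣ᶻ (T′.W₁ ⟨ z ⟩ + T′.W₃ ⟨ z ⟩)
      go (k , f) (k′ , f′) = k + k′ , trans (cong₂ _+_ (w₁ z) (w₃ z)) (lin 5 (λ a c d k k′ → a :+ c := k :* # 3 ⇒ c :+ d := k′ :* # 3 ⇒ ⊢ (a :+ # 3 :* c) :+ (d :- c) := (k :+ k′) :* # 3) (W₁ ⟨ z ⟩) (W₃ ⟨ z ⟩) (W₄ ⟨ z ⟩) k k′ f f′)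
    c₁₂′ : ∀ z → + 3 ∣ᶻ (T′.W₁ ⟨ z ⟩ + T′.W₂ ⟨ z ⟩)
    c₁₂′ z = go (c₁₂ z)
      where
      go : + 3 ∣ᶻ (W₁ ⟨ z ⟩ + W₂ ⟨ z ⟩) → + 3 ∣ᶻ (T′.W₁ ⟨ z ⟩ + T′.W₂ ⟨ z ⟩)
      go (k , f) = k + W₃ ⟨ z ⟩ , trans (cong₂ _+_ (w₁ z) (w₂ z)) (lin 4 (λ a b c k → a :+ b := k :* # 3 ⇒ ⊢ (a :+ # 3 :* c) :+ b := (k :+ c) :* # 3) (W₁ ⟨ z ⟩) (W₂ ⟨ z ⟩) (W₃ ⟨ z ⟩) k f)
    h₃′ : ∀ z → A z → + 3 ∣ᶻ T′.W₃ ⟨ z ⟩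
    h₃′ z Az = go (3∣W₃ z Az) (3∣W₄ z Az)
      where
      go : + 3 ∣ᶻ W₃ ⟨ z ⟩ → + 3 ∣ᶻ W₄ ⟨ z ⟩ → + 3 ∣ᶻ T′.W₃ ⟨ z ⟩
      go (k , f) (k′ , f′) = k′ - k , trans (w₃ z) (lin 4 (λ c d k k′ → c := k :* # 3 ⇒ d := k′ :* # 3 ⇒ ⊢ d :- c := (k′ :- k) :* # 3) (W₃ ⟨ z ⟩) (W₄ ⟨ z ⟩) k k′ f f′)
    white′ : WhiteTet A o a c e
    -- The old zσ still serves: its new coordinates are 5, 1, -2 and -1.
    white′ = whiteTet₃ T′ n≡3′ Ap Aq As Ae zσ (+ 2) (+ 0) (- + 1) (+ 0)
      (trans (w₁ zσ) (cong₂ (λ x y → x + + 3 * y) g₁ zσ₃)) (trans (w₂ zσ) g₂) (trans (w₃ zσ) (cong₂ _-_ zσ₄ zσ₃)) (trans (w₄ zσ) (cong -_ zσ₃)) c₁₃′ c₁₂′ h₃′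
    T₃ = sw12 (sw23 tet)
    b-at : At T′ b (+ 3) (+ 0) (- + 1) (- + 1)
    b-at = at (trans (w₁ b) (trans (cong₂ (λ x y → x + + 3 * y) (W₁r tet) Wb) (ℤₚ.+-identityˡ _))) (trans (w₂ b) (trans (W₁r (sw12 tet)) (sym (ℤₚ.*-zeroˡ T′.n))))
      (trans (w₃ b) (trans (cong₂ _-_ (W₁s (sw12 (sw23 (sw34 tet)))) Wb) (trans (ℤₚ.+-identityˡ _) (sym (ℤₚ.-1*i≡-i T′.n))))) (trans (w₄ b) (trans (cong -_ Wb) (sym (ℤₚ.-1*i≡-i T′.n))))
      where
      Wb : W₃ ⟨ b ⟩ ≡ T′.n
      Wb = trans (W₁p T₃) (sym (Replaced.n≡ R))

  -- Here w = 3b - o - a, and a, c, e, w become the vertices of E63.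
  record Exceptional : Set where
    field
      spike : Spike
      w : Z3
      Aw : A w
      w-at : At (WhiteTet.tet (Spike.white spike)) w (- + 1) (- + 1) (+ 3) (+ 0)

  -- `loop` is applied to the edge oa. A move would leave a third point on its line, against
  -- `long-spike`. Of the remaining positions 2b - o and 2c - a are excluded by e, and 3c - o - a
  -- becomes 3b - o - a by a rotation.
  offSpike : ∀ (S : Spike) → let open WhiteTet (Spike.white S) in ∀ v → A v → OffLine (Spike.white S) v → + 0 ≤ W₃ ⟨ v ⟩ → + 0 ≤ W₄ ⟨ v ⟩ → Exceptional
  offSpike S v Av off h₃ h₄ = go (loop white (bigFree-≡ n≡3 bigFree₃) v Av off)
    where
    open Spike S
    open WhiteTet white
    go : Final white v ⊎ (Σ (Shifted white) λ S → Final (Shifted.white S) v) → Exceptional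
    go (inj₂ (S′ , F)) = ⊥-elim (long S.thirdOn12)
      where
      module S = Shifted S′
      n≡3′ = trans S.n≡ n≡3
      σ≡′ = trans S.σ≡ (trans σ≡ (cong (_- + 1) (sym S.n≡)))
      long : (∃ λ u → A u × (At (WhiteTet.tet S.white) u (+ 2) (- + 1) (+ 0) (+ 0) ⊎ At (WhiteTet.tet S.white) u (- + 1) (+ 2) (+ 0) (+ 0))) → ⊥
      long (u , Au , U) = long-spike S.white n≡3′ σ≡′ Au U (Final.inA F) (side S.white n≡3′ σ≡′ (subst (+ 0 ≤_) (sym (S.W₃≡ v)) h₃) (subst (+ 0 ≤_) (sym (S.W₄≡ v)) h₄) F)
    go (inj₁ F) = by (side white n≡3 σ≡ h₃ h₄ F)
      where
      open Final F using (point; inA)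
      by : Side white n≡3 σ≡ point → Exceptional
      by (l31 W) = ⊥-elim (kill₃ white n≡3 σ≡ (inA , W) (Ae , e-at) (Ae , e-at) (+ 3) (+ 3) (+ 0) (+ 3) (+ 1) (+ 0) (+ 0) (+ 0) (+ 0) (inj₁ refl))
      by (l42 W) = ⊥-elim (kill₃ white n≡3 σ≡ (inA , W) (Ae , e-at) (Ae , e-at) (+ 3) (+ 3) (+ 0) (+ 3) (- + 1) (+ 2) (+ 0) (+ 0) (+ 0) (inj₂ refl))
      by (f3 W) = record { spike = S ; w = point ; Aw = inA ; w-at = W }
      by (f4 (at w₁ w₂ w₃ w₄)) = record { spike = R.spike′ ; w = point ; Aw = inA ; w-at = at
          (trans (R.new₁ point) (val (- + 1) (+ 0) (+ 3) w₁ w₃)) (trans (R.new₂ point) (trans w₂ (cong (- + 1 *_) n′)))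
          (trans (R.new₃ point) (trans (cong₂ _-_ w₄ w₃) (trans (lin 1 (λ n → ⊢ # 3 :* n :- # 0 :* n := # 3 :* n) n) (cong (+ 3 *_) n′))))
          (trans (R.new₄ point) (trans (cong -_ w₃) (lin 2 (λ n n′ → ⊢ :- (# 0 :* n) := # 0 :* n′) n (WhiteTet.n R.white′)))) }
        where
        module R = Rotated (rotate S)
        n′ : n ≡ WhiteTet.n R.white′
        n′ = trans n≡3 (sym R.n≡3′)
        val : ∀ {x y} m k l → x ≡ m * n → y ≡ k * n → x + l * y ≡ (m + l * k) * WhiteTet.n R.white′
        val m k l refl refl = trans (lin 4 (λ m k l n → ⊢ m :* n :+ l :* (k :* n) := (m :+ l :* k) :* n) m k l n) (cong ((m + l * k) *_) n′)

  data OnSpike (S : Spike) (v : Z3) : Set where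
    on : let open WhiteTet (Spike.white S) in W₃ ⟨ v ⟩ ≡ + 0 → W₄ ⟨ v ⟩ ≡ + 0 → OnSpike S v
    isB : v ≡ Spike.b S → OnSpike S v
    isC : v ≡ Spike.c S → OnSpike S v
    isE : v ≡ Spike.e S → OnSpike S v

  private
    thirdVertex : ∀ {p q r s} (T : WhiteTet A p q r s) v → let open WhiteTet T in Inside tet v → ¬ (W₃ ⟨ v ⟩ ≡ + 0 × W₄ ⟨ v ⟩ ≡ + 0) → v ≢ r → v ≢ s → ⊥
    thirdVertex {p} {q} {r} {s} T v (g₁ , g₂ , g₃ , g₄) off ≢r ≢s = whiteEmpty T v (g₁ , g₂ , g₃ , g₄)
      ( (λ e → off (proj₁ (proj₂ (others a b c d g₂ g₃ g₄ (sumW v) e)) , proj₂ (proj₂ (others a b c d g₂ g₃ g₄ (sumW v) e))))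
      , (λ e → let r = others b a c d g₁ g₃ g₄ (trans (lin 4 (λ a b c d → ⊢ b :+ a :+ c :+ d := a :+ b :+ c :+ d) a b c d) (sumW v)) e in off (proj₁ (proj₂ r) , proj₂ (proj₂ r)))
      , (λ e → let o = others c a b d g₁ g₂ g₄ (trans (lin 4 (λ a b c d → ⊢ c :+ a :+ b :+ d := a :+ b :+ c :+ d) a b c d) (sumW v)) e in
          ≢r (unique tet (trans (proj₁ o) (sym (W₁r tet))) (trans (proj₁ (proj₂ o)) (sym (W₁r (sw12 tet)))) (trans e (sym (W₁p T₃))) (trans (proj₂ (proj₂ o)) (sym (W₁s T₄)))))
      , (λ e → let o = others d a b c g₁ g₂ g₃ (trans (lin 4 (λ a b c d → ⊢ d :+ a :+ b :+ c := a :+ b :+ c :+ d) a b c d) (sumW v)) e in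
          ≢s (unique tet (trans (proj₁ o) (sym (W₁s tet))) (trans (proj₁ (proj₂ o)) (sym (W₁s (sw12 tet)))) (trans (proj₂ (proj₂ o)) (sym (W₁s T₃))) (trans e (sym (W₁p T₄))))))
      where
      open WhiteTet T
      T₃ = sw12 (sw23 tet)
      T₄ = sw12 (sw23 (sw34 tet))
      a = W₁ ⟨ v ⟩
      b = W₂ ⟨ v ⟩
      c = W₃ ⟨ v ⟩
      d = W₄ ⟨ v ⟩
      others : ∀ x y z t → + 0 ≤ y → + 0 ≤ z → + 0 ≤ t → x + y + z + t ≡ n → x ≡ n → y ≡ + 0 × z ≡ + 0 × t ≡ + 0
      others x y z t hy hz ht e e′ = lin 5 (λ x y z t n → # 0 :≤ y ⇒ # 0 :≤ z ⇒ # 0 :≤ t ⇒ x :+ y :+ z :+ t := n ⇒ x := n ⇒ ⊢ y := # 0) x y z t n hy hz ht e e′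
        , lin 5 (λ x y z t n → # 0 :≤ y ⇒ # 0 :≤ z ⇒ # 0 :≤ t ⇒ x :+ y :+ z :+ t := n ⇒ x := n ⇒ ⊢ z := # 0) x y z t n hy hz ht e e′
        , lin 5 (λ x y z t n → # 0 :≤ y ⇒ # 0 :≤ z ⇒ # 0 :≤ t ⇒ x :+ y :+ z :+ t := n ⇒ x := n ⇒ ⊢ t := # 0) x y z t n hy hz ht e e′

  -- Modulo the direction of oa the vectors from o to b, c and e add up to zero, so the three cones
  -- spanned by two of them cover the plane. In the coordinates y and x along b and c, rotations
  -- take each cone to the first.
  spikeOrExceptional : ∀ (S : Spike) v → A v → OnSpike S v ⊎ Exceptional
  spikeOrExceptional S v Av = decide (v ≟Z b) (v ≟Z c) (v ≟Z e) (W₃ ⟨ v ⟩ ℤₚ.≟ + 0) (W₄ ⟨ v ⟩ ℤₚ.≟ + 0)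
    where
    open Spike S
    open WhiteTet white
    module R = Rotated (rotate S)
    module R′ = Rotated (rotate R.spike′)
    y = W₃ ⟨ v ⟩
    x = W₄ ⟨ v ⟩
    rot² : v ≢ b → v ≢ c → v ≢ e → ¬ (y ≡ + 0 × x ≡ + 0) → x < + 0 → x ≤ y → Exceptional
    rot² ≢b ≢c ≢e off x<0 x≤y = offSpike R′.spike′ v Av ((λ i → thirdVertex R′.white′ v i off″ ≢e ≢b) , off″)
        (subst (+ 0 ≤_) (sym third) (lin 1 (λ x → x :< # 0 ⇒ ⊢ # 0 :≤ :- x) x x<0)) (subst (+ 0 ≤_) (sym fourth) (ℤₚ.i≤j⇒0≤j-i x≤y))
      where
      third : WhiteTet.W₃ R′.white′ ⟨ v ⟩ ≡ - x
      third = trans (R′.new₃ v) (trans (cong₂ _-_ (R.new₄ v) (R.new₃ v)) (lin 2 (λ x y → ⊢ :- y :- (x :- y) := :- x) x y))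
      fourth : WhiteTet.W₄ R′.white′ ⟨ v ⟩ ≡ y - x
      fourth = trans (R′.new₄ v) (trans (cong -_ (R.new₃ v)) (lin 2 (λ x y → ⊢ :- (x :- y) := y :- x) x y))
      off″ : ¬ (WhiteTet.W₃ R′.white′ ⟨ v ⟩ ≡ + 0 × WhiteTet.W₄ R′.white′ ⟨ v ⟩ ≡ + 0)
      off″ (e₃ , e₄) = off (lin 4 (λ y x t u → t := # 0 ⇒ u := # 0 ⇒ t := :- x ⇒ u := y :- x ⇒ ⊢ y := # 0) y x _ _ e₃ e₄ third fourth , lin 2 (λ x t → t := # 0 ⇒ t := :- x ⇒ ⊢ x := # 0) x _ e₃ third)
    cone : v ≢ b → v ≢ c → v ≢ e → ¬ (y ≡ + 0 × x ≡ + 0) → Dec (+ 0 ≤ y) → Dec (+ 0 ≤ x) → Dec (y ≤ x) → Exceptional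
    cone ≢b ≢c ≢e off (yes hy) (yes hx) _ = offSpike S v Av ((λ i → thirdVertex white v i off ≢b ≢c) , off) hy hx
    cone ≢b ≢c ≢e off (no hy) _ (yes h) = offSpike R.spike′ v Av ((λ i → thirdVertex R.white′ v i off′ ≢c ≢e) , off′)
        (subst (+ 0 ≤_) (sym (R.new₃ v)) (ℤₚ.i≤j⇒0≤j-i h)) (subst (+ 0 ≤_) (sym (R.new₄ v)) (lin 1 (λ y → y :< # 0 ⇒ ⊢ # 0 :≤ :- y) y (ℤₚ.≰⇒> hy)))
      where
      off′ : ¬ (WhiteTet.W₃ R.white′ ⟨ v ⟩ ≡ + 0 × WhiteTet.W₄ R.white′ ⟨ v ⟩ ≡ + 0)
      off′ (e₃ , e₄) = off (lin 2 (λ y t → t := # 0 ⇒ t := :- y ⇒ ⊢ y := # 0) y _ e₄ (R.new₄ v) , lin 4 (λ y x t u → t := # 0 ⇒ u := # 0 ⇒ u := :- y ⇒ t := x :- y ⇒ ⊢ x := # 0) y x _ _ e₃ e₄ (R.new₄ v) (R.new₃ v))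
    cone ≢b ≢c ≢e off (no hy) (yes hx) (no h) = ⊥-elim (h (lin 2 (λ x y → y :< # 0 ⇒ # 0 :≤ x ⇒ ⊢ y :≤ x) x y (ℤₚ.≰⇒> hy) hx))
    cone ≢b ≢c ≢e off (no hy) (no hx) (no h) = rot² ≢b ≢c ≢e off (ℤₚ.≰⇒> hx) (ℤₚ.<⇒≤ (ℤₚ.≰⇒> h))
    cone ≢b ≢c ≢e off (yes hy) (no hx) _ = rot² ≢b ≢c ≢e off (ℤₚ.≰⇒> hx) (lin 2 (λ x y → # 0 :≤ y ⇒ x :< # 0 ⇒ ⊢ x :≤ y) x y hy (ℤₚ.≰⇒> hx))
    decide : Dec (v ≡ b) → Dec (v ≡ c) → Dec (v ≡ e) → Dec (y ≡ + 0) → Dec (x ≡ + 0) → OnSpike S v ⊎ Exceptional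
    decide (yes h) _ _ _ _ = inj₁ (isB h)
    decide _ (yes h) _ _ _ = inj₁ (isC h)
    decide _ _ (yes h) _ _ = inj₁ (isE h)
    decide _ _ _ (yes h) (yes h′) = inj₁ (on h h′)
    decide (no hb) (no hc) (no he) (no hy) _ = inj₂ (cone hb hc he (λ { (p , _) → hy p }) (+ 0 ℤₚ.≤? y) (+ 0 ℤₚ.≤? x) (y ℤₚ.≤? x))
    decide (no hb) (no hc) (no he) _ (no hx) = inj₂ (cone hb hc he (λ { (_ , q) → hx q }) (+ 0 ℤₚ.≤? y) (+ 0 ℤₚ.≤? x) (y ℤₚ.≤? x))

  values : ∀ {p q r s} (T : Tet p q r s) → Tet.n T ≡ + 3 → ∀ {z a b c d} → At T z a b c d → let open Tet T in W₁ ⟨ z ⟩ ≡ a * + 3 × W₂ ⟨ z ⟩ ≡ b * + 3 × W₃ ⟨ z ⟩ ≡ c * + 3 × W₄ ⟨ z ⟩ ≡ d * + 3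
  values T n≡3 {z} {a} {b} {c} {d} (at w₁ w₂ w₃ w₄) = trans w₁ (cong (a *_) n≡3) , trans w₂ (cong (b *_) n≡3) , trans w₃ (cong (c *_) n≡3) , trans w₄ (cong (d *_) n≡3)

  atValues : ∀ {p q r s} (T : Tet p q r s) → Tet.n T ≡ + 3 → ∀ {z a b c d} → let open Tet T in W₁ ⟨ z ⟩ ≡ a * + 3 → W₂ ⟨ z ⟩ ≡ b * + 3 → W₃ ⟨ z ⟩ ≡ c * + 3 → W₄ ⟨ z ⟩ ≡ d * + 3 → At T z a b c d
  atValues T n≡3 {z} {a} {b} {c} {d} w₁ w₂ w₃ w₄ = at (trans w₁ (cong (a *_) (sym n≡3))) (trans w₂ (cong (b *_) (sym n≡3))) (trans w₃ (cong (c *_) (sym n≡3))) (trans w₄ (cong (d *_) (sym n≡3)))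

  facetOf : ∀ {p q r s} (T : Tet p q r s) → let open Tet T in n ≡ + 3 → A p → A q → A r → A s → ∀ z m₁ m₂ m₃ m₄ →
    W₁ ⟨ z ⟩ ≡ m₁ * + 3 - + 1 → W₂ ⟨ z ⟩ ≡ m₂ * + 3 + + 1 → W₃ ⟨ z ⟩ ≡ m₃ * + 3 + + 1 → W₄ ⟨ z ⟩ ≡ m₄ * + 3 - + 1 →
    (∀ z → + 3 ∣ᶻ (W₁ ⟨ z ⟩ + W₃ ⟨ z ⟩)) → (∀ z → + 3 ∣ᶻ (W₁ ⟨ z ⟩ + W₂ ⟨ z ⟩)) → (∀ z → A z → + 3 ∣ᶻ W₃ ⟨ z ⟩) →
    ∀ {b w} → A b → At T b (+ 3) (+ 0) (- + 1) (- + 1) → A w → At T w (+ 8) (- + 1) (- + 3) (- + 3) → ∀ v → A v → + 0 ≤ W₁ ⟨ v ⟩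
  facetOf T n≡3 Ap Aq Ar As z m₁ m₂ m₃ m₄ e₁ e₂ e₃ e₄ c₁₃ c₁₂ h₃ Ab B Aw W =
    facet (whiteTet₃ T n≡3 Ap Aq Ar As z m₁ m₂ m₃ m₄ e₁ e₂ e₃ e₄ c₁₃ c₁₂ h₃) n≡3 (cong (_- + 1) (sym n≡3)) Ab B Aw W

  vertices : ∀ {p q r s} (T : Tet p q r s) → Tet.n T ≡ + 3 → let open Tet T in
    (W₁ ⟨ p ⟩ ≡ + 3 × W₂ ⟨ p ⟩ ≡ + 0 × W₃ ⟨ p ⟩ ≡ + 0 × W₄ ⟨ p ⟩ ≡ + 0) × (W₁ ⟨ q ⟩ ≡ + 0 × W₂ ⟨ q ⟩ ≡ + 3 × W₃ ⟨ q ⟩ ≡ + 0 × W₄ ⟨ q ⟩ ≡ + 0) ×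
    (W₁ ⟨ r ⟩ ≡ + 0 × W₂ ⟨ r ⟩ ≡ + 0 × W₃ ⟨ r ⟩ ≡ + 3 × W₄ ⟨ r ⟩ ≡ + 0) × (W₁ ⟨ s ⟩ ≡ + 0 × W₂ ⟨ s ⟩ ≡ + 0 × W₃ ⟨ s ⟩ ≡ + 0 × W₄ ⟨ s ⟩ ≡ + 3)
  vertices T n≡3 = (trans (W₁p T) n≡3 , W₁q T₂ , W₁q T₃ , W₁q T₄) , (W₁q T , trans (W₁p T₂) n≡3 , W₁r T₃ , W₁r T₄) ,
    (W₁r T , W₁r T₂ , trans (W₁p T₃) n≡3 , W₁s T₄) , (W₁s T , W₁s T₂ , W₁s T₃ , trans (W₁p T₄) n≡3)
    where
    T₂ = sw12 T
    T₃ = sw12 (sw23 T)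
    T₄ = sw12 (sw23 (sw34 T))

  -- The four facets of the exceptional tetrahedron

  module _ (X : Exceptional) where
    open Exceptional X
    open Spike spike
    open WhiteTet white

    private
      module R = Rotated (rotate spike)
      module R′ = Rotated (rotate R.spike′)
      module Wt = WhiteTet R.white′
      w-val = values tet n≡3 w-at
      e-val = values tet n≡3 e-at

      -- Substituting b = 3o - c - e in w = 3b - o - a gives w = 8o - a - 3c - 3e, the form required
      -- by `facet`.
      w-at′ : At Wt.tet w (+ 8) (- + 1) (- + 3) (- + 3)
      w-at′ = atValues Wt.tet R.n≡3′ (trans (R.new₁ w) (cong₂ (λ x y → x + + 3 * y) (proj₁ w-val) (proj₁ (proj₂ (proj₂ w-val))))) (trans (R.new₂ w) (proj₁ (proj₂ w-val)))
        (trans (R.new₃ w) (cong₂ _-_ (proj₂ (proj₂ (proj₂ w-val))) (proj₁ (proj₂ (proj₂ w-val))))) (trans (R.new₄ w) (cong -_ (proj₁ (proj₂ (proj₂ w-val)))))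

    -- The facet through a, c and e, seen from o.
    facet₁ : ∀ v → A v → + 0 ≤ W₁ ⟨ v ⟩ + + 3 * W₃ ⟨ v ⟩
    facet₁ v Av = subst (+ 0 ≤_) (R.new₁ v) (facet R.white′ R.n≡3′ R.σ≡′ Ar R.b-at Aw w-at′ v Av)

    -- The facet through w, e and c, also seen from o: the relation w = 8o - a - 3c - 3e is
    -- symmetric in a and w.
    facet₂ : ∀ v → A v → + 0 ≤ W₁ ⟨ v ⟩ + + 3 * W₃ ⟨ v ⟩ + + 8 * W₂ ⟨ v ⟩
    facet₂ v Av = subst (+ 0 ≤_) (trans (w₁ v) (cong₂ (λ x y → x + + 8 * y) (R.new₁ v) (R.new₂ v)))
        (facetOf T n≡3′ Ap Aw Ae As z⁻ (- + 2) (+ 0) (+ 1) (+ 2)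
          (trans (w₁ z⁻) (cong₂ (λ x y → x + + 8 * y) y₁ y₂)) (trans (w₂ z⁻) (cong -_ y₂)) (trans (w₃ z⁻) (cong₂ (λ x y → x - + 3 * y) y₄ y₂)) (trans (w₄ z⁻) (cong₂ (λ x y → x - + 3 * y) y₃ y₂))
          (λ z → c₁₃′ z (c₁₂ z) (c₁₃ z) (c₃₄ z)) (λ z → c₁₂′ z (c₁₂ z)) (λ z Az → h₃′ z (Wt.3∣W₄ z Az))
          Ar (atValues T n≡3′ (trans (w₁ b) (cong₂ (λ x y → x + + 8 * y) (proj₁ b-val) (proj₁ (proj₂ b-val)))) (trans (w₂ b) (cong -_ (proj₁ (proj₂ b-val)))) (trans (w₃ b) (cong₂ (λ x y → x - + 3 * y) (proj₂ (proj₂ (proj₂ b-val))) (proj₁ (proj₂ b-val)))) (trans (w₄ b) (cong₂ (λ x y → x - + 3 * y) (proj₁ (proj₂ (proj₂ b-val))) (proj₁ (proj₂ b-val)))))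
          Aq (atValues T n≡3′ (trans (w₁ a) (cong₂ (λ x y → x + + 8 * y) (proj₁ a-val) (proj₁ (proj₂ a-val)))) (trans (w₂ a) (cong -_ (proj₁ (proj₂ a-val)))) (trans (w₃ a) (cong₂ (λ x y → x - + 3 * y) (proj₂ (proj₂ (proj₂ a-val))) (proj₁ (proj₂ a-val)))) (trans (w₄ a) (cong₂ (λ x y → x - + 3 * y) (proj₁ (proj₂ (proj₂ a-val))) (proj₁ (proj₂ a-val)))))
          v Av)
      where
      flip-at : At Wt.tet w (+ 8) (- + 1) (- + 3) (- + 3) → At (sw12 Wt.tet) w (- + 1) (+ 8) (- + 3) (- + 3)
      flip-at (at a b c d) = at b a c d
      Q = replaceFirst (sw12 Wt.tet) w {ε = - + 1} {b = + 8} {c = - + 3} {d = - + 3} (flip-at w-at′) (inj₂ refl)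
      T : Tet o w e c
      T = sw34 (sw12 (Replaced.tet Q))
      module T = Tet T
      n≡3′ = trans (Replaced.n≡ Q) R.n≡3′
      w₁ : ∀ z → T.W₁ ⟨ z ⟩ ≡ Wt.W₁ ⟨ z ⟩ + + 8 * Wt.W₂ ⟨ z ⟩
      w₁ z = trans (Replaced.new₂ Q z) (lin 2 (λ a b → ⊢ a :- con (- + 8) :* b := a :+ # 8 :* b) (Wt.W₁ ⟨ z ⟩) (Wt.W₂ ⟨ z ⟩))
      w₂ : ∀ z → T.W₂ ⟨ z ⟩ ≡ - Wt.W₂ ⟨ z ⟩
      w₂ z = trans (Replaced.new₁ Q z) (ℤₚ.-1*i≡-i (Wt.W₂ ⟨ z ⟩))
      w₃ : ∀ z → T.W₃ ⟨ z ⟩ ≡ Wt.W₄ ⟨ z ⟩ - + 3 * Wt.W₂ ⟨ z ⟩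
      w₃ z = trans (Replaced.new₄ Q z) refl
      w₄ : ∀ z → T.W₄ ⟨ z ⟩ ≡ Wt.W₃ ⟨ z ⟩ - + 3 * Wt.W₂ ⟨ z ⟩
      w₄ z = trans (Replaced.new₃ Q z) refl
      open Residues R.white′ R.n≡3′ R.σ≡′
      -- In the new order of the vertices zσ has the opposite residues, so its negative, corrected
      -- by vertices, is used.
      module M = Moved (move Wt.tet (- + 1) (+ 1) (+ 0) (+ 1) (+ 0) Wt.zσ refl)
      z⁻ = M.point
      neg : ∀ {x y v} k → x ≡ - + 1 * y + k * Wt.n → y ≡ v → x ≡ - + 1 * v + k * + 3
      neg {y = y} k e refl = trans e (cong (λ t → - + 1 * y + k * t) R.n≡3′)
      y₁ : Wt.W₁ ⟨ z⁻ ⟩ ≡ + 1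
      y₁ = neg (+ 1) M.at₁ g₁
      y₂ : Wt.W₂ ⟨ z⁻ ⟩ ≡ - + 1
      y₂ = neg (+ 0) M.at₂ g₂
      y₃ : Wt.W₃ ⟨ z⁻ ⟩ ≡ + 2
      y₃ = neg (+ 1) M.at₃ Wt.zσ₃
      y₄ : Wt.W₄ ⟨ z⁻ ⟩ ≡ + 1
      y₄ = neg (+ 0) M.at₄ Wt.zσ₄
      b-val = values Wt.tet R.n≡3′ R.b-at
      a-val = proj₁ (proj₂ (vertices Wt.tet R.n≡3′))
      c₁₃′ : ∀ z → + 3 ∣ᶻ (Wt.W₁ ⟨ z ⟩ + Wt.W₂ ⟨ z ⟩) → + 3 ∣ᶻ (Wt.W₁ ⟨ z ⟩ + Wt.W₃ ⟨ z ⟩) → + 3 ∣ᶻ (Wt.W₃ ⟨ z ⟩ + Wt.W₄ ⟨ z ⟩) → + 3 ∣ᶻ (T.W₁ ⟨ z ⟩ + T.W₃ ⟨ z ⟩)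
      c₁₃′ z (k , f) (l , g) (m , h) = + 5 * k - Wt.W₁ ⟨ z ⟩ - l + m , trans (cong₂ _+_ (w₁ z) (w₃ z)) (lin 7 (λ a b c d k l m → a :+ b := k :* # 3 ⇒ a :+ c := l :* # 3 ⇒ c :+ d := m :* # 3 ⇒ ⊢ (a :+ # 8 :* b) :+ (d :- # 3 :* b) := (# 5 :* k :- a :- l :+ m) :* # 3) (Wt.W₁ ⟨ z ⟩) (Wt.W₂ ⟨ z ⟩) (Wt.W₃ ⟨ z ⟩) (Wt.W₄ ⟨ z ⟩) k l m f g h)
      c₁₂′ : ∀ z → + 3 ∣ᶻ (Wt.W₁ ⟨ z ⟩ + Wt.W₂ ⟨ z ⟩) → + 3 ∣ᶻ (T.W₁ ⟨ z ⟩ + T.W₂ ⟨ z ⟩)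
      c₁₂′ z (k , f) = k + + 2 * Wt.W₂ ⟨ z ⟩ , trans (cong₂ _+_ (w₁ z) (w₂ z)) (lin 3 (λ a b k → a :+ b := k :* # 3 ⇒ ⊢ (a :+ # 8 :* b) :+ (:- b) := (k :+ # 2 :* b) :* # 3) (Wt.W₁ ⟨ z ⟩) (Wt.W₂ ⟨ z ⟩) k f)
      h₃′ : ∀ z → + 3 ∣ᶻ Wt.W₄ ⟨ z ⟩ → + 3 ∣ᶻ T.W₃ ⟨ z ⟩
      h₃′ z (k , f) = k - Wt.W₂ ⟨ z ⟩ , trans (w₃ z) (lin 3 (λ d b k → d := k :* # 3 ⇒ ⊢ d :- # 3 :* b := (k :- b) :* # 3) (Wt.W₄ ⟨ z ⟩) (Wt.W₂ ⟨ z ⟩) k f)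

    -- From o = (b + c + e)/3 and b = (o + a + w)/3 it is visible that o and b can be exchanged
    -- together with the pairs c, e and a, w. The facet through c, a and w is therefore seen from b.
    facet₃ : ∀ v → A v → + 0 ≤ W₃ ⟨ v ⟩ + + 3 * W₁ ⟨ v ⟩
    facet₃ v Av = subst (+ 0 ≤_) (w₁ v)
        (facetOf T n≡3′ Ar As Aq Aw z⁻ (+ 2) (+ 0) (- + 1) (+ 0)
          (trans (w₁ z⁻) (cong₂ (λ x y → x + + 3 * y) y₃ y₁)) (trans (w₂ z⁻) y₄) (trans (w₃ z⁻) (cong₂ _-_ y₂ y₁)) (trans (w₄ z⁻) (cong -_ y₁))
          (λ z → c₁₃′ z (c₁₂ z) (c₁₃ z)) (λ z → c₁₂′ z (c₃₄ z)) (λ z Az → h₃′ z (3∣W₁ z Az) (3∣W₂ z Az))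
          Ap (atValues T n≡3′ (trans (w₁ o) (cong₂ (λ x y → x + + 3 * y) (proj₁ (proj₂ (proj₂ o-val))) (proj₁ o-val))) (trans (w₂ o) (proj₂ (proj₂ (proj₂ o-val)))) (trans (w₃ o) (cong₂ _-_ (proj₁ (proj₂ o-val)) (proj₁ o-val))) (trans (w₄ o) (cong -_ (proj₁ o-val))))
          Ae (atValues T n≡3′ (trans (w₁ e) (cong₂ (λ x y → x + + 3 * y) (proj₁ (proj₂ (proj₂ e-val))) (proj₁ e-val))) (trans (w₂ e) (proj₂ (proj₂ (proj₂ e-val)))) (trans (w₃ e) (cong₂ _-_ (proj₁ (proj₂ e-val)) (proj₁ e-val))) (trans (w₄ e) (cong -_ (proj₁ e-val))))
          v Av)
      where
      Q = replaceFirst tet w {ε = - + 1} {b = - + 1} {c = + 3} {d = + 0} w-at (inj₂ refl)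
      T : Tet b c a w
      T = sw34 (sw23 (sw34 (sw12 (sw23 (Replaced.tet Q)))))
      module T = Tet T
      n≡3′ = trans (Replaced.n≡ Q) n≡3
      w₁ : ∀ z → T.W₁ ⟨ z ⟩ ≡ W₃ ⟨ z ⟩ + + 3 * W₁ ⟨ z ⟩
      w₁ z = trans (Replaced.new₃ Q z) (lin 2 (λ a b → ⊢ a :- con (- + 3) :* b := a :+ # 3 :* b) (W₃ ⟨ z ⟩) (W₁ ⟨ z ⟩))
      w₂ : ∀ z → T.W₂ ⟨ z ⟩ ≡ W₄ ⟨ z ⟩
      w₂ z = trans (Replaced.new₄ Q z) (lin 2 (λ a b → ⊢ a :- # 0 :* b := a) (W₄ ⟨ z ⟩) (W₁ ⟨ z ⟩))
      w₃ : ∀ z → T.W₃ ⟨ z ⟩ ≡ W₂ ⟨ z ⟩ - W₁ ⟨ z ⟩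
      w₃ z = trans (Replaced.new₂ Q z) (lin 2 (λ a b → ⊢ a :- # 1 :* b := a :- b) (W₂ ⟨ z ⟩) (W₁ ⟨ z ⟩))
      w₄ : ∀ z → T.W₄ ⟨ z ⟩ ≡ - W₁ ⟨ z ⟩
      w₄ z = trans (Replaced.new₁ Q z) (ℤₚ.-1*i≡-i (W₁ ⟨ z ⟩))
      open Residues white n≡3 σ≡
      module M = Moved (move tet (- + 1) (+ 1) (+ 0) (+ 1) (+ 0) zσ refl)
      z⁻ = M.point
      neg : ∀ {x y v} k → x ≡ - + 1 * y + k * n → y ≡ v → x ≡ - + 1 * v + k * + 3
      neg {y = y} k e refl = trans e (cong (λ t → - + 1 * y + k * t) n≡3)
      y₁ : W₁ ⟨ z⁻ ⟩ ≡ + 1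
      y₁ = neg (+ 1) M.at₁ g₁
      y₂ : W₂ ⟨ z⁻ ⟩ ≡ - + 1
      y₂ = neg (+ 0) M.at₂ g₂
      y₃ : W₃ ⟨ z⁻ ⟩ ≡ + 2
      y₃ = neg (+ 1) M.at₃ zσ₃
      y₄ : W₄ ⟨ z⁻ ⟩ ≡ + 1
      y₄ = neg (+ 0) M.at₄ zσ₄
      o-val = proj₁ (vertices tet n≡3)
      c₁₃′ : ∀ z → + 3 ∣ᶻ (W₁ ⟨ z ⟩ + W₂ ⟨ z ⟩) → + 3 ∣ᶻ (W₁ ⟨ z ⟩ + W₃ ⟨ z ⟩) → + 3 ∣ᶻ (T.W₁ ⟨ z ⟩ + T.W₃ ⟨ z ⟩)
      c₁₃′ z (k , f) (l , g) = k + l , trans (cong₂ _+_ (w₁ z) (w₃ z)) (lin 5 (λ a b c k l → a :+ b := k :* # 3 ⇒ a :+ c := l :* # 3 ⇒ ⊢ (c :+ # 3 :* a) :+ (b :- a) := (k :+ l) :* # 3) (W₁ ⟨ z ⟩) (W₂ ⟨ z ⟩) (W₃ ⟨ z ⟩) k l f g)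
      c₁₂′ : ∀ z → + 3 ∣ᶻ (W₃ ⟨ z ⟩ + W₄ ⟨ z ⟩) → + 3 ∣ᶻ (T.W₁ ⟨ z ⟩ + T.W₂ ⟨ z ⟩)
      c₁₂′ z (k , f) = k + W₁ ⟨ z ⟩ , trans (cong₂ _+_ (w₁ z) (w₂ z)) (lin 4 (λ a c d k → c :+ d := k :* # 3 ⇒ ⊢ (c :+ # 3 :* a) :+ d := (k :+ a) :* # 3) (W₁ ⟨ z ⟩) (W₃ ⟨ z ⟩) (W₄ ⟨ z ⟩) k f)
      h₃′ : ∀ z → + 3 ∣ᶻ W₁ ⟨ z ⟩ → + 3 ∣ᶻ W₂ ⟨ z ⟩ → + 3 ∣ᶻ T.W₃ ⟨ z ⟩
      h₃′ z (k , f) (l , g) = l - k , trans (w₃ z) (lin 4 (λ a b k l → a := k :* # 3 ⇒ b := l :* # 3 ⇒ ⊢ b :- a := (l :- k) :* # 3) (W₁ ⟨ z ⟩) (W₂ ⟨ z ⟩) k l f g)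

    -- The facet through e, w and a, seen from b, starting with the twice rotated tetrahedron o, a,
    -- e, b.
    facet₄ : ∀ v → A v → + 0 ≤ W₃ ⟨ v ⟩ + + 3 * W₁ ⟨ v ⟩ + + 8 * W₄ ⟨ v ⟩
    facet₄ v Av = subst (+ 0 ≤_) (trans (w₁ v) (trans (cong₂ (λ x y → x + + 3 * y) (x₄ v) (x₁ v)) (lin 3 (λ a c d → ⊢ (c :- d) :+ # 3 :* (a :+ # 3 :* d) := c :+ # 3 :* a :+ # 8 :* d) (W₁ ⟨ v ⟩) (W₃ ⟨ v ⟩) (W₄ ⟨ v ⟩))))
        (facetOf T n≡3′ Ar Ae Aw Aq Y.zσ (+ 2) (+ 0) (- + 1) (+ 0)
          (trans (w₁ Y.zσ) (cong₂ (λ x y → x + + 3 * y) Y.zσ₄ g₁)) (trans (w₂ Y.zσ) Y.zσ₃) (trans (w₃ Y.zσ) (cong -_ g₁)) (trans (w₄ Y.zσ) (cong₂ _-_ g₂ g₁))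
          (λ z → c₁₃′ z (c₁₃ z) (c₃₄ z)) (λ z → c₁₂′ z (c₃₄ z)) (λ z Az → h₃′ z (Y.3∣W₁ z Az))
          Ap (atValues T n≡3′ (trans (w₁ o) (cong₂ (λ x y → x + + 3 * y) (proj₂ (proj₂ (proj₂ o-val))) (proj₁ o-val))) (trans (w₂ o) (proj₁ (proj₂ (proj₂ o-val)))) (trans (w₃ o) (cong -_ (proj₁ o-val))) (trans (w₄ o) (cong₂ _-_ (proj₁ (proj₂ o-val)) (proj₁ o-val))))
          As (atValues T n≡3′ (trans (w₁ c) (cong₂ (λ x y → x + + 3 * y) (proj₂ (proj₂ (proj₂ c-val))) (proj₁ c-val))) (trans (w₂ c) (proj₁ (proj₂ (proj₂ c-val)))) (trans (w₃ c) (cong -_ (proj₁ c-val))) (trans (w₄ c) (cong₂ _-_ (proj₁ (proj₂ c-val)) (proj₁ c-val))))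
          v Av)
      where
      module Y = WhiteTet R′.white′
      x₁ : ∀ z → Y.W₁ ⟨ z ⟩ ≡ W₁ ⟨ z ⟩ + + 3 * W₄ ⟨ z ⟩
      x₁ z = trans (R′.new₁ z) (trans (cong₂ (λ x y → x + + 3 * y) (R.new₁ z) (R.new₃ z)) (lin 3 (λ a c d → ⊢ (a :+ # 3 :* c) :+ # 3 :* (d :- c) := a :+ # 3 :* d) (W₁ ⟨ z ⟩) (W₃ ⟨ z ⟩) (W₄ ⟨ z ⟩)))
      x₂ : ∀ z → Y.W₂ ⟨ z ⟩ ≡ W₂ ⟨ z ⟩
      x₂ z = trans (R′.new₂ z) (R.new₂ z)
      x₃ : ∀ z → Y.W₃ ⟨ z ⟩ ≡ - W₄ ⟨ z ⟩
      x₃ z = trans (R′.new₃ z) (trans (cong₂ _-_ (R.new₄ z) (R.new₃ z)) (lin 2 (λ c d → ⊢ :- c :- (d :- c) := :- d) (W₃ ⟨ z ⟩) (W₄ ⟨ z ⟩)))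
      x₄ : ∀ z → Y.W₄ ⟨ z ⟩ ≡ W₃ ⟨ z ⟩ - W₄ ⟨ z ⟩
      x₄ z = trans (R′.new₄ z) (trans (cong -_ (R.new₃ z)) (lin 2 (λ c d → ⊢ :- (d :- c) := c :- d) (W₃ ⟨ z ⟩) (W₄ ⟨ z ⟩)))
      w-at″ : At Y.tet w (- + 1) (- + 1) (+ 0) (+ 3)
      w-at″ = atValues Y.tet R′.n≡3′ (trans (x₁ w) (cong₂ (λ x y → x + + 3 * y) (proj₁ w-val) (proj₂ (proj₂ (proj₂ w-val))))) (trans (x₂ w) (proj₁ (proj₂ w-val)))
        (trans (x₃ w) (cong -_ (proj₂ (proj₂ (proj₂ w-val))))) (trans (x₄ w) (cong₂ _-_ (proj₁ (proj₂ (proj₂ w-val))) (proj₂ (proj₂ (proj₂ w-val)))))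
      Q = replaceFirst Y.tet w {ε = - + 1} {b = - + 1} {c = + 0} {d = + 3} w-at″ (inj₂ refl)
      T : Tet b e w a
      T = sw12 (sw23 (sw34 (sw12 (sw23 (Replaced.tet Q)))))
      module T = Tet T
      n≡3′ = trans (Replaced.n≡ Q) R′.n≡3′
      w₁ : ∀ z → T.W₁ ⟨ z ⟩ ≡ Y.W₄ ⟨ z ⟩ + + 3 * Y.W₁ ⟨ z ⟩
      w₁ z = trans (Replaced.new₄ Q z) (lin 2 (λ a b → ⊢ a :- con (- + 3) :* b := a :+ # 3 :* b) (Y.W₄ ⟨ z ⟩) (Y.W₁ ⟨ z ⟩))
      w₂ : ∀ z → T.W₂ ⟨ z ⟩ ≡ Y.W₃ ⟨ z ⟩
      w₂ z = trans (Replaced.new₃ Q z) (lin 2 (λ a b → ⊢ a :- # 0 :* b := a) (Y.W₃ ⟨ z ⟩) (Y.W₁ ⟨ z ⟩))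
      w₃ : ∀ z → T.W₃ ⟨ z ⟩ ≡ - Y.W₁ ⟨ z ⟩
      w₃ z = trans (Replaced.new₁ Q z) (ℤₚ.-1*i≡-i (Y.W₁ ⟨ z ⟩))
      w₄ : ∀ z → T.W₄ ⟨ z ⟩ ≡ Y.W₂ ⟨ z ⟩ - Y.W₁ ⟨ z ⟩
      w₄ z = trans (Replaced.new₂ Q z) (lin 2 (λ a b → ⊢ a :- # 1 :* b := a :- b) (Y.W₂ ⟨ z ⟩) (Y.W₁ ⟨ z ⟩))
      open Residues R′.white′ R′.n≡3′ R′.σ≡′
      o-val = proj₁ (vertices Y.tet R′.n≡3′)
      c-val = values Y.tet R′.n≡3′ R′.b-at
      c₁₃′ : ∀ z → + 3 ∣ᶻ (Y.W₁ ⟨ z ⟩ + Y.W₃ ⟨ z ⟩) → + 3 ∣ᶻ (Y.W₃ ⟨ z ⟩ + Y.W₄ ⟨ z ⟩) → + 3 ∣ᶻ (T.W₁ ⟨ z ⟩ + T.W₃ ⟨ z ⟩)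
      c₁₃′ z (k , f) (l , g) = l - k + Y.W₁ ⟨ z ⟩ , trans (cong₂ _+_ (w₁ z) (w₃ z)) (lin 5 (λ a c d k l → a :+ c := k :* # 3 ⇒ c :+ d := l :* # 3 ⇒ ⊢ (d :+ # 3 :* a) :+ (:- a) := (l :- k :+ a) :* # 3) (Y.W₁ ⟨ z ⟩) (Y.W₃ ⟨ z ⟩) (Y.W₄ ⟨ z ⟩) k l f g)
      c₁₂′ : ∀ z → + 3 ∣ᶻ (Y.W₃ ⟨ z ⟩ + Y.W₄ ⟨ z ⟩) → + 3 ∣ᶻ (T.W₁ ⟨ z ⟩ + T.W₂ ⟨ z ⟩)
      c₁₂′ z (k , f) = k + Y.W₁ ⟨ z ⟩ , trans (cong₂ _+_ (w₁ z) (w₂ z)) (lin 4 (λ a c d k → c :+ d := k :* # 3 ⇒ ⊢ (d :+ # 3 :* a) :+ c := (k :+ a) :* # 3) (Y.W₁ ⟨ z ⟩) (Y.W₃ ⟨ z ⟩) (Y.W₄ ⟨ z ⟩) k f)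
      h₃′ : ∀ z → + 3 ∣ᶻ Y.W₁ ⟨ z ⟩ → + 3 ∣ᶻ T.W₃ ⟨ z ⟩
      h₃′ z (k , f) = - k , trans (w₃ z) (lin 2 (λ a k → a := k :* # 3 ⇒ ⊢ :- a := (:- k) :* # 3) (Y.W₁ ⟨ z ⟩) k f)

-- Rational points and homogenised affine functionals

ι : ℤ → ℚ
ι z = z ℚ./ 1

private
  ιᵘ : ∀ z → ℚ.toℚᵘ (ι z) ℚᵘ.≃ ℚᵘ.mkℚᵘ z 0
  ιᵘ z = ℚₚ.toℚᵘ-fromℚᵘ (ℚᵘ.mkℚᵘ z 0)

ι-+ : ∀ a b → ι (a + b) ≡ ι a ℚ.+ ι b
ι-+ a b = ℚₚ.toℚᵘ-injective (ℚᵘₚ.≃-trans (ιᵘ (a + b)) (ℚᵘₚ.≃-trans (ℚᵘ.*≡* (lin 2 (λ a b → ⊢ (a :+ b) :* # 1 := (a :* # 1 :+ b :* # 1) :* # 1) a b))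
  (ℚᵘₚ.≃-sym (ℚᵘₚ.≃-trans (ℚₚ.toℚᵘ-homo-+ (ι a) (ι b)) (ℚᵘₚ.+-cong (ιᵘ a) (ιᵘ b))))))

ι-* : ∀ a b → ι (a * b) ≡ ι a ℚ.* ι b
ι-* a b = ℚₚ.toℚᵘ-injective (ℚᵘₚ.≃-trans (ιᵘ (a * b))
  (ℚᵘₚ.≃-sym (ℚᵘₚ.≃-trans (ℚₚ.toℚᵘ-homo-* (ι a) (ι b)) (ℚᵘₚ.*-cong (ιᵘ a) (ιᵘ b)))))

ι-mono-≤ : ∀ {a b} → a ≤ b → ι a ℚ.≤ ι b
ι-mono-≤ {a} {b} h = ℚₚ.toℚᵘ-cancel-≤ (ℚᵘₚ.≤-respˡ-≃ (ℚᵘₚ.≃-sym (ιᵘ a)) (ℚᵘₚ.≤-respʳ-≃ (ℚᵘₚ.≃-sym (ιᵘ b)) (ℚᵘ.*≤* (ℤₚ.*-monoʳ-≤-nonNeg (+ 1) h))))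

ι-cancel-≤ : ∀ {a b} → ι a ℚ.≤ ι b → a ≤ b
ι-cancel-≤ {a} {b} h = go (ℚᵘₚ.≤-respˡ-≃ (ιᵘ a) (ℚᵘₚ.≤-respʳ-≃ (ιᵘ b) (ℚₚ.toℚᵘ-mono-≤ h)))
  where
  go : ℚᵘ.mkℚᵘ a 0 ℚᵘ.≤ ℚᵘ.mkℚᵘ b 0 → a ≤ b
  go (ℚᵘ.*≤* k) = lin 2 (λ a b → a :* # 1 :≤ b :* # 1 ⇒ ⊢ a :≤ b) a b k

0≤* : ∀ {p q} → 0ℚ ℚ.≤ p → 0ℚ ℚ.≤ q → 0ℚ ℚ.≤ p ℚ.* q
0≤* {p} {q} hp hq = subst (ℚ._≤ p ℚ.* q) (ℚₚ.*-zeroʳ p) (ℚₚ.*-monoˡ-≤-nonNeg p ⦃ ℚ.nonNegative hp ⦄ hq)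

0≤+ : ∀ {p q} → 0ℚ ℚ.≤ p → 0ℚ ℚ.≤ q → 0ℚ ℚ.≤ p ℚ.+ q
0≤+ = ℚₚ.+-mono-≤

vecQ≡ : ∀ {a b c a′ b′ c′ : ℚ} → a ≡ a′ → b ≡ b′ → c ≡ c′ → (Q3 ∋ a ∷ b ∷ c ∷ []) ≡ a′ ∷ b′ ∷ c′ ∷ []
vecQ≡ refl refl refl = refl

row : Aff → Z3
row (aff α β γ δ) = pt α β γ

-- The homogenisation of an affine functional: m is the total weight.
φ : Aff → ℚ → Q3 → ℚ
φ f m x = dotZQ (row f) x ℚ.+ m ℚ.* ι (Aff.δ f)

φ-+ : ∀ f m m′ x x′ → φ f (m ℚ.+ m′) (x +q x′) ≡ φ f m x ℚ.+ φ f m′ x′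
φ-+ (aff α β γ δ) m m′ (x ∷ y ∷ z ∷ []) (x′ ∷ y′ ∷ z′ ∷ []) = solve 12 (λ α β γ δ m m′ x y z x′ y′ z′ →
    α ⊗ (x ⊕ x′) ⊕ (β ⊗ (y ⊕ y′) ⊕ (γ ⊗ (z ⊕ z′) ⊕ Con 0ℚ)) ⊕ (m ⊕ m′) ⊗ δ
    ⊜ (α ⊗ x ⊕ (β ⊗ y ⊕ (γ ⊗ z ⊕ Con 0ℚ)) ⊕ m ⊗ δ) ⊕ (α ⊗ x′ ⊕ (β ⊗ y′ ⊕ (γ ⊗ z′ ⊕ Con 0ℚ)) ⊕ m′ ⊗ δ))
  refl (ι α) (ι β) (ι γ) (ι δ) m m′ x y z x′ y′ z′

φ-* : ∀ f t m x → φ f (t ℚ.* m) (t ·q x) ≡ t ℚ.* φ f m x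
φ-* (aff α β γ δ) t m (x ∷ y ∷ z ∷ []) = solve 9 (λ α β γ δ t m x y z →
    α ⊗ (t ⊗ x) ⊕ (β ⊗ (t ⊗ y) ⊕ (γ ⊗ (t ⊗ z) ⊕ Con 0ℚ)) ⊕ (t ⊗ m) ⊗ δ
    ⊜ t ⊗ (α ⊗ x ⊕ (β ⊗ y ⊕ (γ ⊗ z ⊕ Con 0ℚ)) ⊕ m ⊗ δ))
  refl (ι α) (ι β) (ι γ) (ι δ) t m x y z

φ-0 : ∀ f → φ f 0ℚ zeroQ3 ≡ 0ℚ
φ-0 (aff α β γ δ) = solve 4 (λ α β γ δ →
    α ⊗ Con 0ℚ ⊕ (β ⊗ Con 0ℚ ⊕ (γ ⊗ Con 0ℚ ⊕ Con 0ℚ)) ⊕ Con 0ℚ ⊗ δ ⊜ Con 0ℚ)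
  refl (ι α) (ι β) (ι γ) (ι δ)

φ-ι : ∀ f v → φ f 1ℚ (toQ3 v) ≡ ι (f ⟨ v ⟩)
φ-ι (aff α β γ δ) (x ∷ y ∷ z ∷ []) = trans
  (solve 7 (λ α β γ δ x y z → α ⊗ x ⊕ (β ⊗ y ⊕ (γ ⊗ z ⊕ Con 0ℚ)) ⊕ Con 1ℚ ⊗ δ ⊜ α ⊗ x ⊕ β ⊗ y ⊕ γ ⊗ z ⊕ δ)
    refl (ι α) (ι β) (ι γ) (ι δ) (ι x) (ι y) (ι z))
  (sym (trans (ι-+ (α * x + β * y + γ * z) δ) (cong (ℚ._+ ι δ) (trans (ι-+ (α * x + β * y) (γ * z))
    (cong₂ ℚ._+_ (trans (ι-+ (α * x) (β * y)) (cong₂ ℚ._+_ (ι-* α x) (ι-* β y))) (ι-* γ z))))))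

toQ3-+ : ∀ u v → toQ3 (u +z v) ≡ toQ3 u +q toQ3 v
toQ3-+ (x ∷ y ∷ z ∷ []) (x′ ∷ y′ ∷ z′ ∷ []) = vecQ≡ (ι-+ x x′) (ι-+ y y′) (ι-+ z z′)

toQ3-* : ∀ c v → toQ3 (c ·z v) ≡ ι c ·q toQ3 v
toQ3-* c (x ∷ y ∷ z ∷ []) = vecQ≡ (ι-* c x) (ι-* c y) (ι-* c z)

-- Convex cones

record ConvexCone (P : ℚ → Q3 → Set) : Set where
  field
    P-0 : P 0ℚ zeroQ3
    P-+ : ∀ {m m′ x x′} → P m x → P m′ x′ → P (m ℚ.+ m′) (x +q x′)
    P-* : ∀ {t m x} → 0ℚ ℚ.≤ t → P m x → P (t ℚ.* m) (t ·q x)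

-- `InConv V` is `Cone V 1ℚ` by definition. Leaving the total weight free makes addition and scaling
-- separate closure properties.
Cone : List Z3 → ℚ → Q3 → Set
Cone V m x = Σ (List ℚ) λ ws → (length ws ≡ length V) × All (λ w → 0ℚ ℚ.≤ w) ws × (sumQ ws ≡ m) × (combQ ws V ≡ x)

-- The induction principle for convex hulls: a property closed under the cone operations has to be
-- checked at the listed points only.
cone-least : ∀ {P} → ConvexCone P → ∀ V → (∀ {v} → v ∈ V → P 1ℚ (toQ3 v)) → ∀ {m x} → Cone V m x → P m x
cone-least {P} C L.[] h (L.[] , _ , _ , refl , refl) = ConvexCone.P-0 C
cone-least {P} C (v L.∷ V) h (w L.∷ ws , e , w≥0 All.∷ ws≥0 , refl , refl) =
  P-+ (subst (λ m → P m (w ·q toQ3 v)) (ℚₚ.*-identityʳ w) (P-* w≥0 (h (here refl))))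
    (cone-least C V (λ i → h (there i)) (ws , ℕₚ.suc-injective e , ws≥0 , refl , refl))
  where open ConvexCone C

private
  +q-interchange : ∀ w w′ x y y′ → ((w ℚ.+ w′) ·q x) +q (y +q y′) ≡ ((w ·q x) +q y) +q ((w′ ·q x) +q y′)
  +q-interchange w w′ (a ∷ b ∷ c ∷ []) (a′ ∷ b′ ∷ c′ ∷ []) (a″ ∷ b″ ∷ c″ ∷ []) = vecQ≡ (e w w′ a a′ a″) (e w w′ b b′ b″) (e w w′ c c′ c″)
    where
    e : ∀ w w′ x y z → (w ℚ.+ w′) ℚ.* x ℚ.+ (y ℚ.+ z) ≡ (w ℚ.* x ℚ.+ y) ℚ.+ (w′ ℚ.* x ℚ.+ z)
    e = solve 5 (λ w w′ x y z → (w ⊕ w′) ⊗ x ⊕ (y ⊕ z) ⊜ (w ⊗ x ⊕ y) ⊕ (w′ ⊗ x ⊕ z)) refl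

  ·q-distrib : ∀ t w x y → ((t ℚ.* w) ·q x) +q (t ·q y) ≡ t ·q ((w ·q x) +q y)
  ·q-distrib t w (a ∷ b ∷ c ∷ []) (a′ ∷ b′ ∷ c′ ∷ []) = vecQ≡ (e t w a a′) (e t w b b′) (e t w c c′)
    where
    e : ∀ t w x y → (t ℚ.* w) ℚ.* x ℚ.+ t ℚ.* y ≡ t ℚ.* (w ℚ.* x ℚ.+ y)
    e = solve 4 (λ t w x y → (t ⊗ w) ⊗ x ⊕ t ⊗ y ⊜ t ⊗ (w ⊗ x ⊕ y)) refl

  ·q-zero : ∀ t → t ·q zeroQ3 ≡ zeroQ3
  ·q-zero t = vecQ≡ (ℚₚ.*-zeroʳ t) (ℚₚ.*-zeroʳ t) (ℚₚ.*-zeroʳ t)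

  0·q+ : ∀ v x → (0ℚ ·q v) +q x ≡ x
  0·q+ (a ∷ b ∷ c ∷ []) (a′ ∷ b′ ∷ c′ ∷ []) = vecQ≡ (e a a′) (e b b′) (e c c′)
    where
    e : ∀ x y → 0ℚ ℚ.* x ℚ.+ y ≡ y
    e = solve 2 (λ x y → Con 0ℚ ⊗ x ⊕ y ⊜ y) refl

  1·q+0 : ∀ v → (1ℚ ·q v) +q zeroQ3 ≡ v
  1·q+0 (a ∷ b ∷ c ∷ []) = vecQ≡ (e a) (e b) (e c)
    where
    e : ∀ x → 1ℚ ℚ.* x ℚ.+ 0ℚ ≡ x
    e = solve 1 (λ x → Con 1ℚ ⊗ x ⊕ Con 0ℚ ⊜ x) refl

0≤0 : 0ℚ ℚ.≤ 0ℚ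
0≤0 = ℚₚ.≤-refl

cone-∷ : ∀ {u V m x} → Cone V m x → Cone (u L.∷ V) m x
cone-∷ {u} (ws , e , p , refl , refl) = 0ℚ L.∷ ws , cong suc e , 0≤0 All.∷ p , ℚₚ.+-identityˡ (sumQ ws) , 0·q+ (toQ3 u) _

cone-0 : ∀ V → Cone V 0ℚ zeroQ3
cone-0 L.[] = L.[] , refl , All.[] , refl , refl
cone-0 (v L.∷ V) = cone-∷ {v} (cone-0 V)

cone-+ : ∀ V {m m′ x x′} → Cone V m x → Cone V m′ x′ → Cone V (m ℚ.+ m′) (x +q x′)
cone-+ L.[] (L.[] , _ , _ , refl , refl) (L.[] , _ , _ , refl , refl) = L.[] , refl , All.[] , refl , refl
cone-+ (v L.∷ V) (w L.∷ ws , e , p All.∷ ps , refl , refl) (w′ L.∷ ws′ , e′ , p′ All.∷ ps′ , refl , refl) =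
  go (cone-+ V (ws , ℕₚ.suc-injective e , ps , refl , refl) (ws′ , ℕₚ.suc-injective e′ , ps′ , refl , refl))
  where
  go : Cone V (sumQ ws ℚ.+ sumQ ws′) (combQ ws V +q combQ ws′ V) → Cone (v L.∷ V) _ _
  go (us , f , q , s , c) = w ℚ.+ w′ L.∷ us , cong suc f , 0≤+ p p′ All.∷ q
    , trans (cong (w ℚ.+ w′ ℚ.+_) s) (solve 4 (λ w w′ s s′ → (w ⊕ w′) ⊕ (s ⊕ s′) ⊜ (w ⊕ s) ⊕ (w′ ⊕ s′)) refl w w′ (sumQ ws) (sumQ ws′))
    , trans (cong (((w ℚ.+ w′) ·q toQ3 v) +q_) c) (+q-interchange w w′ (toQ3 v) (combQ ws V) (combQ ws′ V))

cone-* : ∀ V {t m x} → 0ℚ ℚ.≤ t → Cone V m x → Cone V (t ℚ.* m) (t ·q x)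
cone-* L.[] {t} h (L.[] , _ , _ , refl , refl) = L.[] , refl , All.[] , sym (ℚₚ.*-zeroʳ t) , sym (·q-zero t)
cone-* (v L.∷ V) {t} h (w L.∷ ws , e , p All.∷ ps , refl , refl) = go (cone-* V {t} h (ws , ℕₚ.suc-injective e , ps , refl , refl))
  where
  go : Cone V (t ℚ.* sumQ ws) (t ·q combQ ws V) → Cone (v L.∷ V) _ _
  go (us , f , q , s , c) = t ℚ.* w L.∷ us , cong suc f , 0≤* h p All.∷ q
    , trans (cong (t ℚ.* w ℚ.+_) s) (sym (ℚₚ.*-distribˡ-+ t w (sumQ ws)))
    , trans (cong (((t ℚ.* w) ·q toQ3 v) +q_) c) (·q-distrib t w (toQ3 v) (combQ ws V))

cone-vertex : ∀ {v V} → v ∈ V → Cone V 1ℚ (toQ3 v)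
cone-vertex {v} {_ L.∷ V} (here refl) = go (cone-0 V)
  where
  go : Cone V 0ℚ zeroQ3 → Cone (v L.∷ V) 1ℚ (toQ3 v)
  go (ws , e , p , s , c) = 1ℚ L.∷ ws , cong suc e , ℚₚ.nonNegative⁻¹ 1ℚ All.∷ p , cong (1ℚ ℚ.+_) s , trans (cong ((1ℚ ·q toQ3 v) +q_) c) (1·q+0 (toQ3 v))
cone-vertex {v} {u L.∷ V} (there i) = cone-∷ {u} (cone-vertex i)

nonneg-on-cone : ∀ f V → (∀ {v} → v ∈ V → + 0 ≤ f ⟨ v ⟩) → ∀ {m x} → Cone V m x → 0ℚ ℚ.≤ φ f m x
nonneg-on-cone f = cone-nonneg
  where
  C : ConvexCone (λ m x → 0ℚ ℚ.≤ φ f m x)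
  C = record { P-0 = ℚₚ.≤-reflexive (sym (φ-0 f))
    ; P-+ = λ {m} {m′} {x} {x′} h h′ → subst (0ℚ ℚ.≤_) (sym (φ-+ f m m′ x x′)) (0≤+ h h′)
    ; P-* = λ {t} {m} {x} ht h → subst (0ℚ ℚ.≤_) (sym (φ-* f t m x)) (0≤* ht h) }
  cone-nonneg : ∀ V → (∀ {v} → v ∈ V → + 0 ≤ f ⟨ v ⟩) → ∀ {m x} → Cone V m x → 0ℚ ℚ.≤ φ f m x
  cone-nonneg V h = cone-least C V λ {v} i → subst (0ℚ ℚ.≤_) (sym (φ-ι f v)) (ι-mono-≤ (h i))

nonneg-on-points : ∀ f V → (∀ {v} → v ∈ V → + 0 ≤ f ⟨ v ⟩) → ∀ {z} → LatticePt V z → + 0 ≤ f ⟨ z ⟩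
nonneg-on-points f V h {z} i = ι-cancel-≤ (subst (0ℚ ℚ.≤_) (φ-ι f z) (nonneg-on-cone f V h i))

cone-combZ : ∀ V cs → All (λ c → + 0 ≤ proj₁ c × LatticePt V (proj₂ c)) cs → Cone V (ι (sumZ cs)) (toQ3 (combZ cs))
cone-combZ V L.[] All.[] = cone-0 V
cone-combZ V ((c , p) L.∷ cs) ((c≥0 , i) All.∷ is) = subst₂ (Cone V) (trans (cong (ℚ._+ ι (sumZ cs)) (ℚₚ.*-identityʳ (ι c))) (sym (ι-+ c (sumZ cs))))
  (trans (cong (_+q toQ3 (combZ cs)) (sym (toQ3-* c p))) (sym (toQ3-+ (c ·z p) (combZ cs))))
  (cone-+ V (cone-* V (ι-mono-≤ c≥0) i) (cone-combZ V cs is))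

-- The combination lies in the cone with total weight N; scaling by 1/N brings it into the hull.
convex-points : ∀ V cs N z → All (λ c → + 0 ≤ proj₁ c × LatticePt V (proj₂ c)) cs → sumZ cs ≡ N → + 0 < N → combZ cs ≡ N ·z z → LatticePt V z
convex-points V cs (+ zero) z is e (+<+ ()) e′
convex-points V cs N@(+ suc k) z is e N>0 e′ = subst₂ (Cone V) inv (scale z) (cone-* V {r} r≥0 (subst₂ (Cone V) (cong ι e) (trans (cong toQ3 e′) (toQ3-* N z)) (cone-combZ V cs is)))
  where
  r : ℚ
  r = + 1 ℚ./ suc k
  inv : r ℚ.* ι N ≡ 1ℚ
  inv = ℚₚ.toℚᵘ-injective (ℚᵘₚ.≃-trans (ℚₚ.toℚᵘ-homo-* r (ι N)) (ℚᵘₚ.≃-trans (ℚᵘₚ.*-cong (ℚₚ.toℚᵘ-fromℚᵘ (ℚᵘ.mkℚᵘ (+ 1) k)) (ιᵘ N))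
    (ℚᵘ.*≡* (trans (ℤₚ.*-identityʳ (+ 1 * N)) (trans (ℤₚ.*-identityˡ N) (sym (trans (ℤₚ.*-identityˡ _) (cong (λ d → + suc d) (ℕₚ.*-identityʳ k)))))))))
  r≥0 : 0ℚ ℚ.≤ r
  r≥0 = ℚₚ.toℚᵘ-cancel-≤ (ℚᵘₚ.≤-respʳ-≃ (ℚᵘₚ.≃-sym (ℚₚ.toℚᵘ-fromℚᵘ (ℚᵘ.mkℚᵘ (+ 1) k))) (ℚᵘ.*≤* (+≤+ z≤n)))
  one : ∀ x → r ℚ.* (ι N ℚ.* ι x) ≡ ι x
  one x = trans (sym (ℚₚ.*-assoc r (ι N) (ι x))) (trans (cong (ℚ._* ι x) inv) (ℚₚ.*-identityˡ (ι x)))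
  scale : ∀ z → r ·q (ι N ·q toQ3 z) ≡ toQ3 z
  scale (x ∷ y ∷ z ∷ []) = vecQ≡ (one x) (one y) (one z)

-- Equivalence by integral affine maps

matrix : Aff → Aff → Aff → Mat
matrix f g h = row f ∷ row g ∷ row h ∷ []

offset : Aff → Aff → Aff → Z3
offset f g h = pt (Aff.δ f) (Aff.δ g) (Aff.δ h)

-- The map is tested on the two lists. A preimage of a point of W may be any lattice point of the
-- hull of V, since the points found in the proof need not occur in the list V.
module Transport (V W : List Z3) (f g h : Aff)
  (surj : ∀ y₁ y₂ y₃ → ∃ λ x → f ⟨ x ⟩ ≡ y₁ × g ⟨ x ⟩ ≡ y₂ × h ⟨ x ⟩ ≡ y₃)
  (into : ∀ {v} → v ∈ V → LatticePt W (pt (f ⟨ v ⟩) (g ⟨ v ⟩) (h ⟨ v ⟩)))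
  (onto : ∀ {w} → w ∈ W → ∃ λ p → LatticePt V p × pt (f ⟨ p ⟩) (g ⟨ p ⟩) (h ⟨ p ⟩) ≡ w) where

  private
    F : ℚ → Q3 → Q3
    F m x = φ f m x ∷ φ g m x ∷ φ h m x ∷ []

    F-0 : F 0ℚ zeroQ3 ≡ zeroQ3
    F-0 = vecQ≡ (φ-0 f) (φ-0 g) (φ-0 h)
    F-+ : ∀ m m′ x x′ → F (m ℚ.+ m′) (x +q x′) ≡ F m x +q F m′ x′
    F-+ m m′ x x′ = vecQ≡ (φ-+ f m m′ x x′) (φ-+ g m m′ x x′) (φ-+ h m m′ x x′)
    F-* : ∀ t m x → F (t ℚ.* m) (t ·q x) ≡ t ·q F m x
    F-* t m x = vecQ≡ (φ-* f t m x) (φ-* g t m x) (φ-* h t m x)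
    F-ι : ∀ v → F 1ℚ (toQ3 v) ≡ toQ3 (pt (f ⟨ v ⟩) (g ⟨ v ⟩) (h ⟨ v ⟩))
    F-ι v = vecQ≡ (φ-ι f v) (φ-ι g v) (φ-ι h v)

    applyQ-F : ∀ x → applyQ (matrix f g h) (offset f g h) x ≡ F 1ℚ x
    applyQ-F x = vecQ≡ (e f) (e g) (e h)
      where
      e : ∀ f → dotZQ (row f) x ℚ.+ ι (Aff.δ f) ≡ φ f 1ℚ x
      e f = cong (dotZQ (row f) x ℚ.+_) (sym (ℚₚ.*-identityˡ (ι (Aff.δ f))))

    dotZ-row : ∀ f x → dotZ (row f) x + Aff.δ f ≡ f ⟨ x ⟩
    dotZ-row (aff α β γ δ) (x ∷ y ∷ z ∷ []) = lin 7 (λ α β γ δ x y z → ⊢ α :* x :+ (β :* y :+ (γ :* z :+ # 0)) :+ δ := α :* x :+ β :* y :+ γ :* z :+ δ) α β γ δ x y z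

    forth : ∀ {m x} → Cone V m x → Cone W m (F m x)
    forth = cone-least C V λ {v} i → subst (Cone W 1ℚ) (sym (F-ι v)) (into i)
      where
      C : ConvexCone (λ m x → Cone W m (F m x))
      C = record { P-0 = subst (Cone W 0ℚ) (sym F-0) (cone-0 W)
        ; P-+ = λ {m} {m′} {x} {x′} a b → subst (Cone W (m ℚ.+ m′)) (sym (F-+ m m′ x x′)) (cone-+ W a b)
        ; P-* = λ {t} {m} {x} ht a → subst (Cone W (t ℚ.* m)) (sym (F-* t m x)) (cone-* W ht a) }

    back : ∀ {m y} → Cone W m y → ∃ λ x → Cone V m x × F m x ≡ y
    back = cone-least C W λ i → vertex (onto i)
      where
      vertex : ∀ {w} → (∃ λ p → LatticePt V p × pt (f ⟨ p ⟩) (g ⟨ p ⟩) (h ⟨ p ⟩) ≡ w) → ∃ λ x → Cone V 1ℚ x × F 1ℚ x ≡ toQ3 w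
      vertex (p , i , e) = toQ3 p , i , trans (F-ι p) (cong toQ3 e)
      C : ConvexCone (λ m y → ∃ λ x → Cone V m x × F m x ≡ y)
      C = record { P-0 = zeroQ3 , cone-0 V , F-0
        ; P-+ = λ { {m} {m′} (x , c , refl) (x′ , c′ , refl) → x +q x′ , cone-+ V c c′ , F-+ m m′ x x′ }
        ; P-* = λ { {t} {m} ht (x , c , refl) → t ·q x , cone-* V ht c , F-* t m x } }

  transport : UnimodEquiv V W
  transport = matrix f g h , offset f g h , (λ { (y₁ ∷ y₂ ∷ y₃ ∷ []) → inverse (surj y₁ y₂ y₃) }) , λ q → mk⇔
      (λ c → image (back c)) (λ { (p , c , refl) → subst (Cone W 1ℚ) (sym (applyQ-F p)) (forth c) })
    where
    inverse : ∀ {y₁ y₂ y₃} → (∃ λ x → f ⟨ x ⟩ ≡ y₁ × g ⟨ x ⟩ ≡ y₂ × h ⟨ x ⟩ ≡ y₃) → ∃ λ x → applyZ (matrix f g h) (offset f g h) x ≡ pt y₁ y₂ y₃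
    inverse (x , refl , refl , refl) = x , vec≡ (dotZ-row f x) (dotZ-row g x) (dotZ-row h x)
    image : ∀ {q} → (∃ λ x → Cone V 1ℚ x × F 1ℚ x ≡ q) → ∃ λ p → InConv V p × applyQ (matrix f g h) (offset f g h) p ≡ q
    image (x , c , e) = x , c , trans (applyQ-F x) e

-- The lattice of differences

module _ {V : List Z3} where

  sumZ-comb : ∀ k as bs → sumZ (L.map (λ c → k * proj₁ c , proj₂ c) as L.++ bs) ≡ k * sumZ as + sumZ bs
  sumZ-comb k L.[] bs = lin 2 (λ k s → ⊢ s := k :* # 0 :+ s) k (sumZ bs)
  sumZ-comb k ((a , p) L.∷ as) bs = trans (cong (λ t → k * a + t) (sumZ-comb k as bs)) (lin 4 (λ k a s t → ⊢ k :* a :+ (k :* s :+ t) := k :* (a :+ s) :+ t) k a (sumZ as) (sumZ bs))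

  combZ-comb : ∀ k as bs → combZ (L.map (λ c → k * proj₁ c , proj₂ c) as L.++ bs) ≡ (k ·z combZ as) +z combZ bs
  combZ-comb k L.[] bs = e (combZ bs)
    where
    e : ∀ v → v ≡ (k ·z zero3) +z v
    e (x ∷ y ∷ z ∷ []) = vec≡ (s x) (s y) (s z)
      where
      s : ∀ x → x ≡ k * + 0 + x
      s = lin 2 (λ k x → ⊢ x := k :* # 0 :+ x) k
  combZ-comb k ((a , p) L.∷ as) bs = trans (cong (((k * a) ·z p) +z_) (combZ-comb k as bs)) (e p (combZ as) (combZ bs))
    where
    e : ∀ p u v → ((k * a) ·z p) +z ((k ·z u) +z v) ≡ (k ·z ((a ·z p) +z u)) +z v
    e (x ∷ y ∷ z ∷ []) (x′ ∷ y′ ∷ z′ ∷ []) (x″ ∷ y″ ∷ z″ ∷ []) = vec≡ (s x x′ x″) (s y y′ y″) (s z z′ z″)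
      where
      s : ∀ x y z → k * a * x + (k * y + z) ≡ k * (a * x + y) + z
      s = lin 5 (λ k a x y z → ⊢ k :* a :* x :+ (k :* y :+ z) := k :* (a :* x :+ y) :+ z) k a

  linLat-0 : LinLat V zero3
  linLat-0 = L.[] , All.[] , refl , refl

  linLat-comb : ∀ k {a b} → LinLat V a → LinLat V b → LinLat V ((k ·z a) +z b)
  linLat-comb k (as , As , sa , refl) (bs , Bs , sb , refl) = L.map (λ c → k * proj₁ c , proj₂ c) as L.++ bs , Allₚ.++⁺ (Allₚ.map⁺ (All.map (λ x → x) As)) Bs
    , trans (sumZ-comb k as bs) (trans (cong₂ (λ x y → k * x + y) sa sb) (lin 1 (λ k → ⊢ k :* # 0 :+ # 0 := # 0) k)) , combZ-comb k as bs

  linLat-points : ∀ {p q} → LatticePt V p → LatticePt V q → LinLat V (p -z q)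
  linLat-points {p} {q} Ap Aq = (+ 1 , p) L.∷ (- + 1 , q) L.∷ L.[] , Ap All.∷ Aq All.∷ All.[] , refl , e p q
    where
    e : ∀ p q → ((+ 1) ·z p) +z (((- + 1) ·z q) +z zero3) ≡ p -z q
    e (x ∷ y ∷ z ∷ []) (x′ ∷ y′ ∷ z′ ∷ []) = vec≡ (s x x′) (s y y′) (s z z′)
      where
      s : ∀ x y → + 1 * x + (- + 1 * y + + 0) ≡ x - y
      s = lin 2 (λ x y → ⊢ # 1 :* x :+ (con (- + 1) :* y :+ # 0) := x :- y)

-- A subgroup of index three is contained in the kernel of a character modulo three.
module Character (Λ : Z3 → Set) (Λ-0 : Λ zero3) (Λ-comb : ∀ k {a b} → Λ a → Λ b → Λ ((k ·z a) +z b))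
  (r : Fin 3 → Z3) (r-sep : ∀ i j → Λ (r i -z r j) → i ≡ j) (r-cover : ∀ z → ∃ λ i → Λ (z -z r i)) where

  private
    ext : ∀ {x y} → (∀ f → linear f x ≡ linear f y) → x ≡ y
    ext {x} {y} = linear-ext x y

    Λ-lin : ∀ k {a b c} → Λ a → Λ b → (∀ f → linear f c ≡ k * linear f a + linear f b) → Λ c
    Λ-lin k {a} {b} {c} ha hb e = subst Λ (ext {(k ·z a) +z b} {c} λ f → trans (linear-step f k a b) (sym (e f))) (Λ-comb k ha hb)

    Λ-- : ∀ {a b} → Λ a → Λ b → Λ (a -z b)
    Λ-- {a} {b} ha hb = Λ-lin (- + 1) {b} {a} hb ha λ f → trans (linear-- f a b) (lin 2 (λ x y → ⊢ x :- y := con (- + 1) :* y :+ x) (linear f a) (linear f b))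

    Λ-swap : ∀ {a b} → Λ (a -z b) → Λ (b -z a)
    Λ-swap {a} {b} h = Λ-lin (- + 1) {a -z b} {zero3} h Λ-0 λ f → trans (linear-- f b a) (lin 4 (λ x y d z → d := x :- y ⇒ z := # 0 ⇒ ⊢ y :- x := con (- + 1) :* d :+ z) (linear f a) (linear f b) (linear f (a -z b)) (linear f zero3) (linear-- f a b) (linear-zero f))

    Λ-trans : ∀ {a b c} → Λ (a -z b) → Λ (b -z c) → Λ (a -z c)
    Λ-trans {a} {b} {c} h h′ = Λ-lin (+ 1) {a -z b} {b -z c} h h′ λ f → trans (linear-- f a c) (lin 5 (λ x y z u v → u := x :- y ⇒ v := y :- z ⇒ ⊢ x :- z := # 1 :* u :+ v)
      (linear f a) (linear f b) (linear f c) (linear f (a -z b)) (linear f (b -z c)) (linear-- f a b) (linear-- f b c))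

    cls : Z3 → Fin 3
    cls z = proj₁ (r-cover z)

    same : ∀ {x y} → cls x ≡ cls y → Λ (x -z y)
    same {x} {y} e = Λ-trans {x} {r (cls x)} {y} (proj₂ (r-cover x)) (Λ-swap {y} {r (cls x)} (subst (λ i → Λ (y -z r i)) (sym e) (proj₂ (r-cover y))))

    minus0 : ∀ {x} → Λ (x -z zero3) → Λ x
    minus0 {x} h = Λ-lin (+ 1) {x -z zero3} {zero3} h Λ-0 λ f → lin 3 (λ x z d → d := x :- z ⇒ ⊢ x := # 1 :* d :+ z) (linear f x) (linear f zero3) (linear f (x -z zero3)) (linear-- f x zero3)

    data Coincide (a b c d : Z3) : Set where
      ab : Λ (a -z b) → Coincide a b c d
      ac : Λ (a -z c) → Coincide a b c d
      ad : Λ (a -z d) → Coincide a b c d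
      bc : Λ (b -z c) → Coincide a b c d
      bd : Λ (b -z d) → Coincide a b c d
      cd : Λ (c -z d) → Coincide a b c d

    -- There are only three classes. As Λ is not assumed decidable, this pigeonhole argument
    -- replaces deciding which elements are congruent.
    coincide : ∀ a b c d → Coincide a b c d
    coincide a b c d = go (Finₚ.pigeonhole {3} {4} ℕₚ.≤-refl (λ i → cls (lookup (a ∷ b ∷ c ∷ d ∷ []) i)))
      where
      go : _ → Coincide a b c d
      go (zero , suc zero , _ , e) = ab (same {a} {b} e)
      go (zero , suc (suc zero) , _ , e) = ac (same {a} {c} e)
      go (zero , suc (suc (suc zero)) , _ , e) = ad (same {a} {d} e)
      go (suc zero , suc (suc zero) , _ , e) = bc (same {b} {c} e)
      go (suc zero , suc (suc (suc zero)) , _ , e) = bd (same {b} {d} e)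
      go (suc (suc zero) , suc (suc (suc zero)) , _ , e) = cd (same {c} {d} e)
      go (suc zero , suc zero , s≤s () , e)
      go (suc (suc zero) , suc zero , s≤s () , e)
      go (suc (suc (suc _)) , suc zero , s≤s () , e)
      go (suc (suc zero) , suc (suc zero) , s≤s (s≤s ()) , e)
      go (suc (suc (suc zero)) , suc (suc zero) , s≤s (s≤s ()) , e)
      go (suc (suc (suc zero)) , suc (suc (suc zero)) , s≤s (s≤s (s≤s ())) , e)

    multiple : ∀ {g} i j k → Λ ((i ·z g) -z (j ·z g)) → j - i ≡ k → Λ (k ·z g)
    multiple {g} i j _ h refl = Λ-lin (- + 1) {(i ·z g) -z (j ·z g)} {zero3} h Λ-0 λ f → trans (linear-scale f (j - i) g) (lin 7 (λ i j x u v d z → u := i :* x ⇒ v := j :* x ⇒ d := u :- v ⇒ z := # 0 ⇒ ⊢ (j :- i) :* x := con (- + 1) :* d :+ z)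
      i j (linear f g) (linear f (i ·z g)) (linear f (j ·z g)) (linear f ((i ·z g) -z (j ·z g))) (linear f zero3) (linear-scale f i g) (linear-scale f j g) (linear-- f (i ·z g) (j ·z g)) (linear-zero f))

    one· : ∀ {g} → Λ ((+ 1) ·z g) → Λ g
    one· {g} = subst Λ (·z-one g)

  module _ {g : Z3} (g∉ : ¬ Λ g) where

    private
      two-or-three : Λ ((+ 2) ·z g) ⊎ Λ ((+ 3) ·z g)
      two-or-three = go (coincide ((+ 0) ·z g) ((+ 1) ·z g) ((+ 2) ·z g) ((+ 3) ·z g))
        where
        go : Coincide ((+ 0) ·z g) ((+ 1) ·z g) ((+ 2) ·z g) ((+ 3) ·z g) → Λ ((+ 2) ·z g) ⊎ Λ ((+ 3) ·z g)
        go (ab h) = ⊥-elim (g∉ (one· {g} (multiple {g} (+ 0) (+ 1) (+ 1) h refl)))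
        go (ac h) = inj₁ (multiple {g} (+ 0) (+ 2) (+ 2) h refl)
        go (ad h) = inj₂ (multiple {g} (+ 0) (+ 3) (+ 3) h refl)
        go (bc h) = ⊥-elim (g∉ (one· {g} (multiple {g} (+ 1) (+ 2) (+ 1) h refl)))
        go (bd h) = inj₁ (multiple {g} (+ 1) (+ 3) (+ 2) h refl)
        go (cd h) = ⊥-elim (g∉ (one· {g} (multiple {g} (+ 2) (+ 3) (+ 1) h refl)))

    -- With 2g in Λ, the classes of 0 and g would be everything by `half`, and two of the three
    -- representatives would be congruent.
    two∉ : ¬ Λ ((+ 2) ·z g)
    two∉ h₂ = go (half (r zero)) (half (r (suc zero))) (half (r (suc (suc zero))))
      where
      half : ∀ z → Λ z ⊎ Λ (z -z g)
      half z = go (coincide zero3 g z (z +z g))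
        where
        add : ∀ f → linear f (z +z g) ≡ linear f z + linear f g
        add f = trans (cong (λ v → linear f (v +z g)) (sym (·z-one z))) (trans (linear-step f (+ 1) z g) (cong (_+ linear f g) (ℤₚ.*-identityˡ (linear f z))))
        go : Coincide zero3 g z (z +z g) → Λ z ⊎ Λ (z -z g)
        go (ab h) = ⊥-elim (g∉ (minus0 {g} (Λ-swap {zero3} {g} h)))
        go (ac h) = inj₁ (minus0 {z} (Λ-swap {zero3} {z} h))
        go (ad h) = inj₂ (Λ-lin (- + 1) {(+ 2) ·z g} {z +z g} h₂ (minus0 {z +z g} (Λ-swap {zero3} {z +z g} h)) λ f → trans (linear-- f z g)
          (lin 4 (λ x y u v → u := # 2 :* y ⇒ v := x :+ y ⇒ ⊢ x :- y := con (- + 1) :* u :+ v) (linear f z) (linear f g) (linear f ((+ 2) ·z g)) (linear f (z +z g)) (linear-scale f (+ 2) g) (add f)))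
        go (bc h) = inj₂ (Λ-swap {g} {z} h)
        go (bd h) = inj₁ (Λ-lin (- + 1) {g -z (z +z g)} {zero3} h Λ-0 λ f → lin 5 (λ x y u v o → v := y :- u ⇒ u := x :+ y ⇒ o := # 0 ⇒ ⊢ x := con (- + 1) :* v :+ o)
          (linear f z) (linear f g) (linear f (z +z g)) (linear f (g -z (z +z g))) (linear f zero3) (linear-- f g (z +z g)) (add f) (linear-zero f))
        go (cd h) = ⊥-elim (g∉ (Λ-lin (- + 1) {z -z (z +z g)} {zero3} h Λ-0 λ f → lin 5 (λ x y u v o → v := x :- u ⇒ u := x :+ y ⇒ o := # 0 ⇒ ⊢ y := con (- + 1) :* v :+ o)
          (linear f z) (linear f g) (linear f (z +z g)) (linear f (z -z (z +z g))) (linear f zero3) (linear-- f z (z +z g)) (add f) (linear-zero f)))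
      apart : ∀ i j → i ≢ j → Λ (r i) × Λ (r j) ⊎ Λ (r i -z g) × Λ (r j -z g) → ⊥
      apart i j i≢j (inj₁ (a , b)) = i≢j (r-sep i j (Λ-- {r i} {r j} a b))
      apart i j i≢j (inj₂ (a , b)) = i≢j (r-sep i j (Λ-trans {r i} {g} {r j} a (Λ-swap {r j} {g} b)))
      go : Λ (r zero) ⊎ Λ (r zero -z g) → Λ (r (suc zero)) ⊎ Λ (r (suc zero) -z g) → Λ (r (suc (suc zero))) ⊎ Λ (r (suc (suc zero)) -z g) → ⊥
      go (inj₁ a) (inj₁ b) _ = apart zero (suc zero) (λ ()) (inj₁ (a , b))
      go (inj₂ a) (inj₂ b) _ = apart zero (suc zero) (λ ()) (inj₂ (a , b))
      go (inj₁ a) _ (inj₁ c) = apart zero (suc (suc zero)) (λ ()) (inj₁ (a , c))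
      go (inj₂ a) _ (inj₂ c) = apart zero (suc (suc zero)) (λ ()) (inj₂ (a , c))
      go _ (inj₁ b) (inj₁ c) = apart (suc zero) (suc (suc zero)) (λ ()) (inj₁ (b , c))
      go _ (inj₂ b) (inj₂ c) = apart (suc zero) (suc (suc zero)) (λ ()) (inj₂ (b , c))

    three∈ : Λ ((+ 3) ·z g)
    three∈ = go two-or-three
      where
      go : Λ ((+ 2) ·z g) ⊎ Λ ((+ 3) ·z g) → Λ ((+ 3) ·z g)
      go (inj₁ h) = ⊥-elim (two∉ h)
      go (inj₂ h) = h

    -- 0, g and 2g are pairwise incongruent, so z is congruent to one of them.
    generates : ∀ z → ∃ λ m → Λ (z -z (m ·z g))
    generates z = go (coincide ((+ 0) ·z g) ((+ 1) ·z g) ((+ 2) ·z g) z)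
      where
      go : Coincide ((+ 0) ·z g) ((+ 1) ·z g) ((+ 2) ·z g) z → ∃ λ m → Λ (z -z (m ·z g))
      go (ab h) = ⊥-elim (g∉ (one· {g} (multiple {g} (+ 0) (+ 1) (+ 1) h refl)))
      go (ac h) = ⊥-elim (two∉ (multiple {g} (+ 0) (+ 2) (+ 2) h refl))
      go (bc h) = ⊥-elim (g∉ (one· {g} (multiple {g} (+ 1) (+ 2) (+ 1) h refl)))
      go (ad h) = + 0 , Λ-swap {(+ 0) ·z g} {z} h
      go (bd h) = + 1 , Λ-swap {(+ 1) ·z g} {z} h
      go (cd h) = + 2 , Λ-swap {(+ 2) ·z g} {z} h

    multiples : ∀ k → Λ (k ·z g) → + 3 ∣ᶻ k
    multiples k h = go (divide (+ 3) (lin 0 (⊢ # 0 :< # 3)) k)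
      where
      go : (∃ λ q → ∃ λ r → k ≡ r + q * + 3 × + 0 ≤ r × r < + 3) → + 3 ∣ᶻ k
      go (q , r , e , l , u) = by (small₃ r l u)
        where
        rest : Λ (r ·z g)
        rest = Λ-lin (- q) {(+ 3) ·z g} {k ·z g} three∈ h λ f → trans (linear-scale f r g) (trans (lin 3 (λ q r x → ⊢ r :* x := (:- q) :* (# 3 :* x) :+ (r :+ q :* # 3) :* x) q r (linear f g))
          (sym (cong₂ (λ x y → - q * x + y) (linear-scale f (+ 3) g) (trans (linear-scale f k g) (cong (_* linear f g) e)))))
        by : r ≡ + 0 ⊎ r ≡ + 1 ⊎ r ≡ + 2 → + 3 ∣ᶻ k
        by (inj₁ refl) = q , trans e (ℤₚ.+-identityˡ _)
        by (inj₂ (inj₁ refl)) = ⊥-elim (g∉ (one· {g} rest))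
        by (inj₂ (inj₂ refl)) = ⊥-elim (two∉ rest)

    -- κ sends the i-th unit vector, congruent to mᵢ g, to mᵢ. Every z is then congruent to κ(z) g,
    -- and a multiple of g lies in Λ only if the factor is divisible by three.
    character : ∃ λ κ → (∀ z → Λ z → + 3 ∣ᶻ linear κ z) × ¬ (+ 3 ∣ᶻ linear κ g)
    character = go (generates (pt (+ 1) (+ 0) (+ 0))) (generates (pt (+ 0) (+ 1) (+ 0))) (generates (pt (+ 0) (+ 0) (+ 1)))
      where
      go : (∃ λ m → Λ (pt (+ 1) (+ 0) (+ 0) -z (m ·z g))) → (∃ λ m → Λ (pt (+ 0) (+ 1) (+ 0) -z (m ·z g))) → (∃ λ m → Λ (pt (+ 0) (+ 0) (+ 1) -z (m ·z g))) →
        ∃ λ κ → (∀ z → Λ z → + 3 ∣ᶻ linear κ z) × ¬ (+ 3 ∣ᶻ linear κ g)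
      go (m₁ , h₁) (m₂ , h₂) (m₃ , h₃) = κ , (λ z h → multiples (linear κ z) (off z h)) , λ d → g∉ (g∈ d)
        where
        κ = aff m₁ m₂ m₃ (+ 0)
        -- z - κ(z) g is a combination of the three elements eᵢ - mᵢ g of Λ
        rest : ∀ z → Λ (z -z (linear κ z ·z g))
        rest z@(a ∷ b ∷ c ∷ []) = Λ-lin a {pt (+ 1) (+ 0) (+ 0) -z (m₁ ·z g)} {x₂} h₁ (Λ-lin b {u₂} {x₃} h₂ (Λ-lin c {u₃} {zero3} h₃ Λ-0 λ f → refl-3 f) (λ f → linear-step f b u₂ x₃)) eq
          where
          u₂ = pt (+ 0) (+ 1) (+ 0) -z (m₂ ·z g)
          u₃ = pt (+ 0) (+ 0) (+ 1) -z (m₃ ·z g)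
          x₃ = c ·z u₃
          x₂ = (b ·z u₂) +z x₃
          refl-3 : ∀ f → linear f x₃ ≡ c * linear f u₃ + linear f zero3
          refl-3 f = trans (linear-scale f c u₃) (trans (sym (ℤₚ.+-identityʳ _)) (cong (λ t → c * linear f u₃ + t) (sym (linear-zero f))))
          val : ∀ f e m → linear f (e -z (m ·z g)) ≡ linear f e - m * linear f g
          val f e m = trans (linear-- f e (m ·z g)) (cong (λ t → linear f e - t) (linear-scale f m g))
          eq : ∀ f → linear f (z -z (linear κ z ·z g)) ≡ a * linear f (pt (+ 1) (+ 0) (+ 0) -z (m₁ ·z g)) + linear f x₂
          eq f@(aff α β γ δ) = trans (val f z (linear κ z)) (sym (trans (cong₂ (λ x y → a * x + y) (val f (pt (+ 1) (+ 0) (+ 0)) m₁)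
              (trans (linear-step f b u₂ x₃) (cong₂ (λ x y → b * x + y) (val f (pt (+ 0) (+ 1) (+ 0)) m₂) (trans (linear-scale f c u₃) (cong (c *_) (val f (pt (+ 0) (+ 0) (+ 1)) m₃))))))
            (lin 10 (λ a b c α β γ m₁ m₂ m₃ x → ⊢ a :* ((α :* # 1 :+ β :* # 0 :+ γ :* # 0) :- m₁ :* x) :+ (b :* ((α :* # 0 :+ β :* # 1 :+ γ :* # 0) :- m₂ :* x) :+ c :* ((α :* # 0 :+ β :* # 0 :+ γ :* # 1) :- m₃ :* x))
              := (α :* a :+ β :* b :+ γ :* c) :- (m₁ :* a :+ m₂ :* b :+ m₃ :* c) :* x) a b c α β γ m₁ m₂ m₃ (linear f g))))
        off : ∀ z → Λ z → Λ (linear κ z ·z g)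
        off z h = Λ-lin (- + 1) {z -z (linear κ z ·z g)} {z} (rest z) h λ f → lin 3 (λ x y d → d := x :- y ⇒ ⊢ y := con (- + 1) :* d :+ x) (linear f z) (linear f (linear κ z ·z g)) (linear f (z -z (linear κ z ·z g))) (linear-- f z (linear κ z ·z g))
        g∈ : + 3 ∣ᶻ linear κ g → Λ g
        g∈ (k , e) = Λ-lin k {(+ 3) ·z g} {g -z (linear κ g ·z g)} three∈ (rest g) λ f → sym (trans (cong₂ (λ x y → k * x + y) (linear-scale f (+ 3) g) (trans (linear-- f g (linear κ g ·z g))
          (cong (λ t → linear f g - t) (trans (linear-scale f (linear κ g) g) (cong (_* linear f g) e))))) (lin 2 (λ k x → ⊢ k :* (# 3 :* x) :+ (x :- k :* # 3 :* x) := x) k (linear f g)))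

  nontrivial : ∃ λ g → ¬ Λ g
  nontrivial = r zero -z r (suc zero) , λ h → go (r-sep zero (suc zero) h)
    where
    go : zero ≡ suc zero → ⊥
    go ()

-- From the polytope to the abstract hypotheses

radius : List Z3 → ℕ
radius L.[] = 0
radius ((x ∷ y ∷ z ∷ []) L.∷ V) = ∣ x ∣ ℕ.+ ∣ y ∣ ℕ.+ ∣ z ∣ ℕ.+ radius V

radius-bound : ∀ {V v} → v ∈ V → Bounded (radius V) v
radius-bound {(x ∷ y ∷ z ∷ []) L.∷ V} (here refl) =
    ℕₚ.≤-trans (ℕₚ.m≤m+n ∣ x ∣ ∣ y ∣) (ℕₚ.≤-trans (ℕₚ.m≤m+n _ ∣ z ∣) (ℕₚ.m≤m+n _ (radius V)))
  , ℕₚ.≤-trans (ℕₚ.m≤n+m ∣ y ∣ ∣ x ∣) (ℕₚ.≤-trans (ℕₚ.m≤m+n _ ∣ z ∣) (ℕₚ.m≤m+n _ (radius V)))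
  , ℕₚ.≤-trans (ℕₚ.m≤n+m ∣ z ∣ (∣ x ∣ ℕ.+ ∣ y ∣)) (ℕₚ.m≤m+n _ (radius V))
radius-bound {(x ∷ y ∷ z ∷ []) L.∷ V} {a ∷ b ∷ c ∷ []} (there i) = go (radius-bound {V} i)
  where
  go : Bounded (radius V) (a ∷ b ∷ c ∷ []) → _
  go (p , q , r) = ℕₚ.m≤n⇒m≤o+n _ p , ℕₚ.m≤n⇒m≤o+n _ q , ℕₚ.m≤n⇒m≤o+n _ r

abs≤⇒ : ∀ {x M} → ∣ x ∣ ℕ.≤ M → (+ 0 ≤ x + + M) × (+ 0 ≤ - x + + M)
abs≤⇒ {+ n} {M} h = lin 2 (λ n M → # 0 :≤ n ⇒ n :≤ M ⇒ ⊢ # 0 :≤ n :+ M) (+ n) (+ M) (+≤+ z≤n) (+≤+ h) , lin 2 (λ n M → n :≤ M ⇒ ⊢ # 0 :≤ :- n :+ M) (+ n) (+ M) (+≤+ h)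
abs≤⇒ { -[1+ n ]} {M} h = lin 2 (λ n M → n :≤ M ⇒ ⊢ # 0 :≤ :- n :+ M) (+ suc n) (+ M) (+≤+ h) , lin 2 (λ n M → # 0 :≤ n ⇒ n :≤ M ⇒ ⊢ # 0 :≤ n :+ M) (+ suc n) (+ M) (+≤+ z≤n) (+≤+ h)

⇒abs≤ : ∀ {x M} → + 0 ≤ x + + M → + 0 ≤ - x + + M → ∣ x ∣ ℕ.≤ M
⇒abs≤ {+ n} {M} _ h = ℤₚ.drop‿+≤+ (lin 2 (λ n M → # 0 :≤ :- n :+ M ⇒ ⊢ n :≤ M) (+ n) (+ M) h)
⇒abs≤ { -[1+ n ]} {M} h _ = ℤₚ.drop‿+≤+ (lin 2 (λ n M → # 0 :≤ :- n :+ M ⇒ ⊢ n :≤ M) (+ suc n) (+ M) h)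

bounded-points : ∀ V z → LatticePt V z → Bounded (radius V) z
bounded-points V (x ∷ y ∷ z ∷ []) i =
    ⇒abs≤ {x} (coord (aff (+ 1) (+ 0) (+ 0) M) (λ x _ _ → x + M) (λ x y z → lin 4 (λ x y z M → ⊢ # 1 :* x :+ # 0 :* y :+ # 0 :* z :+ M := x :+ M) x y z M) (λ { a b c (p , q , r) → proj₁ (abs≤⇒ {a} p) }))
      (coord (aff (- + 1) (+ 0) (+ 0) M) (λ x _ _ → - x + M) (λ x y z → lin 4 (λ x y z M → ⊢ con (- + 1) :* x :+ # 0 :* y :+ # 0 :* z :+ M := :- x :+ M) x y z M) (λ { a b c (p , q , r) → proj₂ (abs≤⇒ {a} p) }))
  , ⇒abs≤ {y} (coord (aff (+ 0) (+ 1) (+ 0) M) (λ _ y _ → y + M) (λ x y z → lin 4 (λ x y z M → ⊢ # 0 :* x :+ # 1 :* y :+ # 0 :* z :+ M := y :+ M) x y z M) (λ { a b c (p , q , r) → proj₁ (abs≤⇒ {b} q) }))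
      (coord (aff (+ 0) (- + 1) (+ 0) M) (λ _ y _ → - y + M) (λ x y z → lin 4 (λ x y z M → ⊢ # 0 :* x :+ con (- + 1) :* y :+ # 0 :* z :+ M := :- y :+ M) x y z M) (λ { a b c (p , q , r) → proj₂ (abs≤⇒ {b} q) }))
  , ⇒abs≤ {z} (coord (aff (+ 0) (+ 0) (+ 1) M) (λ _ _ z → z + M) (λ x y z → lin 4 (λ x y z M → ⊢ # 0 :* x :+ # 0 :* y :+ # 1 :* z :+ M := z :+ M) x y z M) (λ { a b c (p , q , r) → proj₁ (abs≤⇒ {c} r) }))
      (coord (aff (+ 0) (+ 0) (- + 1) M) (λ _ _ z → - z + M) (λ x y z → lin 4 (λ x y z M → ⊢ # 0 :* x :+ # 0 :* y :+ con (- + 1) :* z :+ M := :- z :+ M) x y z M) (λ { a b c (p , q , r) → proj₂ (abs≤⇒ {c} r) }))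
  where
  M = + radius V
  coord : ∀ f (h : ℤ → ℤ → ℤ → ℤ) → (∀ x y z → f ⟨ pt x y z ⟩ ≡ h x y z) → (∀ a b c → Bounded (radius V) (pt a b c) → + 0 ≤ h a b c) → + 0 ≤ h x y z
  coord f h e b = subst (+ 0 ≤_) (e x y z) (nonneg-on-points f V (λ { {a ∷ b′ ∷ c ∷ []} j → subst (+ 0 ≤_) (sym (e a b′ c)) (b a b′ c (radius-bound j)) }) i)

private
  flip : Aff → Aff
  flip (aff α β γ δ) = aff (- + 1 * α) (- + 1 * β) (- + 1 * γ) (- + 1 * δ + + 1)

  flip-at : ∀ f z → flip f ⟨ z ⟩ ≡ + 1 - f ⟨ z ⟩
  flip-at (aff α β γ δ) (x ∷ y ∷ z ∷ []) = lin 7 (λ α β γ δ x y z → ⊢ con (- + 1) :* α :* x :+ con (- + 1) :* β :* y :+ con (- + 1) :* γ :* z :+ (con (- + 1) :* δ :+ # 1) := # 1 :- (α :* x :+ β :* y :+ γ :* z :+ δ)) α β γ δ x y z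

  flip-sum : ∀ f x y → (dotZQ (row f) x ℚ.- dotZQ (row f) y) ℚ.+ (φ (flip f) 1ℚ x ℚ.+ φ f 1ℚ y) ≡ 1ℚ
  flip-sum (aff α β γ δ) (x ∷ y ∷ z ∷ []) (x′ ∷ y′ ∷ z′ ∷ []) = trans
    (cong (λ t → (dotZQ (pt α β γ) (x ∷ y ∷ z ∷ []) ℚ.- dotZQ (pt α β γ) (x′ ∷ y′ ∷ z′ ∷ [])) ℚ.+ (t ℚ.+ φ (aff α β γ δ) 1ℚ (x′ ∷ y′ ∷ z′ ∷ [])))
      (cong₂ ℚ._+_ (cong₂ ℚ._+_ (cong (ℚ._* x) (ι-* (- + 1) α)) (cong₂ ℚ._+_ (cong (ℚ._* y) (ι-* (- + 1) β)) (cong (λ t → t ℚ.* z ℚ.+ 0ℚ) (ι-* (- + 1) γ))))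
        (cong (1ℚ ℚ.*_) (trans (ι-+ (- + 1 * δ) (+ 1)) (cong (ℚ._+ 1ℚ) (ι-* (- + 1) δ))))))
    (solve 10 (λ α β γ δ x y z x′ y′ z′ → ((α ⊗ x ⊕ (β ⊗ y ⊕ (γ ⊗ z ⊕ Con 0ℚ))) ⊝ (α ⊗ x′ ⊕ (β ⊗ y′ ⊕ (γ ⊗ z′ ⊕ Con 0ℚ)))) ⊕
        (((Con (ι (- + 1)) ⊗ α) ⊗ x ⊕ ((Con (ι (- + 1)) ⊗ β) ⊗ y ⊕ ((Con (ι (- + 1)) ⊗ γ) ⊗ z ⊕ Con 0ℚ)) ⊕ Con 1ℚ ⊗ (Con (ι (- + 1)) ⊗ δ ⊕ Con 1ℚ)) ⊕ (α ⊗ x′ ⊕ (β ⊗ y′ ⊕ (γ ⊗ z′ ⊕ Con 0ℚ)) ⊕ Con 1ℚ ⊗ δ)) ⊜ Con 1ℚ)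
      refl (ι α) (ι β) (ι γ) (ι δ) x y z x′ y′ z′)

-- If f took only the values 0 and 1 on V, then f and 1 - f would be nonnegative on the hull and no
-- two values of f could differ by more than 1. Since f carries its own constant term, the interval
-- from 0 to 1 stands for every interval of length one.
wide : ∀ V → WidthGt1 V → ∀ f → row f ≢ zero3 → ∃ λ v → v ∈ V × (f ⟨ v ⟩ < + 0 ⊎ + 1 < f ⟨ v ⟩)
wide V w f f≢0 = go (Any.any? (λ v → (f ⟨ v ⟩ ℤₚ.<? + 0) ⊎-dec (+ 1 ℤₚ.<? f ⟨ v ⟩)) V)
  where
  go : Dec (Any (λ v → f ⟨ v ⟩ < + 0 ⊎ + 1 < f ⟨ v ⟩) V) → ∃ λ v → v ∈ V × (f ⟨ v ⟩ < + 0 ⊎ + 1 < f ⟨ v ⟩)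
  go (yes a) = find a
  go (no ¬a) = ⊥-elim (contra (w (row f) f≢0))
    where
    low : ∀ {v} → v ∈ V → + 0 ≤ f ⟨ v ⟩
    low i = ℤₚ.≮⇒≥ λ h → ¬a (Any.map (λ { refl → inj₁ h }) i)
    high : ∀ {v} → v ∈ V → + 0 ≤ flip f ⟨ v ⟩
    high {v} i = subst (+ 0 ≤_) (sym (flip-at f v)) (ℤₚ.i≤j⇒0≤j-i (ℤₚ.≮⇒≥ λ h → ¬a (Any.map (λ { refl → inj₂ h }) i)))
    contra : (Σ Q3 λ x → Σ Q3 λ y → InConv V x × InConv V y × (1ℚ ℚ.< dotZQ (row f) x ℚ.- dotZQ (row f) y)) → ⊥
    contra (x , y , cx , cy , h) = ℚₚ.<-irrefl refl (ℚₚ.<-≤-trans h (subst₂ ℚ._≤_ (ℚₚ.+-identityʳ D) (flip-sum f x y)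
      (ℚₚ.+-monoʳ-≤ D (0≤+ (nonneg-on-cone (flip f) V high cx) (nonneg-on-cone f V low cy)))))
      where D = dotZQ (row f) x ℚ.- dotZQ (row f) y

nonconstant : ∀ f → (∃ λ z → ∃ λ z′ → f ⟨ z ⟩ ≢ f ⟨ z′ ⟩) → row f ≢ zero3
nonconstant (aff _ _ _ δ) ((x ∷ y ∷ z ∷ []) , (x′ ∷ y′ ∷ z′ ∷ []) , h) refl = h (lin 7 (λ x y z x′ y′ z′ δ → ⊢ # 0 :* x :+ # 0 :* y :+ # 0 :* z :+ δ := # 0 :* x′ :+ # 0 :* y′ :+ # 0 :* z′ :+ δ) x y z x′ y′ z′ δ)

config : ∀ V → WidthGt1 V → SublatticeIndex V 3 → Config (LatticePt V)
config V w (r , r-sep , r-cover) = go (nontrivial)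
  where
  open Character (LinLat V) linLat-0 (λ k → linLat-comb k) r r-sep r-cover
  go : (∃ λ g → ¬ LinLat V g) → Config (LatticePt V)
  go (g , g∉) = fromChar (character {g} g∉)
    where
    fromChar : (∃ λ κ → (∀ z → LinLat V z → + 3 ∣ᶻ linear κ z) × ¬ (+ 3 ∣ᶻ linear κ g)) → Config (LatticePt V)
    fromChar (κ , vanishes , κg) = record
      { conv = convex-points V ; M = radius V ; bound = bounded-points V ; κ = κ
      ; κ-A = λ p q Ap Aq → diff p q (vanishes (p -z q) (linLat-points {V} {p} {q} Ap Aq))
      ; κ-nontrivial = λ v h → κg (apart (κ ⟨ v ⟩) (h g) (h zero3))
      ; width = λ f nc → vertex (wide V w f (nonconstant f nc)) }
      where
      diff : ∀ p q → + 3 ∣ᶻ linear κ (p -z q) → + 3 ∣ᶻ (κ ⟨ p ⟩ - κ ⟨ q ⟩)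
      diff p q (k , e) = k , trans (lin 3 (λ x y d → ⊢ (x :+ d) :- (y :+ d) := x :- y) (linear κ p) (linear κ q) (Aff.δ κ)) (trans (sym (linear-- κ p q)) e)
      apart : ∀ t → + 3 ∣ᶻ (κ ⟨ g ⟩ - t) → + 3 ∣ᶻ (κ ⟨ zero3 ⟩ - t) → + 3 ∣ᶻ linear κ g
      apart t (k , e) (l , f) = k - l , lin 6 (λ x o d t k l → x :+ d :- t := k :* # 3 ⇒ o :+ d :- t := l :* # 3 ⇒ o := # 0 ⇒ ⊢ x := (k :- l) :* # 3) (linear κ g) (linear κ zero3) (Aff.δ κ) t k l e f (linear-zero κ)
      vertex : ∀ {P : Z3 → Set} → (∃ λ v → v ∈ V × P v) → ∃ λ v → LatticePt V v × P v
      vertex (v , i , p) = v , cone-vertex i , p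

-- Each further point is found off the zero set of a functional vanishing at the previous ones: a
-- plane through s, then a plane through s and q parallel to the third axis, then the plane of s, q
-- and r. The determinant inequality for one step makes the next functional nonconstant.
tetrahedron : ∀ V → WidthGt1 V → ∃ λ p → ∃ λ q → ∃ λ r → ∃ λ s → (p ∈ V × q ∈ V × r ∈ V × s ∈ V) × det4 p q r s ≢ + 0
tetrahedron V w = first (wide V w (aff (+ 1) (+ 0) (+ 0) (+ 0)) (λ ()))
  where
  Result = ∃ λ p → ∃ λ q → ∃ λ r → ∃ λ s → (p ∈ V × q ∈ V × r ∈ V × s ∈ V) × det4 p q r s ≢ + 0
  nonzero : ∀ {t} → t < + 0 ⊎ + 1 < t → t ≢ + 0
  nonzero (inj₁ h) refl = ℤₚ.<-irrefl refl h
  nonzero (inj₂ (+<+ ())) refl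
  first : (∃ λ v → v ∈ V × _) → Result
  first (s@(j ∷ k ∷ l ∷ []) , s∈ , _) = second (wide V w (aff (+ 1) (+ 0) (+ 0) (- j)) (λ ()))
    where
    second : (∃ λ v → v ∈ V × (aff (+ 1) (+ 0) (+ 0) (- j) ⟨ v ⟩ < + 0 ⊎ + 1 < aff (+ 1) (+ 0) (+ 0) (- j) ⟨ v ⟩)) → Result
    second (q@(d ∷ e ∷ f ∷ []) , q∈ , h) = third (wide V w f₂ λ z → d≢j (cong (λ { (_ ∷ y ∷ _) → y }) z))
      where
      d≢j : d - j ≢ + 0
      d≢j z = nonzero h (lin 4 (λ d e f j → d :- j := # 0 ⇒ ⊢ # 1 :* d :+ # 0 :* e :+ # 0 :* f :+ :- j := # 0) d e f j z)
      f₂ = aff (- (e - k)) (d - j) (+ 0) ((e - k) * j - (d - j) * k)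
      third : (∃ λ v → v ∈ V × (f₂ ⟨ v ⟩ < + 0 ⊎ + 1 < f₂ ⟨ v ⟩)) → Result
      third (r@(g ∷ h ∷ i ∷ []) , r∈ , h₂) = fourth (wide V w f₃ λ z → c₃≢0 (cong (λ { (_ ∷ _ ∷ y ∷ _) → y }) z))
        where
        c₁ = (e - k) * (i - l) - (f - l) * (h - k)
        c₂ = - ((d - j) * (i - l) - (f - l) * (g - j))
        c₃ = (d - j) * (h - k) - (e - k) * (g - j)
        f₃ = aff c₁ c₂ c₃ (- (c₁ * j + c₂ * k + c₃ * l))
        c₃≢0 : c₃ ≢ + 0
        c₃≢0 z = nonzero h₂ (trans (lin 7 (λ d e g h i j k → ⊢ :- (e :- k) :* g :+ (d :- j) :* h :+ # 0 :* i :+ ((e :- k) :* j :- (d :- j) :* k) := (d :- j) :* (h :- k) :- (e :- k) :* (g :- j)) d e g h i j k) z)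
        fourth : (∃ λ v → v ∈ V × (f₃ ⟨ v ⟩ < + 0 ⊎ + 1 < f₃ ⟨ v ⟩)) → Result
        fourth (p@(a ∷ b ∷ c ∷ []) , p∈ , h₃) = p , q , r , s , (p∈ , q∈ , r∈ , s∈) , λ z → nonzero h₃ (trans (lin 9 (λ a b c j k l x y z → ⊢ x :* a :+ (:- y) :* b :+ z :* c :+ (:- (x :* j :+ (:- y) :* k :+ z :* l)) := (a :- j) :* x :- (b :- k) :* y :+ (c :- l) :* z)
          a b c j k l c₁ ((d - j) * (i - l) - (f - l) * (g - j)) c₃) z)

-- Coordinates in which P becomes one of the two models

combAff : ℤ → Aff → ℤ → Aff → Aff
combAff k (aff a b c d) l (aff a′ b′ c′ d′) = aff (k * a + l * a′) (k * b + l * b′) (k * c + l * c′) (k * d + l * d′)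

combAff-at : ∀ k f l g z → combAff k f l g ⟨ z ⟩ ≡ k * f ⟨ z ⟩ + l * g ⟨ z ⟩
combAff-at k (aff a b c d) l (aff a′ b′ c′ d′) (x ∷ y ∷ z ∷ []) = lin 13 (λ k l a b c d a′ b′ c′ d′ x y z →
  ⊢ (k :* a :+ l :* a′) :* x :+ (k :* b :+ l :* b′) :* y :+ (k :* c :+ l :* c′) :* z :+ (k :* d :+ l :* d′)
    := k :* (a :* x :+ b :* y :+ c :* z :+ d) :+ l :* (a′ :* x :+ b′ :* y :+ c′ :* z :+ d′)) k l a b c d a′ b′ c′ d′ x y z

third : ∀ k f l g → (∀ z → + 3 ∣ᶻ (k * f ⟨ z ⟩ + l * g ⟨ z ⟩)) → ∃ λ h → ∀ z → k * f ⟨ z ⟩ + l * g ⟨ z ⟩ ≡ h ⟨ z ⟩ * + 3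
third k f l g d = go (divAff (combAff k f l g) (+ 3) (λ z → subst (+ 3 ∣ᶻ_) (sym (combAff-at k f l g z)) (d z)))
  where
  go : (∃ λ h → ∀ z → combAff k f l g ⟨ z ⟩ ≡ h ⟨ z ⟩ * + 3) → ∃ λ h → ∀ z → k * f ⟨ z ⟩ + l * g ⟨ z ⟩ ≡ h ⟨ z ⟩ * + 3
  go (h , e) = h , λ z → trans (sym (combAff-at k f l g z)) (e z)

module Models (V : List Z3) (C : Config (LatticePt V)) where
  open Config C
  open Process C
  open Three C

  private
    A = LatticePt V

  -- Modulo 3 the coordinates W(z) are multiples of (2, 1, 1, -1).
  module Coordinates (S : Spike) where
    open Spike S
    open WhiteTet white public
    open Residues white n≡3 σ≡ public

    o-val = proj₁ (vertices tet n≡3)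
    a-val = proj₁ (proj₂ (vertices tet n≡3))
    b-val = proj₁ (proj₂ (proj₂ (vertices tet n≡3)))
    c-val = proj₂ (proj₂ (proj₂ (vertices tet n≡3)))
    e-val = values tet n≡3 e-at

    sum₃ : ∀ z → W₁ ⟨ z ⟩ + W₂ ⟨ z ⟩ + W₃ ⟨ z ⟩ + W₄ ⟨ z ⟩ ≡ + 3
    sum₃ z = trans (sumW z) n≡3

    -- Supplies preimages for the surjectivity proofs: l zσ, with multiples of the vertices added to
    -- it.
    point : ∀ l k₂ k₃ k₄ → ∃ λ x → W₂ ⟨ x ⟩ ≡ l + k₂ * + 3 × W₃ ⟨ x ⟩ ≡ l + k₃ * + 3 × W₄ ⟨ x ⟩ ≡ - l + k₄ * + 3
    point l k₂ k₃ k₄ = M.point , coord {W₂ ⟨ M.point ⟩} {W₂ ⟨ zσ ⟩} {k₂} M.at₂ g₂ (ℤₚ.*-identityʳ l) , coord {W₃ ⟨ M.point ⟩} {W₃ ⟨ zσ ⟩} {k₃} M.at₃ zσ₃ (ℤₚ.*-identityʳ l)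
        , coord {W₄ ⟨ M.point ⟩} {W₄ ⟨ zσ ⟩} {k₄} M.at₄ zσ₄ (lin 1 (λ l → ⊢ l :* con (- + 1) := :- l) l)
      where
      module M = Moved (move tet l (+ 1 - l - k₂ - k₃ - k₄) k₂ k₃ k₄ zσ (lin 4 (λ l a b c → ⊢ l :+ (# 1 :- l :- a :- b :- c) :+ a :+ b :+ c := # 1) l k₂ k₃ k₄))
      coord : ∀ {x y k t u} → x ≡ l * y + k * n → y ≡ t → l * t ≡ u → x ≡ u + k * + 3
      coord {y = y} {k = k} e refl refl = trans e (cong (λ m → l * y + k * m) n≡3)

    res₂₄ : ∀ z → + 3 ∣ᶻ (+ 1 * W₂ ⟨ z ⟩ + + 1 * W₄ ⟨ z ⟩)
    res₂₄ z = go (c₁₂ z) (c₁₃ z) (c₃₄ z)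
      where
      go : + 3 ∣ᶻ (W₁ ⟨ z ⟩ + W₂ ⟨ z ⟩) → + 3 ∣ᶻ (W₁ ⟨ z ⟩ + W₃ ⟨ z ⟩) → + 3 ∣ᶻ (W₃ ⟨ z ⟩ + W₄ ⟨ z ⟩) → + 3 ∣ᶻ (+ 1 * W₂ ⟨ z ⟩ + + 1 * W₄ ⟨ z ⟩)
      go (k , e) (l , f) (m , g) = k - l + m , lin 7 (λ a b c d k l m → a :+ b := k :* # 3 ⇒ a :+ c := l :* # 3 ⇒ c :+ d := m :* # 3 ⇒ ⊢ # 1 :* b :+ # 1 :* d := (k :- l :+ m) :* # 3)
        (W₁ ⟨ z ⟩) (W₂ ⟨ z ⟩) (W₃ ⟨ z ⟩) (W₄ ⟨ z ⟩) k l m e f g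

    res₂₃ : ∀ z → + 3 ∣ᶻ (+ 2 * W₂ ⟨ z ⟩ + + 1 * W₃ ⟨ z ⟩)
    res₂₃ z = go (c₁₂ z) (c₁₃ z)
      where
      go : + 3 ∣ᶻ (W₁ ⟨ z ⟩ + W₂ ⟨ z ⟩) → + 3 ∣ᶻ (W₁ ⟨ z ⟩ + W₃ ⟨ z ⟩) → + 3 ∣ᶻ (+ 2 * W₂ ⟨ z ⟩ + + 1 * W₃ ⟨ z ⟩)
      go (k , e) (l , f) = + 2 * k + l - W₁ ⟨ z ⟩ , lin 5 (λ a b c k l → a :+ b := k :* # 3 ⇒ a :+ c := l :* # 3 ⇒ ⊢ # 2 :* b :+ # 1 :* c := (# 2 :* k :+ l :- a) :* # 3)
        (W₁ ⟨ z ⟩) (W₂ ⟨ z ⟩) (W₃ ⟨ z ⟩) k l e f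

    res₃₄ : ∀ z → + 3 ∣ᶻ (- + 1 * W₃ ⟨ z ⟩ + - + 1 * W₄ ⟨ z ⟩)
    res₃₄ z = go (c₃₄ z)
      where
      go : + 3 ∣ᶻ (W₃ ⟨ z ⟩ + W₄ ⟨ z ⟩) → + 3 ∣ᶻ (- + 1 * W₃ ⟨ z ⟩ + - + 1 * W₄ ⟨ z ⟩)
      go (k , e) = - k , lin 3 (λ c d k → c :+ d := k :* # 3 ⇒ ⊢ con (- + 1) :* c :+ con (- + 1) :* d := (:- k) :* # 3) (W₃ ⟨ z ⟩) (W₄ ⟨ z ⟩) k e

    res₃₄′ : ∀ z → + 3 ∣ᶻ (- + 1 * W₃ ⟨ z ⟩ + + 2 * W₄ ⟨ z ⟩)
    res₃₄′ z = go (c₃₄ z)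
      where
      go : + 3 ∣ᶻ (W₃ ⟨ z ⟩ + W₄ ⟨ z ⟩) → + 3 ∣ᶻ (- + 1 * W₃ ⟨ z ⟩ + + 2 * W₄ ⟨ z ⟩)
      go (k , e) = W₄ ⟨ z ⟩ - k , lin 3 (λ c d k → c :+ d := k :* # 3 ⇒ ⊢ con (- + 1) :* c :+ # 2 :* d := (d :- k) :* # 3) (W₃ ⟨ z ⟩) (W₄ ⟨ z ⟩) k e

  quotient : ∀ k x l y {t s u m} → k * x + l * y ≡ t * + 3 → x ≡ s → y ≡ u → k * s + l * u ≡ m * + 3 → t ≡ m
  quotient k x l y {t} {m = m} e refl refl h = cancel≡ t m (lin 0 (⊢ # 0 :< # 3)) (trans (sym e) h)

  -- The map ((W₂ + W₄)/3, (2W₂ + W₃)/3, W₂) takes c, e, a and w to the points of `E63` in their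
  -- order. The four facet functionals are the weights that place every point of A in the image
  -- tetrahedron.
  exceptional : Exceptional → UnimodEquiv V E63
  exceptional X = go (third (+ 1) W₂ (+ 1) W₄ res₂₄) (third (+ 2) W₂ (+ 1) W₃ res₂₃)
    where
    open Exceptional X
    open Spike spike
    open Coordinates spike
    w-val = values tet n≡3 w-at
    go : (∃ λ f → ∀ z → + 1 * W₂ ⟨ z ⟩ + + 1 * W₄ ⟨ z ⟩ ≡ f ⟨ z ⟩ * + 3) → (∃ λ g → ∀ z → + 2 * W₂ ⟨ z ⟩ + + 1 * W₃ ⟨ z ⟩ ≡ g ⟨ z ⟩ * + 3) → UnimodEquiv V E63
    go (f , ef) (g , eg) = Transport.transport V E63 f g W₂ surj (λ {v} i → into v (cone-vertex i)) onto
      where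
      surj : ∀ y₁ y₂ y₃ → ∃ λ x → f ⟨ x ⟩ ≡ y₁ × g ⟨ x ⟩ ≡ y₂ × W₂ ⟨ x ⟩ ≡ y₃
      surj y₁ y₂ y₃ = solution (point y₃ (+ 0) (y₂ - y₃) y₁)
        where
        solution : (∃ λ x → W₂ ⟨ x ⟩ ≡ y₃ + + 0 * + 3 × W₃ ⟨ x ⟩ ≡ y₃ + (y₂ - y₃) * + 3 × W₄ ⟨ x ⟩ ≡ - y₃ + y₁ * + 3) → ∃ λ x → f ⟨ x ⟩ ≡ y₁ × g ⟨ x ⟩ ≡ y₂ × W₂ ⟨ x ⟩ ≡ y₃
        solution (x , e₂ , e₃ , e₄) = x , quotient (+ 1) (W₂ ⟨ x ⟩) (+ 1) (W₄ ⟨ x ⟩) (ef x) e₂ e₄ (lin 2 (λ y₁ y₃ → ⊢ # 1 :* (y₃ :+ # 0 :* # 3) :+ # 1 :* (:- y₃ :+ y₁ :* # 3) := y₁ :* # 3) y₁ y₃)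
          , quotient (+ 2) (W₂ ⟨ x ⟩) (+ 1) (W₃ ⟨ x ⟩) (eg x) e₂ e₃ (lin 2 (λ y₂ y₃ → ⊢ # 2 :* (y₃ :+ # 0 :* # 3) :+ # 1 :* (y₃ :+ (y₂ :- y₃) :* # 3) := y₂ :* # 3) y₂ y₃)
          , trans e₂ (lin 1 (λ y → ⊢ y :+ # 0 :* # 3 := y) y₃)
      into : ∀ v → A v → LatticePt E63 (pt (f ⟨ v ⟩) (g ⟨ v ⟩) (W₂ ⟨ v ⟩))
      into v Av = convex-points E63
          -- The four functionals add up to 8 (W₁ + W₂ + W₃ + W₄) = 24.
          ((q₄ , pt (+ 1) (+ 0) (+ 0)) L.∷ (q₃ , pt (- + 1) (- + 1) (+ 0)) L.∷ (q₂ , pt (+ 1) (+ 2) (+ 3)) L.∷ (q₁ , pt (- + 1) (+ 1) (- + 3)) L.∷ L.[]) (+ 24) (pt (f ⟨ v ⟩) (g ⟨ v ⟩) (W₂ ⟨ v ⟩))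
          ((facet₄ X v Av , cone-vertex (here refl)) All.∷ (facet₃ X v Av , cone-vertex (there (here refl))) All.∷ (facet₂ X v Av , cone-vertex (there (there (here refl)))) All.∷
            (facet₁ X v Av , cone-vertex (there (there (there (here refl))))) All.∷ All.[])
          (lin 4 (λ a b c d → a :+ b :+ c :+ d := # 3 ⇒ ⊢ (c :+ # 3 :* a :+ # 8 :* d) :+ ((c :+ # 3 :* a) :+ ((a :+ # 3 :* c :+ # 8 :* b) :+ ((a :+ # 3 :* c) :+ # 0))) := # 24) (W₁ ⟨ v ⟩) (W₂ ⟨ v ⟩) (W₃ ⟨ v ⟩) (W₄ ⟨ v ⟩) (sum₃ v))
          (lin 0 (⊢ # 0 :< # 24))
          (vec≡
            (lin 5 (λ a b c d f → # 1 :* b :+ # 1 :* d := f :* # 3 ⇒ ⊢ (c :+ # 3 :* a :+ # 8 :* d) :* # 1 :+ ((c :+ # 3 :* a) :* con (- + 1) :+ ((a :+ # 3 :* c :+ # 8 :* b) :* # 1 :+ ((a :+ # 3 :* c) :* con (- + 1) :+ # 0))) := # 24 :* f) (W₁ ⟨ v ⟩) (W₂ ⟨ v ⟩) (W₃ ⟨ v ⟩) (W₄ ⟨ v ⟩) (f ⟨ v ⟩) (ef v))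
            (lin 5 (λ a b c d g → # 2 :* b :+ # 1 :* c := g :* # 3 ⇒ ⊢ (c :+ # 3 :* a :+ # 8 :* d) :* # 0 :+ ((c :+ # 3 :* a) :* con (- + 1) :+ ((a :+ # 3 :* c :+ # 8 :* b) :* # 2 :+ ((a :+ # 3 :* c) :* # 1 :+ # 0))) := # 24 :* g) (W₁ ⟨ v ⟩) (W₂ ⟨ v ⟩) (W₃ ⟨ v ⟩) (W₄ ⟨ v ⟩) (g ⟨ v ⟩) (eg v))
            (lin 4 (λ a b c d → ⊢ (c :+ # 3 :* a :+ # 8 :* d) :* # 0 :+ ((c :+ # 3 :* a) :* # 0 :+ ((a :+ # 3 :* c :+ # 8 :* b) :* # 3 :+ ((a :+ # 3 :* c) :* con (- + 3) :+ # 0))) := # 24 :* b) (W₁ ⟨ v ⟩) (W₂ ⟨ v ⟩) (W₃ ⟨ v ⟩) (W₄ ⟨ v ⟩)))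
        where
        -- 24 times the barycentric coordinates with respect to w, a, e and c
        q₁ = W₁ ⟨ v ⟩ + + 3 * W₃ ⟨ v ⟩
        q₂ = W₁ ⟨ v ⟩ + + 3 * W₃ ⟨ v ⟩ + + 8 * W₂ ⟨ v ⟩
        q₃ = W₃ ⟨ v ⟩ + + 3 * W₁ ⟨ v ⟩
        q₄ = W₃ ⟨ v ⟩ + + 3 * W₁ ⟨ v ⟩ + + 8 * W₄ ⟨ v ⟩
      image : ∀ p y₁ y₂ {t₂ t₃ t₄} → W₂ ⟨ p ⟩ ≡ t₂ → W₃ ⟨ p ⟩ ≡ t₃ → W₄ ⟨ p ⟩ ≡ t₄ → + 1 * t₂ + + 1 * t₄ ≡ y₁ * + 3 → + 2 * t₂ + + 1 * t₃ ≡ y₂ * + 3 → pt (f ⟨ p ⟩) (g ⟨ p ⟩) (W₂ ⟨ p ⟩) ≡ pt y₁ y₂ t₂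
      image p y₁ y₂ e₂ e₃ e₄ h h′ = vec≡ (quotient (+ 1) (W₂ ⟨ p ⟩) (+ 1) (W₄ ⟨ p ⟩) (ef p) e₂ e₄ h) (quotient (+ 2) (W₂ ⟨ p ⟩) (+ 1) (W₃ ⟨ p ⟩) (eg p) e₂ e₃ h′) e₂
      onto : ∀ {y} → y ∈ E63 → ∃ λ p → A p × pt (f ⟨ p ⟩) (g ⟨ p ⟩) (W₂ ⟨ p ⟩) ≡ y
      onto (here refl) = c , As , image c (+ 1) (+ 0) (proj₁ (proj₂ c-val)) (proj₁ (proj₂ (proj₂ c-val))) (proj₂ (proj₂ (proj₂ c-val))) refl refl
      onto (there (here refl)) = e , Ae , image e (- + 1) (- + 1) (proj₁ (proj₂ e-val)) (proj₁ (proj₂ (proj₂ e-val))) (proj₂ (proj₂ (proj₂ e-val))) refl refl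
      onto (there (there (here refl))) = a , Aq , image a (+ 1) (+ 2) (proj₁ (proj₂ a-val)) (proj₁ (proj₂ (proj₂ a-val))) (proj₂ (proj₂ (proj₂ a-val))) refl refl
      onto (there (there (there (here refl)))) = w , Aw , image w (- + 1) (+ 1) (proj₁ (proj₂ w-val)) (proj₁ (proj₂ (proj₂ w-val))) (proj₂ (proj₂ (proj₂ w-val))) refl refl

  -- The map ((2W₄ - W₃)/3, -(W₃ + W₄)/3, (W₂ + W₄)/3) sends the line oa to the third axis, with o
  -- at height 0 and a at height 1, and b, c, e to the three remaining points of the model.
  onSpike : (S : Spike) → (∀ {v} → v ∈ V → OnSpike S v) → Σ ℤ λ α → Σ ℤ λ β → (α ≤ + 0) × (+ 0 < β) × UnimodEquiv V (F1 α β)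
  onSpike S on-S = go (third (- + 1) W₃ (+ 2) W₄ res₃₄′) (third (- + 1) W₃ (- + 1) W₄ res₃₄) (third (+ 1) W₂ (+ 1) W₄ res₂₄)
    where
    open Spike S
    open Coordinates S
    Result = Σ ℤ λ α → Σ ℤ λ β → (α ≤ + 0) × (+ 0 < β) × UnimodEquiv V (F1 α β)
    go : (∃ λ f → ∀ z → - + 1 * W₃ ⟨ z ⟩ + + 2 * W₄ ⟨ z ⟩ ≡ f ⟨ z ⟩ * + 3) → (∃ λ g → ∀ z → - + 1 * W₃ ⟨ z ⟩ + - + 1 * W₄ ⟨ z ⟩ ≡ g ⟨ z ⟩ * + 3) →
      (∃ λ h → ∀ z → + 1 * W₂ ⟨ z ⟩ + + 1 * W₄ ⟨ z ⟩ ≡ h ⟨ z ⟩ * + 3) → Result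
    go (f , ef) (g , eg) (h , eh) = model (extremes V (λ i → i))
      where
      F : Z3 → Z3
      F p = pt (f ⟨ p ⟩) (g ⟨ p ⟩) (h ⟨ p ⟩)
      image : ∀ p y₁ y₂ y₃ {t₂ t₃ t₄} → W₂ ⟨ p ⟩ ≡ t₂ → W₃ ⟨ p ⟩ ≡ t₃ → W₄ ⟨ p ⟩ ≡ t₄ → - + 1 * t₃ + + 2 * t₄ ≡ y₁ * + 3 → - + 1 * t₃ + - + 1 * t₄ ≡ y₂ * + 3 → + 1 * t₂ + + 1 * t₄ ≡ y₃ * + 3 → F p ≡ pt y₁ y₂ y₃
      image p y₁ y₂ y₃ e₂ e₃ e₄ h₁ h₂ h₃ = vec≡ (quotient (- + 1) (W₃ ⟨ p ⟩) (+ 2) (W₄ ⟨ p ⟩) (ef p) e₃ e₄ h₁) (quotient (- + 1) (W₃ ⟨ p ⟩) (- + 1) (W₄ ⟨ p ⟩) (eg p) e₃ e₄ h₂)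
        (quotient (+ 1) (W₂ ⟨ p ⟩) (+ 1) (W₄ ⟨ p ⟩) (eh p) e₂ e₄ h₃)
      F-b : F b ≡ pt (- + 1) (- + 1) (+ 0)
      F-b = image b (- + 1) (- + 1) (+ 0) (proj₁ (proj₂ b-val)) (proj₁ (proj₂ (proj₂ b-val))) (proj₂ (proj₂ (proj₂ b-val))) refl refl refl
      F-c : F c ≡ pt (+ 2) (- + 1) (+ 1)
      F-c = image c (+ 2) (- + 1) (+ 1) (proj₁ (proj₂ c-val)) (proj₁ (proj₂ (proj₂ c-val))) (proj₂ (proj₂ (proj₂ c-val))) refl refl refl
      F-e : F e ≡ pt (- + 1) (+ 2) (- + 1)
      F-e = image e (- + 1) (+ 2) (- + 1) (proj₁ (proj₂ e-val)) (proj₁ (proj₂ (proj₂ e-val))) (proj₂ (proj₂ (proj₂ e-val))) refl refl refl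
      F-on : ∀ v → W₃ ⟨ v ⟩ ≡ + 0 → W₄ ⟨ v ⟩ ≡ + 0 → F v ≡ pt (+ 0) (+ 0) (h ⟨ v ⟩)
      F-on v e₃ e₄ = image v (+ 0) (+ 0) (h ⟨ v ⟩) refl e₃ e₄ refl refl (trans (cong (λ t → + 1 * W₂ ⟨ v ⟩ + + 1 * t) (sym e₄)) (eh v))
      Attained : ℤ → Set
      Attained t = ∃ λ p → A p × F p ≡ pt (+ 0) (+ 0) t
      Range : List Z3 → ℤ → ℤ → Set
      Range U α β = ∀ {v} → v ∈ U → W₃ ⟨ v ⟩ ≡ + 0 → W₄ ⟨ v ⟩ ≡ + 0 → α ≤ h ⟨ v ⟩ × h ⟨ v ⟩ ≤ β
      Extremes : List Z3 → Set
      Extremes U = ∃ λ α → ∃ λ β → α ≤ + 0 × + 0 < β × Attained α × Attained β × Range U α β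
      extremes : ∀ U → (∀ {v} → v ∈ U → v ∈ V) → Extremes U
      -- o and a need not be in the list, but they are in A; starting with their heights secures α ≤
      -- 0 < β.
      extremes L.[] _ = + 0 , + 1 , ℤₚ.≤-refl , lin 0 (⊢ # 0 :< # 1)
        , (o , Ap , image o (+ 0) (+ 0) (+ 0) (proj₁ (proj₂ o-val)) (proj₁ (proj₂ (proj₂ o-val))) (proj₂ (proj₂ (proj₂ o-val))) refl refl refl)
        , (a , Aq , image a (+ 0) (+ 0) (+ 1) (proj₁ (proj₂ a-val)) (proj₁ (proj₂ (proj₂ a-val))) (proj₂ (proj₂ (proj₂ a-val))) refl refl refl) , λ ()
      extremes (v L.∷ U) sub = step (extremes U (λ i → sub (there i))) (W₃ ⟨ v ⟩ ℤₚ.≟ + 0) (W₄ ⟨ v ⟩ ℤₚ.≟ + 0)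
        where
        t = h ⟨ v ⟩
        step : Extremes U → Dec (W₃ ⟨ v ⟩ ≡ + 0) → Dec (W₄ ⟨ v ⟩ ≡ + 0) → Extremes (v L.∷ U)
        step (α , β , lo , hi , atα , atβ , ran) (no ¬e) _ = α , β , lo , hi , atα , atβ , λ { (here refl) e₃ _ → ⊥-elim (¬e e₃) ; (there i) → ran i }
        step (α , β , lo , hi , atα , atβ , ran) (yes _) (no ¬e) = α , β , lo , hi , atα , atβ , λ { (here refl) _ e₄ → ⊥-elim (¬e e₄) ; (there i) → ran i }
        step (α , β , lo , hi , atα , atβ , ran) (yes e₃) (yes e₄) = by (ℤₚ.≤-total α t) (ℤₚ.≤-total t β)
          where
          atv : Attained t
          atv = v , cone-vertex (sub (here refl)) , F-on v e₃ e₄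
          by : α ≤ t ⊎ t ≤ α → t ≤ β ⊎ β ≤ t → Extremes (v L.∷ U)
          by (inj₁ p) (inj₁ q) = α , β , lo , hi , atα , atβ , λ { (here refl) _ _ → p , q ; (there i) → ran i }
          by (inj₁ p) (inj₂ q) = α , t , lo , ℤₚ.<-≤-trans hi q , atα , atv , λ { (here refl) _ _ → p , ℤₚ.≤-refl ; (there i) k₃ k₄ → proj₁ (ran i k₃ k₄) , ℤₚ.≤-trans (proj₂ (ran i k₃ k₄)) q }
          by (inj₂ p) (inj₁ q) = t , β , ℤₚ.≤-trans p lo , hi , atv , atβ , λ { (here refl) _ _ → ℤₚ.≤-refl , q ; (there i) k₃ k₄ → ℤₚ.≤-trans p (proj₁ (ran i k₃ k₄)) , proj₂ (ran i k₃ k₄) }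
          by (inj₂ p) (inj₂ q) = t , t , ℤₚ.≤-trans p lo , ℤₚ.<-≤-trans hi q , atv , atv
            , λ { (here refl) _ _ → ℤₚ.≤-refl , ℤₚ.≤-refl ; (there i) k₃ k₄ → ℤₚ.≤-trans p (proj₁ (ran i k₃ k₄)) , ℤₚ.≤-trans (proj₂ (ran i k₃ k₄)) q }
      model : Extremes V → Result
      model (α , β , lo , hi , atα , atβ , ran) = α , β , lo , hi , Transport.transport V (F1 α β) f g h surj into onto
        where
        surj : ∀ y₁ y₂ y₃ → ∃ λ x → f ⟨ x ⟩ ≡ y₁ × g ⟨ x ⟩ ≡ y₂ × h ⟨ x ⟩ ≡ y₃
        surj y₁ y₂ y₃ = solution (point (y₂ - y₁) y₃ (- y₂) (+ 0))
          where
          solution : (∃ λ x → W₂ ⟨ x ⟩ ≡ (y₂ - y₁) + y₃ * + 3 × W₃ ⟨ x ⟩ ≡ (y₂ - y₁) + (- y₂) * + 3 × W₄ ⟨ x ⟩ ≡ - (y₂ - y₁) + + 0 * + 3) → ∃ λ x → f ⟨ x ⟩ ≡ y₁ × g ⟨ x ⟩ ≡ y₂ × h ⟨ x ⟩ ≡ y₃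
          solution (x , e₂ , e₃ , e₄) = x
            , quotient (- + 1) (W₃ ⟨ x ⟩) (+ 2) (W₄ ⟨ x ⟩) (ef x) e₃ e₄ (lin 2 (λ y₁ y₂ → ⊢ con (- + 1) :* ((y₂ :- y₁) :+ (:- y₂) :* # 3) :+ # 2 :* (:- (y₂ :- y₁) :+ # 0 :* # 3) := y₁ :* # 3) y₁ y₂)
            , quotient (- + 1) (W₃ ⟨ x ⟩) (- + 1) (W₄ ⟨ x ⟩) (eg x) e₃ e₄ (lin 2 (λ y₁ y₂ → ⊢ con (- + 1) :* ((y₂ :- y₁) :+ (:- y₂) :* # 3) :+ con (- + 1) :* (:- (y₂ :- y₁) :+ # 0 :* # 3) := y₂ :* # 3) y₁ y₂)
            , quotient (+ 1) (W₂ ⟨ x ⟩) (+ 1) (W₄ ⟨ x ⟩) (eh x) e₂ e₄ (lin 3 (λ y₁ y₂ y₃ → ⊢ # 1 :* ((y₂ :- y₁) :+ y₃ :* # 3) :+ # 1 :* (:- (y₂ :- y₁) :+ # 0 :* # 3) := y₃ :* # 3) y₁ y₂ y₃)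
        into : ∀ {v} → v ∈ V → LatticePt (F1 α β) (F v)
        into {v} i = by (on-S i)
          where
          t = h ⟨ v ⟩
          by : OnSpike S v → LatticePt (F1 α β) (F v)
          by (isB refl) = subst (LatticePt (F1 α β)) (sym F-b) (cone-vertex (there (there (here refl))))
          by (isC refl) = subst (LatticePt (F1 α β)) (sym F-c) (cone-vertex (there (there (there (here refl)))))
          by (isE refl) = subst (LatticePt (F1 α β)) (sym F-e) (cone-vertex (there (there (there (there (here refl))))))
          by (on e₃ e₄) = subst (LatticePt (F1 α β)) (sym (F-on v e₃ e₄)) (convex-points (F1 α β) ((β - t , pt (+ 0) (+ 0) α) L.∷ (t - α , pt (+ 0) (+ 0) β) L.∷ L.[]) (β - α) (pt (+ 0) (+ 0) t)
            ((ℤₚ.i≤j⇒0≤j-i (proj₂ (ran i e₃ e₄)) , cone-vertex (here refl)) All.∷ (ℤₚ.i≤j⇒0≤j-i (proj₁ (ran i e₃ e₄)) , cone-vertex (there (here refl))) All.∷ All.[])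
            (lin 3 (λ α β t → ⊢ (β :- t) :+ ((t :- α) :+ # 0) := β :- α) α β t)
            (lin 2 (λ α β → α :≤ # 0 ⇒ # 0 :< β ⇒ ⊢ # 0 :< β :- α) α β lo hi)
            (vec≡ (zeroes t) (zeroes t) (lin 3 (λ α β t → ⊢ (β :- t) :* α :+ ((t :- α) :* β :+ # 0) := (β :- α) :* t) α β t)))
            where
            zeroes : ∀ t → (β - t) * + 0 + ((t - α) * + 0 + + 0) ≡ (β - α) * + 0
            zeroes t = lin 3 (λ α β t → ⊢ (β :- t) :* # 0 :+ ((t :- α) :* # 0 :+ # 0) := (β :- α) :* # 0) α β t
        onto : ∀ {y} → y ∈ F1 α β → ∃ λ p → A p × F p ≡ y
        onto (here refl) = atα
        onto (there (here refl)) = atβ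
        onto (there (there (here refl))) = b , Ar , F-b
        onto (there (there (there (here refl)))) = c , As , F-c
        onto (there (there (there (there (here refl))))) = e , Ae , F-e

  split : ∀ S U → (∀ {v} → v ∈ U → v ∈ V) → (∀ {v} → v ∈ U → OnSpike S v) ⊎ Exceptional
  split S L.[] _ = inj₁ λ ()
  split S (v L.∷ U) sub = go (spikeOrExceptional S v (cone-vertex (sub (here refl)))) (split S U (λ i → sub (there i)))
    where
    go : OnSpike S v ⊎ Exceptional → (∀ {v} → v ∈ U → OnSpike S v) ⊎ Exceptional → (∀ {u} → u ∈ v L.∷ U → OnSpike S u) ⊎ Exceptional
    go (inj₂ X) _ = inj₂ X
    go _ (inj₂ X) = inj₂ X
    go (inj₁ p) (inj₁ ps) = inj₁ λ { (here refl) → p ; (there i) → ps i }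

  classification : EmptyTet C → UnimodEquiv V E63 ⊎ (Σ ℤ λ a → Σ ℤ λ b → (a ≤ + 0) × (+ 0 < b) × UnimodEquiv V (F1 a b))
  classification E = go (findSpike E)
    where
    go : ∀ {n} → Found n → UnimodEquiv V E63 ⊎ (Σ ℤ λ a → Σ ℤ λ b → (a ≤ + 0) × (+ 0 < b) × UnimodEquiv V (F1 a b))
    go (found _ S) = by (split S V (λ i → i))
      where
      by : (∀ {v} → v ∈ V → OnSpike S v) ⊎ Exceptional → _
      by (inj₁ p) = inj₂ (onSpike S p)
      by (inj₂ X) = inj₁ (exceptional X)

theorem5p4 : (V : List Z3) → Dim3 V → WidthGt1 V → SublatticeIndex V 3 →
    UnimodEquiv V E63 ⊎ (Σ ℤ λ a → Σ ℤ λ b → (a ≤ + 0) × (+ 0 < b) × UnimodEquiv V (F1 a b))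
theorem5p4 V _ width index = go (tetrahedron V width)
  where
  C = config V width index
  go : (∃ λ p → ∃ λ q → ∃ λ r → ∃ λ s → (p ∈ V × q ∈ V × r ∈ V × s ∈ V) × det4 p q r s ≢ + 0) → _
  go (p , q , r , s , (p∈ , q∈ , r∈ , s∈) , d≢0) = Models.classification V C
    (toEmpty C (vol p q r s) p q r s (cone-vertex p∈) (cone-vertex q∈) (cone-vertex r∈) (cone-vertex s∈) ℕₚ.≤-refl (λ e → d≢0 (ℤₚ.∣i∣≡0⇒i≡0 e)))
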